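{- For every integer $k\ge 2$ there exist finitely many rational numbers $\omega^{(C_3)}_{k,i}$, indexed by integers $i\le 3k-2$, such that $$\widehat W_{k,C_3}(z)=\frac{b_k}{(1-T(z))^{3k}}-\frac{c'_k}{(1-T(z))^{3k-1}}+\sum_{i\le 3k-2}\frac{\omega^{(C_3)}_{k,i}}{(1-T(z))^{i}},$$ where the sum is finite, and the numbers $c'_k$ are defined for all $k\ge1$ by $c'_1=\frac{25}{24}$ and $c'_{k+1}=c_{k+1}+\frac32 k b_k$.
   Context: $T(z)=\sum_{n\ge1}n^{n-1}z^n/n!$ is the EGF of rooted labelled trees. $\widehat W_{k,C_3}(z)=\sum_{n}g_{n,k}z^n/n!$, where $g_{n,k}$ is the number of connected simple graphs on vertex set $\{1,\dots,n\}$ with $n+k$ edges containing no triangle (as a not necessarily induced subgraph). Wright's constants: $b_1=\frac5{24}$, $2(k+1)b_{k+1}=3k(k+1)b_k+3\sum_{t=1}^{k-1}t(k-t)b_tb_{k-t}$ for $k\ge1$; $c_1=\frac{19}{24}$, $2(3k+2)c_{k+1}=8(k+1)b_{k+1}+3kb_k+(3k+2)(3k-1)c_k+6\sum_{t=1}^{k-1}t(3k-3t-1)b_tc_{k-t}$ for $k\ge1$. Terms with negative index $i$ in the sum are polynomials in $T$. -}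

module Defs where

open import Data.Bool using (Bool; true; false; _∧_; _∨_; not; if_then_else_)
open import Data.Nat as ℕ using (ℕ; zero; suc; _∸_; _^_; _≡ᵇ_; _<ᵇ_)
open import Data.Nat.Properties using (_!≢0)
open import Data.Nat.Combinatorics using ()
open import Data.Nat using (_!)
open import Data.Fin using (Fin; toℕ)
open import Data.List using (List; []; _∷_; map; _++_; concatMap; length; filter; allFin)
open import Data.Bool.ListAction using (any; all)
open import Data.Bool.Properties using (T?)
open import Data.Product using (_×_; _,_)
open import Data.Integer as ℤ using (ℤ; +_; -[1+_])
open import Data.Rational using (ℚ; _/_; _+_; _*_; _-_; 0ℚ; 1ℚ; -_)
open import Relation.Nullary.Decidable using (does)
open import Function using (_∘_)

Σ< : ℕ → (ℕ → ℚ) → ℚ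
Σ< zero    f = 0ℚ
Σ< (suc n) f = Σ< n f + f n

Series : Set
Series = ℕ → ℚ

oneS : Series
oneS zero    = 1ℚ
oneS (suc _) = 0ℚ

_·S_ : Series → Series → Series
(f ·S g) n = Σ< (suc n) (λ i → f i * g (n ∸ i))

powS : Series → ℕ → Series
powS f zero    = oneS
powS f (suc j) = f ·S powS f j

Tser : Series
Tser zero    = 0ℚ
Tser (suc m) = _/_ (+ (suc m ^ m)) (suc m !) {{(suc m) !≢0}}

oneMinusT : Series
oneMinusT zero    = 1ℚ
oneMinusT (suc m) = - Tser (suc m)

-- 1/(1 - T(z)) = Σ_{j≥0} T(z)^j ; since T has zero constant term,
-- only j ≤ n contributes to the coefficient of z^n.
invOneMinusT : Series
invOneMinusT n = Σ< (suc n) (λ j → powS Tser j n)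

P : ℤ → Series
P (+ m)      = powS invOneMinusT m
P -[1+ p ]   = powS oneMinusT (suc p)

-- Wright's constants b_k, c_k, c'_k

ℕ→ℚ : ℕ → ℚ
ℕ→ℚ n = (+ n) / 1

-- bUpTo m is a function agreeing with b_t for 1 ≤ t ≤ m+1
bUpTo : ℕ → (ℕ → ℚ)
bUpTo zero t = if t ≡ᵇ 1 then (+ 5) / 24 else 0ℚ
bUpTo (suc m) t =
  if t ≡ᵇ suc k then new else f t
  where
  k = suc m
  f = bUpTo m
  new : ℚ
  new = ((ℕ→ℚ (3 ℕ.* k ℕ.* (k ℕ.+ 1)) * f k)
         + (ℕ→ℚ 3 * Σ< k (λ t → ℕ→ℚ (t ℕ.* (k ∸ t)) * f t * f (k ∸ t))))
        * ((+ 1) / (2 ℕ.* (k ℕ.+ 1)))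
  -- (t = 0 term of the sum vanishes since t (k - t) = 0)

b : ℕ → ℚ
b k = bUpTo k k

-- cUpTo m agrees with c_t for 1 ≤ t ≤ m+1
cUpTo : ℕ → (ℕ → ℚ)
cUpTo zero t = if t ≡ᵇ 1 then (+ 19) / 24 else 0ℚ
cUpTo (suc m) t =
  if t ≡ᵇ suc k then new else f t
  where
  k = suc m
  f = cUpTo m
  new : ℚ
  new = ((ℕ→ℚ (8 ℕ.* (k ℕ.+ 1)) * b (k ℕ.+ 1))
         + (ℕ→ℚ (3 ℕ.* k) * b k)
         + (ℕ→ℚ ((3 ℕ.* k ℕ.+ 2) ℕ.* (3 ℕ.* k ∸ 1)) * f k)
         + (ℕ→ℚ 6 * Σ< k (λ t → (if t ≡ᵇ 0 then 0ℚ
                 else ℕ→ℚ (t ℕ.* (3 ℕ.* k ∸ 3 ℕ.* t ∸ 1)) * b t * f (k ∸ t)))))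
        * ((+ 1) / (2 ℕ.* (3 ℕ.* k ℕ.+ 2)))

c : ℕ → ℚ
c k = cUpTo k k

c′ : ℕ → ℚ
c′ zero          = 0ℚ   -- unused (c'_k only defined for k ≥ 1)
c′ (suc zero)    = (+ 25) / 24
c′ (suc (suc k)) = c (suc (suc k)) + ((+ 3) / 2) * ℕ→ℚ (suc k) * b (suc k)

-- Simple graphs on {0,…,n-1}: an edge set is a sublist of the list of
-- all pairs (i , j) with i < j.

pairs : (n : ℕ) → List (Fin n × Fin n)
pairs n = concatMap (λ i → concatMap (λ j →
            if toℕ i <ᵇ toℕ j then (i , j) ∷ [] else []) (allFin n)) (allFin n)

sublists : {A : Set} → List A → List (List A)
sublists []       = [] ∷ []
sublists (x ∷ xs) = map (x ∷_) (sublists xs) ++ sublists xs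

EdgeSet : ℕ → Set
EdgeSet n = List (Fin n × Fin n)

_==F_ : {n : ℕ} → Fin n → Fin n → Bool
a ==F b = toℕ a ≡ᵇ toℕ b

adj : {n : ℕ} → EdgeSet n → Fin n → Fin n → Bool
adj E u v = any (λ { (a , b) → (a ==F u ∧ b ==F v) ∨ (a ==F v ∧ b ==F u) }) E

reach : {n : ℕ} → EdgeSet n → ℕ → Fin n → Fin n → Bool
reach E zero    u v = u ==F v
reach {n} E (suc m) u v = reach E m u v ∨ any (λ w → reach E m u w ∧ adj E w v) (allFin n)

-- connected: every two vertices are joined by a walk (a path has length < n)
connected : {n : ℕ} → EdgeSet n → Bool
connected {n} E = all (λ u → all (λ v → reach E n u v) (allFin n)) (allFin n)

triangleFree : {n : ℕ} → EdgeSet n → Bool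
triangleFree {n} E = not (any (λ a → any (λ b' → any (λ c'' →
  adj E a b' ∧ adj E b' c'' ∧ adj E a c'') (allFin n)) (allFin n)) (allFin n))

g : ℕ → ℕ → ℕ
g n k = length (filter (λ E → T? ((length E ≡ᵇ n ℕ.+ k) ∧ connected E ∧ triangleFree E))
                       (sublists (pairs n)))

{-# OPTIONS --safe #-}
module Submission where

-- Let w mark edges, q = 1 + w and y = w/q.  Möbius inversion over edge sets writes the series F of all
-- triangle-free graphs as Σ q^(n choose 2) Mₙ(y) zⁿ/n!, where log M = Σ αₘ zᵐ only involves connected edge sets all
-- of whose edges lie in triangles; such a set with m vertices has at least 3(m - 1)/2 edges.  With
-- L = log F, D = z d/dz, σ : z ↦ qz and E = z σF / F, deleting the cluster of a vertex gives
--   D L = Σ m αₘ E · σE ⋯ σ^(m-1)E   and   D E = E + E (σ D L - D L),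
-- and differentiating in w gives Wright's equation for L with a lower-order source.  After z ↦ z/w the
-- coefficient of w⁻¹ in D L is T, and both equations for the coefficient of wᵏ lie in ℚ[T, 1/(1-T)] modulo
-- its unknown Lₖ.  Eliminating the derivative of D Lₖ between them gives (k + 1) D Lₖ, hence k Lₖ, as an
-- element of that ring, without integration (so no logarithm arises).  Since T is transcendental, comparing
-- the two leading coefficients in Wright's equation yields the recurrences of b and c′.

-- Whether a graph is triangle-free does not depend on an edge that lies in no triangle; this is why
-- a cluster containing such an edge has Möbius weight zero. A surviving cluster with m vertices has
-- at least m + (m - 3)/2 edges, so each order in w sees finitely many m. For positive excess all
-- clusters stay below the two leading poles; the triangle acts on them only through excess 0, where
-- it replaces T³/2 by T⁴/2 over (1-T)² and thus turns 19/24 into 25/24.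
--
-- With θ = 1 - T one has θ D = T d/dT, so Wright's equation θ D L + k L = J asks for a primitive of
-- T^(k-1) J in the variable T, and the shape of J does not exclude a term 1/(1-T) there. The vertex
-- equation is a second first-order equation with the same terms θ D Y - (D T) Y for Y = D L, but
-- with zeroth-order coefficient -1 where the differentiated edge equation has k; hence the
-- difference is algebraic. For k = 0 a logarithm really occurs, since the cycles contribute
-- log(1/(1-T))/2, so excess 0 is treated only through Y.

-- Rational scalars, algebras over ℚ, and formal power series

module RationalAlgebras where
  open import Defs using (ℕ→ℚ)
  open import Level using (0ℓ)
  open import Algebra.Bundles using (CommutativeRing)
  import Algebra.Solver.Ring as RingSolver
  import Algebra.Solver.Ring.AlmostCommutativeRing as ACR
  import Algebra.Properties.Ring as RingProperties
  open import Data.Nat as ℕ using (ℕ; zero; suc)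
  import Data.Nat.Properties as ℕₚ
  open import Data.Integer as ℤ using (+_)
  import Data.Integer.Properties as ℤₚ
  import Data.Rational.Unnormalised as ℚᵘ
  import Data.Rational.Unnormalised.Properties as ℚᵘₚ
  open import Data.Rational as ℚ using (ℚ; 0ℚ; 1ℚ)
  import Data.Rational.Properties as ℚₚ
  open import Data.Maybe using (Maybe; just; nothing)
  open import Data.Product using (_,_)
  open import Relation.Nullary using (yes; no)
  open import Relation.Binary.PropositionalEquality as ≡ using (_≡_)
  import Relation.Binary.Reasoning.Setoid as SetoidReasoning

  toℚᵘ-ℕ→ℚ : ∀ n → ℚ.toℚᵘ (ℕ→ℚ n) ℚᵘ.≃ ℚᵘ.mkℚᵘ (+ n) 0
  toℚᵘ-ℕ→ℚ n = ℚₚ.toℚᵘ-fromℚᵘ (ℚᵘ.mkℚᵘ (+ n) 0)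

  -- Elements of `ℚ` are kept in lowest terms, so the identity is checked on unnormalised fractions
  -- with denominator 1, where it is a cross-multiplication.
  ℕ→ℚ-+ : ∀ m n → ℕ→ℚ (m ℕ.+ n) ≡ ℕ→ℚ m ℚ.+ ℕ→ℚ n
  ℕ→ℚ-+ m n = ℚₚ.toℚᵘ-injective (begin
    ℚ.toℚᵘ (ℕ→ℚ (m ℕ.+ n))                        ≈⟨ toℚᵘ-ℕ→ℚ (m ℕ.+ n) ⟩
    ℚᵘ.mkℚᵘ (+ (m ℕ.+ n)) 0                       ≈⟨ ℚᵘ.*≡* (≡.cong (ℤ._* + 1) (≡.sym (≡.cong₂ ℤ._+_ (ℤₚ.*-identityʳ (+ m)) (ℤₚ.*-identityʳ (+ n))))) ⟩
    ℚᵘ.mkℚᵘ (+ m) 0 ℚᵘ.+ ℚᵘ.mkℚᵘ (+ n) 0          ≈⟨ ℚᵘₚ.+-cong (toℚᵘ-ℕ→ℚ m) (toℚᵘ-ℕ→ℚ n) ⟨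
    ℚ.toℚᵘ (ℕ→ℚ m) ℚᵘ.+ ℚ.toℚᵘ (ℕ→ℚ n)            ≈⟨ ℚₚ.toℚᵘ-homo-+ (ℕ→ℚ m) (ℕ→ℚ n) ⟨
    ℚ.toℚᵘ (ℕ→ℚ m ℚ.+ ℕ→ℚ n)                      ∎)
    where open SetoidReasoning ℚᵘₚ.≃-setoid

  ℕ→ℚ-* : ∀ m n → ℕ→ℚ (m ℕ.* n) ≡ ℕ→ℚ m ℚ.* ℕ→ℚ n
  ℕ→ℚ-* m n = ℚₚ.toℚᵘ-injective (begin
    ℚ.toℚᵘ (ℕ→ℚ (m ℕ.* n))                        ≈⟨ toℚᵘ-ℕ→ℚ (m ℕ.* n) ⟩
    ℚᵘ.mkℚᵘ (+ (m ℕ.* n)) 0                       ≈⟨ ℚᵘ.*≡* (≡.cong (ℤ._* + 1) (ℤₚ.pos-* m n)) ⟩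
    ℚᵘ.mkℚᵘ (+ m) 0 ℚᵘ.* ℚᵘ.mkℚᵘ (+ n) 0          ≈⟨ ℚᵘₚ.*-cong (toℚᵘ-ℕ→ℚ m) (toℚᵘ-ℕ→ℚ n) ⟨
    ℚ.toℚᵘ (ℕ→ℚ m) ℚᵘ.* ℚ.toℚᵘ (ℕ→ℚ n)            ≈⟨ ℚₚ.toℚᵘ-homo-* (ℕ→ℚ m) (ℕ→ℚ n) ⟨
    ℚ.toℚᵘ (ℕ→ℚ m ℚ.* ℕ→ℚ n)                      ∎)
    where open SetoidReasoning ℚᵘₚ.≃-setoid

  ℕ→ℚ-suc : ∀ n → ℕ→ℚ (suc n) ≡ 1ℚ ℚ.+ ℕ→ℚ n
  ℕ→ℚ-suc n = ℕ→ℚ-+ 1 n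

  /-*-cancel : ∀ m n .{{_ : ℕ.NonZero n}} → ((+ m) ℚ./ n) ℚ.* ℕ→ℚ n ≡ ℕ→ℚ m
  /-*-cancel m (suc n) = ℚₚ.toℚᵘ-injective (begin
    ℚ.toℚᵘ ((+ m ℚ./ suc n) ℚ.* ℕ→ℚ (suc n))             ≈⟨ ℚₚ.toℚᵘ-homo-* (+ m ℚ./ suc n) (ℕ→ℚ (suc n)) ⟩
    ℚ.toℚᵘ (+ m ℚ./ suc n) ℚᵘ.* ℚ.toℚᵘ (ℕ→ℚ (suc n))     ≈⟨ ℚᵘₚ.*-cong (ℚₚ.toℚᵘ-fromℚᵘ (ℚᵘ.mkℚᵘ (+ m) n)) (toℚᵘ-ℕ→ℚ (suc n)) ⟩
    ℚᵘ.mkℚᵘ (+ m) n ℚᵘ.* ℚᵘ.mkℚᵘ (+ suc n) 0             ≈⟨ ℚᵘ.*≡* (ℤₚ.*-assoc (+ m) (+ suc n) (+ 1)) ⟩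
    ℚᵘ.mkℚᵘ (+ m) 0                                      ≈⟨ toℚᵘ-ℕ→ℚ m ⟨
    ℚ.toℚᵘ (ℕ→ℚ m)                                       ∎)
    where open SetoidReasoning ℚᵘₚ.≃-setoid

  *-cancelʳ-ℕ→ℚ : ∀ n .{{_ : ℕ.NonZero n}} {p q} → p ℚ.* ℕ→ℚ n ≡ q ℚ.* ℕ→ℚ n → p ≡ q
  *-cancelʳ-ℕ→ℚ n {p} {q} eq = ≡.trans (undo p) (≡.trans (≡.cong (ℚ._* r) eq) (≡.sym (undo q)))
    where
    r = + 1 ℚ./ n
    undo : ∀ p → p ≡ p ℚ.* ℕ→ℚ n ℚ.* r
    undo p = begin
      p                         ≡⟨ ℚₚ.*-identityʳ p ⟨
      p ℚ.* 1ℚ                  ≡⟨ ≡.cong (p ℚ.*_) (/-*-cancel 1 n) ⟨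
      p ℚ.* (r ℚ.* ℕ→ℚ n)       ≡⟨ ≡.cong (p ℚ.*_) (ℚₚ.*-comm r (ℕ→ℚ n)) ⟩
      p ℚ.* (ℕ→ℚ n ℚ.* r)       ≡⟨ ℚₚ.*-assoc p (ℕ→ℚ n) r ⟨
      p ℚ.* ℕ→ℚ n ℚ.* r         ∎
      where open ≡.≡-Reasoning

  ℕ→ℚ-*-cancelˡ : ∀ n {p q} → ℕ→ℚ (suc n) ℚ.* p ≡ ℕ→ℚ (suc n) ℚ.* q → p ≡ q
  ℕ→ℚ-*-cancelˡ n {p} {q} eq = *-cancelʳ-ℕ→ℚ (suc n) (≡.trans (ℚₚ.*-comm p _) (≡.trans eq (ℚₚ.*-comm _ q)))

  -- A single interface for ℚ, for series in w, and for series in z whose coefficients are series in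
  -- w. The ring solver has rational coefficients, so identities with constants such as ½ are
  -- decided at every level.
  record QAlgebra : Set₁ where
    field
      commutativeRing : CommutativeRing 0ℓ 0ℓ
    open CommutativeRing commutativeRing public
    field
      ι   : ℚ → Carrier
      ι-+ : ∀ p q → ι (p ℚ.+ q) ≈ ι p + ι q
      ι-* : ∀ p q → ι (p ℚ.* q) ≈ ι p * ι q
      ι-0 : ι 0ℚ ≈ 0#
      ι-1 : ι 1ℚ ≈ 1#

    open RingProperties ring public using (-0#≈0#)

    ι-neg : ∀ p → ι (ℚ.- p) ≈ - ι p
    ι-neg p = begin
      ι (ℚ.- p)                      ≈⟨ +-identityʳ _ ⟨
      ι (ℚ.- p) + 0#                 ≈⟨ +-congˡ (-‿inverseʳ (ι p)) ⟨
      ι (ℚ.- p) + (ι p + - ι p)      ≈⟨ +-assoc _ _ _ ⟨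
      (ι (ℚ.- p) + ι p) + - ι p      ≈⟨ +-congʳ (ι-+ _ _) ⟨
      ι (ℚ.- p ℚ.+ p) + - ι p        ≡⟨ ≡.cong (λ r → ι r + - ι p) (ℚₚ.+-inverseˡ p) ⟩
      ι 0ℚ + - ι p                   ≈⟨ +-congʳ ι-0 ⟩
      0# + - ι p                     ≈⟨ +-identityˡ _ ⟩
      - ι p                          ∎
      where open SetoidReasoning setoid

    pow : Carrier → ℕ → Carrier
    pow x zero    = 1#
    pow x (suc n) = x * pow x n

    ν : ℕ → Carrier
    ν n = ι (ℕ→ℚ n)

    pow-+ : ∀ x m n → pow x (m ℕ.+ n) ≈ pow x m * pow x n
    pow-+ x zero    n = sym (*-identityˡ _)
    pow-+ x (suc m) n = trans (*-congˡ (pow-+ x m n)) (sym (*-assoc _ _ _))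

    ν-suc : ∀ n → ν (suc n) ≈ ι 1ℚ + ν n
    ν-suc n = trans (reflexive (≡.cong ι (ℕ→ℚ-suc n))) (ι-+ 1ℚ (ℕ→ℚ n))

    ν-inverse : ∀ n x → ι (+ 1 ℚ./ suc n) * (ν (suc n) * x) ≈ x
    ν-inverse n x = trans (sym (*-assoc _ _ _)) (trans (*-congʳ (sym (ι-* _ _)))
      (trans (*-congʳ (trans (reflexive (≡.cong ι (/-*-cancel 1 (suc n)))) ι-1)) (*-identityˡ x)))

    ν-cancel : ∀ n {x y} → ν (suc n) * x ≈ ν (suc n) * y → x ≈ y
    ν-cancel n {x} {y} eq = trans (sym (ν-inverse n x)) (trans (*-congˡ eq) (ν-inverse n y))

    private
      coefficient≟ : ∀ p q → Maybe (ι p ≈ ι q)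
      coefficient≟ p q with p ℚ.≟ q
      ... | yes ≡.refl = just refl
      ... | no  _      = nothing

      scalars : ℚₚ.+-*-rawRing ACR.-Raw-AlmostCommutative⟶ ACR.fromCommutativeRing commutativeRing
      scalars = record { ⟦_⟧ = ι ; +-homo = ι-+ ; *-homo = ι-* ; -‿homo = ι-neg ; 0-homo = ι-0 ; 1-homo = ι-1 }

    module Solver = RingSolver ℚₚ.+-*-rawRing (ACR.fromCommutativeRing commutativeRing) scalars coefficient≟

  ℚ-algebra : QAlgebra
  ℚ-algebra = record
    { commutativeRing = ℚₚ.+-*-commutativeRing
    ; ι = λ p → p
    ; ι-+ = λ _ _ → ≡.refl
    ; ι-* = λ _ _ → ≡.refl
    ; ι-0 = ≡.refl
    ; ι-1 = ≡.refl
    }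

  module Antidiagonal (A : QAlgebra) where
    open QAlgebra A
    open Solver using (solve; _:=_; _:+_; _:*_; :-_; con)
    open SetoidReasoning setoid

    -- The sum over a + b = n by recursion on n. Both indices are available without truncated
    -- subtraction, and a shift of one factor is nearly definitional.
    conv : (ℕ → ℕ → Carrier) → ℕ → Carrier
    conv f zero    = f 0 0
    conv f (suc n) = f 0 (suc n) + conv (λ a b → f (suc a) b) n

    conv-cong≡ : ∀ {f g} n → (∀ a b → a ℕ.+ b ≡ n → f a b ≈ g a b) → conv f n ≈ conv g n
    conv-cong≡ zero    eq = eq 0 0 ≡.refl
    conv-cong≡ (suc n) eq = +-cong (eq 0 (suc n) ≡.refl) (conv-cong≡ n (λ a b p → eq (suc a) b (≡.cong suc p)))

    conv-cong : ∀ {f g} → (∀ a b → f a b ≈ g a b) → ∀ n → conv f n ≈ conv g n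
    conv-cong eq n = conv-cong≡ n (λ a b _ → eq a b)

    conv-0 : ∀ {f} n → (∀ a b → a ℕ.+ b ≡ n → f a b ≈ 0#) → conv f n ≈ 0#
    conv-0 zero    eq = eq 0 0 ≡.refl
    conv-0 (suc n) eq = trans (+-cong (eq 0 (suc n) ≡.refl) (conv-0 n (λ a b p → eq (suc a) b (≡.cong suc p)))) (+-identityˡ 0#)

    conv-+ : ∀ f g n → conv (λ a b → f a b + g a b) n ≈ conv f n + conv g n
    conv-+ f g zero    = refl
    conv-+ f g (suc n) = trans (+-congˡ (conv-+ (λ a b → f (suc a) b) (λ a b → g (suc a) b) n))
      (solve 4 (λ a b c d → (a :+ b) :+ (c :+ d) := (a :+ c) :+ (b :+ d)) refl _ _ _ _)

    conv-*ˡ : ∀ x f n → conv (λ a b → x * f a b) n ≈ x * conv f n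
    conv-*ˡ x f zero    = refl
    conv-*ˡ x f (suc n) = trans (+-congˡ (conv-*ˡ x (λ a b → f (suc a) b) n)) (sym (distribˡ x _ _))

    conv-*ʳ : ∀ x f n → conv (λ a b → f a b * x) n ≈ conv f n * x
    conv-*ʳ x f n = trans (conv-cong (λ a b → *-comm (f a b) x) n) (trans (conv-*ˡ x f n) (*-comm x _))

    conv-last : ∀ f n → conv f (suc n) ≈ conv (λ a b → f a (suc b)) n + f (suc n) 0
    conv-last f zero    = refl
    conv-last f (suc n) = trans (+-congˡ (conv-last (λ a b → f (suc a) b) n)) (sym (+-assoc _ _ _))

    conv-flip : ∀ f n → conv f n ≈ conv (λ a b → f b a) n
    conv-flip f zero    = refl
    conv-flip f (suc n) = begin
      f 0 (suc n) + conv (λ a b → f (suc a) b) n   ≈⟨ +-congˡ (conv-flip (λ a b → f (suc a) b) n) ⟩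
      f 0 (suc n) + conv (λ a b → f (suc b) a) n   ≈⟨ +-comm _ _ ⟩
      conv (λ a b → f (suc b) a) n + f 0 (suc n)   ≈⟨ conv-last (λ a b → f b a) n ⟨
      conv (λ a b → f b a) (suc n)                 ∎

    conv-swap : ∀ (f : ℕ → ℕ → ℕ → ℕ → Carrier) m n →
      conv (λ a b → conv (f a b) n) m ≈ conv (λ c d → conv (λ a b → f a b c d) m) n
    conv-swap f zero    n = refl
    conv-swap f (suc m) n = trans (+-congˡ (conv-swap (λ a → f (suc a)) m n)) (sym (conv-+ _ _ n))

    conv-assoc : ∀ (f : ℕ → ℕ → ℕ → Carrier) n →
      conv (λ s c → conv (λ a b → f a b c) s) n ≈ conv (λ a s → conv (f a) s) n
    conv-assoc f zero    = refl
    conv-assoc f (suc n) = begin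
      f 0 0 (suc n) + conv (λ s c → f 0 (suc s) c + conv (λ a b → f (suc a) b c) s) n
        ≈⟨ +-congˡ (conv-+ (λ s c → f 0 (suc s) c) (λ s c → conv (λ a b → f (suc a) b c) s) n) ⟩
      f 0 0 (suc n) + (conv (λ s c → f 0 (suc s) c) n + conv (λ s c → conv (λ a b → f (suc a) b c) s) n)
        ≈⟨ +-assoc _ _ _ ⟨
      conv (f 0) (suc n) + conv (λ s c → conv (λ a b → f (suc a) b c) s) n
        ≈⟨ +-congˡ (conv-assoc (λ a → f (suc a)) n) ⟩
      conv (λ a s → conv (f a) s) (suc n) ∎

    conv-first : ∀ f n → (∀ a b → f (suc a) b ≈ 0#) → conv f n ≈ f 0 n
    conv-first f zero    z = refl
    conv-first f (suc n) z = trans (+-congˡ (conv-0 n (λ a b _ → z a b))) (+-identityʳ _)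

    conv-shiftˡ : ∀ m n {f} → (∀ a b → a ℕ.< m → f a b ≈ 0#) →
      conv f (m ℕ.+ n) ≈ conv (λ a b → f (m ℕ.+ a) b) n
    conv-shiftˡ zero    n z = refl
    conv-shiftˡ (suc m) n z = trans (+-cong (z 0 _ (ℕ.s≤s ℕ.z≤n)) (conv-shiftˡ m n (λ a b a<m → z (suc a) b (ℕ.s≤s a<m)))) (+-identityˡ _)

    conv-shiftʳ : ∀ m n {f} → (∀ a b → b ℕ.< m → f a b ≈ 0#) →
      conv f (m ℕ.+ n) ≈ conv (λ a b → f a (m ℕ.+ b)) n
    conv-shiftʳ m n {f} z = begin
      conv f (m ℕ.+ n)                       ≈⟨ conv-flip f (m ℕ.+ n) ⟩
      conv (λ a b → f b a) (m ℕ.+ n)         ≈⟨ conv-shiftˡ m n (λ a b → z b a) ⟩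
      conv (λ a b → f b (m ℕ.+ a)) n         ≈⟨ conv-flip (λ a b → f b (m ℕ.+ a)) n ⟩
      conv (λ a b → f a (m ℕ.+ b)) n         ∎

    sum : ℕ → (ℕ → Carrier) → Carrier
    sum zero    f = 0#
    sum (suc n) f = sum n f + f n

    sum-cong : ∀ n {f g} → (∀ j → j ℕ.< n → f j ≈ g j) → sum n f ≈ sum n g
    sum-cong zero    eq = refl
    sum-cong (suc n) eq = +-cong (sum-cong n (λ j j<n → eq j (ℕₚ.m<n⇒m<1+n j<n))) (eq n ℕₚ.≤-refl)

    sum-first : ∀ n f → sum (suc n) f ≈ f 0 + sum n (λ j → f (suc j))
    sum-first zero    f = +-comm _ _
    sum-first (suc n) f = trans (+-congʳ (sum-first n f)) (+-assoc _ _ _)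

    sum-+ : ∀ n f g → sum n (λ j → f j + g j) ≈ sum n f + sum n g
    sum-+ zero    f g = sym (+-identityˡ 0#)
    sum-+ (suc n) f g = trans (+-congʳ (sum-+ n f g))
      (solve 4 (λ a b c d → (a :+ b) :+ (c :+ d) := (a :+ c) :+ (b :+ d)) refl _ _ _ _)

    sum-*ˡ : ∀ n x f → x * sum n f ≈ sum n (λ j → x * f j)
    sum-*ˡ zero    x f = zeroʳ x
    sum-*ˡ (suc n) x f = trans (distribˡ x _ _) (+-congʳ (sum-*ˡ n x f))

    sum-*ʳ : ∀ n x f → sum n f * x ≈ sum n (λ j → f j * x)
    sum-*ʳ n x f = trans (*-comm _ x) (trans (sum-*ˡ n x f) (sum-cong n (λ j _ → *-comm x (f j))))

    conv-sum : ∀ m (f : ℕ → ℕ → ℕ → Carrier) n →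
      conv (λ a b → sum m (f a b)) n ≈ sum m (λ j → conv (λ a b → f a b j) n)
    conv-sum zero    f n = conv-0 n (λ _ _ _ → refl)
    conv-sum (suc m) f n = trans (conv-+ _ _ n) (+-congʳ (conv-sum m f n))

    sum-truncate : ∀ m d {f} → (∀ j → m ℕ.≤ j → f j ≈ 0#) → sum (d ℕ.+ m) f ≈ sum m f
    sum-truncate m zero    z = refl
    sum-truncate m (suc d) z = trans (+-cong (sum-truncate m d z) (z (d ℕ.+ m) (ℕₚ.m≤n+m m d))) (+-identityʳ _)

    sum-truncate-≤ : ∀ {m n f} → m ℕ.≤ n → (∀ j → m ℕ.≤ j → f j ≈ 0#) → sum n f ≈ sum m f
    sum-truncate-≤ {m} {n} {f} m≤n z =
      trans (reflexive (≡.cong (λ k → sum k f) (≡.sym (ℕₚ.m∸n+n≡m m≤n)))) (sum-truncate m (n ℕ.∸ m) z)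

    conv≈sum : ∀ h n → conv h n ≈ sum (suc n) (λ i → h i (n ℕ.∸ i))
    conv≈sum h zero    = sym (+-identityˡ _)
    conv≈sum h (suc n) = trans (+-congˡ (conv≈sum (λ a b → h (suc a) b) n)) (sym (sum-first (suc n) (λ i → h i (suc n ℕ.∸ i))))

  module PowerSeries (A : QAlgebra) where
    open QAlgebra A
    open Antidiagonal A public
    open Solver using (solve; _:=_; _:+_; _:*_; :-_; con)
    private
      S = ℕ → Carrier

    infix 4 _≋_
    _≋_ : S → S → Set
    X ≋ Y = ∀ n → X n ≈ Y n

    _⊛_ : S → S → S
    (X ⊛ Y) n = conv (λ a b → X a * Y b) n

    constant : Carrier → S
    constant x zero    = x
    constant x (suc n) = 0#

    ⊛-cong : ∀ {X X′ Y Y′} → X ≋ X′ → Y ≋ Y′ → X ⊛ Y ≋ X′ ⊛ Y′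
    ⊛-cong p q n = conv-cong (λ a b → *-cong (p a) (q b)) n

    ⊛-comm : ∀ X Y → X ⊛ Y ≋ Y ⊛ X
    ⊛-comm X Y n = trans (conv-flip _ n) (conv-cong (λ a b → *-comm (X b) (Y a)) n)

    ⊛-assoc : ∀ X Y Z → (X ⊛ Y) ⊛ Z ≋ X ⊛ (Y ⊛ Z)
    ⊛-assoc X Y Z n = trans (conv-cong (λ s c → sym (conv-*ʳ (Z c) _ s)) n)
      (trans (conv-assoc (λ a b c → X a * Y b * Z c) n)
      (conv-cong (λ a s → trans (conv-cong (λ b c → *-assoc (X a) (Y b) (Z c)) s) (conv-*ˡ (X a) _ s)) n))

    constant-⊛ : ∀ x X n → (constant x ⊛ X) n ≈ x * X n
    constant-⊛ x X n = conv-first _ n (λ a b → zeroˡ (X b))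

    ⊛-distribˡ : ∀ X Y Z n → (X ⊛ (λ m → Y m + Z m)) n ≈ (X ⊛ Y) n + (X ⊛ Z) n
    ⊛-distribˡ X Y Z n = trans (conv-cong (λ a b → distribˡ (X a) (Y b) (Z b)) n) (conv-+ _ _ n)

    series-commutativeRing : CommutativeRing 0ℓ 0ℓ
    series-commutativeRing = record
      { Carrier = S
      ; _≈_ = _≋_
      ; _+_ = λ X Y n → X n + Y n
      ; _*_ = _⊛_
      ; -_  = λ X n → - X n
      ; 0#  = λ _ → 0#
      ; 1#  = constant 1#
      ; isCommutativeRing = record
        { isRing = record
          { +-isAbelianGroup = record
            { isGroup = record
              { isMonoid = record
                { isSemigroup = record
                  { isMagma = record
                    { isEquivalence = record
                      { refl = λ n → refl ; sym = λ p n → sym (p n) ; trans = λ p q n → trans (p n) (q n) }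
                    ; ∙-cong = λ p q n → +-cong (p n) (q n)
                    }
                  ; assoc = λ X Y Z n → +-assoc (X n) (Y n) (Z n)
                  }
                ; identity = (λ X n → +-identityˡ (X n)) , (λ X n → +-identityʳ (X n))
                }
              ; inverse = (λ X n → -‿inverseˡ (X n)) , (λ X n → -‿inverseʳ (X n))
              ; ⁻¹-cong = λ p n → -‿cong (p n)
              }
            ; comm = λ X Y n → +-comm (X n) (Y n)
            }
          ; *-cong = ⊛-cong
          ; *-assoc = ⊛-assoc
          ; *-identity = identityˡ , (λ X n → trans (⊛-comm X _ n) (identityˡ X n))
          ; distrib = ⊛-distribˡ ,
              (λ X Y Z n → trans (⊛-comm _ X n) (trans (⊛-distribˡ X Y Z n) (+-cong (⊛-comm X Y n) (⊛-comm X Z n))))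
          }
        ; *-comm = ⊛-comm
        }
      }
      where
      identityˡ : ∀ X → constant 1# ⊛ X ≋ X
      identityˡ X n = trans (constant-⊛ 1# X n) (*-identityˡ (X n))

    series-algebra : QAlgebra
    series-algebra = record
      { commutativeRing = series-commutativeRing
      ; ι = λ p → constant (ι p)
      ; ι-+ = λ { p q zero → ι-+ p q ; p q (suc n) → sym (+-identityˡ 0#) }
      ; ι-* = λ { p q zero → ι-* p q
                ; p q (suc n) → sym (trans (constant-⊛ (ι p) _ (suc n)) (zeroʳ (ι p))) }
      ; ι-0 = λ { zero → ι-0 ; (suc n) → refl }
      ; ι-1 = λ { zero → ι-1 ; (suc n) → refl }
      }

    ι-⊛ : ∀ p X n → (constant (ι p) ⊛ X) n ≈ ι p * X n
    ι-⊛ p = constant-⊛ (ι p)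

    D : S → S
    D X n = ν n * X n

    D-cong : ∀ {X Y} → X ≋ Y → D X ≋ D Y
    D-cong p n = *-congˡ (p n)

    D-+ : ∀ X Y n → D (λ m → X m + Y m) n ≈ D X n + D Y n
    D-+ X Y n = distribˡ (ν n) (X n) (Y n)

    D-⊛ : ∀ X Y n → D (X ⊛ Y) n ≈ (D X ⊛ Y) n + (X ⊛ D Y) n
    D-⊛ X Y n = begin
      ν n * (X ⊛ Y) n                                    ≈⟨ conv-*ˡ (ν n) _ n ⟨
      conv (λ a b → ν n * (X a * Y b)) n                 ≈⟨ conv-cong≡ n split ⟩
      conv (λ a b → ν a * X a * Y b + X a * (ν b * Y b)) n ≈⟨ conv-+ _ _ n ⟩
      (D X ⊛ Y) n + (X ⊛ D Y) n                          ∎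
      where
      open SetoidReasoning setoid
      split : ∀ a b → a ℕ.+ b ≡ n → ν n * (X a * Y b) ≈ ν a * X a * Y b + X a * (ν b * Y b)
      split a b ≡.refl = trans (*-congʳ (trans (reflexive (≡.cong ι (ℕ→ℚ-+ a b))) (ι-+ _ _)))
        (solve 4 (λ x y a b → (a :+ b) :* (x :* y) := a :* x :* y :+ x :* (b :* y)) refl (X a) (Y b) (ν a) (ν b))


    D-neg : ∀ X n → D (λ m → - X m) n ≈ - D X n
    D-neg X n = solve 2 (λ x y → x :* :- y := :- (x :* y)) refl (ν n) (X n)

    D-constant : ∀ x n → D (constant x) n ≈ 0#
    D-constant x zero    = trans (*-congʳ ι-0) (zeroˡ x)
    D-constant x (suc n) = zeroʳ _

    shift : S → S
    shift X zero    = 0#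
    shift X (suc n) = X n

    shift-cong : ∀ {X Y} → X ≋ Y → shift X ≋ shift Y
    shift-cong eq zero    = refl
    shift-cong eq (suc n) = eq n

    shift-⊛ : ∀ X Y → shift X ⊛ Y ≋ shift (X ⊛ Y)
    shift-⊛ X Y zero    = zeroˡ _
    shift-⊛ X Y (suc n) = trans (+-congʳ (zeroˡ _)) (+-identityˡ _)

    private
      module 𝕊 = QAlgebra series-algebra

    pow-vanishes : ∀ {U} → U 0 ≈ 0# → ∀ j {n} → n ℕ.< j → 𝕊.pow U j n ≈ 0#
    pow-vanishes {U} U₀ (suc j) {n} (ℕ.s≤s n≤j) = conv-0 n term
      where
      term : ∀ a b → a ℕ.+ b ≡ n → U a * 𝕊.pow U j b ≈ 0#
      term zero    b _      = trans (*-congʳ U₀) (zeroˡ _)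
      term (suc a) b ≡.refl = trans (*-congˡ (pow-vanishes U₀ j (ℕₚ.≤-trans (ℕ.s≤s (ℕₚ.m≤n+m b a)) n≤j))) (zeroʳ _)

    geometric : S → S
    geometric U n = sum (suc n) (λ j → 𝕊.pow U j n)

    -- The coefficient at n truncates the geometric series at j = n. Adding the vanishing power n +
    -- 1 makes the index shift possible, and inside the product the truncation at n may be shortened
    -- to b because higher powers of U vanish at b.
    geometric-fixpoint : ∀ {U} → U 0 ≈ 0# → geometric U ≋ 𝕊.1# 𝕊.+ U ⊛ geometric U
    geometric-fixpoint {U} U₀ n = begin
      geometric U n                                             ≈⟨ +-identityʳ _ ⟨
      geometric U n + 0#                                        ≈⟨ +-congˡ (pow-vanishes U₀ (suc n) ℕₚ.≤-refl) ⟨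
      sum (suc (suc n)) (λ j → 𝕊.pow U j n)                     ≈⟨ sum-first (suc n) _ ⟩
      𝕊.1# n + sum (suc n) (λ j → 𝕊.pow U (suc j) n)            ≈⟨ +-congˡ (conv-sum (suc n) (λ a b j → U a * 𝕊.pow U j b) n) ⟨
      𝕊.1# n + conv (λ a b → sum (suc n) (λ j → U a * 𝕊.pow U j b)) n
        ≈⟨ +-congˡ (conv-cong≡ n extend) ⟩
      𝕊.1# n + (U ⊛ geometric U) n                              ∎
      where
      open SetoidReasoning setoid
      extend : ∀ a b → a ℕ.+ b ≡ n → sum (suc n) (λ j → U a * 𝕊.pow U j b) ≈ U a * geometric U b
      extend a b ≡.refl = trans (sym (sum-*ˡ (suc n) (U a) _))
        (*-congˡ (sum-truncate-≤ (ℕ.s≤s (ℕₚ.m≤n+m b a)) (λ j b<j → pow-vanishes U₀ j b<j)))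

-- The differential equation of the tree function

module TreeFunction where
  open RationalAlgebras
  open import Defs using (ℕ→ℚ; Series; Tser)
  open import Data.Nat as ℕ using (ℕ; zero; suc; _!)
  import Data.Nat.Properties as ℕₚ
  open import Data.Nat.Properties using (_!≢0)
  open import Data.Integer using (+_)
  open import Data.Rational using (ℚ; 0ℚ; 1ℚ; _+_; _*_; -_; _/_)
  import Data.Rational.Properties as ℚₚ
  open import Relation.Binary.PropositionalEquality
  open PowerSeries ℚ-algebra
  open QAlgebra ℚ-algebra using (pow; pow-+; module Solver)
  module 𝕊 = QAlgebra series-algebra
  open import Relation.Binary.Reasoning.Setoid 𝕊.setoid as ≋-Reasoning using ()

  1/! : ℕ → ℚ
  1/! n = _/_ (+ 1) (n !) {{n !≢0}}

  1/!-cancel : ∀ n → 1/! n * ℕ→ℚ (n !) ≡ 1ℚ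
  1/!-cancel n = /-*-cancel 1 (n !) {{n !≢0}}

  /!-≡ : ∀ m n → _/_ (+ m) (n !) {{n !≢0}} ≡ ℕ→ℚ m * 1/! n
  /!-≡ m n = *-cancelʳ-ℕ→ℚ (n !) {{n !≢0}} (begin
    _/_ (+ m) (n !) {{n !≢0}} * ℕ→ℚ (n !)     ≡⟨ /-*-cancel m (n !) {{n !≢0}} ⟩
    ℕ→ℚ m                                     ≡⟨ ℚₚ.*-identityʳ _ ⟨
    ℕ→ℚ m * 1ℚ                                ≡⟨ cong (ℕ→ℚ m *_) (1/!-cancel n) ⟨
    ℕ→ℚ m * (1/! n * ℕ→ℚ (n !))               ≡⟨ ℚₚ.*-assoc (ℕ→ℚ m) _ _ ⟨
    ℕ→ℚ m * 1/! n * ℕ→ℚ (n !)                 ∎)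
    where open ≡-Reasoning

  1/!-suc : ∀ n → ℕ→ℚ (suc n) * 1/! (suc n) ≡ 1/! n
  1/!-suc n = *-cancelʳ-ℕ→ℚ (n !) {{n !≢0}} (begin
    ℕ→ℚ (suc n) * 1/! (suc n) * ℕ→ℚ (n !)     ≡⟨ solve 3 (λ a b c → a :* b :* c := b :* (a :* c)) refl (ℕ→ℚ (suc n)) (1/! (suc n)) (ℕ→ℚ (n !)) ⟩
    1/! (suc n) * (ℕ→ℚ (suc n) * ℕ→ℚ (n !))   ≡⟨ cong (1/! (suc n) *_) (ℕ→ℚ-* (suc n) (n !)) ⟨
    1/! (suc n) * ℕ→ℚ (suc n !)               ≡⟨ 1/!-cancel (suc n) ⟩
    1ℚ                                        ≡⟨ 1/!-cancel n ⟨
    1/! n * ℕ→ℚ (n !)                         ∎)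
    where
    open ≡-Reasoning
    open Solver

  pow-* : ∀ x y n → pow (x * y) n ≡ pow x n * pow y n
  pow-* x y zero    = refl
  pow-* x y (suc n) = trans (cong (x * y *_) (pow-* x y n))
    (Solver.solve 4 (λ a b c d → a Solver.:* b Solver.:* (c Solver.:* d) Solver.:= a Solver.:* c Solver.:* (b Solver.:* d)) refl x y (pow x n) (pow y n))

  ℕ→ℚ-^ : ∀ m n → ℕ→ℚ (m ℕ.^ n) ≡ pow (ℕ→ℚ m) n
  ℕ→ℚ-^ m zero    = refl
  ℕ→ℚ-^ m (suc n) = trans (ℕ→ℚ-* m (m ℕ.^ n)) (cong (ℕ→ℚ m *_) (ℕ→ℚ-^ m n))

  expS : ℚ → Series
  expS x n = pow x n * 1/! n

  D-expS : ∀ x → D (expS x) ≋ shift (λ n → x * expS x n)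
  D-expS x zero    = ℚₚ.*-zeroˡ (expS x 0)
  D-expS x (suc n) = trans
    (Solver.solve 4 (λ s x p i → s Solver.:* (x Solver.:* p Solver.:* i) Solver.:= x Solver.:* (p Solver.:* (s Solver.:* i))) refl (ℕ→ℚ (suc n)) x (pow x n) (1/! (suc n)))
    (cong (λ i → x * (pow x n * i)) (1/!-suc n))

  *ˡ-⊛ : ∀ x X Y n → ((λ m → x * X m) ⊛ Y) n ≡ x * (X ⊛ Y) n
  *ˡ-⊛ x X Y n = trans (conv-cong (λ a b → ℚₚ.*-assoc x (X a) (Y b)) n) (conv-*ˡ x _ n)

  expS-+ : ∀ x y → expS x ⊛ expS y ≋ expS (x + y)
  expS-+ x y zero    = refl
  expS-+ x y (suc n) = *-cancelʳ-ℕ→ℚ (suc n) (trans (ℚₚ.*-comm _ s) (trans step (ℚₚ.*-comm s _)))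
    where
    open ≡-Reasoning
    s = ℕ→ℚ (suc n)
    X = expS x
    Y = expS y
    step : D (X ⊛ Y) (suc n) ≡ s * expS (x + y) (suc n)
    step = begin
      D (X ⊛ Y) (suc n)                              ≡⟨ D-⊛ X Y (suc n) ⟩
      (D X ⊛ Y) (suc n) + (X ⊛ D Y) (suc n)          ≡⟨ cong₂ _+_ (⊛-cong {D X} {_} {Y} (D-expS x) (λ _ → refl) (suc n))
                                                          (trans (⊛-comm X (D Y) (suc n)) (⊛-cong {D Y} {_} {X} (D-expS y) (λ _ → refl) (suc n))) ⟩
      (shift (λ m → x * X m) ⊛ Y) (suc n) + (shift (λ m → y * Y m) ⊛ X) (suc n)
        ≡⟨ cong₂ _+_ (trans (shift-⊛ (λ m → x * X m) Y (suc n)) (*ˡ-⊛ x X Y n)) (trans (shift-⊛ (λ m → y * Y m) X (suc n)) (*ˡ-⊛ y Y X n)) ⟩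
      x * (X ⊛ Y) n + y * (Y ⊛ X) n                  ≡⟨ cong (λ p → x * (X ⊛ Y) n + y * p) (⊛-comm Y X n) ⟩
      x * (X ⊛ Y) n + y * (X ⊛ Y) n                  ≡⟨ ℚₚ.*-distribʳ-+ _ x y ⟨
      (x + y) * (X ⊛ Y) n                            ≡⟨ cong ((x + y) *_) (expS-+ x y n) ⟩
      (x + y) * expS (x + y) n                       ≡⟨ D-expS (x + y) (suc n) ⟨
      s * expS (x + y) (suc n)                       ∎

  iterD : ℕ → Series → Series
  iterD zero    X = X
  iterD (suc m) X = D (iterD m X)

  -- The polynomials p with (z d/dz)^m e^z = p(z) e^z; their coefficients are the Stirling numbers
  -- of the second kind.
  touchard : ℕ → Series
  touchard zero    = 𝕊.1#
  touchard (suc m) = D (touchard m) 𝕊.+ shift (touchard m)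

  D-expS1 : D (expS 1ℚ) ≋ shift (expS 1ℚ)
  D-expS1 zero    = D-expS 1ℚ 0
  D-expS1 (suc n) = trans (D-expS 1ℚ (suc n)) (ℚₚ.*-identityˡ _)

  iterD-exp : ∀ m → iterD m (expS 1ℚ) ≋ touchard m ⊛ expS 1ℚ
  iterD-exp zero    n = sym (𝕊.*-identityˡ (expS 1ℚ) n)
  iterD-exp (suc m) = begin
    D (iterD m e)                         ≈⟨ D-cong (iterD-exp m) ⟩
    D (p ⊛ e)                             ≈⟨ D-⊛ p e ⟩
    D p ⊛ e 𝕊.+ p ⊛ D e                   ≈⟨ 𝕊.+-congˡ {D p ⊛ e} (𝕊.*-congˡ {p} D-expS1) ⟩
    D p ⊛ e 𝕊.+ p ⊛ shift e               ≈⟨ 𝕊.+-congˡ {D p ⊛ e} (⊛-comm p (shift e)) ⟩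
    D p ⊛ e 𝕊.+ shift e ⊛ p               ≈⟨ 𝕊.+-congˡ {D p ⊛ e} (λ n → trans (shift-⊛ e p n) (trans (shift-cong (⊛-comm e p) n) (sym (shift-⊛ p e n)))) ⟩
    D p ⊛ e 𝕊.+ shift p ⊛ e               ≈⟨ 𝕊.distribʳ e (D p) (shift p) ⟨
    (D p 𝕊.+ shift p) ⊛ e                 ∎
    where
    open ≋-Reasoning
    e = expS 1ℚ
    p = touchard m

  touchard-degree : ∀ m {n} → m ℕ.< n → touchard m n ≡ 0ℚ
  touchard-degree zero    {suc n} _ = refl
  touchard-degree (suc m) {suc n} (ℕ.s≤s m<n) = cong₂ _+_
    (trans (cong (ℕ→ℚ (suc n) *_) (touchard-degree m (ℕₚ.m<n⇒m<1+n m<n))) (ℚₚ.*-zeroʳ (ℕ→ℚ (suc n))))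
    (touchard-degree m m<n)

  expS0 : expS 0ℚ ≋ 𝕊.1#
  expS0 zero    = refl
  expS0 (suc n) = trans (cong (_* 1/! (suc n)) (ℚₚ.*-zeroˡ (pow 0ℚ n))) (ℚₚ.*-zeroˡ (1/! (suc n)))

  -- The coefficients are c-th finite differences of the polynomial a ↦ aᵐ, divided by c!.
  finite-difference : ∀ m {c} → m ℕ.< c → (iterD m (expS 1ℚ) ⊛ expS (- 1ℚ)) c ≡ 0ℚ
  finite-difference m {c} m<c = begin
    (iterD m (expS 1ℚ) ⊛ expS (- 1ℚ)) c             ≡⟨ 𝕊.*-congʳ (iterD-exp m) c ⟩
    ((touchard m ⊛ expS 1ℚ) ⊛ expS (- 1ℚ)) c        ≡⟨ ⊛-assoc (touchard m) (expS 1ℚ) (expS (- 1ℚ)) c ⟩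
    (touchard m ⊛ (expS 1ℚ ⊛ expS (- 1ℚ))) c        ≡⟨ 𝕊.*-congˡ {touchard m} (𝕊.trans (expS-+ 1ℚ (- 1ℚ)) expS0) c ⟩
    (touchard m ⊛ 𝕊.1#) c                           ≡⟨ 𝕊.*-identityʳ (touchard m) c ⟩
    touchard m c                                    ≡⟨ touchard-degree m m<c ⟩
    0ℚ                                              ∎
    where open ≡-Reasoning

  iterD-coefficient : ∀ m a → iterD m (expS 1ℚ) a ≡ pow (ℕ→ℚ a) m * 1/! a
  iterD-coefficient zero    a = cong (_* 1/! a) (pow-1 a)
    where
    pow-1 : ∀ a → pow 1ℚ a ≡ 1ℚ
    pow-1 zero    = refl
    pow-1 (suc a) = trans (ℚₚ.*-identityˡ _) (pow-1 a)
  iterD-coefficient (suc m) a = trans (cong (ℕ→ℚ a *_) (iterD-coefficient m a)) (sym (ℚₚ.*-assoc (ℕ→ℚ a) _ _))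

  Tser-coefficient : ∀ m → Tser (suc m) ≡ pow (ℕ→ℚ (suc m)) m * 1/! (suc m)
  Tser-coefficient m = trans (/!-≡ (suc m ℕ.^ m) (suc m)) (cong (_* 1/! (suc m)) (ℕ→ℚ-^ (suc m) m))

  private
    inner : ℕ → ℚ
    inner = conv (λ a j → Tser a * expS (- ℕ→ℚ a) j)

    -- The product of a^(a-1)/a! and (-a)^j/j! is, up to the sign (-1)^j, a^(a+j-1)/(a! j!), whose
    -- exponent depends only on a + j. The sum is therefore a finite difference of order m + 2 of
    -- the polynomial a^(m+1).
    inner-vanishes : ∀ m → inner (suc (suc m)) ≡ 0ℚ
    inner-vanishes m = trans (conv-cong≡ (suc (suc m)) term) (finite-difference (suc m) ℕₚ.≤-refl)
      where
      open ≡-Reasoning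
      open Solver
      term : ∀ a j → a ℕ.+ j ≡ suc (suc m) →
        Tser a * expS (- ℕ→ℚ a) j ≡ iterD (suc m) (expS 1ℚ) a * expS (- 1ℚ) j
      term zero    j _ = trans (ℚₚ.*-zeroˡ (expS (- ℕ→ℚ 0) j)) (sym (trans (cong (_* expS (- 1ℚ) j) (ℚₚ.*-zeroˡ (iterD m (expS 1ℚ) 0))) (ℚₚ.*-zeroˡ (expS (- 1ℚ) j))))
      term (suc a) j eq = begin
        Tser (suc a) * (pow (- x) j * 1/! j)
          ≡⟨ cong₂ (λ t p → t * (p * 1/! j)) (Tser-coefficient a)
               (trans (cong (λ y → pow y j) (solve 1 (λ x → :- x := x :* con (- 1ℚ)) refl x)) (pow-* x (- 1ℚ) j)) ⟩
        pow x a * 1/! (suc a) * (pow x j * pow (- 1ℚ) j * 1/! j)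
          ≡⟨ solve 5 (λ p i q r k → p :* i :* (q :* r :* k) := p :* q :* i :* (r :* k)) refl
               (pow x a) (1/! (suc a)) (pow x j) (pow (- 1ℚ) j) (1/! j) ⟩
        pow x a * pow x j * 1/! (suc a) * (pow (- 1ℚ) j * 1/! j)
          ≡⟨ cong (λ p → p * 1/! (suc a) * expS (- 1ℚ) j)
               (trans (sym (pow-+ x a j)) (cong (pow x) (ℕₚ.suc-injective eq))) ⟩
        pow x (suc m) * 1/! (suc a) * expS (- 1ℚ) j
          ≡⟨ cong (_* expS (- 1ℚ) j) (iterD-coefficient (suc m) (suc a)) ⟨
        iterD (suc m) (expS 1ℚ) (suc a) * expS (- 1ℚ) j ∎
        where x = ℕ→ℚ (suc a)

    selfpowers : Series
    selfpowers n = expS (ℕ→ℚ n) n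

    selfpowers≋ : selfpowers ≋ 𝕊.1# 𝕊.+ D Tser
    selfpowers≋ zero    = refl
    selfpowers≋ (suc n) = begin
      x * pow x n * 1/! (suc n)       ≡⟨ ℚₚ.*-assoc x _ _ ⟩
      x * (pow x n * 1/! (suc n))     ≡⟨ cong (x *_) (Tser-coefficient n) ⟨
      x * Tser (suc n)                ≡⟨ ℚₚ.+-identityˡ _ ⟨
      0ℚ + x * Tser (suc n)           ∎
      where
      open ≡-Reasoning
      x = ℕ→ℚ (suc n)

    -- Abel's identity. With b = (a + b) - a, the power b^b is expanded by the binomial theorem and
    -- the terms are regrouped by s = a + j. The inner sums vanish for s = 0 and for s at least 2;
    -- the one for s = 1 equals 1 and leaves N^(N-1)/(N-1)! with N = a + b.
    abel : D Tser ≋ Tser ⊛ selfpowers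
    abel zero    = refl
    abel (suc n) = sym (begin
      conv (λ a b → Tser a * expS (ℕ→ℚ b) b) (suc n)
        ≡⟨ conv-cong≡ (suc n) binomial ⟩
      conv (λ a b → conv (λ j i → Tser a * expS (- ℕ→ℚ a) j * expS x i) b) (suc n)
        ≡⟨ conv-assoc (λ a j i → Tser a * expS (- ℕ→ℚ a) j * expS x i) (suc n) ⟨
      conv (λ s i → conv (λ a j → Tser a * expS (- ℕ→ℚ a) j * expS x i) s) (suc n)
        ≡⟨ conv-cong (λ s i → conv-*ʳ (expS x i) (λ a j → Tser a * expS (- ℕ→ℚ a) j) s) (suc n) ⟩
      inner 0 * expS x (suc n) + conv (λ s i → inner (suc s) * expS x i) n
        ≡⟨ cong₂ _+_ (ℚₚ.*-zeroˡ (expS x (suc n)))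
             (conv-first (λ s i → inner (suc s) * expS x i) n
               (λ s i → trans (cong (_* expS x i) (inner-vanishes s)) (ℚₚ.*-zeroˡ (expS x i)))) ⟩
      0ℚ + 1ℚ * expS x n                      ≡⟨ trans (ℚₚ.+-identityˡ _) (ℚₚ.*-identityˡ _) ⟩
      pow x n * 1/! n                         ≡⟨ cong (pow x n *_) (1/!-suc n) ⟨
      pow x n * (x * 1/! (suc n))             ≡⟨ solve 3 (λ p x i → p :* (x :* i) := x :* (p :* i)) refl (pow x n) x (1/! (suc n)) ⟩
      x * (pow x n * 1/! (suc n))             ≡⟨ cong (x *_) (Tser-coefficient n) ⟨
      x * Tser (suc n)                        ∎)
      where
      open ≡-Reasoning
      open Solver
      x = ℕ→ℚ (suc n)
      binomial : ∀ a b → a ℕ.+ b ≡ suc n →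
        Tser a * expS (ℕ→ℚ b) b ≡ conv (λ j i → Tser a * expS (- ℕ→ℚ a) j * expS x i) b
      binomial a b eq = begin
        Tser a * expS (ℕ→ℚ b) b                              ≡⟨ cong (λ y → Tser a * expS y b) difference ⟩
        Tser a * expS (- ℕ→ℚ a + x) b                        ≡⟨ cong (Tser a *_) (expS-+ (- ℕ→ℚ a) x b) ⟨
        Tser a * (expS (- ℕ→ℚ a) ⊛ expS x) b                 ≡⟨ conv-*ˡ (Tser a) _ b ⟨
        conv (λ j i → Tser a * (expS (- ℕ→ℚ a) j * expS x i)) b ≡⟨ conv-cong (λ j i → sym (ℚₚ.*-assoc (Tser a) _ _)) b ⟩
        conv (λ j i → Tser a * expS (- ℕ→ℚ a) j * expS x i) b ∎
        where
        difference : ℕ→ℚ b ≡ - ℕ→ℚ a + x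
        difference = trans (solve 2 (λ a b → b := :- a :+ (a :+ b)) refl (ℕ→ℚ a) (ℕ→ℚ b))
          (cong (λ y → - ℕ→ℚ a + y) (trans (sym (ℕ→ℚ-+ a b)) (cong ℕ→ℚ eq)))

  -- The logarithmic derivative of T = z e^T. In this form no composition of series is needed.
  D-Tser : D Tser ≋ Tser 𝕊.+ Tser ⊛ D Tser
  D-Tser = begin
    D Tser                            ≈⟨ abel ⟩
    Tser ⊛ selfpowers                 ≈⟨ 𝕊.*-congˡ {Tser} selfpowers≋ ⟩
    Tser ⊛ (𝕊.1# 𝕊.+ D Tser)          ≈⟨ 𝕊.distribˡ Tser 𝕊.1# (D Tser) ⟩
    Tser ⊛ 𝕊.1# 𝕊.+ Tser ⊛ D Tser     ≈⟨ 𝕊.+-congʳ {Tser ⊛ D Tser} (𝕊.*-identityʳ Tser) ⟩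
    Tser 𝕊.+ Tser ⊛ D Tser            ∎
    where open ≋-Reasoning

-- Laurent polynomials in 1 - T and their two leading coefficients

module LaurentPolynomials where
  open RationalAlgebras
  open import Defs using (ℕ→ℚ)
  open import Data.Nat as ℕ using (ℕ; zero; suc)
  import Data.Nat.Properties as ℕₚ
  open import Data.Rational as ℚ using (ℚ; 0ℚ; 1ℚ)
  import Data.Rational.Properties as ℚₚ
  open import Data.Product using (∃; _×_; _,_; proj₁; proj₂)
  open import Function using (_∘_)
  open import Relation.Binary.PropositionalEquality as ≡ using (_≡_)
  import Relation.Binary.Reasoning.Setoid as SetoidReasoning

  ν*≡0 : ∀ n {p} → ℕ→ℚ (suc n) ℚ.* p ≡ 0ℚ → p ≡ 0ℚ
  ν*≡0 n {p} eq = *-cancelʳ-ℕ→ℚ (suc n) (≡.trans (ℚₚ.*-comm p _) (≡.trans eq (≡.sym (ℚₚ.*-zeroˡ (ℕ→ℚ (suc n))))))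

  -- What the pole calculus needs to know about T. The fields `DT-cancel` and `ι-injective` serve
  -- the transcendence of T, on which comparison of coefficients rests.
  record TreeAlgebra : Set₁ where
    field
      algebra : QAlgebra
    open QAlgebra algebra public
    field
      D           : Carrier → Carrier
      D-cong      : ∀ {x y} → x ≈ y → D x ≈ D y
      D-+         : ∀ x y → D (x + y) ≈ D x + D y
      D-*         : ∀ x y → D (x * y) ≈ D x * y + x * D y
      D-ι         : ∀ p → D (ι p) ≈ 0#
      T           : Carrier
      D-T         : D T ≈ T + T * D T
      Q           : Carrier
      θ*Q         : (1# + - T) * Q ≈ 1#
      DT-cancel   : ∀ x → D T * x ≈ 0# → x ≈ 0#
      ι-injective : ∀ p → ι p ≈ 0# → p ≡ 0ℚ

  module Poles (𝒯 : TreeAlgebra) where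
    open TreeAlgebra 𝒯 public
    open Antidiagonal algebra using (conv; sum)
    open Solver using (solve; _:=_; _:+_; _:*_; :-_; con)
    open SetoidReasoning setoid
    module ℚA = Antidiagonal ℚ-algebra

    θ : Carrier
    θ = 1# + - T

    D-0 : D 0# ≈ 0#
    D-0 = trans (D-cong (sym ι-0)) (D-ι 0ℚ)

    D-scale : ∀ p x → D (ι p * x) ≈ ι p * D x
    D-scale p x = trans (D-* (ι p) x) (trans (+-congʳ (trans (*-congʳ (D-ι p)) (zeroˡ x))) (+-identityˡ _))

    D-neg : ∀ x → D (- x) ≈ - D x
    D-neg x = begin
      D (- x)             ≈⟨ D-cong (solve 1 (λ x → :- x := con (ℚ.- 1ℚ) :* x) refl x) ⟩
      D (ι (ℚ.- 1ℚ) * x)  ≈⟨ D-scale _ x ⟩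
      ι (ℚ.- 1ℚ) * D x    ≈⟨ solve 1 (λ x → con (ℚ.- 1ℚ) :* x := :- x) refl (D x) ⟩
      - D x               ∎

    Dθ≈-DT : D θ ≈ - D T
    Dθ≈-DT = begin
      D (1# + - T)     ≈⟨ D-+ 1# (- T) ⟩
      D 1# + D (- T)   ≈⟨ +-cong (trans (D-cong (sym ι-1)) (D-ι 1ℚ)) (D-neg T) ⟩
      0# + - D T       ≈⟨ +-identityˡ _ ⟩
      - D T            ∎

    θ*DT : θ * D T ≈ T
    θ*DT = begin
      (1# + - T) * D T       ≈⟨ solve 3 (λ o t d → (o :+ :- t) :* d := o :* d :+ :- (t :* d)) refl 1# T (D T) ⟩
      1# * D T + - (T * D T) ≈⟨ +-congʳ (trans (*-identityˡ (D T)) D-T) ⟩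
      T + T * D T + - (T * D T) ≈⟨ solve 2 (λ t d → t :+ d :+ :- d := t) refl T (T * D T) ⟩
      T                      ∎

    -- On functions of θ this says θ D = (θ - 1) d/dθ. Hence `θ * D` preserves polynomials in θ and
    -- raises a pole order by at most 1, and `D` raises it by at most 2.
    θ*Dθ : θ * D θ ≈ θ + - ι 1ℚ
    θ*Dθ = begin
      θ * D θ          ≈⟨ *-congˡ Dθ≈-DT ⟩
      θ * - D T        ≈⟨ solve 2 (λ x y → x :* :- y := :- (x :* y)) refl θ (D T) ⟩
      - (θ * D T)      ≈⟨ -‿cong θ*DT ⟩
      - T              ≈⟨ solve 2 (λ o t → :- t := o :+ :- t :+ :- o) refl 1# T ⟩
      θ + - 1#         ≈⟨ +-congˡ (-‿cong ι-1) ⟨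
      θ + - ι 1ℚ       ∎

    θ-cancel : ∀ {x y} → θ * x ≈ θ * y → x ≈ y
    θ-cancel {x} {y} eq = trans (sym (undo x)) (trans (*-congˡ eq) (undo y))
      where
      undo : ∀ x → Q * (θ * x) ≈ x
      undo x = trans (solve 3 (λ q t x → q :* (t :* x) := (t :* q) :* x) refl Q θ x) (trans (*-congʳ θ*Q) (*-identityˡ x))

    -- Membership in ℚ[θ], witnessed by a Horner scheme. It is evidence about an element of the
    -- carrier up to `≈`; the coefficients are not determined by the type.
    data Poly (x : Carrier) : Set where
      poly-0 : x ≈ 0# → Poly x
      poly-∷ : ∀ p {y} → Poly y → x ≈ ι p + θ * y → Poly x

    poly-cong : ∀ {x y} → x ≈ y → Poly x → Poly y
    poly-cong eq (poly-0 x≈)     = poly-0 (trans (sym eq) x≈)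
    poly-cong eq (poly-∷ p y x≈) = poly-∷ p y (trans (sym eq) x≈)

    poly-split : ∀ {x} → Poly x → ∃ λ p → ∃ λ y → Poly y × (x ≈ ι p + θ * y)
    poly-split (poly-0 x≈)     = 0ℚ , 0# , poly-0 refl ,
      trans x≈ (sym (trans (+-cong ι-0 (zeroʳ θ)) (+-identityˡ 0#)))
    poly-split (poly-∷ p y x≈) = p , _ , y , x≈

    poly-ι : ∀ p → Poly (ι p)
    poly-ι p = poly-∷ p (poly-0 refl) (sym (trans (+-congˡ (zeroʳ θ)) (+-identityʳ _)))

    poly-1 : Poly 1#
    poly-1 = poly-cong ι-1 (poly-ι 1ℚ)

    poly-θ* : ∀ {x} → Poly x → Poly (θ * x)
    poly-θ* px = poly-∷ 0ℚ px (sym (trans (+-congʳ ι-0) (+-identityˡ _)))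

    poly-+ : ∀ {x y} → Poly x → Poly y → Poly (x + y)
    poly-+ (poly-0 x≈) py = poly-cong (sym (trans (+-congʳ x≈) (+-identityˡ _))) py
    poly-+ px@(poly-∷ _ _ _) (poly-0 y≈) = poly-cong (sym (trans (+-congˡ y≈) (+-identityʳ _))) px
    poly-+ (poly-∷ p {x} px x≈) (poly-∷ q {y} py y≈) = poly-∷ (p ℚ.+ q) (poly-+ px py)
      (trans (+-cong x≈ y≈) (trans
        (solve 5 (λ a b t x y → (a :+ t :* x) :+ (b :+ t :* y) := (a :+ b) :+ t :* (x :+ y)) refl (ι p) (ι q) θ x y)
        (+-congʳ (sym (ι-+ p q)))))

    poly-scale : ∀ r {x} → Poly x → Poly (ι r * x)
    poly-scale r (poly-0 x≈) = poly-0 (trans (*-congˡ x≈) (zeroʳ _))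
    poly-scale r (poly-∷ p {x} px x≈) = poly-∷ (r ℚ.* p) (poly-scale r px)
      (trans (*-congˡ x≈) (trans
        (solve 4 (λ r p t x → r :* (p :+ t :* x) := r :* p :+ t :* (r :* x)) refl (ι r) (ι p) θ x)
        (+-congʳ (sym (ι-* r p)))))

    poly-neg : ∀ {x} → Poly x → Poly (- x)
    poly-neg {x} px = poly-cong (solve 1 (λ x → con (ℚ.- 1ℚ) :* x := :- x) refl x) (poly-scale (ℚ.- 1ℚ) px)

    poly-* : ∀ {x y} → Poly x → Poly y → Poly (x * y)
    poly-* (poly-0 x≈) py = poly-0 (trans (*-congʳ x≈) (zeroˡ _))
    poly-* {x} {y} (poly-∷ p {x′} px x≈) py = poly-cong
      (sym (trans (*-congʳ x≈) (solve 4 (λ p t x y → (p :+ t :* x) :* y := p :* y :+ t :* (x :* y)) refl (ι p) θ x′ y)))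
      (poly-+ (poly-scale p py) (poly-θ* (poly-* px py)))

    poly-θ : Poly θ
    poly-θ = poly-cong (*-identityʳ θ) (poly-θ* poly-1)

    poly-T : Poly T
    poly-T = poly-cong (solve 2 (λ o t → o :+ :- (o :+ :- t) := t) refl 1# T) (poly-+ poly-1 (poly-neg poly-θ))

    poly-θ-1 : Poly (θ + - ι 1ℚ)
    poly-θ-1 = poly-+ poly-θ (poly-neg (poly-ι 1ℚ))

    D-θ* : ∀ x → θ * D (θ * x) ≈ (θ + - ι 1ℚ) * x + θ * (θ * D x)
    D-θ* x = begin
      θ * D (θ * x)                    ≈⟨ *-congˡ (D-* θ x) ⟩
      θ * (D θ * x + θ * D x)          ≈⟨ solve 4 (λ t d x e → t :* (d :* x :+ t :* e) := (t :* d) :* x :+ t :* (t :* e)) refl θ (D θ) x (D x) ⟩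
      (θ * D θ) * x + θ * (θ * D x)    ≈⟨ +-congʳ (*-congʳ θ*Dθ) ⟩
      (θ + - ι 1ℚ) * x + θ * (θ * D x)   ∎

    D-ι+ : ∀ p x → D (ι p + x) ≈ D x
    D-ι+ p x = trans (D-+ (ι p) x) (trans (+-congʳ (D-ι p)) (+-identityˡ _))

    poly-θD : ∀ {x} → Poly x → Poly (θ * D x)
    poly-θD (poly-0 x≈) = poly-0 (trans (*-congˡ (trans (D-cong x≈) D-0)) (zeroʳ θ))
    poly-θD (poly-∷ p {x} px x≈) = poly-cong
      (sym (trans (*-congˡ (trans (D-cong x≈) (D-ι+ p (θ * x)))) (D-θ* x)))
      (poly-+ (poly-* poly-θ-1 px) (poly-θ* (poly-θD px)))

    θ^ : ℕ → Carrier
    θ^ = pow θ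

    θ²Dθ^ : ∀ d → θ * (θ * D (θ^ d)) ≈ ν d * ((θ + - ι 1ℚ) * θ^ d)
    θ²Dθ^ zero = trans (*-congˡ (trans (*-congˡ (trans (D-cong (sym ι-1)) (D-ι 1ℚ))) (zeroʳ θ)))
      (trans (zeroʳ θ) (sym (trans (*-congʳ ι-0) (zeroˡ _))))
    θ²Dθ^ (suc d) = begin
      θ * (θ * D (θ * θ^ d))                              ≈⟨ *-congˡ (D-θ* (θ^ d)) ⟩
      θ * ((θ + - ι 1ℚ) * θ^ d + θ * (θ * D (θ^ d)))        ≈⟨ *-congˡ (+-congˡ (θ²Dθ^ d)) ⟩
      θ * ((θ + - ι 1ℚ) * θ^ d + ν d * ((θ + - ι 1ℚ) * θ^ d)) ≈⟨ solve 4 (λ t u v n → t :* (u :* v :+ n :* (u :* v)) := (con 1ℚ :+ n) :* (u :* (t :* v))) refl θ (θ + - ι 1ℚ) (θ^ d) (ν d) ⟩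
      (ι 1ℚ + ν d) * ((θ + - ι 1ℚ) * (θ * θ^ d))            ≈⟨ *-congʳ (trans (sym (ι-+ _ _)) (reflexive (≡.cong ι (≡.sym (ℕ→ℚ-suc d))))) ⟩
      ν (suc d) * ((θ + - ι 1ℚ) * (θ * θ^ d))               ∎

    -- The quotient rule with cleared denominators: the derivative of x is expressed by the
    -- numerator θ^d x alone, so that closure of ℚ[θ] under `θ * D` carries over to Laurent
    -- polynomials.
    θ^*θD : ∀ d x → θ^ (suc d) * (θ * D x) ≈ θ * (θ * D (θ^ d * x)) + - (ν d * ((θ + - ι 1ℚ) * (θ^ d * x)))
    θ^*θD d x = sym (begin
      θ * (θ * D (θ^ d * x)) + - (ν d * ((θ + - ι 1ℚ) * (θ^ d * x)))
        ≈⟨ +-cong (*-congˡ (*-congˡ (D-* (θ^ d) x))) (-‿cong (solve 4 (λ n u v x → n :* (u :* (v :* x)) := n :* (u :* v) :* x) refl (ν d) (θ + - ι 1ℚ) (θ^ d) x)) ⟩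
      θ * (θ * (D (θ^ d) * x + θ^ d * D x)) + - (ν d * ((θ + - ι 1ℚ) * θ^ d) * x)
        ≈⟨ +-congˡ (-‿cong (*-congʳ (θ²Dθ^ d))) ⟨
      θ * (θ * (D (θ^ d) * x + θ^ d * D x)) + - (θ * (θ * D (θ^ d)) * x)
        ≈⟨ solve 5 (λ t e x v f → t :* (t :* (e :* x :+ v :* f)) :+ :- (t :* (t :* e) :* x) := t :* v :* (t :* f)) refl θ (D (θ^ d)) x (θ^ d) (D x) ⟩
      θ^ (suc d) * (θ * D x) ∎)

    -- Membership in θ^(-d) ℚ[θ]: a Laurent polynomial in 1 - T with a pole of order at most d.
    record In (d : ℕ) (x : Carrier) : Set where
      constructor mkIn
      field
        numerator : Poly (θ^ d * x)
    open In

    in-cong : ∀ {d x y} → x ≈ y → In d x → In d y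
    in-cong eq (mkIn p) = mkIn (poly-cong (*-congˡ eq) p)

    in-poly : ∀ {x} → Poly x → In 0 x
    in-poly {x} p = mkIn (poly-cong (sym (*-identityˡ x)) p)

    in-suc : ∀ {d x} → In d x → In (suc d) x
    in-suc (mkIn p) = mkIn (poly-cong (sym (*-assoc _ _ _)) (poly-θ* p))

    in-raise : ∀ e {d x} → In d x → In (e ℕ.+ d) x
    in-raise zero    i = i
    in-raise (suc e) i = in-suc (in-raise e i)

    in-≤ : ∀ {d e x} → d ℕ.≤ e → In d x → In e x
    in-≤ {d} {e} {x} d≤e i = ≡.subst (λ m → In m x) (ℕₚ.m∸n+n≡m d≤e) (in-raise (e ℕ.∸ d) i)

    in-+ : ∀ {d x y} → In d x → In d y → In d (x + y)
    in-+ (mkIn p) (mkIn q) = mkIn (poly-cong (sym (distribˡ _ _ _)) (poly-+ p q))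

    in-scale : ∀ r {d x} → In d x → In d (ι r * x)
    in-scale r {d} {x} (mkIn p) = mkIn (poly-cong (solve 3 (λ r v x → r :* (v :* x) := v :* (r :* x)) refl (ι r) (θ^ d) x) (poly-scale r p))

    in-neg : ∀ {d x} → In d x → In d (- x)
    in-neg {d} {x} (mkIn p) = mkIn (poly-cong (solve 2 (λ v x → :- (v :* x) := v :* :- x) refl (θ^ d) x) (poly-neg p))

    in-* : ∀ {d e x y} → In d x → In e y → In (d ℕ.+ e) (x * y)
    in-* {d} {e} {x} {y} (mkIn p) (mkIn q) = mkIn (poly-cong
      (trans (solve 4 (λ u v x y → u :* x :* (v :* y) := u :* v :* (x :* y)) refl (θ^ d) (θ^ e) x y) (*-congʳ (sym (pow-+ θ d e))))
      (poly-* p q))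

    in-0 : ∀ d → In d 0#
    in-0 d = mkIn (poly-0 (zeroʳ _))

    in-θD : ∀ {d x} → In d x → In (suc d) (θ * D x)
    in-θD {d} {x} (mkIn p) = mkIn (poly-cong (sym (θ^*θD d x))
      (poly-+ (poly-θ* (poly-θD p)) (poly-neg (poly-scale (ℕ→ℚ d) (poly-* poly-θ-1 p)))))

    θ^*θ* : ∀ d x → θ^ d * (θ * x) ≈ θ^ (suc d) * x
    θ^*θ* d x = solve 3 (λ v t x → v :* (t :* x) := t :* v :* x) refl (θ^ d) θ x

    in-D : ∀ {d x} → In d x → In (suc (suc d)) (D x)
    in-D {d} {x} i = mkIn (poly-cong (θ^*θ* (suc d) (D x)) (numerator (in-θD i)))

    in-conv : ∀ {d} {f : ℕ → ℕ → Carrier} n → (∀ a b → a ℕ.+ b ≡ n → In d (f a b)) → In d (conv f n)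
    in-conv zero    i = i 0 0 ≡.refl
    in-conv (suc n) i = in-+ (i 0 (suc n) ≡.refl) (in-conv n (λ a b eq → i (suc a) b (≡.cong suc eq)))

    in-sum : ∀ {d} n {f} → (∀ j → In d (f j)) → In d (sum n f)
    in-sum {d} zero i = in-0 d
    in-sum (suc n) i = in-+ (in-sum n i) (i n)

    -- The expansion x = a θ^(-d) + b θ^(-d+1) + lower poles. Both a and b may vanish, so d is only
    -- an upper bound for the order and one element has expansions at many d.
    record Lead (d : ℕ) (a b : ℚ) (x : Carrier) : Set where
      constructor mkLead
      field
        {rest}    : Carrier
        rest-poly : Poly rest
        expansion : θ^ d * x ≈ ι a + θ * (ι b + θ * rest)

    lead-cong : ∀ {d a b x y} → x ≈ y → Lead d a b x → Lead d a b y
    lead-cong eq (mkLead pz e) = mkLead pz (trans (*-congˡ (sym eq)) e)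

    lead-coefficients : ∀ {d d′ a a′ b b′ x} → d ≡ d′ → a ≡ a′ → b ≡ b′ → Lead d a b x → Lead d′ a′ b′ x
    lead-coefficients ≡.refl ≡.refl ≡.refl l = l

    in-lead : ∀ {d x} → In d x → ∃ λ a → ∃ λ b → Lead d a b x
    in-lead (mkIn i) with poly-split i
    ... | a , y , py , eq with poly-split py
    ...   | b , z , pz , eq′ = a , b , mkLead pz (trans eq (+-congˡ (*-congˡ eq′)))

    lead-in : ∀ {d a b x} → Lead d a b x → In d x
    lead-in {a = a} {b} (mkLead pz eq) = mkIn (poly-cong (sym eq) (poly-+ (poly-ι a) (poly-θ* (poly-+ (poly-ι b) (poly-θ* pz)))))

    lead-suc : ∀ {d a b x} → Lead d a b x → Lead (suc d) 0ℚ a x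
    lead-suc {d} {a} {b} {x} (mkLead {z} pz eq) = mkLead (poly-+ (poly-ι b) (poly-θ* pz))
      (begin
        θ * θ^ d * x                                     ≈⟨ *-assoc _ _ _ ⟩
        θ * (θ^ d * x)                                   ≈⟨ *-congˡ eq ⟩
        θ * (ι a + θ * (ι b + θ * z))                    ≈⟨ solve 3 (λ t a u → t :* (a :+ t :* u) := con 0ℚ :+ t :* (a :+ t :* u)) refl θ (ι a) (ι b + θ * z) ⟩
        ι 0ℚ + θ * (ι a + θ * (ι b + θ * z))             ∎)

    in-lead-suc : ∀ {d x} → In d x → ∃ λ b → Lead (suc d) 0ℚ b x
    in-lead-suc i with in-lead i
    ... | a , b , l = a , lead-suc l

    in-lead-suc² : ∀ {d x} → In d x → Lead (suc (suc d)) 0ℚ 0ℚ x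
    in-lead-suc² i with in-lead i
    ... | a , b , l = lead-suc (lead-suc l)

    lead-+ : ∀ {d a b a′ b′ x y} → Lead d a b x → Lead d a′ b′ y → Lead d (a ℚ.+ a′) (b ℚ.+ b′) (x + y)
    lead-+ {d} {a} {b} {a′} {b′} {x} {y} (mkLead {z} pz e) (mkLead {z′} pz′ e′) = mkLead (poly-+ pz pz′)
      (begin
        θ^ d * (x + y)          ≈⟨ distribˡ _ _ _ ⟩
        θ^ d * x + θ^ d * y     ≈⟨ +-cong e e′ ⟩
        (ι a + θ * (ι b + θ * z)) + (ι a′ + θ * (ι b′ + θ * z′))
          ≈⟨ solve 7 (λ t a b z a′ b′ z′ → (a :+ t :* (b :+ t :* z)) :+ (a′ :+ t :* (b′ :+ t :* z′))
               := (a :+ a′) :+ t :* ((b :+ b′) :+ t :* (z :+ z′))) refl θ (ι a) (ι b) z (ι a′) (ι b′) z′ ⟩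
        (ι a + ι a′) + θ * ((ι b + ι b′) + θ * (z + z′))
          ≈⟨ +-cong (ι-+ a a′) (*-congˡ (+-congʳ (ι-+ b b′))) ⟨
        ι (a ℚ.+ a′) + θ * (ι (b ℚ.+ b′) + θ * (z + z′)) ∎)

    lead-scale : ∀ r {d a b x} → Lead d a b x → Lead d (r ℚ.* a) (r ℚ.* b) (ι r * x)
    lead-scale r {d} {a} {b} {x} (mkLead {z} pz e) = mkLead (poly-scale r pz)
      (begin
        θ^ d * (ι r * x)        ≈⟨ solve 3 (λ v r x → v :* (r :* x) := r :* (v :* x)) refl (θ^ d) (ι r) x ⟩
        ι r * (θ^ d * x)        ≈⟨ *-congˡ e ⟩
        ι r * (ι a + θ * (ι b + θ * z))
          ≈⟨ solve 5 (λ r t a b z → r :* (a :+ t :* (b :+ t :* z)) := r :* a :+ t :* (r :* b :+ t :* (r :* z))) refl (ι r) θ (ι a) (ι b) z ⟩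
        ι r * ι a + θ * (ι r * ι b + θ * (ι r * z))
          ≈⟨ +-cong (ι-* r a) (*-congˡ (+-congʳ (ι-* r b))) ⟨
        ι (r ℚ.* a) + θ * (ι (r ℚ.* b) + θ * (ι r * z)) ∎)

    lead-* : ∀ {d e a b a′ b′ x y} → Lead d a b x → Lead e a′ b′ y →
      Lead (d ℕ.+ e) (a ℚ.* a′) (a ℚ.* b′ ℚ.+ b ℚ.* a′) (x * y)
    lead-* {d} {e} {a} {b} {a′} {b′} {x} {y} (mkLead {z} pz eq) (mkLead {z′} pz′ eq′) = mkLead
      (poly-+ (poly-+ (poly-+ (poly-+ (poly-scale b (poly-ι b′)) (poly-scale a pz′)) (poly-scale a′ pz))
        (poly-θ* (poly-+ (poly-scale b pz′) (poly-scale b′ pz)))) (poly-θ* (poly-θ* (poly-* pz pz′))))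
      (begin
        θ^ (d ℕ.+ e) * (x * y)     ≈⟨ *-congʳ (pow-+ θ d e) ⟩
        θ^ d * θ^ e * (x * y)      ≈⟨ solve 4 (λ u v x y → u :* v :* (x :* y) := u :* x :* (v :* y)) refl (θ^ d) (θ^ e) x y ⟩
        θ^ d * x * (θ^ e * y)      ≈⟨ *-cong eq eq′ ⟩
        (ι a + θ * (ι b + θ * z)) * (ι a′ + θ * (ι b′ + θ * z′))
          ≈⟨ solve 7 (λ t a b z a′ b′ z′ → (a :+ t :* (b :+ t :* z)) :* (a′ :+ t :* (b′ :+ t :* z′))
               := a :* a′ :+ t :* ((a :* b′ :+ b :* a′) :+ t :* (b :* b′ :+ a :* z′ :+ a′ :* z :+ t :* (b :* z′ :+ b′ :* z) :+ t :* (t :* (z :* z′)))))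
               refl θ (ι a) (ι b) z (ι a′) (ι b′) z′ ⟩
        ι a * ι a′ + θ * ((ι a * ι b′ + ι b * ι a′) + θ * _)
          ≈⟨ +-cong (ι-* a a′) (*-congˡ (+-congʳ (trans (ι-+ _ _) (+-cong (ι-* a b′) (ι-* b a′))))) ⟨
        ι (a ℚ.* a′) + θ * (ι (a ℚ.* b′ ℚ.+ b ℚ.* a′) + θ * _) ∎)

    -- Applied to θ^(-d), the operator θ D gives d θ^(-d-1) - d θ^(-d). The second new coefficient
    -- thus combines (d - 1) b from the second old term with -d a from the first.
    lead-θD : ∀ {d a b x} → Lead d a b x →
      Lead (suc d) (ℕ→ℚ d ℚ.* a) ((ℕ→ℚ d ℚ.- 1ℚ) ℚ.* b ℚ.- ℕ→ℚ d ℚ.* a) (θ * D x)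
    lead-θD {d} {a} {b} {x} (mkLead {z} pz eq) = mkLead
      (poly-+ (poly-+ (poly-+ (poly-+ pu (poly-+ (poly-θ* pz) (poly-neg pz))) (poly-θ* (poly-θD pz)))
        (poly-neg (poly-scale (ℕ→ℚ d) pu))) (poly-+ (poly-scale (ℕ→ℚ d) pz) (poly-neg pz)))
      (begin
        θ^ (suc d) * (θ * D x)
          ≈⟨ θ^*θD d x ⟩
        θ * (θ * D (θ^ d * x)) + - (ν d * ((θ + - ι 1ℚ) * (θ^ d * x)))
          ≈⟨ +-cong (*-congˡ (trans (*-congˡ (trans (D-cong eq) (D-ι+ a _))) (D-θ* _))) (-‿cong (*-congˡ (*-congˡ eq))) ⟩
        θ * ((θ + - ι 1ℚ) * u + θ * (θ * D u)) + - (ν d * ((θ + - ι 1ℚ) * (ι a + θ * u)))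
          ≈⟨ +-congʳ (*-congˡ (+-congˡ (*-congˡ (trans (*-congˡ (D-ι+ b _)) (D-θ* z))))) ⟩
        θ * ((θ + - ι 1ℚ) * u + θ * ((θ + - ι 1ℚ) * z + θ * (θ * D z))) + - (ν d * ((θ + - ι 1ℚ) * (ι a + θ * u)))
          ≈⟨ +-cong (*-congˡ (+-cong (minus-1 u) (*-congˡ (+-congʳ (minus-1 z))))) (-‿cong (*-congˡ (minus-1 (ι a + θ * u)))) ⟩
        θ * ((θ * u + - u) + θ * ((θ * z + - z) + θ * (θ * D z))) + - (ν d * (θ * (ι a + θ * u) + - (ι a + θ * u)))
          ≈⟨ solve 6 (λ t n a u z f → t :* ((t :* u :+ :- u) :+ t :* ((t :* z :+ :- z) :+ f)) :+ :- (n :* (t :* (a :+ t :* u) :+ :- (a :+ t :* u)))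
               := n :* a :+ t :* ((n :* u :+ :- u :+ :- (n :* a)) :+ t :* (u :+ (t :* z :+ :- z) :+ f :+ :- (n :* u))))
               refl θ (ν d) (ι a) u z (θ * (θ * D z)) ⟩
        ν d * ι a + θ * ((ν d * u + - u + - (ν d * ι a)) + θ * (u + (θ * z + - z) + θ * (θ * D z) + - (ν d * u)))
          ≈⟨ +-congˡ (*-congˡ (solve 6 (λ t n a b z r → (n :* (b :+ t :* z) :+ :- (b :+ t :* z) :+ :- a) :+ t :* r
               := ((n :+ :- con 1ℚ) :* b :+ :- a) :+ t :* (r :+ (n :* z :+ :- z))) refl θ (ν d) (ν d * ι a) (ι b) z _)) ⟩
        ν d * ι a + θ * (((ν d + - ι 1ℚ) * ι b + - (ν d * ι a)) + θ * _)
          ≈⟨ +-cong (ι-* _ a) (*-congˡ (+-congʳ (trans (ι-+ _ _) (+-cong (trans (ι-* _ b) (*-congʳ (trans (ι-+ _ _) (+-congˡ (ι-neg 1ℚ)))))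
               (trans (ι-neg _) (-‿cong (ι-* _ a))))))) ⟨
        ι (ℕ→ℚ d ℚ.* a) + θ * (ι ((ℕ→ℚ d ℚ.- 1ℚ) ℚ.* b ℚ.- ℕ→ℚ d ℚ.* a) + θ * _) ∎)
      where
      u = ι b + θ * z
      minus-1 : ∀ x → (θ + - ι 1ℚ) * x ≈ θ * x + - x
      minus-1 x = solve 2 (λ t x → (t :+ :- con 1ℚ) :* x := t :* x :+ :- x) refl θ x
      pu : Poly u
      pu = poly-+ (poly-ι b) (poly-θ* pz)

    lead-D : ∀ {d a b x} → Lead d a b x →
      Lead (suc (suc d)) (ℕ→ℚ d ℚ.* a) ((ℕ→ℚ d ℚ.- 1ℚ) ℚ.* b ℚ.- ℕ→ℚ d ℚ.* a) (D x)
    lead-D {d} {x = x} l = mkLead (Lead.rest-poly l′) (trans (sym (θ^*θ* (suc d) (D x))) (Lead.expansion l′))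
      where l′ = lead-θD l

    lead-conv : ∀ {d} {α β : ℕ → ℕ → ℚ} {f : ℕ → ℕ → Carrier} n →
      (∀ a b → a ℕ.+ b ≡ n → Lead d (α a b) (β a b) (f a b)) → Lead d (ℚA.conv α n) (ℚA.conv β n) (conv f n)
    lead-conv zero    l = l 0 0 ≡.refl
    lead-conv (suc n) l = lead-+ (l 0 (suc n) ≡.refl) (lead-conv n (λ a b eq → l (suc a) b (≡.cong suc eq)))

    ev : ℕ → (ℕ → ℚ) → Carrier
    ev zero    c = 0#
    ev (suc n) c = ι (c 0) + θ * ev n (c ∘ suc)

    ev-cong : ∀ n {c c′} → (∀ j → c j ≡ c′ j) → ev n c ≈ ev n c′
    ev-cong zero    eq = refl
    ev-cong (suc n) eq = +-cong (reflexive (≡.cong ι (eq 0))) (*-congˡ (ev-cong n (eq ∘ suc)))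

    ev-+ : ∀ n c c′ → ev n c + ev n c′ ≈ ev n (λ j → c j ℚ.+ c′ j)
    ev-+ zero    c c′ = +-identityˡ 0#
    ev-+ (suc n) c c′ = trans
      (solve 5 (λ t a x b y → (a :+ t :* x) :+ (b :+ t :* y) := (a :+ b) :+ t :* (x :+ y)) refl θ (ι (c 0)) (ev n (c ∘ suc)) (ι (c′ 0)) (ev n (c′ ∘ suc)))
      (+-cong (sym (ι-+ _ _)) (*-congˡ (ev-+ n (c ∘ suc) (c′ ∘ suc))))

    ev-zeros : ∀ n {c} → (∀ j → j ℕ.< n → c j ≡ 0ℚ) → ev n c ≈ 0#
    ev-zeros zero    z = refl
    ev-zeros (suc n) z = trans (+-cong (trans (reflexive (≡.cong ι (z 0 (ℕ.s≤s ℕ.z≤n)))) ι-0)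
      (trans (*-congˡ (ev-zeros n (λ j j<n → z (suc j) (ℕ.s≤s j<n)))) (zeroʳ θ))) (+-identityˡ 0#)

    D-ev : ∀ n c → D (ev (suc n) c) ≈ D θ * ev n (λ j → ℕ→ℚ (suc j) ℚ.* c (suc j))
    D-ev zero    c = trans (D-cong (trans (+-congˡ (zeroʳ θ)) (+-identityʳ _))) (trans (D-ι (c 0)) (sym (zeroʳ _)))
    D-ev (suc n) c = begin
      D (ι (c 0) + θ * E)                    ≈⟨ D-ι+ (c 0) _ ⟩
      D (θ * E)                              ≈⟨ D-* θ E ⟩
      D θ * E + θ * D E                      ≈⟨ +-congˡ (*-congˡ (D-ev n (c ∘ suc))) ⟩
      D θ * (ι (c 1) + θ * E₁) + θ * (D θ * E₂)  ≈⟨ solve 5 (λ t d a x y → d :* (a :+ t :* x) :+ t :* (d :* y) := d :* (a :+ t :* (x :+ y))) refl θ (D θ) (ι (c 1)) E₁ E₂ ⟩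
      D θ * (ι (c 1) + θ * (E₁ + E₂))        ≈⟨ *-congˡ (+-cong (reflexive (≡.cong ι (≡.sym (ℚₚ.*-identityˡ (c 1)))))
                                                  (*-congˡ (trans (ev-+ n _ _) (ev-cong n coefficient)))) ⟩
      D θ * ev (suc n) (λ j → ℕ→ℚ (suc j) ℚ.* c (suc j)) ∎
      where
      E  = ev (suc n) (c ∘ suc)
      E₁ = ev n (λ j → c (suc (suc j)))
      E₂ = ev n (λ j → ℕ→ℚ (suc j) ℚ.* c (suc (suc j)))
      coefficient : ∀ j → c (suc (suc j)) ℚ.+ ℕ→ℚ (suc j) ℚ.* c (suc (suc j)) ≡ ℕ→ℚ (suc (suc j)) ℚ.* c (suc (suc j))
      coefficient j = ≡.trans (≡.cong (ℚ._+ ℕ→ℚ (suc j) ℚ.* x) (≡.sym (ℚₚ.*-identityˡ x)))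
        (≡.trans (≡.sym (ℚₚ.*-distribʳ-+ x 1ℚ (ℕ→ℚ (suc j)))) (≡.cong (ℚ._* x) (≡.sym (ℕ→ℚ-suc (suc j)))))
        where x = c (suc (suc j))

    -- T is transcendental: differentiating a relation between the powers of θ lowers its degree.
    ev-injective : ∀ n c → ev n c ≈ 0# → ∀ j → j ℕ.< n → c j ≡ 0ℚ
    ev-injective (suc n) c eq = coefficients
      where
      higher : ∀ j → j ℕ.< n → c (suc j) ≡ 0ℚ
      higher j j<n = ν*≡0 j (ev-injective n _ (DT-cancel _ (begin
        D T * X              ≈⟨ solve 2 (λ d x → d :* x := :- (:- d :* x)) refl (D T) X ⟩
        - (- D T * X)        ≈⟨ -‿cong (*-congʳ Dθ≈-DT) ⟨
        - (D θ * X)          ≈⟨ -‿cong (D-ev n c) ⟨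
        - D (ev (suc n) c)   ≈⟨ -‿cong (trans (D-cong eq) D-0) ⟩
        - 0#                 ≈⟨ -0#≈0# ⟩
        0#                   ∎)) j j<n)
        where X = ev n (λ j → ℕ→ℚ (suc j) ℚ.* c (suc j))
      coefficients : ∀ j → j ℕ.< suc n → c j ≡ 0ℚ
      coefficients zero    _ = ι-injective (c 0) (begin
        ι (c 0)                            ≈⟨ +-identityʳ _ ⟨
        ι (c 0) + 0#                       ≈⟨ +-congˡ (trans (*-congˡ (ev-zeros n higher)) (zeroʳ θ)) ⟨
        ι (c 0) + θ * ev n (c ∘ suc)       ≈⟨ eq ⟩
        0#                                 ∎)
      coefficients (suc j) (ℕ.s≤s j<n) = higher j j<n

    cons : ℚ → (ℕ → ℚ) → ℕ → ℚ
    cons p c zero    = p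
    cons p c (suc j) = c j

    poly-ev : ∀ {x} → Poly x → ∃ λ n → ∃ λ c → x ≈ ev n c
    poly-ev (poly-0 x≈)     = 0 , (λ _ → 0ℚ) , x≈
    poly-ev (poly-∷ p py x≈) with poly-ev py
    ... | n , c , y≈ = suc n , cons p c , trans x≈ (+-congˡ (*-congˡ y≈))

    -- After multiplication by θ^d the expansion of zero is a polynomial relation for θ, so
    -- transcendence forces every coefficient to vanish.
    lead-0-unique : ∀ {d a b x} → x ≈ 0# → Lead d a b x → a ≡ 0ℚ × b ≡ 0ℚ
    lead-0-unique {d} {a} {b} {x} x≈0 (mkLead pz e) = injective 0 (ℕ.s≤s ℕ.z≤n) , injective 1 (ℕ.s≤s (ℕ.s≤s ℕ.z≤n))
      where
      n  = proj₁ (poly-ev pz)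
      c  = proj₁ (proj₂ (poly-ev pz))
      z≈ = proj₂ (proj₂ (poly-ev pz))
      injective = ev-injective (suc (suc n)) (cons a (cons b c)) (trans (+-congˡ (*-congˡ (+-congˡ (*-congˡ (sym z≈)))))
        (trans (sym e) (trans (*-congˡ x≈0) (zeroʳ _))))

    private
      difference : ∀ {p q} → p ℚ.+ ℚ.- 1ℚ ℚ.* q ≡ 0ℚ → p ≡ q
      difference {p} {q} eq = ≡.trans
        (S.solve 2 (λ p q → p S.:= (p S.:+ S.con (ℚ.- 1ℚ) S.:* q) S.:+ q) ≡.refl p q)
        (≡.trans (≡.cong (ℚ._+ q) eq) (ℚₚ.+-identityˡ q))
        where module S = QAlgebra.Solver ℚ-algebra

    lead-unique : ∀ {d a b a′ b′ x} → Lead d a b x → Lead d a′ b′ x → a ≡ a′ × b ≡ b′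
    lead-unique {x = x} l l′ = difference (proj₁ zero-lead) , difference (proj₂ zero-lead)
      where
      zero-lead = lead-0-unique (trans (+-congˡ (solve 1 (λ x → con (ℚ.- 1ℚ) :* x := :- x) refl x)) (-‿inverseʳ x))
                                (lead-+ l (lead-scale (ℚ.- 1ℚ) l′))

    module Equation {κ : ℚ} {e : ℕ} {l j : Carrier} {j₀ j₁ : ℚ}
                    (equation : θ * D l + ι κ * l ≈ j) (j-lead : Lead (suc e) j₀ j₁ j) where

      operator-lead : ∀ {d a b} → Lead d a b l →
        Lead (suc d) (ℕ→ℚ d ℚ.* a ℚ.+ κ ℚ.* 0ℚ) ((ℕ→ℚ d ℚ.- 1ℚ) ℚ.* b ℚ.- ℕ→ℚ d ℚ.* a ℚ.+ κ ℚ.* a) j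
      operator-lead ll = lead-cong equation (lead-+ (lead-θD ll) (lead-scale κ (lead-suc ll)))

      *0-cancel : ∀ {p} → p ℚ.+ κ ℚ.* 0ℚ ≡ p
      *0-cancel {p} = ≡.trans (≡.cong (p ℚ.+_) (ℚₚ.*-zeroʳ κ)) (ℚₚ.+-identityʳ p)

      -- A pole of order n > e in l would produce under θ D a pole of order n + 1 with coefficient n
      -- a. The term κ l is of order n only, and j has order at most e + 1, so nothing can cancel
      -- it.
      lower-lead : ∀ d {a b} → Lead (suc d ℕ.+ e) a b l → In (d ℕ.+ e) l
      lower-lead d {a} {b} ll@(mkLead {z} pz eq) = mkIn (poly-cong (sym (θ-cancel (trans (sym (*-assoc _ _ _)) (trans eq
              (trans (+-congʳ (trans (reflexive (≡.cong ι a≡0)) ι-0)) (+-identityˡ _)))))) (poly-+ (poly-ι b) (poly-θ* pz)))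
        where
        a≡0 : a ≡ 0ℚ
        a≡0 = ν*≡0 (d ℕ.+ e) (≡.trans (≡.sym *0-cancel)
          (proj₁ (lead-unique (operator-lead ll) (proj₂ (in-lead-suc (in-≤ (ℕ.s≤s (ℕₚ.m≤n+m e d)) (lead-in j-lead)))))))

      lower : ∀ d → In (d ℕ.+ e) l → In e l
      lower zero    i = i
      lower (suc d) i = lower d (lower-lead d (proj₂ (proj₂ (in-lead i))))

      solution-equations : ∀ {a b} → Lead e a b l →
        (ℕ→ℚ e ℚ.* a ≡ j₀) × ((ℕ→ℚ e ℚ.- 1ℚ) ℚ.* b ℚ.- ℕ→ℚ e ℚ.* a ℚ.+ κ ℚ.* a ≡ j₁)
      solution-equations ll = ≡.trans (≡.sym *0-cancel) (proj₁ p) , proj₂ p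
        where p = lead-unique (operator-lead ll) j-lead

      solution : ∀ {d} → In d l → ∃ λ a → ∃ λ b → Lead e a b l
      solution {d} i = in-lead (lower d (in-≤ (ℕₚ.m≤m+n d e) i))

-- The graded equations and the induction on the excess

module GradedSystems where
  open RationalAlgebras
  open LaurentPolynomials
  open import Defs using (ℕ→ℚ)
  open import Data.Nat as ℕ using (ℕ; zero; suc)
  import Data.Nat.Properties as ℕₚ
  open import Data.Nat.Solver using (module +-*-Solver)
  open import Data.Rational as ℚ using (ℚ; 0ℚ; 1ℚ; ½)
  import Data.Rational.Properties as ℚₚ
  open import Data.Integer using (+_)
  open import Data.Product using (∃; _,_; proj₁; proj₂)
  open import Data.Nat.Induction using (<-rec)
  open import Relation.Binary.PropositionalEquality as ≡ using (_≡_)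
  import Relation.Binary.Reasoning.Setoid as SetoidReasoning

  -- The exponent of 1/(1 - T) in the i-th component is at most 3i - 1, and 0 for i = 0.
  poleBound : ℕ → ℕ
  poleBound zero    = 0
  poleBound (suc k) = 2 ℕ.+ 3 ℕ.* k

  -- The unknown second coefficient carries the factor 3(p + 1) - 1 = 3p + 2, which is a successor
  -- and can be cancelled.
  second-cancel : ∀ p {a a′ b b′ s} → a ≡ a′ →
    (ℕ→ℚ (3 ℕ.* suc p) ℚ.- 1ℚ) ℚ.* b ℚ.- s ℚ.* a ℚ.+ ℕ→ℚ (suc p) ℚ.* a ≡
    (ℕ→ℚ (3 ℕ.* suc p) ℚ.- 1ℚ) ℚ.* b′ ℚ.- s ℚ.* a′ ℚ.+ ℕ→ℚ (suc p) ℚ.* a′ → b ≡ b′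
  second-cancel p {a} {_} {b} {b′} {s} ≡.refl eq = ℕ→ℚ-*-cancelˡ (1 ℕ.+ 3 ℕ.* p) (begin
    ℕ→ℚ (2 ℕ.+ 3 ℕ.* p) ℚ.* b     ≡⟨ ≡.cong (ℚ._* b) (≡.sym pred) ⟩
    m ℚ.* b                       ≡⟨ S.solve 3 (λ x y z → x S.:= ((x S.:+ S.:- y) S.:+ z) S.:+ (y S.:+ S.:- z)) ≡.refl (m ℚ.* b) (s ℚ.* a) (ℕ→ℚ (suc p) ℚ.* a) ⟩
    _                             ≡⟨ ≡.cong (ℚ._+ (s ℚ.* a ℚ.- ℕ→ℚ (suc p) ℚ.* a)) eq ⟩
    _                             ≡⟨ S.solve 3 (λ x y z → x S.:= ((x S.:+ S.:- y) S.:+ z) S.:+ (y S.:+ S.:- z)) ≡.refl (m ℚ.* b′) (s ℚ.* a) (ℕ→ℚ (suc p) ℚ.* a) ⟨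
    m ℚ.* b′                      ≡⟨ ≡.cong (ℚ._* b′) pred ⟩
    ℕ→ℚ (2 ℕ.+ 3 ℕ.* p) ℚ.* b′    ∎)
    where
    open ≡.≡-Reasoning
    module S = QAlgebra.Solver ℚ-algebra
    m = ℕ→ℚ (3 ℕ.* suc p) ℚ.- 1ℚ
    pred : m ≡ ℕ→ℚ (2 ℕ.+ 3 ℕ.* p)
    pred = ≡.trans (≡.cong (ℚ._- 1ℚ) (≡.trans (≡.cong ℕ→ℚ (ℕₚ.*-suc 3 p)) (ℕ→ℚ-suc (2 ℕ.+ 3 ℕ.* p))))
      (S.solve 1 (λ x → (S.con 1ℚ S.:+ x) S.:+ S.:- S.con 1ℚ S.:= x) ≡.refl (ℕ→ℚ (2 ℕ.+ 3 ℕ.* p)))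

  module Coefficients (bb dd : ℕ → ℚ) where
    -- The two leading coefficients of `Y (suc k)`. For positive k they come from those of
    -- `L (suc k)` by `lead-D`. For k = 0 they are read off from (1 - θ)⁴/2 over θ², because `L 1`
    -- contains a logarithm.
    y y′ : ℕ → ℚ
    y zero    = ½
    y (suc k) = ℕ→ℚ (3 ℕ.* suc k) ℚ.* bb (suc k)
    y′ zero    = ℚ.- ℕ→ℚ 2
    y′ (suc k) = (ℕ→ℚ (3 ℕ.* suc k) ℚ.- 1ℚ) ℚ.* dd (suc k) ℚ.- ℕ→ℚ (3 ℕ.* suc k) ℚ.* bb (suc k)

    open Antidiagonal ℚ-algebra using (conv)

    -- Wright's equation compared at the poles of order 3p + 4 (`first`) and 3p + 3 (`second`).
    record Recurrences : Set where
      field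
        first : ∀ p → ℕ→ℚ (3 ℕ.* suc p) ℚ.* bb (suc p) ≡
          ½ ℚ.* (ℕ→ℚ (2 ℕ.+ 3 ℕ.* p) ℚ.* y p ℚ.+ conv (λ a b → y a ℚ.* y b) p)
        second : ∀ p → (ℕ→ℚ (3 ℕ.* suc p) ℚ.- 1ℚ) ℚ.* dd (suc p) ℚ.- ℕ→ℚ (3 ℕ.* suc p) ℚ.* bb (suc p) ℚ.+ ℕ→ℚ (suc p) ℚ.* bb (suc p) ≡
          ½ ℚ.* ((ℕ→ℚ (2 ℕ.+ 3 ℕ.* p) ℚ.- 1ℚ) ℚ.* y′ p ℚ.- ℕ→ℚ (2 ℕ.+ 3 ℕ.* p) ℚ.* y p
                 ℚ.+ conv (λ a b → y a ℚ.* y′ b ℚ.+ y′ a ℚ.* y b) p)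

  module _ (𝒯 : TreeAlgebra) where
    open Poles 𝒯
    open Antidiagonal algebra using (conv; conv-last; conv-flip)

    -- In the intended instance index i stands for connected graphs with i - 1 more edges than
    -- vertices. `C j` multiplies the coefficient of zⁿ by (n choose j), `Ω` is σY - Y, `N` collects
    -- what clusters other than a single vertex add to Y, and `S` is their source in the edge
    -- equation. The bounds `N-in` and `S-in` require information on `E` only up to the same index,
    -- which lags one step behind the unknown.
    record GradedSystem : Set where
      field
        L Y E N S : ℕ → Carrier
        C     : ℕ → Carrier → Carrier
        C-1   : ∀ x → C 1 x ≈ D x
        C-in  : ∀ j {d x} → In d x → ∃ λ e → In e (C j x)
        Ω     : ℕ → Carrier
        Ω-0   : Ω 0 ≈ 0#
        Ω-suc : ∀ l → Ω (suc l) ≈ conv (λ j r → C (suc j) (Y r)) l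
        Y-L   : ∀ i → Y i ≈ D (L i)
        E-0   : E 0 ≈ T
        Y-0   : Y 0 ≈ E 0
        Y-suc : ∀ i → Y (suc i) ≈ E (suc i) + N i
        vertex : ∀ i → D (E i) ≈ E i + conv (λ h l → E h * Ω l) (suc i)
        edge-0   : D (L 0) + - L 0 ≈ ι ½ * (Y 0 * Y 0)
        edge-suc : ∀ i → (ν i * L (suc i) + D (L (suc i))) + ((ν i + - ι 1ℚ) * L i + D (L i))
                       ≈ ι ½ * (D (D (L i)) + - D (L i)) + ι ½ * conv (λ a b → Y a * Y b) (suc i) + S i
        N-in : ∀ n → (∀ h → h ℕ.≤ n → In (poleBound h) (E h)) → In (poleBound n) (N n)
        S-in : ∀ n → (∀ h → h ℕ.≤ n → In (poleBound h) (E h)) → In (poleBound n) (S n)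
        S-0  : S 0 ≈ - (ι ½ * (T * (T * T)))

    module Leading (system : GradedSystem) (bb dd : ℕ → ℚ) where
      open GradedSystem system
      open Coefficients bb dd
      open Solver using (solve; _:=_; _:+_; _:*_; :-_; con)
      open SetoidReasoning setoid

      InR : Carrier → Set
      InR x = ∃ λ d → In d x

      r-cong : ∀ {x y} → x ≈ y → InR x → InR y
      r-cong eq (d , i) = d , in-cong eq i

      r-+ : ∀ {x y} → InR x → InR y → InR (x + y)
      r-+ (d , i) (e , j) = d ℕ.+ e , in-+ (in-≤ (ℕₚ.m≤m+n d e) i) (in-≤ (ℕₚ.m≤n+m e d) j)

      r-* : ∀ {x y} → InR x → InR y → InR (x * y)
      r-* (d , i) (e , j) = d ℕ.+ e , in-* i j

      r-neg : ∀ {x} → InR x → InR (- x)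
      r-neg (d , i) = d , in-neg i

      r-scale : ∀ r {x} → InR x → InR (ι r * x)
      r-scale r (d , i) = d , in-scale r i

      r-D : ∀ {x} → InR x → InR (D x)
      r-D (d , i) = _ , in-D i

      r-0 : InR 0#
      r-0 = 0 , in-0 0

      r-conv : ∀ {f : ℕ → ℕ → Carrier} n → (∀ a b → a ℕ.+ b ≡ n → InR (f a b)) → InR (conv f n)
      r-conv zero    i = i 0 0 ≡.refl
      r-conv (suc n) i = r-+ (i 0 (suc n) ≡.refl) (r-conv n (λ a b eq → i (suc a) b (≡.cong suc eq)))

      r-conv-last : ∀ {f : ℕ → ℕ → Carrier} n → (∀ a b → a ℕ.+ suc b ≡ n → InR (f a (suc b))) → InR (conv f n + - f n 0)
      r-conv-last zero    i = r-cong (sym (-‿inverseʳ _)) r-0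
      r-conv-last (suc n) i = r-cong (sym (+-assoc _ _ _))
        (r-+ (i 0 n ≡.refl) (r-conv-last n (λ a b eq → i (suc a) b (≡.cong suc eq))))

      T-in : In 0 T
      T-in = in-poly poly-T

      Y-0≈T : Y 0 ≈ T
      Y-0≈T = trans Y-0 E-0

      -- The count of unrooted trees: a tree has one vertex more than it has edges, so rootings at a
      -- vertex minus rootings at an edge count it once.
      L-0≈ : L 0 ≈ T + - (ι ½ * (T * T))
      L-0≈ = begin
        L 0                               ≈⟨ solve 2 (λ l d → l := d :+ :- (d :+ :- l)) refl (L 0) (D (L 0)) ⟩
        D (L 0) + - (D (L 0) + - L 0)     ≈⟨ +-cong (trans (sym (Y-L 0)) Y-0≈T) (-‿cong (trans edge-0 (*-congˡ (*-cong Y-0≈T Y-0≈T)))) ⟩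
        T + - (ι ½ * (T * T))             ∎

      θY₁≈ : θ * Y 1 ≈ ι ½ * D T + - (ι ½ * T) + - (ι ½ * (T * T)) + - (ι ½ * (T * (T * T)))
      θY₁≈ = begin
        (1# + - T) * Y 1
          ≈⟨ solve 3 (λ o t y → (o :+ :- t) :* y := o :* y :+ :- (t :* y)) refl 1# T (Y 1) ⟩
        1# * Y 1 + - (T * Y 1)
          ≈⟨ +-congʳ (*-identityˡ _) ⟩
        Y 1 + - (T * Y 1)
          ≈⟨ solve 5 (λ d y t l₁ l₀ → y :+ :- (t :* y) := ((con 0ℚ :* l₁ :+ y) :+ ((con 0ℚ :+ :- con 1ℚ) :* l₀ :+ t)) :+ (l₀ :+ :- t :+ :- (t :* y))) refl (D T) (Y 1) T (L 1) (L 0) ⟩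
        ((ι 0ℚ * L 1 + Y 1) + ((ι 0ℚ + - ι 1ℚ) * L 0 + T)) + (L 0 + - T + - (T * Y 1))
          ≈⟨ +-cong edge₀ (+-congʳ (+-congʳ L-0≈)) ⟩
        (ι ½ * (D T + - T) + ι ½ * (T * Y 1 + Y 1 * T) + - (ι ½ * (T * (T * T)))) + (T + - (ι ½ * (T * T)) + - T + - (T * Y 1))
          ≈⟨ solve 3 (λ d y t → (con ½ :* (d :+ :- t) :+ con ½ :* (t :* y :+ y :* t) :+ :- (con ½ :* (t :* (t :* t)))) :+ (t :+ :- (con ½ :* (t :* t)) :+ :- t :+ :- (t :* y))
               := con ½ :* d :+ :- (con ½ :* t) :+ :- (con ½ :* (t :* t)) :+ :- (con ½ :* (t :* (t :* t)))) refl (D T) (Y 1) T ⟩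
        _ ∎
        where
        edge₀ : (ι 0ℚ * L 1 + Y 1) + ((ι 0ℚ + - ι 1ℚ) * L 0 + T) ≈ ι ½ * (D T + - T) + ι ½ * (T * Y 1 + Y 1 * T) + - (ι ½ * (T * (T * T)))
        edge₀ = begin
          (ι 0ℚ * L 1 + Y 1) + ((ι 0ℚ + - ι 1ℚ) * L 0 + T)
            ≈⟨ +-cong (+-congˡ (Y-L 1)) (+-congˡ (trans (sym Y-0≈T) (Y-L 0))) ⟩
          (ν 0 * L 1 + D (L 1)) + ((ν 0 + - ι 1ℚ) * L 0 + D (L 0))
            ≈⟨ edge-suc 0 ⟩
          ι ½ * (D (D (L 0)) + - D (L 0)) + ι ½ * (Y 0 * Y 1 + Y 1 * Y 0) + S 0
            ≈⟨ +-cong (+-cong (*-congˡ (+-cong (D-cong DL₀) (-‿cong DL₀))) (*-congˡ (+-cong (*-congʳ Y-0≈T) (*-congˡ Y-0≈T)))) S-0 ⟩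
          _ ∎
          where
          DL₀ = trans (sym (Y-L 0)) Y-0≈T

      -- The unicyclic graphs whose cycle has at least four vertices, marked at one vertex. The
      -- factor T⁴ in place of T³ is the effect of the source `S 0`, that is, of the triangle.
      θ²Y₁≈ : θ^ 2 * Y 1 ≈ ι ½ * (T * T * (T * T))
      θ²Y₁≈ = begin
        θ * (θ * 1#) * Y 1       ≈⟨ *-congʳ (*-congˡ (*-identityʳ θ)) ⟩
        θ * θ * Y 1              ≈⟨ *-assoc θ θ (Y 1) ⟩
        θ * (θ * Y 1)            ≈⟨ *-congˡ θY₁≈ ⟩
        θ * (ι ½ * D T + - (ι ½ * T) + - (ι ½ * (T * T)) + - (ι ½ * (T * (T * T))))
          ≈⟨ solve 4 (λ h d t u → u :* (h :* d :+ :- (h :* t) :+ :- (h :* (t :* t)) :+ :- (h :* (t :* (t :* t))))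
               := h :* (u :* d) :+ :- (h :* (u :* (t :+ t :* t :+ t :* (t :* t))))) refl (ι ½) (D T) T θ ⟩
        ι ½ * (θ * D T) + - (ι ½ * (θ * (T + T * T + T * (T * T))))
          ≈⟨ +-cong (*-congˡ θ*DT) (-‿cong (*-congˡ (trans (*-congʳ (+-congʳ (sym ι-1))) refl))) ⟩
        ι ½ * T + - (ι ½ * ((ι 1ℚ + - T) * (T + T * T + T * (T * T))))
          ≈⟨ solve 2 (λ h t → h :* t :+ :- (h :* ((con 1ℚ :+ :- t) :* (t :+ t :* t :+ t :* (t :* t)))) := h :* (t :* t :* (t :* t))) refl (ι ½) T ⟩
        ι ½ * (T * T * (T * T)) ∎

      T-lead : Lead 0 1ℚ (ℚ.- 1ℚ) T
      T-lead = mkLead (poly-0 refl) (begin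
        1# * T                                   ≈⟨ *-identityˡ T ⟩
        T                                        ≈⟨ solve 2 (λ o t → t := o :+ (:- con 1ℚ :* (o :+ :- t))) refl 1# T ⟩
        1# + - ι 1ℚ * θ                          ≈⟨ +-cong (sym ι-1) (trans (*-congʳ (sym (ι-neg 1ℚ))) (*-comm _ θ)) ⟩
        ι 1ℚ + θ * ι (ℚ.- 1ℚ)                    ≈⟨ +-congˡ (*-congˡ (sym (trans (+-congˡ (zeroʳ θ)) (+-identityʳ _)))) ⟩
        ι 1ℚ + θ * (ι (ℚ.- 1ℚ) + θ * 0#)         ∎)

      Y₁-lead : Lead 2 ½ (ℚ.- ℕ→ℚ 2) (Y 1)
      Y₁-lead = mkLead (Lead.rest-poly l) (trans θ²Y₁≈ (trans (sym (*-identityˡ _)) (Lead.expansion l)))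
        where
        l : Lead 0 ½ (ℚ.- ℕ→ℚ 2) (ι ½ * (T * T * (T * T)))
        l = lead-scale ½ (lead-* (lead-* T-lead T-lead) (lead-* T-lead T-lead))

      -- `L-lead` is demanded only for successors: `L 1` contains log(1/(1-T))/2, and only its
      -- derivative is a Laurent polynomial.
      record Good (k : ℕ) : Set where
        field
          Y-lead : Lead (2 ℕ.+ 3 ℕ.* k) (y k) (y′ k) (Y (suc k))
          E-in   : In (2 ℕ.+ 3 ℕ.* k) (E (suc k))
          L-lead : ∀ p → k ≡ suc p → Lead (3 ℕ.* k) (bb k) (dd k) (L (suc k))

      good-0 : Good 0
      good-0 = record
        { Y-lead = Y₁-lead
        ; E-in   = in-cong (trans (+-congʳ (Y-suc 0)) (solve 2 (λ e n → e :+ n :+ :- n := e) refl (E 1) (N 0)))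
                     (in-+ (lead-in Y₁-lead) (in-neg (in-raise 2 (N-in 0 λ { zero _ → in-cong (sym E-0) T-in }))))
        ; L-lead = λ _ ()
        }

      module Step (p : ℕ) (good : ∀ h → h ℕ.< suc p → Good h) (recurrences : Recurrences) where
        open Recurrences recurrences
        k i : ℕ
        k = suc p
        i = suc k

        good-≤ : ∀ h → h ℕ.≤ p → Good h
        good-≤ h h≤p = good h (ℕ.s≤s h≤p)

        E-pole : ∀ h → h ℕ.≤ k → In (poleBound h) (E h)
        E-pole zero    _            = in-cong (sym E-0) T-in
        E-pole (suc h) (ℕ.s≤s h≤p) = Good.E-in (good-≤ h h≤p)

        Y-r : ∀ h → h ℕ.≤ k → InR (Y h)
        Y-r zero    _            = 0 , in-cong (sym Y-0≈T) T-in
        Y-r (suc h) (ℕ.s≤s h≤p) = _ , lead-in (Good.Y-lead (good-≤ h h≤p))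

        -- All terms of Wright's equation whose poles have order at most 3p + 2. This is two below
        -- the order 3p + 4 of `J`, so they do not reach its two leading coefficients.
        rest : Carrier
        rest = - (ι ½ * Y k) + - (ν p * L k) + - Y k + S k

        J : Carrier
        J = ι ½ * (D (Y k) + conv (λ a b → Y (suc a) * Y (suc b)) p) + rest

        -- The extreme terms of the quadratic sum both equal T times D (L i). With the factor ½ they
        -- add up to one such product, which turns D (L i) into (1 - T) D (L i).
        ode : θ * D (L i) + ν k * L i ≈ J
        ode = begin
          (1# + - T) * D (L i) + ν k * L i
            ≈⟨ +-congʳ (solve 3 (λ o t d → (o :+ :- t) :* d := o :* d :+ :- (t :* d)) refl 1# T (D (L i))) ⟩
          (1# * D (L i) + - (T * D (L i))) + ν k * L i
            ≈⟨ +-congʳ (+-congʳ (*-identityˡ _)) ⟩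
          (D (L i) + - (T * D (L i))) + ν k * L i
            ≈⟨ solve 5 (λ d t n m y → (d :+ :- (t :* d)) :+ n := ((n :+ d) :+ (m :+ y)) :+ (:- m :+ :- y :+ :- (t :* d))) refl (D (L i)) T (ν k * L i) (ν p * L k) (Y k) ⟩
          ((ν k * L i + D (L i)) + (ν p * L k + Y k)) + (- (ν p * L k) + - Y k + - (T * D (L i)))
            ≈⟨ +-congʳ edges ⟩
          (ι ½ * (D (Y k) + - Y k) + ι ½ * (T * D (L i) + (M + D (L i) * T)) + S k) + (- (ν p * L k) + - Y k + - (T * D (L i)))
            ≈⟨ solve 7 (λ e y d t m s l → (con ½ :* (e :+ :- y) :+ con ½ :* (t :* d :+ (m :+ d :* t)) :+ s) :+ (:- l :+ :- y :+ :- (t :* d))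
                 := con ½ :* (e :+ m) :+ (:- (con ½ :* y) :+ :- l :+ :- y :+ s)) refl (D (Y k)) (Y k) (D (L i)) T M (S k) (ν p * L k) ⟩
          J ∎
          where
          M = conv (λ a b → Y (suc a) * Y (suc b)) p
          edges : (ν k * L i + D (L i)) + (ν p * L k + Y k) ≈ ι ½ * (D (Y k) + - Y k) + ι ½ * (T * D (L i) + (M + D (L i) * T)) + S k
          edges = begin
            (ν k * L i + D (L i)) + (ν p * L k + Y k)
              ≈⟨ +-congˡ (+-cong (*-congʳ (trans (solve 1 (λ n → n := (con 1ℚ :+ n) :+ :- con 1ℚ) refl (ν p)) (+-congʳ (trans (sym (ι-+ _ _)) (reflexive (≡.cong ι (≡.sym (ℕ→ℚ-suc p)))))))) (Y-L k)) ⟩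
            (ν k * L i + D (L i)) + ((ν k + - ι 1ℚ) * L k + D (L k))
              ≈⟨ edge-suc k ⟩
            ι ½ * (D (D (L k)) + - D (L k)) + ι ½ * conv (λ a b → Y a * Y b) i + S k
              ≈⟨ +-congʳ (+-cong (*-congˡ (+-cong (D-cong (sym (Y-L k))) (-‿cong (sym (Y-L k)))))
                   (*-congˡ (+-cong (*-cong Y-0≈T (Y-L i)) (trans (conv-last (λ a b → Y (suc a) * Y b) p) (+-congˡ (*-cong (Y-L i) Y-0≈T)))))) ⟩
            _ ∎

        -- For p = 0 the term would involve the logarithm in `L 1`, but its coefficient p vanishes
        -- exactly then.
        νL-in : In (2 ℕ.+ 3 ℕ.* p) (ν p * L k)
        νL-in = go p ≡.refl
          where
          go : ∀ q → p ≡ q → In (2 ℕ.+ 3 ℕ.* p) (ν p * L k)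
          go zero    ≡.refl = in-cong (sym (trans (*-congʳ ι-0) (zeroˡ _))) (in-0 _)
          go (suc q) ≡.refl = in-scale _ (in-raise 2 (lead-in (Good.L-lead (good-≤ p ℕₚ.≤-refl) q ≡.refl)))

        rest-in : In (2 ℕ.+ 3 ℕ.* p) rest
        rest-in = in-+ (in-+ (in-+ (in-neg (in-scale ½ Y-in)) (in-neg νL-in)) (in-neg Y-in)) (S-in k E-pole)
          where Y-in = lead-in (Good.Y-lead (good-≤ p ℕₚ.≤-refl))

        exponents : ∀ a b → a ℕ.+ b ≡ p → (2 ℕ.+ 3 ℕ.* a) ℕ.+ (2 ℕ.+ 3 ℕ.* b) ≡ 4 ℕ.+ 3 ℕ.* p
        exponents a b ≡.refl = solveℕ 2 (λ a b → (conℕ 2 ⊕ conℕ 3 ⊗ a) ⊕ (conℕ 2 ⊕ conℕ 3 ⊗ b) ⊜ conℕ 4 ⊕ conℕ 3 ⊗ (a ⊕ b)) ≡.refl a b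
          where open +-*-Solver renaming (solve to solveℕ; _:+_ to _⊕_; _:*_ to _⊗_; _:=_ to _⊜_; con to conℕ)

        J-lead : Lead (suc (3 ℕ.* k)) (ℕ→ℚ (3 ℕ.* k) ℚ.* bb k)
                   ((ℕ→ℚ (3 ℕ.* k) ℚ.- 1ℚ) ℚ.* dd k ℚ.- ℕ→ℚ (3 ℕ.* k) ℚ.* bb k ℚ.+ ℕ→ℚ k ℚ.* bb k) J
        J-lead = lead-coefficients (≡.cong suc (≡.sym (ℕₚ.*-suc 3 p)))
          (≡.trans (ℚₚ.+-identityʳ _) (≡.sym (first p))) (≡.trans (ℚₚ.+-identityʳ _) (≡.sym (second p)))
          (lead-+ (lead-scale ½ (lead-+ (lead-D (Good.Y-lead (good-≤ p ℕₚ.≤-refl))) (lead-conv p product))) (in-lead-suc² rest-in))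
          where
          product : ∀ a b → a ℕ.+ b ≡ p → Lead (4 ℕ.+ 3 ℕ.* p) (y a ℚ.* y b) (y a ℚ.* y′ b ℚ.+ y′ a ℚ.* y b) (Y (suc a) * Y (suc b))
          product a b eq = lead-coefficients (exponents a b eq) ≡.refl ≡.refl
            (lead-* (Good.Y-lead (good-≤ a (≡.subst (a ℕ.≤_) eq (ℕₚ.m≤m+n a b)))) (Good.Y-lead (good-≤ b (≡.subst (b ℕ.≤_) eq (ℕₚ.m≤n+m b a)))))

        N-r : InR (N k)
        N-r = _ , N-in k E-pole

        Ω-r : ∀ b → b ℕ.≤ k → InR (Ω (suc b))
        Ω-r b b≤k = r-cong (sym (Ω-suc b)) (r-conv b (λ j r eq → C-in (suc j) (proj₂ (Y-r r (ℕₚ.≤-trans (≡.subst (r ℕ.≤_) eq (ℕₚ.m≤n+m r j)) b≤k)))))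

        Ω-top : InR (Ω (suc i) + - D (Y i))
        Ω-top = r-cong (+-cong (trans (sym (conv-flip (λ j r → C (suc j) (Y r)) i)) (sym (Ω-suc i))) (-‿cong (C-1 (Y i))))
          (r-conv-last {λ r j → C (suc j) (Y r)} i (λ r j eq → C-in (suc (suc j)) (proj₂ (Y-r r (ℕₚ.≤-pred (≡.subst (r ℕ.<_) eq (ℕₚ.m<m+n r (ℕ.s≤s ℕ.z≤n))))))))

        Ω-1 : Ω 1 ≈ D T
        Ω-1 = trans (Ω-suc 0) (trans (C-1 (Y 0)) (D-cong Y-0≈T))

        -- Only two summands of the vertex equation contain unknowns: T times Ω at i + 1, whose top
        -- part is `D (Y i)`, and `E i` times Ω at 1, which is `D T`. The index i + 1 of `E` does
        -- not enter because it meets Ω at 0.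
        vertex-r : InR (D (E i) + - E i + - (T * D (Y i)) + - (E i * D T))
        vertex-r = r-cong eq (r-+ (r-* (0 , T-in) Ω-top) middle)
          where
          M = conv (λ a b → E (suc a) * Ω (suc b)) k
          middle : InR (M + - (E i * Ω 1))
          middle = r-conv-last {λ a b → E (suc a) * Ω (suc b)} k (λ a b eq → r-*
            (_ , E-pole (suc a) (≡.subst (a ℕ.<_) eq (ℕₚ.m<m+n a (ℕ.s≤s ℕ.z≤n))))
            (Ω-r (suc b) (≡.subst (suc b ℕ.≤_) eq (ℕₚ.m≤n+m (suc b) a))))
          eq : T * (Ω (suc i) + - D (Y i)) + (M + - (E i * Ω 1)) ≈ D (E i) + - E i + - (T * D (Y i)) + - (E i * D T)
          eq = begin
            T * (Ω (suc i) + - D (Y i)) + (M + - (E i * Ω 1))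
              ≈⟨ +-congˡ (+-congˡ (-‿cong (*-congˡ Ω-1))) ⟩
            T * (Ω (suc i) + - D (Y i)) + (M + - (E i * D T))
              ≈⟨ solve 6 (λ t w y m e d → t :* (w :+ :- y) :+ (m :+ :- d) := (e :+ (t :* w :+ (m :+ con 0ℚ))) :+ :- e :+ :- (t :* y) :+ :- d) refl T (Ω (suc i)) (D (Y i)) M (E i) (E i * D T) ⟩
            (E i + (T * Ω (suc i) + (M + ι 0ℚ))) + - E i + - (T * D (Y i)) + - (E i * D T)
              ≈⟨ +-congʳ (+-congʳ (+-congʳ (sym expand))) ⟩
            D (E i) + - E i + - (T * D (Y i)) + - (E i * D T) ∎
            where
            expand : D (E i) ≈ E i + (T * Ω (suc i) + (M + ι 0ℚ))
            expand = trans (vertex i) (+-congˡ (+-cong (*-congʳ E-0) (trans (conv-last (λ a b → E (suc a) * Ω b) k)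
              (+-congˡ (trans (*-congˡ Ω-0) (trans (zeroʳ _) (sym ι-0)))))))

        E≈ : E i ≈ Y i + - N k
        E≈ = trans (solve 2 (λ e n → e := e :+ n :+ :- n) refl (E i) (N k)) (+-congʳ (sym (Y-suc k)))

        vertexY-r : InR (θ * D (Y i) + - Y i + - (Y i * D T))
        vertexY-r = r-cong eq (r-+ vertex-r (r-+ (r-D N-r) (r-+ (r-neg N-r) (r-neg (r-* N-r (r-D (0 , T-in)))))))
          where
          eq : (D (E i) + - E i + - (T * D (Y i)) + - (E i * D T)) + (D (N k) + (- N k + - (N k * D T))) ≈ θ * D (Y i) + - Y i + - (Y i * D T)
          eq = begin
            (D (E i) + - E i + - (T * D (Y i)) + - (E i * D T)) + (D (N k) + (- N k + - (N k * D T)))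
              ≈⟨ solve 7 (λ de e t dy dt dn n → (de :+ :- e :+ :- (t :* dy) :+ :- (e :* dt)) :+ (dn :+ (:- n :+ :- (n :* dt)))
                   := (de :+ dn) :+ :- (t :* dy) :+ :- (e :+ n) :+ :- ((e :+ n) :* dt)) refl (D (E i)) (E i) T (D (Y i)) (D T) (D (N k)) (N k) ⟩
            (D (E i) + D (N k)) + - (T * D (Y i)) + - (E i + N k) + - ((E i + N k) * D T)
              ≈⟨ +-cong (+-cong (+-congʳ (trans (sym (D-+ _ _)) (trans (D-cong (sym (Y-suc k))) (sym (*-identityˡ _))))) (-‿cong (sym (Y-suc k)))) (-‿cong (*-congʳ (sym (Y-suc k)))) ⟩
            1# * D (Y i) + - (T * D (Y i)) + - Y i + - (Y i * D T)
              ≈⟨ solve 5 (λ o t dy y dt → o :* dy :+ :- (t :* dy) :+ :- y :+ :- (y :* dt) := (o :+ :- t) :* dy :+ :- y :+ :- (y :* dt)) refl 1# T (D (Y i)) (Y i) (D T) ⟩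
            θ * D (Y i) + - Y i + - (Y i * D T) ∎

        -- Differentiating `ode` leaves an equation in `Y i` alone, to be set against the vertex
        -- equation; the derivative of θ supplies the term with `D T`.
        edgeY-r : InR (- D T * Y i + θ * D (Y i) + ν k * Y i)
        edgeY-r = r-cong (begin
          D J                                             ≈⟨ D-cong ode ⟨
          D (θ * D (L i) + ν k * L i)                     ≈⟨ D-+ _ _ ⟩
          D (θ * D (L i)) + D (ν k * L i)                 ≈⟨ +-cong (D-cong (*-congˡ (sym (Y-L i)))) (trans (D-scale _ _) (*-congˡ (sym (Y-L i)))) ⟩
          D (θ * Y i) + ν k * Y i                         ≈⟨ +-congʳ (trans (D-* θ (Y i)) (+-congʳ (*-congʳ Dθ≈-DT))) ⟩
          - D T * Y i + θ * D (Y i) + ν k * Y i           ∎) (r-D (_ , lead-in J-lead))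

        -- Both equations contain θ D Y - (D T) Y. What remains in the difference is k Y from the
        -- edge equation and Y from the vertex equation, and k + 1 is invertible.
        Y-ring : InR (Y i)
        Y-ring = r-cong (begin
          ι r * ((- D T * Y i + θ * D (Y i) + ν k * Y i) + - (θ * D (Y i) + - Y i + - (Y i * D T)))
            ≈⟨ *-congˡ (solve 4 (λ d y e n → (:- d :* y :+ e :+ n :* y) :+ :- (e :+ :- y :+ :- (y :* d)) := (con 1ℚ :+ n) :* y) refl (D T) (Y i) (θ * D (Y i)) (ν k)) ⟩
          ι r * ((ι 1ℚ + ν k) * Y i)
            ≈⟨ *-congˡ (*-congʳ (trans (sym (ι-+ _ _)) (reflexive (≡.cong ι (≡.sym (ℕ→ℚ-suc k)))))) ⟩
          ι r * (ν i * Y i)       ≈⟨ ν-inverse k (Y i) ⟩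
          Y i                     ∎) (r-scale r (r-+ edgeY-r (r-neg vertexY-r)))
          where
          r = + 1 ℚ./ i

        -- Once `Y i` is known, `ode` becomes a linear equation for k `L i`. Dividing by k uses that
        -- k is positive in the induction step.
        L-ring : InR (L i)
        L-ring = r-cong (begin
          ι r * (J + - (θ * Y i))                             ≈⟨ *-congˡ (+-cong (sym ode) (-‿cong (*-congˡ (Y-L i)))) ⟩
          ι r * (θ * D (L i) + ν k * L i + - (θ * D (L i)))   ≈⟨ *-congˡ (solve 2 (λ a b → a :+ b :+ :- a := b) refl (θ * D (L i)) (ν k * L i)) ⟩
          ι r * (ν k * L i)                                   ≈⟨ ν-inverse p (L i) ⟩
          L i                                                 ∎) (r-scale r (r-+ (_ , lead-in J-lead) (r-neg (r-* (0 , in-poly poly-θ) Y-ring))))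
          where r = + 1 ℚ./ k

        open Equation {κ = ℕ→ℚ k} ode J-lead

        L-lead′ : Lead (3 ℕ.* k) (bb k) (dd k) (L i)
        L-lead′ = lead-coefficients ≡.refl a≡ b≡ l
          where
          l = proj₂ (proj₂ (solution (proj₂ L-ring)))
          a≡ : _ ≡ bb k
          -- The natural number is the predecessor of 3k as that product unfolds.
          a≡ = ℕ→ℚ-*-cancelˡ (p ℕ.+ (k ℕ.+ (k ℕ.+ 0))) (proj₁ (solution-equations l))
          b≡ : _ ≡ dd k
          b≡ = second-cancel p {s = ℕ→ℚ (3 ℕ.* k)} a≡ (proj₂ (solution-equations l))

        Y-lead′ : Lead (2 ℕ.+ 3 ℕ.* k) (y k) (y′ k) (Y i)
        Y-lead′ = lead-cong (sym (Y-L i)) (lead-D L-lead′)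

        good-suc : Good k
        good-suc = record
          { Y-lead = Y-lead′
          ; E-in   = in-cong (sym E≈) (in-+ (lead-in Y-lead′) (in-neg (in-≤ (ℕ.s≤s (ℕ.s≤s (ℕₚ.*-monoʳ-≤ 3 (ℕₚ.n≤1+n p)))) (N-in k E-pole))))
          ; L-lead = λ _ _ → L-lead′
          }

      good : Recurrences → ∀ k → Good k
      good recurrences = <-rec Good λ where
        zero    _   → good-0
        (suc p) rec → Step.good-suc p (λ h h<k → rec h<k) recurrences

-- The recurrences of Wright's constants

module WrightConstants where
  open RationalAlgebras
  open GradedSystems
  open import Defs using (ℕ→ℚ; Σ<; b; c; c′; bUpTo; cUpTo)
  open import Data.Bool using (true; false; if_then_else_)
  open import Data.Nat as ℕ using (ℕ; zero; suc; _∸_; _≡ᵇ_)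
  import Data.Nat.Properties as ℕₚ
  import Data.Integer as ℤ
  open import Data.Rational using (ℚ; 0ℚ; 1ℚ; ½; _+_; _*_; -_; _-_; _/_)
  import Data.Rational.Properties as ℚₚ
  open import Relation.Binary.PropositionalEquality
  open PowerSeries ℚ-algebra
  open QAlgebra ℚ-algebra using (module Solver)
  module 𝕊 = QAlgebra series-algebra

  Σ<≡sum : ∀ n f → Σ< n f ≡ sum n f
  Σ<≡sum zero    f = refl
  Σ<≡sum (suc n) f = cong (_+ f n) (Σ<≡sum n f)

  Σ<≡conv : ∀ h k → h k 0 ≡ 0ℚ → Σ< k (λ t → h t (k ∸ t)) ≡ conv h k
  Σ<≡conv h k z = begin
    Σ< k (λ t → h t (k ∸ t))                     ≡⟨ Σ<≡sum k _ ⟩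
    sum k (λ t → h t (k ∸ t))                    ≡⟨ ℚₚ.+-identityʳ _ ⟨
    sum k (λ t → h t (k ∸ t)) + 0ℚ               ≡⟨ cong (sum k (λ t → h t (k ∸ t)) +_) (trans (cong (h k) (ℕₚ.n∸n≡0 k)) z) ⟨
    sum (suc k) (λ t → h t (k ∸ t))              ≡⟨ conv≈sum h k ⟨
    conv h k                                     ∎
    where open ≡-Reasoning

  Σ<-cong : ∀ n {f g} → (∀ j → j ℕ.< n → f j ≡ g j) → Σ< n f ≡ Σ< n g
  Σ<-cong n eq = trans (Σ<≡sum n _) (trans (sum-cong n eq) (sym (Σ<≡sum n _)))

  ≡ᵇ-refl : ∀ n → (n ≡ᵇ n) ≡ true
  ≡ᵇ-refl zero    = refl
  ≡ᵇ-refl (suc n) = ≡ᵇ-refl n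

  <⇒≢ᵇ : ∀ {m n} → m ℕ.< n → (m ≡ᵇ n) ≡ false
  <⇒≢ᵇ {zero}  {suc n} _             = refl
  <⇒≢ᵇ {suc m} {suc n} (ℕ.s≤s m<n)  = <⇒≢ᵇ m<n

  if-true : ∀ {e} {x y : ℚ} → e ≡ true → (if e then x else y) ≡ x
  if-true refl = refl

  if-false : ∀ {e} {x y : ℚ} → e ≡ false → (if e then x else y) ≡ y
  if-false refl = refl

  bUpTo-stable : ∀ d m t → t ℕ.≤ suc m → bUpTo (d ℕ.+ m) t ≡ bUpTo m t
  bUpTo-stable zero    m t t≤ = refl
  bUpTo-stable (suc d) m t t≤ = trans
    (if-false (<⇒≢ᵇ {t} {suc (suc (d ℕ.+ m))} (ℕ.s≤s (ℕₚ.≤-trans t≤ (ℕ.s≤s (ℕₚ.m≤n+m m d))))))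
    (bUpTo-stable d m t t≤)

  cUpTo-stable : ∀ d m t → t ℕ.≤ suc m → cUpTo (d ℕ.+ m) t ≡ cUpTo m t
  cUpTo-stable zero    m t t≤ = refl
  cUpTo-stable (suc d) m t t≤ = trans
    (if-false (<⇒≢ᵇ {t} {suc (suc (d ℕ.+ m))} (ℕ.s≤s (ℕₚ.≤-trans t≤ (ℕ.s≤s (ℕₚ.m≤n+m m d))))))
    (cUpTo-stable d m t t≤)

  -- An entry is never overwritten once it has been filled in; hence the tables for m and for t
  -- agree at t.
  bUpTo≡b : ∀ m t → t ℕ.≤ suc m → bUpTo m t ≡ b t
  bUpTo≡b m zero    _ = trans (cong (λ k → bUpTo k 0) (sym (ℕₚ.+-identityʳ m))) (bUpTo-stable m 0 0 ℕ.z≤n)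
  bUpTo≡b m (suc t) (ℕ.s≤s t≤m) = trans
    (trans (cong (λ k → bUpTo k (suc t)) (sym (ℕₚ.m∸n+n≡m t≤m))) (bUpTo-stable (m ∸ t) t (suc t) ℕₚ.≤-refl))
    (sym (bUpTo-stable 1 t (suc t) ℕₚ.≤-refl))

  cUpTo≡c : ∀ m t → t ℕ.≤ suc m → cUpTo m t ≡ c t
  cUpTo≡c m zero    _ = trans (cong (λ k → cUpTo k 0) (sym (ℕₚ.+-identityʳ m))) (cUpTo-stable m 0 0 ℕ.z≤n)
  cUpTo≡c m (suc t) (ℕ.s≤s t≤m) = trans
    (trans (cong (λ k → cUpTo k (suc t)) (sym (ℕₚ.m∸n+n≡m t≤m))) (cUpTo-stable (m ∸ t) t (suc t) ℕₚ.≤-refl))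
    (sym (cUpTo-stable 1 t (suc t) ℕₚ.≤-refl))

  1/-cancel : ∀ n .{{_ : ℕ.NonZero n}} x → ℕ→ℚ n * (x * ((ℤ.+ 1) / n)) ≡ x
  1/-cancel n x = trans (Solver.solve 3 (λ n x i → n Solver.:* (x Solver.:* i) Solver.:= x Solver.:* (i Solver.:* n)) refl (ℕ→ℚ n) x ((ℤ.+ 1) / n))
    (trans (cong (x *_) (/-*-cancel 1 n)) (ℚₚ.*-identityʳ x))

  b-recurrence : ∀ m → let k = suc m in
    ℕ→ℚ (2 ℕ.* (k ℕ.+ 1)) * b (suc k) ≡
    ℕ→ℚ (3 ℕ.* k ℕ.* (k ℕ.+ 1)) * b k + ℕ→ℚ 3 * conv (λ t s → ℕ→ℚ (t ℕ.* s) * b t * b s) k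
  b-recurrence m = trans (cong (ℕ→ℚ (2 ℕ.* (k ℕ.+ 1)) *_) unfold) (trans (1/-cancel (2 ℕ.* (k ℕ.+ 1)) _)
      (cong₂ (λ u v → ℕ→ℚ (3 ℕ.* k ℕ.* (k ℕ.+ 1)) * u + ℕ→ℚ 3 * v) (bUpTo≡b m k ℕₚ.≤-refl)
        (trans (Σ<-cong k (λ t t<k → cong₂ (λ u v → ℕ→ℚ (t ℕ.* (k ∸ t)) * u * v) (bUpTo≡b m t (ℕₚ.<⇒≤ t<k)) (bUpTo≡b m (k ∸ t) (ℕₚ.m∸n≤m k t))))
          (Σ<≡conv (λ t s → ℕ→ℚ (t ℕ.* s) * b t * b s) k
            (trans (cong (λ j → ℕ→ℚ j * b k * b 0) (ℕₚ.*-zeroʳ k)) (trans (cong (_* b 0) (ℚₚ.*-zeroˡ (b k))) (ℚₚ.*-zeroˡ (b 0))))))))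
    where
    k = suc m
    unfold : b (suc k) ≡ ((ℕ→ℚ (3 ℕ.* k ℕ.* (k ℕ.+ 1)) * bUpTo m k)
           + (ℕ→ℚ 3 * Σ< k (λ t → ℕ→ℚ (t ℕ.* (k ∸ t)) * bUpTo m t * bUpTo m (k ∸ t))))
          * ((ℤ.+ 1) / (2 ℕ.* (k ℕ.+ 1)))
    unfold = trans (bUpTo-stable 1 (suc m) (suc k) ℕₚ.≤-refl)
      (if-true (≡ᵇ-refl k))

  ℕ→ℚ-∸1 : ∀ n → 1 ℕ.≤ n → ℕ→ℚ (n ∸ 1) ≡ ℕ→ℚ n - 1ℚ
  ℕ→ℚ-∸1 (suc n) _ = sym (trans (cong (_- 1ℚ) (ℕ→ℚ-suc n))
    (Solver.solve 1 (λ x → (Solver.con 1ℚ Solver.:+ x) Solver.:+ Solver.:- Solver.con 1ℚ Solver.:= x) refl (ℕ→ℚ n)))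

  cTerm : ℕ → ℕ → ℚ
  cTerm t s = ℕ→ℚ t * (ℕ→ℚ (3 ℕ.* s) - 1ℚ) * b t * c s

  c-recurrence : ∀ m → let k = suc m in
    ℕ→ℚ (2 ℕ.* (3 ℕ.* k ℕ.+ 2)) * c (suc k) ≡
    ℕ→ℚ (8 ℕ.* (k ℕ.+ 1)) * b (k ℕ.+ 1) + ℕ→ℚ (3 ℕ.* k) * b k
    + ℕ→ℚ ((3 ℕ.* k ℕ.+ 2) ℕ.* (3 ℕ.* k ∸ 1)) * c k + ℕ→ℚ 6 * conv cTerm k
  c-recurrence m = trans (cong (ℕ→ℚ (2 ℕ.* (3 ℕ.* k ℕ.+ 2)) *_) unfold) (trans (1/-cancel (2 ℕ.* (3 ℕ.* k ℕ.+ 2)) (ℕ→ℚ (8 ℕ.* (k ℕ.+ 1)) * b (k ℕ.+ 1) + ℕ→ℚ (3 ℕ.* k) * b k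
         + ℕ→ℚ ((3 ℕ.* k ℕ.+ 2) ℕ.* (3 ℕ.* k ∸ 1)) * cUpTo m k + ℕ→ℚ 6 * Σ< k summand))
      (cong₂ (λ u v → ℕ→ℚ (8 ℕ.* (k ℕ.+ 1)) * b (k ℕ.+ 1) + ℕ→ℚ (3 ℕ.* k) * b k
         + ℕ→ℚ ((3 ℕ.* k ℕ.+ 2) ℕ.* (3 ℕ.* k ∸ 1)) * u + ℕ→ℚ 6 * v) (cUpTo≡c m k ℕₚ.≤-refl)
        (trans (Σ<-cong k term) (Σ<≡conv cTerm k (ℚₚ.*-zeroʳ (ℕ→ℚ k * (ℕ→ℚ 0 - 1ℚ) * b k))))))
    where
    k = suc m
    summand : ℕ → ℚ
    summand t = if t ≡ᵇ 0 then 0ℚ else ℕ→ℚ (t ℕ.* (3 ℕ.* k ∸ 3 ℕ.* t ∸ 1)) * b t * cUpTo m (k ∸ t)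
    unfold : c (suc k) ≡ ((ℕ→ℚ (8 ℕ.* (k ℕ.+ 1)) * b (k ℕ.+ 1))
           + (ℕ→ℚ (3 ℕ.* k) * b k)
           + (ℕ→ℚ ((3 ℕ.* k ℕ.+ 2) ℕ.* (3 ℕ.* k ∸ 1)) * cUpTo m k)
           + (ℕ→ℚ 6 * Σ< k summand))
          * ((ℤ.+ 1) / (2 ℕ.* (3 ℕ.* k ℕ.+ 2)))
    unfold = trans (cUpTo-stable 1 (suc m) (suc k) ℕₚ.≤-refl) (if-true (≡ᵇ-refl k))
    term : ∀ t → t ℕ.< k → summand t ≡ cTerm t (k ∸ t)
    term zero    _   = sym (trans (cong (λ u → u * b 0 * c k) (ℚₚ.*-zeroˡ (ℕ→ℚ (3 ℕ.* k) - 1ℚ)))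
      (trans (cong (_* c k) (ℚₚ.*-zeroˡ (b 0))) (ℚₚ.*-zeroˡ (c k))))
    -- The strict bound makes 3(k - t) positive, so the truncated subtraction of 1 agrees with the
    -- rational one.
    term (suc t) t<k = cong₂ (λ u v → u * b (suc t) * v)
      (trans (ℕ→ℚ-* (suc t) (3 ℕ.* k ∸ 3 ℕ.* suc t ∸ 1)) (cong (ℕ→ℚ (suc t) *_) (trans (cong (λ j → ℕ→ℚ (j ∸ 1)) (sym (ℕₚ.*-distribˡ-∸ 3 k (suc t))))
        (ℕ→ℚ-∸1 (3 ℕ.* (k ∸ suc t)) (ℕₚ.*-mono-≤ {1} {3} (ℕ.s≤s ℕ.z≤n) (ℕₚ.m<n⇒0<n∸m t<k))))))
      (cUpTo≡c m (k ∸ suc t) (ℕₚ.m∸n≤m k (suc t)))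

  private
    -- Absorbing the weights k and 3k - 1 turns the sums in both recurrences into plain
    -- convolutions. `V` measures the correction from c to c′.
    X U V W : ℕ → ℚ
    X k = ℕ→ℚ k * b k
    U k = (ℕ→ℚ (3 ℕ.* k) - 1ℚ) * c k
    W k = (ℕ→ℚ (3 ℕ.* k) - 1ℚ) * c′ k
    V k = W k - U k

    ν3 : ∀ k → ℕ→ℚ (3 ℕ.* k) ≡ ℕ→ℚ 3 * ℕ→ℚ k
    ν3 = ℕ→ℚ-* 3

    -- For k ≥ 1; b₁ itself is not produced by the recurrence.
    X-recurrence : ∀ m → ℕ→ℚ 2 * X (suc (suc m)) ≡ ℕ→ℚ 3 * (1ℚ + ℕ→ℚ (suc m)) * X (suc m) + ℕ→ℚ 3 * (X ⊛ X) (suc m)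
    X-recurrence m = begin
      ℕ→ℚ 2 * (ℕ→ℚ (suc k) * b (suc k))            ≡⟨ ℚₚ.*-assoc (ℕ→ℚ 2) (ℕ→ℚ (suc k)) (b (suc k)) ⟨
      ℕ→ℚ 2 * ℕ→ℚ (suc k) * b (suc k)              ≡⟨ cong (_* b (suc k)) (trans (cong (λ j → ℕ→ℚ (2 ℕ.* j)) (ℕₚ.+-comm k 1)) (ℕ→ℚ-* 2 (suc k))) ⟨
      ℕ→ℚ (2 ℕ.* (k ℕ.+ 1)) * b (suc k)            ≡⟨ b-recurrence m ⟩
      ℕ→ℚ (3 ℕ.* k ℕ.* (k ℕ.+ 1)) * b k + ℕ→ℚ 3 * conv (λ t s → ℕ→ℚ (t ℕ.* s) * b t * b s) k
        ≡⟨ cong₂ (λ u v → u * b k + ℕ→ℚ 3 * v)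
             (trans (ℕ→ℚ-* (3 ℕ.* k) (k ℕ.+ 1)) (cong₂ _*_ (ν3 k) (ℕ→ℚ-+ k 1)))
             (conv-cong (λ t s → trans (cong (λ u → u * b t * b s) (ℕ→ℚ-* t s))
                (solve 4 (λ t s x y → t :* s :* x :* y := t :* x :* (s :* y)) refl (ℕ→ℚ t) (ℕ→ℚ s) (b t) (b s))) k) ⟩
      ℕ→ℚ 3 * ℕ→ℚ k * (ℕ→ℚ k + 1ℚ) * b k + ℕ→ℚ 3 * (X ⊛ X) k
        ≡⟨ cong (_+ ℕ→ℚ 3 * (X ⊛ X) k) (solve 2 (λ κ x → con (ℕ→ℚ 3) :* κ :* (κ :+ con 1ℚ) :* x := con (ℕ→ℚ 3) :* (con 1ℚ :+ κ) :* (κ :* x)) refl (ℕ→ℚ k) (b k)) ⟩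
      ℕ→ℚ 3 * (1ℚ + ℕ→ℚ k) * X k + ℕ→ℚ 3 * (X ⊛ X) k ∎
      where
      open ≡-Reasoning
      open Solver
      k = suc m

    ν3k+2 : ∀ k → ℕ→ℚ (3 ℕ.* k ℕ.+ 2) ≡ ℕ→ℚ 3 * ℕ→ℚ k + ℕ→ℚ 2
    ν3k+2 k = trans (ℕ→ℚ-+ (3 ℕ.* k) 2) (cong (_+ ℕ→ℚ 2) (ν3 k))

    ν3suc-1 : ∀ k → ℕ→ℚ (3 ℕ.* suc k) - 1ℚ ≡ ℕ→ℚ 3 * ℕ→ℚ k + ℕ→ℚ 2
    ν3suc-1 k = trans (cong (_- 1ℚ) (trans (ν3 (suc k)) (cong (ℕ→ℚ 3 *_) (ℕ→ℚ-suc k))))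
      (solve 1 (λ κ → con (ℕ→ℚ 3) :* (con 1ℚ :+ κ) :+ :- con 1ℚ := con (ℕ→ℚ 3) :* κ :+ con (ℕ→ℚ 2)) refl (ℕ→ℚ k))
      where open Solver

    U-recurrence : ∀ m → let k = suc m in
      ℕ→ℚ 2 * U (suc k) ≡ ℕ→ℚ 8 * X (suc k) + ℕ→ℚ 3 * X k + (ℕ→ℚ 3 * ℕ→ℚ k + ℕ→ℚ 2) * U k + ℕ→ℚ 6 * (X ⊛ U) k
    U-recurrence m = begin
      ℕ→ℚ 2 * ((ℕ→ℚ (3 ℕ.* suc k) - 1ℚ) * c (suc k))
        ≡⟨ cong (λ u → ℕ→ℚ 2 * (u * c (suc k))) (trans (ν3suc-1 k) (sym (ν3k+2 k))) ⟩
      ℕ→ℚ 2 * (ℕ→ℚ (3 ℕ.* k ℕ.+ 2) * c (suc k))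
        ≡⟨ ℚₚ.*-assoc (ℕ→ℚ 2) (ℕ→ℚ (3 ℕ.* k ℕ.+ 2)) (c (suc k)) ⟨
      ℕ→ℚ 2 * ℕ→ℚ (3 ℕ.* k ℕ.+ 2) * c (suc k)
        ≡⟨ cong (_* c (suc k)) (ℕ→ℚ-* 2 (3 ℕ.* k ℕ.+ 2)) ⟨
      ℕ→ℚ (2 ℕ.* (3 ℕ.* k ℕ.+ 2)) * c (suc k)
        ≡⟨ c-recurrence m ⟩
      ℕ→ℚ (8 ℕ.* (k ℕ.+ 1)) * b (k ℕ.+ 1) + ℕ→ℚ (3 ℕ.* k) * b k
      + ℕ→ℚ ((3 ℕ.* k ℕ.+ 2) ℕ.* (3 ℕ.* k ∸ 1)) * c k + ℕ→ℚ 6 * conv cTerm k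
        ≡⟨ cong₂ _+_ (cong₂ _+_ (cong₂ _+_
             (trans (cong (λ j → ℕ→ℚ (8 ℕ.* j) * b j) (ℕₚ.+-comm k 1)) (trans (cong (_* b (suc k)) (ℕ→ℚ-* 8 (suc k))) (ℚₚ.*-assoc (ℕ→ℚ 8) (ℕ→ℚ (suc k)) (b (suc k)))))
             (trans (cong (_* b k) (ν3 k)) (ℚₚ.*-assoc (ℕ→ℚ 3) (ℕ→ℚ k) (b k))))
             (trans (cong (_* c k) (trans (ℕ→ℚ-* (3 ℕ.* k ℕ.+ 2) (3 ℕ.* k ∸ 1)) (cong₂ _*_ (ν3k+2 k) (ℕ→ℚ-∸1 (3 ℕ.* k) (ℕ.s≤s ℕ.z≤n)))))
               (ℚₚ.*-assoc (ℕ→ℚ 3 * ℕ→ℚ k + ℕ→ℚ 2) (ℕ→ℚ (3 ℕ.* k) - 1ℚ) (c k))))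
             (cong (ℕ→ℚ 6 *_) (conv-cong (λ t s → solve 4 (λ t u x y → t :* u :* x :* y := t :* x :* (u :* y)) refl (ℕ→ℚ t) (ℕ→ℚ (3 ℕ.* s) - 1ℚ) (b t) (c s)) k)) ⟩
      ℕ→ℚ 8 * X (suc k) + ℕ→ℚ 3 * X k + (ℕ→ℚ 3 * ℕ→ℚ k + ℕ→ℚ 2) * U k + ℕ→ℚ 6 * (X ⊛ U) k ∎
      where
      open ≡-Reasoning
      open Solver
      k = suc m

    3/2 9/2 9/4 : ℚ
    3/2 = (ℤ.+ 3) / 2
    9/2 = (ℤ.+ 9) / 2
    9/4 = (ℤ.+ 9) / 4

    -- The series with V = z Z. Its constant ½ is (3 - 1)(25/24 - 19/24); the other coefficients
    -- restate that c′ exceeds c at k + 1 by (3/2) k b_k.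
    Z : ℕ → ℚ
    Z = 𝕊.ι 9/2 ⊛ D X 𝕊.+ 𝕊.ι (ℕ→ℚ 3) ⊛ X 𝕊.+ 𝕊.ι ½

    V-suc : ∀ m → V (suc (suc m)) ≡ (ℕ→ℚ 3 * ℕ→ℚ (suc m) + ℕ→ℚ 2) * (3/2 * X (suc m))
    V-suc m = begin
      (u * (x + 3/2 * ν * β) - u * x)      ≡⟨ solve 5 (λ u x h n b → u :* (x :+ h :* n :* b) :+ :- (u :* x) := u :* (h :* (n :* b))) refl u x 3/2 ν β ⟩
      u * (3/2 * (ν * β))                  ≡⟨ cong (_* (3/2 * X (suc m))) (ν3suc-1 (suc m)) ⟩
      _ ∎
      where
      open ≡-Reasoning
      open Solver
      u = ℕ→ℚ (3 ℕ.* suc (suc m)) - 1ℚ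
      x = c (suc (suc m))
      ν = ℕ→ℚ (suc m)
      β = b (suc m)

    Z-coefficient : ∀ k → Z k ≡ 9/2 * (ℕ→ℚ k * X k) + ℕ→ℚ 3 * X k + 𝕊.ι ½ k
    Z-coefficient k = cong₂ (λ u v → u + v + 𝕊.ι ½ k) (ι-⊛ 9/2 (D X) k) (ι-⊛ (ℕ→ℚ 3) X k)

    V≋shiftZ : V ≋ shift Z
    V≋shiftZ zero          = refl
    V≋shiftZ (suc zero)    = refl
    V≋shiftZ (suc (suc m)) = trans (V-suc m) (trans
      (solve 2 (λ n x → (con (ℕ→ℚ 3) :* n :+ con (ℕ→ℚ 2)) :* (con 3/2 :* x) := con 9/2 :* (n :* x) :+ con (ℕ→ℚ 3) :* x :+ con 0ℚ) refl (ℕ→ℚ (suc m)) (X (suc m)))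
      (sym (Z-coefficient (suc m))))
      where open Solver

    -- By symmetry X D X is half of D (X²), so the product is expressed through X² and X alone, to
    -- which the recurrence of b applies.
    X⊛Z : ∀ n → (X ⊛ Z) n ≡ 9/4 * (ℕ→ℚ n * (X ⊛ X) n) + ℕ→ℚ 3 * (X ⊛ X) n + ½ * X n
    X⊛Z n = begin
      (X ⊛ Z) n
        ≡⟨ solve 2 (λ x d → x :* (con 9/2 :* d :+ con (ℕ→ℚ 3) :* x :+ con ½) := con 9/4 :* (d :* x :+ x :* d) :+ con (ℕ→ℚ 3) :* (x :* x) :+ con ½ :* x) (λ _ → refl) X (D X) n ⟩
      (𝕊.ι 9/4 ⊛ (D X ⊛ X 𝕊.+ X ⊛ D X)) n + (𝕊.ι (ℕ→ℚ 3) ⊛ (X ⊛ X)) n + (𝕊.ι ½ ⊛ X) n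
        ≡⟨ cong₂ _+_ (cong₂ _+_ (trans (ι-⊛ 9/4 (D X ⊛ X 𝕊.+ X ⊛ D X) n) (cong (9/4 *_) (sym (D-⊛ X X n)))) (ι-⊛ (ℕ→ℚ 3) (X ⊛ X) n)) (ι-⊛ ½ X n) ⟩
      9/4 * (ℕ→ℚ n * (X ⊛ X) n) + ℕ→ℚ 3 * (X ⊛ X) n + ½ * X n ∎
      where
      open ≡-Reasoning
      open 𝕊.Solver

    X⊛V-suc : ∀ n → (X ⊛ V) (suc n) ≡ (X ⊛ Z) n
    X⊛V-suc n = begin
      (X ⊛ V) (suc n)         ≡⟨ 𝕊.*-congˡ {X} V≋shiftZ (suc n) ⟩
      (X ⊛ shift Z) (suc n)   ≡⟨ ⊛-comm X (shift Z) (suc n) ⟩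
      (shift Z ⊛ X) (suc n)   ≡⟨ shift-⊛ Z X (suc n) ⟩
      (Z ⊛ X) n               ≡⟨ ⊛-comm Z X n ⟩
      (X ⊛ Z) n               ∎
      where open ≡-Reasoning

    -- The explicit correction solves the linear recurrence of c with only the source 3 X_k. After
    -- the convolution is rewritten by `X⊛Z`, this is a multiple of the recurrence of X at the
    -- preceding index; that recurrence starts at 1, so k = 1 is checked numerically.
    V-recurrence : ∀ m → let k = suc m in
      ℕ→ℚ 2 * V (suc k) ≡ ℕ→ℚ 3 * X k + (ℕ→ℚ 3 * ℕ→ℚ k + ℕ→ℚ 2) * V k + ℕ→ℚ 6 * (X ⊛ V) k
    V-recurrence zero    = trans (cong (ℕ→ℚ 2 *_) (V-suc 0)) refl
    V-recurrence (suc m) = sym (begin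
      ℕ→ℚ 3 * x₂ + (ℕ→ℚ 3 * κ₂ + ℕ→ℚ 2) * V k₂ + ℕ→ℚ 6 * (X ⊛ V) k₂
        ≡⟨ cong₂ (λ u v → ℕ→ℚ 3 * x₂ + (ℕ→ℚ 3 * κ₂ + ℕ→ℚ 2) * u + ℕ→ℚ 6 * v) (V-suc m) (trans (X⊛V-suc k₁) (X⊛Z k₁)) ⟩
      ℕ→ℚ 3 * x₂ + (ℕ→ℚ 3 * κ₂ + ℕ→ℚ 2) * ((ℕ→ℚ 3 * κ₁ + ℕ→ℚ 2) * (3/2 * x₁)) + ℕ→ℚ 6 * (9/4 * (κ₁ * xx) + ℕ→ℚ 3 * xx + ½ * x₁)
        ≡⟨ cong (λ κ → ℕ→ℚ 3 * x₂ + (ℕ→ℚ 3 * κ + ℕ→ℚ 2) * ((ℕ→ℚ 3 * κ₁ + ℕ→ℚ 2) * (3/2 * x₁)) + ℕ→ℚ 6 * (9/4 * (κ₁ * xx) + ℕ→ℚ 3 * xx + ½ * x₁)) (ℕ→ℚ-suc k₁) ⟩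
      ℕ→ℚ 3 * x₂ + (ℕ→ℚ 3 * (1ℚ + κ₁) + ℕ→ℚ 2) * ((ℕ→ℚ 3 * κ₁ + ℕ→ℚ 2) * (3/2 * x₁)) + ℕ→ℚ 6 * (9/4 * (κ₁ * xx) + ℕ→ℚ 3 * xx + ½ * x₁)
        ≡⟨ solve 4 (λ x₂ κ x₁ xx →
             con (ℕ→ℚ 3) :* x₂ :+ (con (ℕ→ℚ 3) :* (con 1ℚ :+ κ) :+ con (ℕ→ℚ 2)) :* ((con (ℕ→ℚ 3) :* κ :+ con (ℕ→ℚ 2)) :* (con 3/2 :* x₁))
               :+ con (ℕ→ℚ 6) :* (con 9/4 :* (κ :* xx) :+ con (ℕ→ℚ 3) :* xx :+ con ½ :* x₁)
             := con (ℕ→ℚ 3) :* x₂ :+ (con 9/2 :* κ :+ con (ℕ→ℚ 6)) :* (con (ℕ→ℚ 3) :* (con 1ℚ :+ κ) :* x₁ :+ con (ℕ→ℚ 3) :* xx)) refl x₂ κ₁ x₁ xx ⟩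
      ℕ→ℚ 3 * x₂ + (9/2 * κ₁ + ℕ→ℚ 6) * (ℕ→ℚ 3 * (1ℚ + κ₁) * x₁ + ℕ→ℚ 3 * xx)
        ≡⟨ cong (λ u → ℕ→ℚ 3 * x₂ + (9/2 * κ₁ + ℕ→ℚ 6) * u) (X-recurrence m) ⟨
      ℕ→ℚ 3 * x₂ + (9/2 * κ₁ + ℕ→ℚ 6) * (ℕ→ℚ 2 * x₂)
        ≡⟨ solve 2 (λ κ x → con (ℕ→ℚ 3) :* x :+ (con 9/2 :* κ :+ con (ℕ→ℚ 6)) :* (con (ℕ→ℚ 2) :* x)
             := con (ℕ→ℚ 2) :* ((con (ℕ→ℚ 3) :* (con 1ℚ :+ κ) :+ con (ℕ→ℚ 2)) :* (con 3/2 :* x))) refl κ₁ x₂ ⟩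
      ℕ→ℚ 2 * ((ℕ→ℚ 3 * (1ℚ + κ₁) + ℕ→ℚ 2) * (3/2 * x₂))
        ≡⟨ cong (λ κ → ℕ→ℚ 2 * ((ℕ→ℚ 3 * κ + ℕ→ℚ 2) * (3/2 * x₂))) (ℕ→ℚ-suc k₁) ⟨
      ℕ→ℚ 2 * ((ℕ→ℚ 3 * κ₂ + ℕ→ℚ 2) * (3/2 * x₂))
        ≡⟨ cong (ℕ→ℚ 2 *_) (V-suc (suc m)) ⟨
      ℕ→ℚ 2 * V (suc k₂) ∎)
      where
      open ≡-Reasoning
      open Solver
      k₁ = suc m
      k₂ = suc k₁
      κ₁ = ℕ→ℚ k₁
      κ₂ = ℕ→ℚ k₂
      x₁ = X k₁
      x₂ = X k₂
      xx = (X ⊛ X) k₁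

    W≡ : ∀ k → W k ≡ U k + V k
    W≡ k = Solver.solve 2 (λ w u → w Solver.:= u Solver.:+ (w Solver.:+ Solver.:- u)) refl (W k) (U k)

    -- The recurrences of `U` and `V` have the same linear part, so their sum satisfies it with the
    -- sources added.
    W-recurrence : ∀ m → let k = suc m in
      ℕ→ℚ 2 * W (suc k) ≡ ℕ→ℚ 8 * X (suc k) + ℕ→ℚ 6 * X k + (ℕ→ℚ 3 * ℕ→ℚ k + ℕ→ℚ 2) * W k + ℕ→ℚ 6 * (X ⊛ W) k
    W-recurrence m = begin
      ℕ→ℚ 2 * W (suc k)                              ≡⟨ cong (ℕ→ℚ 2 *_) (W≡ (suc k)) ⟩
      ℕ→ℚ 2 * (U (suc k) + V (suc k))                ≡⟨ ℚₚ.*-distribˡ-+ (ℕ→ℚ 2) (U (suc k)) (V (suc k)) ⟩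
      ℕ→ℚ 2 * U (suc k) + ℕ→ℚ 2 * V (suc k)          ≡⟨ cong₂ _+_ (U-recurrence m) (V-recurrence m) ⟩
      (ℕ→ℚ 8 * X (suc k) + ℕ→ℚ 3 * X k + κ * U k + ℕ→ℚ 6 * (X ⊛ U) k) + (ℕ→ℚ 3 * X k + κ * V k + ℕ→ℚ 6 * (X ⊛ V) k)
        ≡⟨ solve 7 (λ a x κ u v p q → (a :+ con (ℕ→ℚ 3) :* x :+ κ :* u :+ con (ℕ→ℚ 6) :* p) :+ (con (ℕ→ℚ 3) :* x :+ κ :* v :+ con (ℕ→ℚ 6) :* q)
             := a :+ con (ℕ→ℚ 6) :* x :+ κ :* (u :+ v) :+ con (ℕ→ℚ 6) :* (p :+ q)) refl (ℕ→ℚ 8 * X (suc k)) (X k) κ (U k) (V k) ((X ⊛ U) k) ((X ⊛ V) k) ⟩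
      ℕ→ℚ 8 * X (suc k) + ℕ→ℚ 6 * X k + κ * (U k + V k) + ℕ→ℚ 6 * ((X ⊛ U) k + (X ⊛ V) k)
        ≡⟨ cong₂ (λ u v → ℕ→ℚ 8 * X (suc k) + ℕ→ℚ 6 * X k + κ * u + ℕ→ℚ 6 * v) (W≡ k)
             (trans (𝕊.*-congˡ {X} W≡ k) (𝕊.distribˡ X U V k)) ⟨
      ℕ→ℚ 8 * X (suc k) + ℕ→ℚ 6 * X k + κ * W k + ℕ→ℚ 6 * (X ⊛ W) k ∎
      where
      open ≡-Reasoning
      open Solver
      k = suc m
      κ = ℕ→ℚ 3 * ℕ→ℚ k + ℕ→ℚ 2

  open Coefficients b (λ k → - c′ k)

  private
    y-suc : ∀ k → y (suc k) ≡ ℕ→ℚ 3 * X (suc k)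
    y-suc k = trans (cong (_* b (suc k)) (ν3 (suc k))) (ℚₚ.*-assoc (ℕ→ℚ 3) (ℕ→ℚ (suc k)) (b (suc k)))

    y′-suc : ∀ k → y′ (suc k) ≡ - W (suc k) - ℕ→ℚ 3 * X (suc k)
    y′-suc k = cong₂ _-_ (Solver.solve 2 (λ u v → u Solver.:* Solver.:- v Solver.:= Solver.:- (u Solver.:* v)) refl (ℕ→ℚ (3 ℕ.* suc k) - 1ℚ) (c′ (suc k))) (y-suc k)

    -- The value at 0 is carried by the constant ½ because X vanishes there. The cross terms of this
    -- constant in y² and y y′ are what shifts the linear coefficients of Wright's recurrences.
    y≋ : y ≋ 𝕊.ι (ℕ→ℚ 3) ⊛ X 𝕊.+ 𝕊.ι ½
    y≋ zero    = refl
    y≋ (suc k) = trans (y-suc k) (trans (sym (ι-⊛ (ℕ→ℚ 3) X (suc k))) (sym (ℚₚ.+-identityʳ ((𝕊.ι (ℕ→ℚ 3) ⊛ X) (suc k)))))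

    y′≋ : y′ ≋ 𝕊.- W 𝕊.+ 𝕊.- (𝕊.ι (ℕ→ℚ 3) ⊛ X) 𝕊.+ 𝕊.ι (- ℕ→ℚ 2)
    y′≋ zero    = refl
    y′≋ (suc k) = trans (y′-suc k) (trans (cong (λ u → - W (suc k) - u) (sym (ι-⊛ (ℕ→ℚ 3) X (suc k))))
      (sym (ℚₚ.+-identityʳ (- W (suc k) - (𝕊.ι (ℕ→ℚ 3) ⊛ X) (suc k)))))

    y⊛y : ∀ m → (y ⊛ y) (suc m) ≡ ℕ→ℚ 9 * (X ⊛ X) (suc m) + ℕ→ℚ 3 * X (suc m)
    y⊛y m = begin
      (y ⊛ y) n       ≡⟨ ⊛-cong {y} {Y} {y} {Y} y≋ y≋ n ⟩
      (Y ⊛ Y) n       ≡⟨ solve 1 (λ x → (con (ℕ→ℚ 3) :* x :+ con ½) :* (con (ℕ→ℚ 3) :* x :+ con ½)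
                            := con (ℕ→ℚ 9) :* (x :* x) :+ con (ℕ→ℚ 3) :* x :+ con ((ℤ.+ 1) / 4)) (λ _ → refl) X n ⟩
      (𝕊.ι (ℕ→ℚ 9) ⊛ (X ⊛ X)) n + (𝕊.ι (ℕ→ℚ 3) ⊛ X) n + 0ℚ
                      ≡⟨ trans (ℚₚ.+-identityʳ _) (cong₂ _+_ (ι-⊛ (ℕ→ℚ 9) (X ⊛ X) n) (ι-⊛ (ℕ→ℚ 3) X n)) ⟩
      ℕ→ℚ 9 * (X ⊛ X) n + ℕ→ℚ 3 * X n ∎
      where
      open ≡-Reasoning
      open 𝕊.Solver
      n = suc m
      Y = 𝕊.ι (ℕ→ℚ 3) ⊛ X 𝕊.+ 𝕊.ι ½

    15/2 : ℚ
    15/2 = (ℤ.+ 15) / 2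

    y⊛y′ : ∀ m → (y ⊛ y′) (suc m) ≡ - (ℕ→ℚ 3 * (X ⊛ W) (suc m) + ℕ→ℚ 9 * (X ⊛ X) (suc m) + 15/2 * X (suc m) + ½ * W (suc m))
    y⊛y′ m = begin
      (y ⊛ y′) n      ≡⟨ ⊛-cong {y} {Y} {y′} {Y′} y≋ y′≋ n ⟩
      (Y ⊛ Y′) n      ≡⟨ solve 2 (λ x w → (con (ℕ→ℚ 3) :* x :+ con ½) :* (:- w :+ :- (con (ℕ→ℚ 3) :* x) :+ con (- ℕ→ℚ 2))
                            := :- (con (ℕ→ℚ 3) :* (x :* w) :+ con (ℕ→ℚ 9) :* (x :* x) :+ con 15/2 :* x :+ con ½ :* w) :+ con (- 1ℚ)) (λ _ → refl) X W n ⟩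
      - ((𝕊.ι (ℕ→ℚ 3) ⊛ (X ⊛ W)) n + (𝕊.ι (ℕ→ℚ 9) ⊛ (X ⊛ X)) n + (𝕊.ι 15/2 ⊛ X) n + (𝕊.ι ½ ⊛ W) n) + 0ℚ
                      ≡⟨ trans (ℚₚ.+-identityʳ _) (cong -_ (cong₂ _+_ (cong₂ _+_ (cong₂ _+_ (ι-⊛ (ℕ→ℚ 3) (X ⊛ W) n) (ι-⊛ (ℕ→ℚ 9) (X ⊛ X) n)) (ι-⊛ 15/2 X n)) (ι-⊛ ½ W n))) ⟩
      - (ℕ→ℚ 3 * (X ⊛ W) n + ℕ→ℚ 9 * (X ⊛ X) n + 15/2 * X n + ½ * W n) ∎
      where
      open ≡-Reasoning
      open 𝕊.Solver
      n = suc m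
      Y = 𝕊.ι (ℕ→ℚ 3) ⊛ X 𝕊.+ 𝕊.ι ½
      Y′ = 𝕊.- W 𝕊.+ 𝕊.- (𝕊.ι (ℕ→ℚ 3) ⊛ X) 𝕊.+ 𝕊.ι (- ℕ→ℚ 2)

    ν2+3k : ∀ k → ℕ→ℚ (2 ℕ.+ 3 ℕ.* k) ≡ ℕ→ℚ 3 * ℕ→ℚ k + ℕ→ℚ 2
    ν2+3k k = trans (cong ℕ→ℚ (ℕₚ.+-comm 2 (3 ℕ.* k))) (ν3k+2 k)

  wright-recurrences : Recurrences
  wright-recurrences = record { first = first ; second = second }
    where
    open ≡-Reasoning
    open Solver
    first : ∀ p → ℕ→ℚ (3 ℕ.* suc p) * b (suc p) ≡ ½ * (ℕ→ℚ (2 ℕ.+ 3 ℕ.* p) * y p + (y ⊛ y) p)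
    -- Here 3 · 5/24 = ½ (2 · ½ + ¼): the initial value of b is forced by the leading coefficient ½
    -- at excess 0.
    first zero    = refl
    first (suc m) = sym (begin
      ½ * (ℕ→ℚ (2 ℕ.+ 3 ℕ.* k) * y k + (y ⊛ y) k)
        ≡⟨ cong (½ *_) (cong₂ _+_ (cong₂ _*_ (ν2+3k k) (y-suc m)) (y⊛y m)) ⟩
      ½ * ((ℕ→ℚ 3 * κ + ℕ→ℚ 2) * (ℕ→ℚ 3 * X k) + (ℕ→ℚ 9 * (X ⊛ X) k + ℕ→ℚ 3 * X k))
        ≡⟨ solve 3 (λ κ x xx → con ½ :* ((con (ℕ→ℚ 3) :* κ :+ con (ℕ→ℚ 2)) :* (con (ℕ→ℚ 3) :* x) :+ (con (ℕ→ℚ 9) :* xx :+ con (ℕ→ℚ 3) :* x))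
             := con 3/2 :* (con (ℕ→ℚ 3) :* (con 1ℚ :+ κ) :* x :+ con (ℕ→ℚ 3) :* xx)) refl κ (X k) ((X ⊛ X) k) ⟩
      3/2 * (ℕ→ℚ 3 * (1ℚ + κ) * X k + ℕ→ℚ 3 * (X ⊛ X) k)
        ≡⟨ cong (3/2 *_) (X-recurrence m) ⟨
      3/2 * (ℕ→ℚ 2 * X (suc k))
        ≡⟨ solve 1 (λ x → con 3/2 :* (con (ℕ→ℚ 2) :* x) := con (ℕ→ℚ 3) :* x) refl (X (suc k)) ⟩
      ℕ→ℚ 3 * X (suc k)
        ≡⟨ y-suc k ⟨
      ℕ→ℚ (3 ℕ.* suc k) * b (suc k) ∎)
      where
      k = suc m
      κ = ℕ→ℚ k

    second : ∀ p → (ℕ→ℚ (3 ℕ.* suc p) - 1ℚ) * - c′ (suc p) - ℕ→ℚ (3 ℕ.* suc p) * b (suc p) + ℕ→ℚ (suc p) * b (suc p) ≡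
      ½ * ((ℕ→ℚ (2 ℕ.+ 3 ℕ.* p) - 1ℚ) * y′ p - ℕ→ℚ (2 ℕ.+ 3 ℕ.* p) * y p + conv (λ a b → y a * y′ b + y′ a * y b) p)
    -- Both sides equal -5/2. This is where 25/24 is tied to the value -2 of y′ at 0.
    second zero    = refl
    second (suc m) = sym (begin
      ½ * ((ℕ→ℚ (2 ℕ.+ 3 ℕ.* k) - 1ℚ) * y′ k - ℕ→ℚ (2 ℕ.+ 3 ℕ.* k) * y k + conv (λ a b → y a * y′ b + y′ a * y b) k)
        ≡⟨ cong (½ *_) (cong₂ _+_ (cong₂ _-_ (cong₂ (λ u v → (u - 1ℚ) * v) (ν2+3k k) (y′-suc m)) (cong₂ _*_ (ν2+3k k) (y-suc m)))
             (trans (conv-+ (λ a b → y a * y′ b) (λ a b → y′ a * y b) k) (cong₂ _+_ (y⊛y′ m) (trans (⊛-comm y′ y k) (y⊛y′ m))))) ⟩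
      ½ * ((ℕ→ℚ 3 * κ + ℕ→ℚ 2 - 1ℚ) * (- W k - ℕ→ℚ 3 * X k) - (ℕ→ℚ 3 * κ + ℕ→ℚ 2) * (ℕ→ℚ 3 * X k) + (- q + - q))
        ≡⟨ solve 5 (λ κ w x xw xx → let q = con (ℕ→ℚ 3) :* xw :+ con (ℕ→ℚ 9) :* xx :+ con 15/2 :* x :+ con ½ :* w in
             con ½ :* ((con (ℕ→ℚ 3) :* κ :+ con (ℕ→ℚ 2) :+ :- con 1ℚ) :* (:- w :+ :- (con (ℕ→ℚ 3) :* x)) :+ :- ((con (ℕ→ℚ 3) :* κ :+ con (ℕ→ℚ 2)) :* (con (ℕ→ℚ 3) :* x)) :+ (:- q :+ :- q))
             := :- (con ½ :* (con (ℕ→ℚ 6) :* x :+ (con (ℕ→ℚ 3) :* κ :+ con (ℕ→ℚ 2)) :* w :+ con (ℕ→ℚ 6) :* xw)) :+ :- (con (ℕ→ℚ 3) :* (con (ℕ→ℚ 3) :* (con 1ℚ :+ κ) :* x :+ con (ℕ→ℚ 3) :* xx)))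
             refl κ (W k) (X k) ((X ⊛ W) k) ((X ⊛ X) k) ⟩
      - (½ * (ℕ→ℚ 6 * X k + (ℕ→ℚ 3 * κ + ℕ→ℚ 2) * W k + ℕ→ℚ 6 * (X ⊛ W) k)) - ℕ→ℚ 3 * (ℕ→ℚ 3 * (1ℚ + κ) * X k + ℕ→ℚ 3 * (X ⊛ X) k)
        ≡⟨ cong (λ u → - (½ * (ℕ→ℚ 6 * X k + (ℕ→ℚ 3 * κ + ℕ→ℚ 2) * W k + ℕ→ℚ 6 * (X ⊛ W) k)) - ℕ→ℚ 3 * u) (X-recurrence m) ⟨
      - (½ * (ℕ→ℚ 6 * X k + (ℕ→ℚ 3 * κ + ℕ→ℚ 2) * W k + ℕ→ℚ 6 * (X ⊛ W) k)) - ℕ→ℚ 3 * (ℕ→ℚ 2 * X (suc k))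
        ≡⟨ solve 4 (λ a p q x → :- (con ½ :* (a :+ p :+ q)) :+ :- (con (ℕ→ℚ 3) :* (con (ℕ→ℚ 2) :* x)) := :- (con ½ :* (con (ℕ→ℚ 8) :* x :+ a :+ p :+ q)) :+ :- (con (ℕ→ℚ 2) :* x))
             refl (ℕ→ℚ 6 * X k) ((ℕ→ℚ 3 * κ + ℕ→ℚ 2) * W k) (ℕ→ℚ 6 * (X ⊛ W) k) (X (suc k)) ⟩
      - (½ * (ℕ→ℚ 8 * X (suc k) + ℕ→ℚ 6 * X k + (ℕ→ℚ 3 * κ + ℕ→ℚ 2) * W k + ℕ→ℚ 6 * (X ⊛ W) k)) - ℕ→ℚ 2 * X (suc k)
        ≡⟨ cong (λ u → - (½ * u) - ℕ→ℚ 2 * X (suc k)) (W-recurrence m) ⟨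
      - (½ * (ℕ→ℚ 2 * W (suc k))) - ℕ→ℚ 2 * X (suc k)
        ≡⟨ solve 4 (λ u v n β → :- (con ½ :* (con (ℕ→ℚ 2) :* (u :* v))) :+ :- (con (ℕ→ℚ 2) :* (n :* β)) := u :* :- v :+ :- (con (ℕ→ℚ 3) :* (n :* β)) :+ n :* β)
             refl (ℕ→ℚ (3 ℕ.* suc k) - 1ℚ) (c′ (suc k)) (ℕ→ℚ (suc k)) (b (suc k)) ⟩
      (ℕ→ℚ (3 ℕ.* suc k) - 1ℚ) * - c′ (suc k) - ℕ→ℚ 3 * X (suc k) + X (suc k)
        ≡⟨ cong (λ u → (ℕ→ℚ (3 ℕ.* suc k) - 1ℚ) * - c′ (suc k) - u + X (suc k)) (y-suc k) ⟨
      (ℕ→ℚ (3 ℕ.* suc k) - 1ℚ) * - c′ (suc k) - ℕ→ℚ (3 ℕ.* suc k) * b (suc k) + ℕ→ℚ (suc k) * b (suc k) ∎)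
      where
      k = suc m
      κ = ℕ→ℚ k
      q = ℕ→ℚ 3 * (X ⊛ W) k + ℕ→ℚ 9 * (X ⊛ X) k + 15/2 * X k + ½ * W k

-- Graphs on lists of natural numbers and the splitting off of a component

module SimpleGraphs where
  open RationalAlgebras
  open import Data.Bool using (if_then_else_)
  open import Data.Nat as ℕ using (ℕ)
  open import Data.List using (List; []; _∷_; map; _++_)
  import Data.List.Properties as Listₚ
  open import Data.List.Membership.Propositional using (_∈_)
  open import Data.List.Membership.Propositional.Properties using (∈-++⁺ˡ; ∈-++⁺ʳ; ∈-++⁻)
  open import Data.List.Relation.Unary.Any using (here; there)
  open import Data.List.Relation.Unary.All as All using (All; []; _∷_)
  import Data.List.Relation.Unary.All.Properties as Allₚ
  open import Data.List.Relation.Unary.AllPairs using ([]; _∷_)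
  open import Data.List.Relation.Unary.Unique.Propositional using (Unique)
  open import Data.List.Relation.Binary.Permutation.Propositional as Perm using (_↭_; ↭-sym; ↭-trans; prep; swap)
  import Data.List.Relation.Binary.Permutation.Propositional.Properties as Permₚ
  open import Data.List.Relation.Ternary.Interleaving.Propositional using (Interleaving; []; consˡ; consʳ; toPermutation)
  open import Data.List.Relation.Binary.Sublist.Propositional using (_⊆_; []; _∷_; _∷ʳ_; lookup)
  open import Data.List.Relation.Binary.Sublist.Propositional.Properties using (All-resp-⊆)
  open import Data.Product using (∃; _×_; _,_; proj₁; proj₂; map₂)
  open import Data.Sum as Sum using (_⊎_; inj₁; inj₂; [_,_])
  open import Data.Empty using (⊥; ⊥-elim)
  open import Function using (_∘_; id; mk⇔)
  open import Relation.Nullary using (¬_; Dec; yes; no; does; ¬?; _×-dec_; _⊎-dec_)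
  open import Relation.Nullary.Decidable using (map′; dec-true; dec-false; does-⇔)
  open import Relation.Binary.Construct.Closure.ReflexiveTransitive using (Star; ε; _◅_; _◅◅_; gmap)
  open import Relation.Binary.PropositionalEquality as ≡ using (_≡_)
  import Relation.Binary.Reasoning.Setoid as SetoidReasoning
  import Algebra.Solver.CommutativeMonoid as MonoidSolver

  -- Vertices are bare natural numbers, so a vertex set can be split into two parts and both keep
  -- their labels.
  Edge : Set
  Edge = ℕ × ℕ

  Adj : List Edge → ℕ → ℕ → Set
  Adj E u v = (u , v) ∈ E ⊎ (v , u) ∈ E

  Path : List Edge → ℕ → ℕ → Set
  Path E = Star (Adj E)

  adj-sym : ∀ {E u v} → Adj E u v → Adj E v u
  adj-sym = [ inj₂ , inj₁ ]

  adj-mono : ∀ {E E′} → (∀ {e} → e ∈ E → e ∈ E′) → ∀ {u v} → Adj E u v → Adj E′ u v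
  adj-mono f = [ inj₁ ∘ f , inj₂ ∘ f ]

  path-mono : ∀ {E E′} → (∀ {e} → e ∈ E → e ∈ E′) → ∀ {u v} → Path E u v → Path E′ u v
  path-mono f = gmap id (adj-mono f)

  Via : List Edge → ℕ → ℕ → ℕ → ℕ → Set
  Via E a b u v = Path E u v ⊎ (Path E u a × Path E b v) ⊎ (Path E u b × Path E a v)

  via-path : ∀ {E a b u v} → Via E a b u v → Path ((a , b) ∷ E) u v
  via-path (inj₁ p)              = path-mono there p
  via-path (inj₂ (inj₁ (p , q))) = path-mono there p ◅◅ inj₁ (here ≡.refl) ◅ path-mono there q
  via-path (inj₂ (inj₂ (p , q))) = path-mono there p ◅◅ inj₂ (here ≡.refl) ◅ path-mono there q

  -- A path can be shortened until it uses the edge at most once, in one of the two directions. This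
  -- makes reachability decidable by recursion on the list of edges.
  path-via : ∀ {E a b u v} → Path ((a , b) ∷ E) u v → Via E a b u v
  path-via ε = inj₁ ε
  path-via {E} {a} {b} {v = v} (e ◅ p) = step e (path-via p)
    where
    extend : ∀ {u w} → Adj E u w → Via E a b w v → Via E a b u v
    extend e (inj₁ p)              = inj₁ (e ◅ p)
    extend e (inj₂ (inj₁ (p , q))) = inj₂ (inj₁ (e ◅ p , q))
    extend e (inj₂ (inj₂ (p , q))) = inj₂ (inj₂ (e ◅ p , q))
    step : ∀ {u w} → Adj ((a , b) ∷ E) u w → Via E a b w v → Via E a b u v
    step (inj₁ (here ≡.refl)) (inj₁ p)              = inj₂ (inj₁ (ε , p))
    step (inj₁ (here ≡.refl)) (inj₂ (inj₁ (_ , p))) = inj₂ (inj₁ (ε , p))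
    step (inj₁ (here ≡.refl)) (inj₂ (inj₂ (_ , p))) = inj₁ p
    step (inj₂ (here ≡.refl)) (inj₁ p)              = inj₂ (inj₂ (ε , p))
    step (inj₂ (here ≡.refl)) (inj₂ (inj₁ (_ , p))) = inj₁ p
    step (inj₂ (here ≡.refl)) (inj₂ (inj₂ (_ , p))) = inj₂ (inj₂ (ε , p))
    step (inj₁ (there i)) q = extend (inj₁ i) q
    step (inj₂ (there i)) q = extend (inj₂ i) q

  path? : ∀ E u v → Dec (Path E u v)
  path? [] u v = map′ (λ { ≡.refl → ε }) (λ { ε → ≡.refl ; (inj₁ () ◅ _) ; (inj₂ () ◅ _) }) (u ℕ.≟ v)
  path? ((a , b) ∷ E) u v = map′ via-path path-via
    (path? E u v ⊎-dec (path? E u a ×-dec path? E b v) ⊎-dec (path? E u b ×-dec path? E a v))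

  Conn : ℕ → List ℕ → List Edge → Set
  Conn v I E = All (Path E v) I

  conn? : ∀ v I E → Dec (Conn v I E)
  conn? v I E = All.all? (path? E v) I

  pairsL : ∀ {A : Set} → List A → List (A × A)
  pairsL []      = []
  pairsL (x ∷ V) = map (x ,_) V ++ pairsL V

  On : List ℕ → List Edge → Set
  On V = All (λ e → proj₁ e ∈ V × proj₂ e ∈ V)

  pairsL-on : ∀ V → On V (pairsL V)
  pairsL-on []      = []
  pairsL-on (x ∷ V) = Allₚ.++⁺ (Allₚ.map⁺ (All.tabulate (λ y∈V → here ≡.refl , there y∈V)))
    (All.map (λ (p , q) → there p , there q) (pairsL-on V))

  adj-on : ∀ {V E u v} → On V E → Adj E u v → u ∈ V × v ∈ V
  adj-on on (inj₁ i) = All.lookup on i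
  adj-on on (inj₂ i) = proj₂ (All.lookup on i) , proj₁ (All.lookup on i)

  adj-++⁻ : ∀ E {E′ u v} → Adj (E ++ E′) u v → Adj E u v ⊎ Adj E′ u v
  adj-++⁻ E (inj₁ i) = Sum.map inj₁ inj₁ (∈-++⁻ E i)
  adj-++⁻ E (inj₂ i) = Sum.map inj₂ inj₂ (∈-++⁻ E i)

  Disjoint : List ℕ → List ℕ → Set
  Disjoint I O = ∀ {x} → x ∈ I → x ∈ O → ⊥

  Cross : List ℕ → List ℕ → Edge → Set
  Cross I O (a , b) = (a ∈ I × b ∈ O) ⊎ (a ∈ O × b ∈ I)

  interleaving-∈ˡ : ∀ {A : Set} {I O V : List A} → Interleaving I O V → ∀ {x} → x ∈ I → x ∈ V
  interleaving-∈ˡ s x∈I = Permₚ.∈-resp-↭ (↭-sym (toPermutation s)) (∈-++⁺ˡ x∈I)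

  interleaving-∈ʳ : ∀ {A : Set} {I O V : List A} → Interleaving I O V → ∀ {x} → x ∈ O → x ∈ V
  interleaving-∈ʳ {I = I} s x∈O = Permₚ.∈-resp-↭ (↭-sym (toPermutation s)) (∈-++⁺ʳ I x∈O)

  interleaving-disjoint : ∀ {I O V} → Interleaving I O V → Unique V → Disjoint I O
  interleaving-disjoint (consˡ s) (u ∷ _) (here ≡.refl) x∈O = All.lookup u (interleaving-∈ʳ s x∈O) ≡.refl
  interleaving-disjoint (consˡ s) (_ ∷ u) (there x∈I)   x∈O = interleaving-disjoint s u x∈I x∈O
  interleaving-disjoint (consʳ s) (u ∷ _) x∈I (here ≡.refl) = All.lookup u (interleaving-∈ˡ s x∈I) ≡.refl
  interleaving-disjoint (consʳ s) (_ ∷ u) x∈I (there x∈O)   = interleaving-disjoint s u x∈I x∈O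

  interleaving-uniqueˡ : ∀ {I O V : List ℕ} → Interleaving I O V → Unique V → Unique I
  interleaving-uniqueˡ []        _       = []
  interleaving-uniqueˡ (consˡ s) (u ∷ v) = All.tabulate (λ x∈I → All.lookup u (interleaving-∈ˡ s x∈I)) ∷ interleaving-uniqueˡ s v
  interleaving-uniqueˡ (consʳ s) (_ ∷ v) = interleaving-uniqueˡ s v

  interleaving-uniqueʳ : ∀ {I O V : List ℕ} → Interleaving I O V → Unique V → Unique O
  interleaving-uniqueʳ []        _       = []
  interleaving-uniqueʳ (consˡ s) (_ ∷ v) = interleaving-uniqueʳ s v
  interleaving-uniqueʳ (consʳ s) (u ∷ v) = All.tabulate (λ x∈O → All.lookup u (interleaving-∈ʳ s x∈O)) ∷ interleaving-uniqueʳ s v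

  cross-mono : ∀ {I I′ O O′} → (∀ {x} → x ∈ I → x ∈ I′) → (∀ {x} → x ∈ O → x ∈ O′) → ∀ {e} → Cross I O e → Cross I′ O′ e
  cross-mono f g (inj₁ (p , q)) = inj₁ (f p , g q)
  cross-mono f g (inj₂ (p , q)) = inj₂ (g p , f q)

  -- An interleaving preserves the order within both parts, so pairs inside a part appear in the
  -- list of V with the orientation that they have in the list of that part.
  pairsL-split : ∀ {I O V} → Interleaving I O V →
    ∃ λ cs → All (Cross I O) cs × (pairsL V ↭ cs ++ (pairsL I ++ pairsL O))
  pairsL-split [] = [] , [] , Perm.refl
  pairsL-split {x ∷ I} {O} {_ ∷ V} (consˡ s) with pairsL-split s
  ... | cs , cross , perm = map (x ,_) O ++ cs ,
    Allₚ.++⁺ (Allₚ.map⁺ (All.tabulate (λ y∈O → inj₁ (here ≡.refl , y∈O)))) (All.map (cross-mono there id) cross) ,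
    ↭-trans (Permₚ.++⁺ (↭-trans (Permₚ.map⁺ (x ,_) (toPermutation s)) (Perm.↭-reflexive (Listₚ.map-++ (x ,_) I O))) perm)
      (solve 5 (λ a b c d e → (a ⊕ b) ⊕ (c ⊕ (d ⊕ e)) ⊜ (b ⊕ c) ⊕ ((a ⊕ d) ⊕ e)) Perm.refl
        (map (x ,_) I) (map (x ,_) O) cs (pairsL I) (pairsL O))
    where open MonoidSolver (Permₚ.++-commutativeMonoid {A = Edge}) using (solve; _⊕_; _⊜_)
  pairsL-split {I} {x ∷ O} {_ ∷ V} (consʳ s) with pairsL-split s
  ... | cs , cross , perm = map (x ,_) I ++ cs ,
    Allₚ.++⁺ (Allₚ.map⁺ (All.tabulate (λ y∈I → inj₂ (here ≡.refl , y∈I)))) (All.map (cross-mono id there) cross) ,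
    ↭-trans (Permₚ.++⁺ (↭-trans (Permₚ.map⁺ (x ,_) (toPermutation s)) (Perm.↭-reflexive (Listₚ.map-++ (x ,_) I O))) perm)
      (solve 5 (λ a b c d e → (a ⊕ b) ⊕ (c ⊕ (d ⊕ e)) ⊜ (a ⊕ c) ⊕ (d ⊕ (b ⊕ e))) Perm.refl
        (map (x ,_) I) (map (x ,_) O) cs (pairsL I) (pairsL O))
    where open MonoidSolver (Permₚ.++-commutativeMonoid {A = Edge}) using (solve; _⊕_; _⊜_)

  module SubsetSums (A : QAlgebra) where
    open QAlgebra A
    open Solver using (solve; _:=_; _:+_; _:*_)
    open SetoidReasoning setoid

    ind : ∀ {P : Set} → Dec P → Carrier
    ind d = if does d then 1# else 0#

    ind-⇔ : ∀ {P Q : Set} (P? : Dec P) (Q? : Dec Q) → (P → Q) → (Q → P) → ind P? ≈ ind Q?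
    ind-⇔ P? Q? f g = reflexive (≡.cong (if_then 1# else 0#) (does-⇔ (mk⇔ f g) P? Q?))

    ind-no : ∀ {P : Set} (P? : Dec P) → ¬ P → ind P? ≈ 0#
    ind-no P? ¬p = reflexive (≡.cong (if_then 1# else 0#) (dec-false P? ¬p))

    ind-yes : ∀ {P : Set} (P? : Dec P) → P → ind P? ≈ 1#
    ind-yes P? p = reflexive (≡.cong (if_then 1# else 0#) (dec-true P? p))

    Σsub : ∀ {B : Set} → List B → (List B → Carrier) → Carrier
    Σsub []       f = f []
    Σsub (x ∷ xs) f = Σsub xs (λ E → f (x ∷ E)) + Σsub xs f

    Σsub-cong : ∀ {B : Set} (xs : List B) {f g} → (∀ E → E ⊆ xs → f E ≈ g E) → Σsub xs f ≈ Σsub xs g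
    Σsub-cong []       eq = eq [] []
    Σsub-cong (x ∷ xs) eq = +-cong (Σsub-cong xs (λ E s → eq (x ∷ E) (≡.refl ∷ s))) (Σsub-cong xs (λ E s → eq E (x ∷ʳ s)))

    Σsub-0 : ∀ {B : Set} (xs : List B) {f} → (∀ E → f E ≈ 0#) → Σsub xs f ≈ 0#
    Σsub-0 []       z = z []
    Σsub-0 (x ∷ xs) z = trans (+-cong (Σsub-0 xs (λ E → z (x ∷ E))) (Σsub-0 xs z)) (+-identityˡ 0#)

    Σsub-+ : ∀ {B : Set} (xs : List B) f g → Σsub xs (λ E → f E + g E) ≈ Σsub xs f + Σsub xs g
    Σsub-+ []       f g = refl
    Σsub-+ (x ∷ xs) f g = trans (+-cong (Σsub-+ xs _ _) (Σsub-+ xs f g))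
      (solve 4 (λ a b c d → (a :+ b) :+ (c :+ d) := (a :+ c) :+ (b :+ d)) refl _ _ _ _)

    Σsub-*ˡ : ∀ {B : Set} (xs : List B) y f → Σsub xs (λ E → y * f E) ≈ y * Σsub xs f
    Σsub-*ˡ []       y f = refl
    Σsub-*ˡ (x ∷ xs) y f = trans (+-cong (Σsub-*ˡ xs y _) (Σsub-*ˡ xs y f)) (sym (distribˡ y _ _))

    Σsub-*ʳ : ∀ {B : Set} (xs : List B) y f → Σsub xs (λ E → f E * y) ≈ Σsub xs f * y
    Σsub-*ʳ xs y f = trans (Σsub-cong xs (λ E _ → *-comm (f E) y)) (trans (Σsub-*ˡ xs y f) (*-comm y _))

    Σsub-++ : ∀ {B : Set} (xs ys : List B) f → Σsub (xs ++ ys) f ≈ Σsub xs (λ E → Σsub ys (λ E′ → f (E ++ E′)))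
    Σsub-++ []       ys f = refl
    Σsub-++ (x ∷ xs) ys f = +-cong (Σsub-++ xs ys _) (Σsub-++ xs ys f)

    Σsub-map : ∀ {B C : Set} (ρ : B → C) xs f → Σsub (map ρ xs) f ≈ Σsub xs (f ∘ map ρ)
    Σsub-map ρ []       f = refl
    Σsub-map ρ (x ∷ xs) f = +-cong (Σsub-map ρ xs _) (Σsub-map ρ xs f)

    Σsub-↭ : ∀ {B : Set} {xs ys : List B} {f} → (∀ {E E′} → E ↭ E′ → f E ≈ f E′) → xs ↭ ys → Σsub xs f ≈ Σsub ys f
    Σsub-↭ inv Perm.refl        = refl
    Σsub-↭ inv (prep x p)       = +-cong (Σsub-↭ (inv ∘ prep x) p) (Σsub-↭ inv p)
    Σsub-↭ {xs = _ ∷ _ ∷ xs} {_ ∷ _ ∷ ys} {f} inv (swap x y p) = begin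
      (Σsub xs _ + Σsub xs (λ E → f (x ∷ E))) + (Σsub xs (λ E → f (y ∷ E)) + Σsub xs f)
        ≈⟨ +-cong (+-cong (trans (Σsub-cong xs (λ E _ → inv (swap x y Perm.refl))) (Σsub-↭ (inv ∘ prep y ∘ prep x) p))
             (Σsub-↭ (inv ∘ prep x) p)) (+-cong (Σsub-↭ (inv ∘ prep y) p) (Σsub-↭ inv p)) ⟩
      (Σsub ys _ + Σsub ys (λ E → f (x ∷ E))) + (Σsub ys (λ E → f (y ∷ E)) + Σsub ys f)
        ≈⟨ solve 4 (λ a b c d → (a :+ b) :+ (c :+ d) := (a :+ c) :+ (b :+ d)) refl _ _ _ _ ⟩
      (Σsub ys _ + Σsub ys (λ E → f (y ∷ E))) + (Σsub ys (λ E → f (x ∷ E)) + Σsub ys f) ∎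
    Σsub-↭ inv (Perm.trans p q) = trans (Σsub-↭ inv p) (Σsub-↭ inv q)

    Σsub-drop : ∀ {B : Set} (cs xs : List B) {f} → All (λ c → ∀ E → f (c ∷ E) ≈ 0#) cs → Σsub (cs ++ xs) f ≈ Σsub xs f
    Σsub-drop []       xs []       = refl
    Σsub-drop (c ∷ cs) xs (z ∷ zs) = trans (+-cong (Σsub-0 (cs ++ xs) z) (Σsub-drop cs xs zs)) (+-identityˡ _)

    Σsplit : List ℕ → (List ℕ → List ℕ → Carrier) → Carrier
    Σsplit []      f = f [] []
    Σsplit (x ∷ V) f = Σsplit V (λ I O → f (x ∷ I) O) + Σsplit V (λ I O → f I (x ∷ O))

    Σsplit-cong : ∀ V {f g} → (∀ {I O} → Interleaving I O V → f I O ≈ g I O) → Σsplit V f ≈ Σsplit V g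
    Σsplit-cong []      eq = eq []
    Σsplit-cong (x ∷ V) eq = +-cong (Σsplit-cong V (λ s → eq (consˡ s))) (Σsplit-cong V (λ s → eq (consʳ s)))

    Σsplit-0 : ∀ V {f} → (∀ I O → f I O ≈ 0#) → Σsplit V f ≈ 0#
    Σsplit-0 []      z = z [] []
    Σsplit-0 (x ∷ V) z = trans (+-cong (Σsplit-0 V (λ I O → z _ O)) (Σsplit-0 V (λ I O → z I _))) (+-identityˡ 0#)

    Σsplit-*ˡ : ∀ V y f → y * Σsplit V f ≈ Σsplit V (λ I O → y * f I O)
    Σsplit-*ˡ []      y f = refl
    Σsplit-*ˡ (x ∷ V) y f = trans (distribˡ y _ _) (+-cong (Σsplit-*ˡ V y _) (Σsplit-*ˡ V y _))

    Σsub-Σsplit : ∀ {B : Set} (xs : List B) V (f : List B → List ℕ → List ℕ → Carrier) →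
      Σsub xs (λ E → Σsplit V (f E)) ≈ Σsplit V (λ I O → Σsub xs (λ E → f E I O))
    Σsub-Σsplit xs []      f = refl
    Σsub-Σsplit xs (x ∷ V) f = trans (Σsub-+ xs _ _) (+-cong (Σsub-Σsplit xs V _) (Σsub-Σsplit xs V _))

    module _ {P : ℕ → Set} (P? : ∀ u → Dec (P u)) where
      separates? : ∀ I O → Dec (All P I × All (¬_ ∘ P) O)
      separates? I O = All.all? P? I ×-dec All.all? (¬? ∘ P?) O

      -- A partition of unity: exactly one split puts the vertices with the property on one side and
      -- all others on the other side.
      Σsplit-one : ∀ V → Σsplit V (λ I O → ind (separates? I O)) ≈ 1#
      Σsplit-one []      = ind-yes (separates? [] []) ([] , [])
      Σsplit-one (x ∷ V) = decide (P? x)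
        where
        decide : Dec (P x) → Σsplit (x ∷ V) (λ I O → ind (separates? I O)) ≈ 1#
        decide (yes px) = trans (+-cong
          (trans (Σsplit-cong V (λ {I} {O} _ → ind-⇔ (separates? (x ∷ I) O) (separates? I O) (λ { (_ ∷ p , q) → p , q }) (λ (p , q) → px ∷ p , q)))
            (Σsplit-one V))
          (Σsplit-0 V (λ I O → ind-no (separates? I (x ∷ O)) (λ { (_ , ¬px ∷ _) → ¬px px })))) (+-identityʳ 1#)
        decide (no ¬px) = trans (+-cong
          (Σsplit-0 V (λ I O → ind-no (separates? (x ∷ I) O) (λ { (px ∷ _ , _) → ¬px px })))
          (trans (Σsplit-cong V (λ {I} {O} _ → ind-⇔ (separates? I (x ∷ O)) (separates? I O) (λ { (p , _ ∷ q) → p , q }) (λ (p , q) → p , ¬px ∷ q)))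
            (Σsplit-one V))) (+-identityˡ 1#)

    -- Invariance under permutations is required because splitting a vertex set reorders the list of
    -- its pairs.
    record Multiplicative (φ : List Edge → Carrier) : Set where
      field
        φ-↭  : ∀ {E E′} → E ↭ E′ → φ E ≈ φ E′
        φ-++ : ∀ {I O E E′} → Disjoint I O → On I E → On O E′ → φ (E ++ E′) ≈ φ E * φ E′

    allGraphs : (List Edge → Carrier) → List ℕ → Carrier
    allGraphs φ V = Σsub (pairsL V) φ

    connectedGraphs : (List Edge → Carrier) → ℕ → List ℕ → Carrier
    connectedGraphs φ v I = Σsub (pairsL (v ∷ I)) (λ E → ind (conn? v I E) * φ E)

    module _ {φ : List Edge → Carrier} (mult : Multiplicative φ) where
      open Multiplicative mult

      -- For each graph the partition of unity selects the vertices I of the component of v. A cross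
      -- edge would join a reached vertex to an unreached one, so such edge sets contribute zero and
      -- the rest of the weight factors.
      component-formula : ∀ v V → Unique (v ∷ V) →
        allGraphs φ (v ∷ V) ≈ Σsplit V (λ I O → connectedGraphs φ v I * allGraphs φ O)
      component-formula v V uniq = begin
        Σsub ps φ
          ≈⟨ Σsub-cong ps (λ E _ → trans (sym (*-identityʳ _)) (trans (*-congˡ (sym (Σsplit-one (path? E v) V))) (Σsplit-*ˡ V (φ E) _))) ⟩
        Σsub ps (λ E → Σsplit V (λ I O → φ E * ind (separates? (path? E v) I O)))
          ≈⟨ Σsub-Σsplit ps V _ ⟩
        Σsplit V (λ I O → Σsub ps (λ E → φ E * ind (separates? (path? E v) I O)))
          ≈⟨ Σsplit-cong V component ⟩
        Σsplit V (λ I O → connectedGraphs φ v I * allGraphs φ O) ∎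
        where
        ps = pairsL (v ∷ V)
        component : ∀ {I O} → Interleaving I O V →
          Σsub ps (λ E → φ E * ind (separates? (path? E v) I O)) ≈ connectedGraphs φ v I * allGraphs φ O
        component {I} {O} s = begin
          Σsub ps h                                                       ≈⟨ Σsub-↭ h-↭ perm ⟩
          Σsub (cs ++ (pairsL (v ∷ I) ++ pairsL O)) h                     ≈⟨ Σsub-drop cs _ (All.map h-cross cross) ⟩
          Σsub (pairsL (v ∷ I) ++ pairsL O) h                             ≈⟨ Σsub-++ (pairsL (v ∷ I)) (pairsL O) h ⟩
          Σsub (pairsL (v ∷ I)) (λ E → Σsub (pairsL O) (λ E′ → h (E ++ E′)))
            ≈⟨ Σsub-cong (pairsL (v ∷ I)) (λ E sub → trans (Σsub-cong (pairsL O) (λ E′ sub′ →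
                 h-++ (All-resp-⊆ sub (pairsL-on (v ∷ I))) (All-resp-⊆ sub′ (pairsL-on O)))) (Σsub-*ˡ (pairsL O) _ φ)) ⟩
          Σsub (pairsL (v ∷ I)) (λ E → (ind (conn? v I E) * φ E) * Σsub (pairsL O) φ)
            ≈⟨ Σsub-*ʳ (pairsL (v ∷ I)) _ _ ⟩
          connectedGraphs φ v I * allGraphs φ O ∎
          where
          h : List Edge → Carrier
          h E = φ E * ind (separates? (path? E v) I O)
          split = pairsL-split {v ∷ I} {O} {v ∷ V} (consˡ s)
          cs    = proj₁ split
          cross = proj₁ (proj₂ split)
          perm  = proj₂ (proj₂ split)
          disjoint : Disjoint (v ∷ I) O
          disjoint = interleaving-disjoint (consˡ s) uniq

          Separates : List Edge → Set
          Separates E = All (Path E v) I × All (¬_ ∘ Path E v) O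

          separates-mono : ∀ {E E′} → (∀ {e} → e ∈ E → e ∈ E′) → (∀ {e} → e ∈ E′ → e ∈ E) → Separates E → Separates E′
          separates-mono f g (p , q) = All.map (path-mono f) p , All.map (λ n → n ∘ path-mono g) q

          h-↭ : ∀ {E E′} → E ↭ E′ → h E ≈ h E′
          h-↭ {E} {E′} p = *-cong (φ-↭ p) (ind-⇔ (separates? (path? E v) I O) (separates? (path? E′ v) I O)
            (separates-mono (Permₚ.∈-resp-↭ p) (Permₚ.∈-resp-↭ (↭-sym p))) (separates-mono (Permₚ.∈-resp-↭ (↭-sym p)) (Permₚ.∈-resp-↭ p)))

          reached : ∀ {E x} → Separates E → x ∈ v ∷ I → Path E v x
          reached _       (here ≡.refl) = ε
          reached (p , _) (there x∈I)   = All.lookup p x∈I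

          h-cross : ∀ {e} → Cross (v ∷ I) O e → ∀ E → h (e ∷ E) ≈ 0#
          h-cross {e} c E = trans (*-congˡ (ind-no (separates? (path? (e ∷ E) v) I O) (no-separation c))) (zeroʳ _)
            where
            no-separation : Cross (v ∷ I) O e → ¬ Separates (e ∷ E)
            no-separation (inj₁ (a∈ , b∈)) sep = All.lookup (proj₂ sep) b∈ (reached sep a∈ ◅◅ inj₁ (here ≡.refl) ◅ ε)
            no-separation (inj₂ (a∈ , b∈)) sep = All.lookup (proj₂ sep) a∈ (reached sep b∈ ◅◅ inj₂ (here ≡.refl) ◅ ε)

          confined : ∀ {E E′ x y} → On (v ∷ I) E → On O E′ → x ∈ v ∷ I → Path (E ++ E′) x y → y ∈ v ∷ I × Path E x y
          confined on on′ x∈ ε = x∈ , ε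
          confined {E} on on′ x∈ (e ◅ p) with adj-++⁻ E e
          ... | inj₁ a = map₂ (a ◅_) (confined on on′ (proj₂ (adj-on on a)) p)
          ... | inj₂ a = ⊥-elim (disjoint x∈ (proj₁ (adj-on on′ a)))

          h-++ : ∀ {E E′} → On (v ∷ I) E → On O E′ → h (E ++ E′) ≈ (ind (conn? v I E) * φ E) * φ E′
          h-++ {E} {E′} on on′ = begin
            φ (E ++ E′) * ind (separates? (path? (E ++ E′) v) I O)
              ≈⟨ *-cong (φ-++ disjoint on on′) (ind-⇔ (separates? (path? (E ++ E′) v) I O) (conn? v I E)
                   (λ (p , _) → All.map (λ q → proj₂ (confined on on′ (here ≡.refl) q)) p)
                   (λ p → All.map (path-mono ∈-++⁺ˡ) p , All.tabulate (λ o∈ q → disjoint (proj₁ (confined on on′ (here ≡.refl) q)) o∈))) ⟩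
            (φ E * φ E′) * ind (conn? v I E)
              ≈⟨ solve 3 (λ a b c → (a :* b) :* c := (c :* a) :* b) refl _ _ _ ⟩
            (ind (conn? v I E) * φ E) * φ E′ ∎

-- Bounded reachability agrees with the existence of paths

module Connectivity where
  open RationalAlgebras
  open SimpleGraphs
  open import Defs using (pairs; EdgeSet; _==F_; adj; reach; connected)
  open import Data.Bool using (Bool; true; false; T; if_then_else_; _∧_; _∨_)
  import Data.Bool.Properties as Boolₚ
  open import Data.Fin as Fin using (Fin; zero; suc; toℕ)
  import Data.Fin.Properties as Finₚ
  open import Data.Nat as ℕ using (ℕ; zero; suc; _≤_; _<_; z≤n; s≤s)
  import Data.Nat.Properties as ℕₚ
  open import Data.List using (List; []; _∷_; map; _++_; length; concatMap; allFin; tabulate)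
  import Data.List.Properties as Listₚ
  open import Data.List.Membership.Propositional using (_∈_; find; lose)
  open import Data.List.Membership.Propositional.Properties using (∈-map⁻; ∈-map⁺; ∈-allFin)
  open import Data.List.Relation.Unary.Any as Any using (here; there; Any)
  import Data.List.Relation.Unary.Any.Properties as Anyₚ
  open import Data.List.Relation.Unary.All as All using (All; []; _∷_)
  import Data.List.Relation.Unary.All.Properties as Allₚ
  open import Data.Product as Product using (∃; _×_; _,_; proj₁; proj₂)
  open import Data.Sum using (_⊎_; inj₁; inj₂; [_,_])
  open import Data.Empty using (⊥-elim)
  open import Data.Unit using (tt)
  open import Function using (_∘_; id; Equivalence)
  open import Relation.Nullary using (¬_; yes; no)
  open import Relation.Nullary.Decidable using (T?)
  open import Relation.Binary.Construct.Closure.ReflexiveTransitive using (Star; ε; _◅_; _◅◅_; reverse; gmap)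
  open import Relation.Binary.PropositionalEquality using (_≡_; refl; cong; cong₂; sym; trans; subst)

  T-∧⁻ : ∀ {a b} → T (a ∧ b) → T a × T b
  T-∧⁻ = Equivalence.to Boolₚ.T-∧

  T-∧⁺ : ∀ {a b} → T a → T b → T (a ∧ b)
  T-∧⁺ p q = Equivalence.from Boolₚ.T-∧ (p , q)

  T-∨⁻ : ∀ {a b} → T (a ∨ b) → T a ⊎ T b
  T-∨⁻ = Equivalence.to Boolₚ.T-∨

  T-∨⁺ : ∀ {a b} → T a ⊎ T b → T (a ∨ b)
  T-∨⁺ = Equivalence.from Boolₚ.T-∨

  relabel : ∀ {A B : Set} → (A → B) → A × A → B × B
  relabel ρ = Product.map ρ ρ

  pairsL-map : ∀ {A B : Set} (ρ : A → B) V → pairsL (map ρ V) ≡ map (relabel ρ) (pairsL V)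
  pairsL-map ρ []      = refl
  pairsL-map ρ (x ∷ V) = trans
    (cong₂ _++_ (trans (sym (Listₚ.map-∘ V)) (Listₚ.map-∘ V)) (pairsL-map ρ V))
    (sym (Listₚ.map-++ (relabel ρ) (map (x ,_) V) (pairsL V)))

  private
    entry : ∀ {n} → Fin n → Fin n → List (Fin n × Fin n)
    entry i j = if toℕ i ℕ.<ᵇ toℕ j then (i , j) ∷ [] else []

    pairsIn : ∀ {n} → List (Fin n) → List (Fin n) → List (Fin n × Fin n)
    pairsIn xs ys = concatMap (λ i → concatMap (entry i) ys) xs

    allFin-suc : ∀ n → allFin (suc n) ≡ zero ∷ map suc (allFin n)
    allFin-suc n = cong (zero ∷_) (sym (Listₚ.map-tabulate id suc))

    row-zero : ∀ {n} (ys : List (Fin n)) → concatMap (entry zero) (map suc ys) ≡ map (zero ,_) (map suc ys)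
    row-zero []       = refl
    row-zero (y ∷ ys) = cong ((zero , suc y) ∷_) (row-zero ys)

    row-suc : ∀ {n} (i : Fin n) (ys : List (Fin n)) →
      concatMap (entry (suc i)) (map suc ys) ≡ map (relabel suc) (concatMap (entry i) ys)
    row-suc i []       = refl
    row-suc i (y ∷ ys) with toℕ i ℕ.<ᵇ toℕ y
    ... | true  = cong (_ ∷_) (row-suc i ys)
    ... | false = row-suc i ys

    rows-suc : ∀ {n} (xs ys : List (Fin n)) → pairsIn (map suc xs) (zero ∷ map suc ys) ≡ map (relabel suc) (pairsIn xs ys)
    rows-suc []       ys = refl
    rows-suc (x ∷ xs) ys = trans (cong₂ _++_ (row-suc x ys) (rows-suc xs ys)) (sym (Listₚ.map-++ (relabel suc) _ (pairsIn xs ys)))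

  pairs≡pairsL : ∀ n → pairs n ≡ pairsL (allFin n)
  pairs≡pairsL zero    = refl
  pairs≡pairsL (suc n) = trans (cong (λ xs → pairsIn xs xs) (allFin-suc n))
    (trans (cong₂ _++_ (row-zero (allFin n)) (trans (rows-suc (allFin n) (allFin n))
      (trans (cong (map (relabel suc)) (pairs≡pairsL n)) (sym (pairsL-map suc (allFin n))))))
    (sym (cong pairsL (allFin-suc n))))

  ==F⇒≡ : ∀ {n} {a b : Fin n} → T (a ==F b) → a ≡ b
  ==F⇒≡ {a = a} {b} t = Finₚ.toℕ-injective (ℕₚ.≡ᵇ⇒≡ (toℕ a) (toℕ b) t)

  ≡⇒==F : ∀ {n} {a b : Fin n} → a ≡ b → T (a ==F b)
  ≡⇒==F {a = a} {b} e = ℕₚ.≡⇒≡ᵇ (toℕ a) (toℕ b) (cong toℕ e)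

  module _ {n : ℕ} (E : EdgeSet n) where
    AdjF : Fin n → Fin n → Set
    AdjF u v = (u , v) ∈ E ⊎ (v , u) ∈ E

    adj⇒AdjF : ∀ {u v} → T (adj E u v) → AdjF u v
    adj⇒AdjF {u} {v} t with find (Anyₚ.any⁻ _ E t)
    ... | (a , b) , e∈E , t′ with T-∨⁻ t′
    ...   | inj₁ p with refl ← ==F⇒≡ {a = a} (proj₁ (T-∧⁻ p)) | refl ← ==F⇒≡ {a = b} (proj₂ (T-∧⁻ {a ==F u} p)) = inj₁ e∈E
    ...   | inj₂ p with refl ← ==F⇒≡ {a = a} (proj₁ (T-∧⁻ p)) | refl ← ==F⇒≡ {a = b} (proj₂ (T-∧⁻ {a ==F v} p)) = inj₂ e∈E

    AdjF⇒adj : ∀ {u v} → AdjF u v → T (adj E u v)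
    AdjF⇒adj {u} {v} (inj₁ i) = Anyₚ.any⁺ _ (lose i (T-∨⁺ (inj₁ (T-∧⁺ (≡⇒==F {a = u} refl) (≡⇒==F {a = v} refl)))))
    AdjF⇒adj {u} {v} (inj₂ i) = Anyₚ.any⁺ _ (lose i (T-∨⁺ {v ==F u ∧ u ==F v} (inj₂ (T-∧⁺ (≡⇒==F {a = v} refl) (≡⇒==F {a = u} refl)))))

    PathF : Fin n → Fin n → Set
    PathF = Star AdjF

    reach⇒path : ∀ m {u v} → T (reach E m u v) → PathF u v
    reach⇒path zero {u} t with refl ← ==F⇒≡ {a = u} t = ε
    reach⇒path (suc m) {u} {v} t with T-∨⁻ {reach E m u v} t
    ... | inj₁ p = reach⇒path m p
    ... | inj₂ p with find (Anyₚ.any⁻ (λ w → reach E m u w ∧ adj E w v) (allFin n) p)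
    ...   | w , _ , q = reach⇒path m (proj₁ (T-∧⁻ q)) ◅◅ adj⇒AdjF (proj₂ (T-∧⁻ {reach E m u w} q)) ◅ ε

    reach-suc : ∀ m {u v} → T (reach E m u v) → T (reach E (suc m) u v)
    reach-suc m t = T-∨⁺ (inj₁ t)

    reach-step : ∀ m {u w v} → T (reach E m u w) → AdjF w v → T (reach E (suc m) u v)
    reach-step m {u} {w} {v} t e = T-∨⁺ {reach E m u v} (inj₂ (Anyₚ.any⁺ (λ w → reach E m u w ∧ adj E w v) (lose (∈-allFin w) (T-∧⁺ t (AdjF⇒adj e)))))

  count : ∀ {A : Set} → (A → Bool) → List A → ℕ
  count p []       = 0
  count p (x ∷ xs) = (if p x then 1 else 0) ℕ.+ count p xs

  count-≤ : ∀ {A : Set} (p : A → Bool) xs → count p xs ≤ length xs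
  count-≤ p []       = z≤n
  count-≤ p (x ∷ xs) with p x
  ... | true  = s≤s (count-≤ p xs)
  ... | false = ℕₚ.m≤n⇒m≤1+n (count-≤ p xs)

  module _ {A : Set} {p q : A → Bool} (p⇒q : ∀ x → T (p x) → T (q x)) where
    count-mono : ∀ xs → count p xs ≤ count q xs
    count-mono []       = z≤n
    count-mono (x ∷ xs) with p x | q x | p⇒q x
    ... | true  | true  | _ = s≤s (count-mono xs)
    ... | true  | false | f = ⊥-elim (f tt)
    ... | false | true  | _ = ℕₚ.m≤n⇒m≤1+n (count-mono xs)
    ... | false | false | _ = count-mono xs

    count-< : ∀ xs {x} → x ∈ xs → T (q x) → ¬ T (p x) → count p xs < count q xs
    count-< (x ∷ xs) (here refl) tq ¬tp with p x | q x
    ... | true  | _    = ⊥-elim (¬tp tt)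
    ... | false | true = s≤s (count-mono xs)
    count-< (y ∷ xs) (there x∈) tq ¬tp with p y | q y | p⇒q y
    ... | true  | true  | _ = s≤s (count-< xs x∈ tq ¬tp)
    ... | true  | false | f = ⊥-elim (f tt)
    ... | false | true  | _ = ℕₚ.m≤n⇒m≤1+n (count-< xs x∈ tq ¬tp)
    ... | false | false | _ = count-< xs x∈ tq ¬tp

  count-positive : ∀ {A : Set} (p : A → Bool) xs {x} → x ∈ xs → T (p x) → 1 ≤ count p xs
  count-positive p xs x∈ t = ℕₚ.≤-trans (s≤s z≤n) (count-< {p = λ _ → false} {p} (λ _ ()) xs x∈ t (λ ()))

  module _ {n : ℕ} (E : EdgeSet n) (u : Fin n) where
    Closed : ℕ → Set
    Closed m = ∀ v → T (reach E (suc m) u v) → T (reach E m u v)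

    private
      size : ℕ → ℕ
      size m = count (reach E m u) (allFin n)

    closed-suc : ∀ m → Closed m → Closed (suc m)
    closed-suc m closed v t with T-∨⁻ {reach E (suc m) u v} t
    ... | inj₁ p = p
    ... | inj₂ p with find (Anyₚ.any⁻ (λ w → reach E (suc m) u w ∧ adj E w v) (allFin n) p)
    ...   | w , _ , q = reach-step E m (closed w (proj₁ (T-∧⁻ q))) (adj⇒AdjF E (proj₂ (T-∧⁻ {reach E (suc m) u w} q)))

    grows : ∀ m → Closed m ⊎ (suc m ≤ size m)
    grows zero    = inj₂ (count-positive (reach E 0 u) (allFin n) (∈-allFin u) (≡⇒==F {a = u} refl))
    grows (suc m) with grows m
    ... | inj₁ closed = inj₁ (closed-suc m closed)
    ... | inj₂ m<size with size m ℕ.<? size (suc m)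
    ...   | yes lt = inj₂ (ℕₚ.≤-trans (s≤s m<size) lt)
    ...   | no ¬lt = inj₁ (closed-suc m closed)
      where
      closed : Closed m
      closed v t with T? (reach E m u v)
      ... | yes p = p
      ... | no ¬p = ⊥-elim (¬lt (count-< (λ w → reach-suc E m) (allFin n) (∈-allFin v) t ¬p))

    -- The set of vertices reached in m steps grows with m until it is closed, so it is closed for m = n.
    closed-n : Closed n
    closed-n with grows n
    ... | inj₁ closed = closed
    ... | inj₂ n<size = ⊥-elim (ℕₚ.<-irrefl refl (ℕₚ.≤-trans n<size
      (subst (size n ≤_) (Listₚ.length-tabulate id) (count-≤ (reach E n u) (allFin n)))))

    path⇒reach : ∀ {v} → PathF E u v → T (reach E n u v)
    path⇒reach p = follow (start n) p
      where
      start : ∀ m → T (reach E m u u)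
      start zero    = ≡⇒==F {a = u} refl
      start (suc m) = reach-suc E m (start m)
      follow : ∀ {w v} → T (reach E n u w) → PathF E w v → T (reach E n u v)
      follow t ε       = t
      follow t (e ◅ p) = follow (closed-n _ (reach-step E n t e)) p

  pathF-sym : ∀ {n} {E : EdgeSet n} {u v} → PathF E u v → PathF E v u
  pathF-sym = reverse [ inj₂ , inj₁ ]

  connected⇒path : ∀ {n} (E : EdgeSet n) → T (connected E) → ∀ u v → PathF E u v
  connected⇒path {n} E t u v = reach⇒path E n
    (All.lookup (Allₚ.all⁺ (reach E n u) (allFin n) (All.lookup (Allₚ.all⁺ _ (allFin n) t) (∈-allFin u))) (∈-allFin v))

  path⇒connected : ∀ {n} (E : EdgeSet n) → (∀ u v → PathF E u v) → T (connected E)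
  path⇒connected {n} E p = Allₚ.all⁻ _ {xs = allFin n} (All.tabulate λ {u} _ → Allₚ.all⁻ (reach E n u) {xs = allFin n} (All.tabulate λ {v} _ → path⇒reach E u (p u v)))

  module _ {n : ℕ} (ρ : Fin n → ℕ) (ρ-injective : ∀ {i j} → ρ i ≡ ρ j → i ≡ j) (E : EdgeSet n) where
    relabel-∈⁻ : ∀ {u v} → (ρ u , ρ v) ∈ map (relabel ρ) E → (u , v) ∈ E
    relabel-∈⁻ i with ∈-map⁻ (relabel ρ) i
    ... | (a , b) , e∈ , eq with refl ← ρ-injective (cong proj₁ eq) | refl ← ρ-injective (cong proj₂ eq) = e∈

    relabel-image : ∀ {x y} → Adj (map (relabel ρ) E) x y → ∃ λ u → ∃ λ v → x ≡ ρ u × y ≡ ρ v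
    relabel-image (inj₁ i) with ∈-map⁻ (relabel ρ) i
    ... | (a , b) , _ , refl = a , b , refl , refl
    relabel-image (inj₂ i) with ∈-map⁻ (relabel ρ) i
    ... | (a , b) , _ , refl = b , a , refl , refl

    adj-relabel⁻ : ∀ {u v} → Adj (map (relabel ρ) E) (ρ u) (ρ v) → AdjF E u v
    adj-relabel⁻ = [ inj₁ ∘ relabel-∈⁻ , inj₂ ∘ relabel-∈⁻ ]

    adj-relabel⁺ : ∀ {u v} → AdjF E u v → Adj (map (relabel ρ) E) (ρ u) (ρ v)
    adj-relabel⁺ = [ inj₁ ∘ ∈-map⁺ (relabel ρ) , inj₂ ∘ ∈-map⁺ (relabel ρ) ]

    path-relabel⁺ : ∀ {u v} → PathF E u v → Path (map (relabel ρ) E) (ρ u) (ρ v)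
    path-relabel⁺ = gmap ρ adj-relabel⁺

    -- Both endpoints of every edge lie in the image of ρ, so a path that starts there never leaves
    -- it and can be pulled back edge by edge.
    path-relabel⁻ : ∀ {u v x y} → x ≡ ρ u → y ≡ ρ v → Path (map (relabel ρ) E) x y → PathF E u v
    path-relabel⁻ ex ey ε with refl ← ρ-injective (trans (sym ex) ey) = ε
    path-relabel⁻ refl ey (e ◅ p) with relabel-image e
    ... | _ , w , _ , refl = adj-relabel⁻ e ◅ path-relabel⁻ refl ey p

  -- Paths from the single root suffice, since adjacency is symmetric and paths can be joined at the
  -- root.
  conn⇒connected : ∀ {n} (ρ : Fin (suc n) → ℕ) → (∀ {i j} → ρ i ≡ ρ j → i ≡ j) → ∀ E →
    Conn (ρ zero) (map (ρ ∘ suc) (allFin n)) (map (relabel ρ) E) → T (connected E)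
  conn⇒connected {n} ρ inj E conn = path⇒connected E (λ u v → pathF-sym (from-zero u) ◅◅ from-zero v)
    where
    from-zero : ∀ u → PathF E zero u
    from-zero zero    = ε
    from-zero (suc u) = path-relabel⁻ ρ inj E refl refl (All.lookup conn (∈-map⁺ (ρ ∘ suc) (∈-allFin u)))

  connected⇒conn : ∀ {n} (ρ : Fin (suc n) → ℕ) → (∀ {i j} → ρ i ≡ ρ j → i ≡ j) → ∀ E →
    T (connected E) → Conn (ρ zero) (map (ρ ∘ suc) (allFin n)) (map (relabel ρ) E)
  connected⇒conn {n} ρ inj E t = Allₚ.map⁺ (All.tabulate (λ {u} _ → path-relabel⁺ ρ inj E (connected⇒path E t zero (suc u))))

-- Triangle-covered graphs and Möbius inversion over edge sets

module TriangleClusters where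
  open RationalAlgebras
  open SimpleGraphs
  open Connectivity
  open import Data.Bool using (Bool; T; _∨_)
  open import Data.Nat as ℕ using (ℕ; zero; suc; _≤_; _<_; z≤n; s≤s)
  import Data.Nat.Properties as ℕₚ
  open import Data.List using (List; []; _∷_; map; _++_; length)
  import Data.List.Properties as Listₚ
  open import Data.List.Membership.Propositional using (_∈_; _∉_; find; lose)
  open import Data.List.Membership.Propositional.Properties using (∈-++⁺ˡ; ∈-++⁺ʳ; ∈-++⁻; ∈-∃++)
  open import Data.List.Relation.Unary.Any as Any using (here; there; Any)
  open import Data.List.Relation.Unary.All as All using (All; []; _∷_)
  import Data.List.Relation.Unary.All.Properties as Allₚ
  open import Data.List.Relation.Unary.AllPairs using ([]; _∷_)
  open import Data.List.Relation.Unary.Unique.Propositional using (Unique)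
  open import Data.List.Relation.Binary.Permutation.Propositional as Perm using (_↭_; ↭-sym; prep; swap)
  import Data.List.Relation.Binary.Permutation.Propositional.Properties as Permₚ
  open import Data.List.Relation.Binary.Sublist.Propositional using (_⊆_; []; _∷_; _∷ʳ_; lookup)
  open import Data.List.Relation.Binary.Sublist.Propositional.Properties using (All-resp-⊆)
  import Data.Product.Properties as Productₚ
  open import Data.Product as Product using (∃; _×_; _,_; proj₁; proj₂)
  open import Data.Sum as Sum using (_⊎_; inj₁; inj₂; [_,_])
  open import Data.Empty using (⊥; ⊥-elim)
  open import Function using (_∘_)
  open import Relation.Nullary using (¬_; Dec; yes; no; ¬?; _×-dec_; _⊎-dec_)
  open import Relation.Nullary.Decidable using (map′; toWitness; fromWitness; isYes)
  open import Relation.Binary.Construct.Closure.ReflexiveTransitive using (ε; _◅_)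
  open import Relation.Binary.PropositionalEquality as ≡ using (_≡_; _≢_)
  import Relation.Binary.Reasoning.Setoid as SetoidReasoning

  _≟E_ : (e f : Edge) → Dec (e ≡ f)
  _≟E_ = Productₚ.≡-dec ℕ._≟_ ℕ._≟_

  adj? : ∀ E u v → Dec (Adj E u v)
  adj? E u v = Any.any? ((u , v) ≟E_) E ⊎-dec Any.any? ((v , u) ≟E_) E

  Tri : List Edge → Set
  Tri E = ∃ λ a → ∃ λ b → ∃ λ c → Adj E a b × Adj E b c × Adj E a c

  vertices : List Edge → List ℕ
  vertices []            = []
  vertices ((a , b) ∷ E) = a ∷ b ∷ vertices E

  edge-vertices : ∀ {a b} E → (a , b) ∈ E → a ∈ vertices E × b ∈ vertices E
  edge-vertices (_ ∷ E) (here ≡.refl) = here ≡.refl , there (here ≡.refl)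
  edge-vertices (_ ∷ E) (there i)     = Product.map (there ∘ there) (there ∘ there) (edge-vertices E i)

  adj-vertices : ∀ E {a b} → Adj E a b → a ∈ vertices E × b ∈ vertices E
  adj-vertices E (inj₁ i) = edge-vertices E i
  adj-vertices E (inj₂ i) = Product.swap (edge-vertices E i)

  exists? : ∀ {P : ℕ → Set} (V : List ℕ) → (∀ {x} → P x → x ∈ V) → (∀ x → Dec (P x)) → Dec (∃ P)
  exists? V bound P? = map′ (λ p → Product.map₂ proj₂ (find p)) (λ (x , p) → lose (bound p) p) (Any.any? P? V)

  tri? : ∀ E → Dec (Tri E)
  tri? E = exists? V (λ (_ , _ , p , _) → proj₁ (adj-vertices E p)) λ a →
           exists? V (λ (_ , p , _) → proj₂ (adj-vertices E p)) λ b →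
           exists? V (λ (_ , p , _) → proj₂ (adj-vertices E p)) λ c →
           adj? E a b ×-dec adj? E b c ×-dec adj? E a c
    where V = vertices E

  tri-mono : ∀ {E E′} → (∀ {e} → e ∈ E → e ∈ E′) → Tri E → Tri E′
  tri-mono f (a , b , c , p , q , r) = a , b , c , adj-mono f p , adj-mono f q , adj-mono f r

  -- Any two edges of a triangle share a vertex, so they cannot lie over disjoint vertex sets.
  tri-++⁻ : ∀ {I O E E′} → Disjoint I O → On I E → On O E′ → Tri (E ++ E′) → Tri E ⊎ Tri E′
  tri-++⁻ {E = E} disjoint on on′ (a , b , c , p , q , r) with adj-++⁻ E p | adj-++⁻ E q | adj-++⁻ E r
  ... | inj₁ p | inj₁ q | inj₁ r = inj₁ (a , b , c , p , q , r)
  ... | inj₂ p | inj₂ q | inj₂ r = inj₂ (a , b , c , p , q , r)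
  ... | inj₁ p | inj₂ q | _      = ⊥-elim (disjoint (proj₂ (adj-on on p)) (proj₁ (adj-on on′ q)))
  ... | inj₂ p | inj₁ q | _      = ⊥-elim (disjoint (proj₁ (adj-on on q)) (proj₂ (adj-on on′ p)))
  ... | inj₁ p | inj₁ q | inj₂ r = ⊥-elim (disjoint (proj₁ (adj-on on p)) (proj₁ (adj-on on′ r)))
  ... | inj₂ p | inj₂ q | inj₁ r = ⊥-elim (disjoint (proj₁ (adj-on on r)) (proj₁ (adj-on on′ p)))

  CommonNeighbour : List Edge → Edge → Set
  CommonNeighbour E (a , b) = ∃ λ c → Adj E a c × Adj E b c

  commonNeighbour? : ∀ E e → Dec (CommonNeighbour E e)
  commonNeighbour? E (a , b) = exists? (vertices E) (λ (p , _) → proj₂ (adj-vertices E p)) λ c → adj? E a c ×-dec adj? E b c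

  adj-∷⁻ : ∀ {a b E u v} → Adj ((a , b) ∷ E) u v → ((u ≡ a × v ≡ b) ⊎ (u ≡ b × v ≡ a)) ⊎ Adj E u v
  adj-∷⁻ (inj₁ (here ≡.refl)) = inj₁ (inj₁ (≡.refl , ≡.refl))
  adj-∷⁻ (inj₂ (here ≡.refl)) = inj₁ (inj₂ (≡.refl , ≡.refl))
  adj-∷⁻ (inj₁ (there i))     = inj₂ (inj₁ i)
  adj-∷⁻ (inj₂ (there i))     = inj₂ (inj₂ i)

  -- If e were one of the three sides, the opposite corner would be a common neighbour of its
  -- endpoints; each side and each orientation is a case.
  tri-∷⁻ : ∀ {e E} → ¬ CommonNeighbour (e ∷ E) e → Tri (e ∷ E) → Tri E
  tri-∷⁻ {e} {E} ¬c (a , b , c , p , q , r) with adj-∷⁻ p | adj-∷⁻ q | adj-∷⁻ r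
  ... | inj₂ p′ | inj₂ q′ | inj₂ r′ = a , b , c , p′ , q′ , r′
  ... | inj₁ (inj₁ (≡.refl , ≡.refl)) | _ | _ = ⊥-elim (¬c (c , r , q))
  ... | inj₁ (inj₂ (≡.refl , ≡.refl)) | _ | _ = ⊥-elim (¬c (c , q , r))
  ... | inj₂ _ | inj₁ (inj₁ (≡.refl , ≡.refl)) | _ = ⊥-elim (¬c (a , adj-sym p , adj-sym r))
  ... | inj₂ _ | inj₁ (inj₂ (≡.refl , ≡.refl)) | _ = ⊥-elim (¬c (a , adj-sym r , adj-sym p))
  ... | inj₂ _ | inj₂ _ | inj₁ (inj₁ (≡.refl , ≡.refl)) = ⊥-elim (¬c (b , p , adj-sym q))
  ... | inj₂ _ | inj₂ _ | inj₁ (inj₂ (≡.refl , ≡.refl)) = ⊥-elim (¬c (b , adj-sym q , p))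

  common-mono : ∀ {E E′} → (∀ {e} → e ∈ E → e ∈ E′) → ∀ {e} → CommonNeighbour E e → CommonNeighbour E′ e
  common-mono f (c , p , q) = c , adj-mono f p , adj-mono f q

  unique-≤ : ∀ {V U : List ℕ} → Unique V → (∀ {x} → x ∈ V → x ∈ U) → length V ≤ length U
  unique-≤ [] sub = z≤n
  unique-≤ {x ∷ V} (x∉V ∷ uniq) sub with ∈-∃++ (sub (here ≡.refl))
  ... | U₁ , U₂ , ≡.refl = ℕₚ.≤-trans (s≤s (unique-≤ uniq rest))
      (ℕₚ.≤-reflexive (≡.trans (≡.cong suc (Listₚ.length-++ U₁)) (≡.trans (≡.sym (ℕₚ.+-suc (length U₁) (length U₂))) (≡.sym (Listₚ.length-++ U₁)))))
    where
    rest : ∀ {y} → y ∈ V → y ∈ U₁ ++ U₂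
    rest y∈V with ∈-++⁻ U₁ (sub (there y∈V))
    ... | inj₁ i             = ∈-++⁺ˡ i
    ... | inj₂ (there i)     = ∈-++⁺ʳ U₁ i
    ... | inj₂ (here ≡.refl) = ⊥-elim (All.lookup x∉V y∈V ≡.refl)

  -- A connected graph in which every edge lies in a triangle is exhausted by adding to a set of vertices
  -- either one vertex and two edges or two vertices and three edges at a time.
  module TriangleCovered {v : ℕ} {I : List ℕ} {H : List Edge} (unique : Unique (v ∷ I))
      (loopless : All (λ e → proj₁ e ≢ proj₂ e) H) (conn : Conn v I H) (covered : All (CommonNeighbour H) H) where

    V : List ℕ
    V = v ∷ I

    _∈?_ : ∀ x (U : List ℕ) → Dec (x ∈ U)
    x ∈? U = Any.any? (x ℕ.≟_) U

    Inside : List ℕ → Edge → Set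
    Inside U (a , b) = a ∈ U × b ∈ U

    inside? : ∀ U e → Dec (Inside U e)
    inside? U (a , b) = a ∈? U ×-dec b ∈? U

    inside : List ℕ → Edge → Bool
    inside U e = isYes (inside? U e)

    size : List ℕ → ℕ
    size U = count (inside U) H

    Joins : Edge → ℕ → ℕ → Set
    Joins e x y = e ≡ (x , y) ⊎ e ≡ (y , x)

    adj-edge : ∀ {x y} → Adj H x y → ∃ λ e → e ∈ H × Joins e x y
    adj-edge (inj₁ i) = _ , i , inj₁ ≡.refl
    adj-edge (inj₂ i) = _ , i , inj₂ ≡.refl

    joins-inside : ∀ {e x y U} → Joins e x y → x ∈ U → y ∈ U → Inside U e
    joins-inside (inj₁ ≡.refl) x∈ y∈ = x∈ , y∈
    joins-inside (inj₂ ≡.refl) x∈ y∈ = y∈ , x∈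

    joins-outside : ∀ {e x y U} → Joins e x y → y ∉ U → ¬ Inside U e
    joins-outside (inj₁ ≡.refl) y∉ (_ , y∈) = y∉ y∈
    joins-outside (inj₂ ≡.refl) y∉ (y∈ , _) = y∉ y∈

    joins-≢ : ∀ {e x y x′ y′} → Joins e x y → Joins e x′ y′ → x ≢ x′ → (x ≡ y′ → y ≡ x′ → ⊥) → ⊥
    joins-≢ (inj₁ ≡.refl) (inj₁ ≡.refl) n m = n ≡.refl
    joins-≢ (inj₁ ≡.refl) (inj₂ ≡.refl) n m = m ≡.refl ≡.refl
    joins-≢ (inj₂ ≡.refl) (inj₁ ≡.refl) n m = m ≡.refl ≡.refl
    joins-≢ (inj₂ ≡.refl) (inj₂ ≡.refl) n m = n ≡.refl

    adj-≢ : ∀ {x y} → Adj H x y → x ≢ y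
    adj-≢ (inj₁ i) = All.lookup loopless i
    adj-≢ (inj₂ i) = All.lookup loopless i ∘ ≡.sym

    common : ∀ {x y} → Adj H x y → ∃ λ c → Adj H x c × Adj H y c
    common (inj₁ i) = All.lookup covered i
    common (inj₂ i) = Product.map₂ Product.swap (All.lookup covered i)

    _or_ : (Edge → Bool) → Edge → Edge → Bool
    (p or e) f = p f ∨ isYes (f ≟E e)

    or-left : ∀ p e f → T (p f) → T ((p or e) f)
    or-left p e f t = T-∨⁺ (inj₁ t)

    or-right : ∀ p e → T ((p or e) e)
    or-right p e = T-∨⁺ {p e} (inj₂ (fromWitness ≡.refl))

    or-⊥ : ∀ p e f → ¬ T (p f) → f ≢ e → ¬ T ((p or e) f)
    or-⊥ p e f ¬p f≢e t = [ ¬p , f≢e ∘ toWitness ] (T-∨⁻ {p f} t)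

    or-⇒ : ∀ {p q : Edge → Bool} {e} → (∀ f → T (p f) → T (q f)) → T (q e) → ∀ f → T ((p or e) f) → T (q f)
    or-⇒ {p} {q} imp tq f t with T-∨⁻ {p f} t
    ... | inj₁ tp = imp f tp
    ... | inj₂ eq with ≡.refl ← toWitness eq = tq

    inside-mono : ∀ {U U′} → (∀ {x} → x ∈ U → x ∈ U′) → ∀ f → T (inside U f) → T (inside U′ f)
    inside-mono f e t = fromWitness (Product.map f f (toWitness t))

    ¬inside : ∀ {U f} → ¬ Inside U f → ¬ T (inside U f)
    ¬inside ¬i t = ¬i (toWitness t)

    -- The invariant 3(|U| - 1) ≤ 2 · (edges inside U). A new vertex with two edges adds 3 to the
    -- left and 4 to the right; two new vertices with three edges add 6 to both. Triangles glued at
    -- one common vertex attain equality.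
    Balanced : List ℕ → Set
    Balanced U = 3 ℕ.* length U ≤ 2 ℕ.* size U ℕ.+ 3

    leave : ∀ {U x y} → x ∈ U → y ∉ U → Path H x y → ∃ λ a → ∃ λ b → a ∈ U × b ∉ U × Adj H a b
    leave x∈ y∉ ε = ⊥-elim (y∉ x∈)
    leave {U} x∈ y∉ (_◅_ {j = w} e p) with w ∈? U
    ... | yes w∈ = leave w∈ y∉ p
    ... | no  w∉ = _ , w , x∈ , w∉ , e

    -- By connectedness some edge ab leaves U, and covering puts it into a triangle abc. If c lies
    -- in U, then b arrives with the edges ab and bc; otherwise b and c arrive with all three sides.
    extend : ∀ U → v ∈ U → Balanced U → length U < length V →
      ∃ λ U′ → v ∈ U′ × Balanced U′ × (length U < length U′)
    extend U v∈ balanced short with All.all? (_∈? U) V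
    ... | yes all = ⊥-elim (ℕₚ.<-irrefl ≡.refl (ℕₚ.≤-trans short (unique-≤ unique (All.lookup all))))
    ... | no ¬all with find (Allₚ.¬All⇒Any¬ (_∈? U) V ¬all)
    ...   | x , x∈V , x∉U with leave v∈ x∉U (reaches x∈V)
      where
      reaches : ∀ {x} → x ∈ V → Path H v x
      reaches (here ≡.refl) = ε
      reaches (there i)     = All.lookup conn i
    ...     | a , b , a∈ , b∉ , ab with common ab
    ...       | c , ac , bc with c ∈? U
    ...         | yes c∈ = b ∷ U , there v∈ , balanced′ , ℕₚ.≤-refl
      where
      e₁ = proj₁ (adj-edge ab)
      j₁ = proj₂ (proj₂ (adj-edge ab))
      e₂ = proj₁ (adj-edge bc)
      j₂ = Sum.swap (proj₂ (proj₂ (adj-edge bc)))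
      -- The predicates interpolate between being inside U and being inside the enlarged set by one
      -- edge at a time. Each edge lies in H, and its distinctness from the earlier ones makes every
      -- count strictly larger.
      p₁ = inside U or e₁
      p₂ = p₁ or e₂
      e₂≢e₁ : e₂ ≢ e₁
      e₂≢e₁ eq = joins-≢ (≡.subst (λ e → Joins e c b) eq j₂) j₁ (adj-≢ ac ∘ ≡.sym) (λ c≡b _ → adj-≢ bc (≡.sym c≡b))
      grow : 2 ℕ.+ size U ≤ size (b ∷ U)
      grow = ℕₚ.≤-trans (s≤s (count-< {q = p₁} (or-left (inside U) e₁) H (proj₁ (proj₂ (adj-edge ab))) (or-right (inside U) e₁) (¬inside (joins-outside j₁ b∉))))
        (ℕₚ.≤-trans (count-< {p = p₁} {q = p₂} (or-left p₁ e₂) H (proj₁ (proj₂ (adj-edge bc))) (or-right p₁ e₂)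
                      (or-⊥ (inside U) e₁ e₂ (¬inside (joins-outside j₂ b∉)) e₂≢e₁))
          (count-mono {p = p₂} (or-⇒ {p₁} (or-⇒ {inside U} (inside-mono there) (fromWitness (joins-inside j₁ (there a∈) (here ≡.refl))))
                             (fromWitness (joins-inside j₂ (there c∈) (here ≡.refl)))) H))
      balanced′ : Balanced (b ∷ U)
      balanced′ = begin
        3 ℕ.* suc (length U)              ≡⟨ ℕₚ.*-suc 3 (length U) ⟩
        3 ℕ.+ 3 ℕ.* length U              ≤⟨ ℕₚ.+-mono-≤ {3} {4} (s≤s (s≤s (s≤s z≤n))) balanced ⟩
        4 ℕ.+ (2 ℕ.* size U ℕ.+ 3)        ≡⟨ ≡.cong (ℕ._+ 3) (≡.sym (ℕₚ.*-distribˡ-+ 2 2 (size U))) ⟩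
        2 ℕ.* (2 ℕ.+ size U) ℕ.+ 3        ≤⟨ ℕₚ.+-monoˡ-≤ 3 (ℕₚ.*-monoʳ-≤ 2 grow) ⟩
        2 ℕ.* size (b ∷ U) ℕ.+ 3          ∎
        where open ℕₚ.≤-Reasoning
    ...         | no c∉ = c ∷ b ∷ U , there (there v∈) , balanced′ , ℕₚ.m≤n⇒m≤1+n ℕₚ.≤-refl
      where
      e₁ = proj₁ (adj-edge ab)
      j₁ = proj₂ (proj₂ (adj-edge ab))
      e₂ = proj₁ (adj-edge bc)
      j₂ = proj₂ (proj₂ (adj-edge bc))
      e₃ = proj₁ (adj-edge ac)
      j₃ = proj₂ (proj₂ (adj-edge ac))
      p₁ = inside U or e₁
      p₂ = p₁ or e₂
      p₃ = p₂ or e₃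
      e₂≢e₁ : e₂ ≢ e₁
      e₂≢e₁ eq = joins-≢ (≡.subst (λ e → Joins e b c) eq j₂) j₁ (adj-≢ ab ∘ ≡.sym) (λ _ → adj-≢ ac ∘ ≡.sym)
      e₃≢e₁ : e₃ ≢ e₁
      e₃≢e₁ eq = joins-≢ (≡.subst (λ e → Joins e c a) eq (Sum.swap j₃)) j₁ (adj-≢ ac ∘ ≡.sym) (λ c≡b _ → adj-≢ bc (≡.sym c≡b))
      e₃≢e₂ : e₃ ≢ e₂
      e₃≢e₂ eq = joins-≢ (≡.subst (λ e → Joins e a c) eq j₃) j₂ (adj-≢ ab) (λ a≡c _ → adj-≢ ac a≡c)
      grow : 3 ℕ.+ size U ≤ size (c ∷ b ∷ U)
      grow = ℕₚ.≤-trans (s≤s (s≤s (count-< {q = p₁} (or-left (inside U) e₁) H (proj₁ (proj₂ (adj-edge ab))) (or-right (inside U) e₁) (¬inside (joins-outside j₁ b∉)))))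
        (ℕₚ.≤-trans (s≤s (count-< {p = p₁} {q = p₂} (or-left p₁ e₂) H (proj₁ (proj₂ (adj-edge bc))) (or-right p₁ e₂)
                      (or-⊥ (inside U) e₁ e₂ (¬inside (joins-outside j₂ c∉)) e₂≢e₁)))
        (ℕₚ.≤-trans (count-< {p = p₂} {q = p₃} (or-left p₂ e₃) H (proj₁ (proj₂ (adj-edge ac))) (or-right p₂ e₃)
                      (or-⊥ p₁ e₂ e₃ (or-⊥ (inside U) e₁ e₃ (¬inside (joins-outside j₃ c∉)) e₃≢e₁) e₃≢e₂))
          (count-mono {p = p₃} (or-⇒ {p₂} (or-⇒ {p₁} (or-⇒ {inside U} (inside-mono (there ∘ there))
            (fromWitness (joins-inside j₁ (there (there a∈)) (there (here ≡.refl)))))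
            (fromWitness (joins-inside j₂ (there (here ≡.refl)) (here ≡.refl))))
            (fromWitness (joins-inside j₃ (there (there a∈)) (here ≡.refl)))) H)))
      balanced′ : Balanced (c ∷ b ∷ U)
      balanced′ = begin
        3 ℕ.* suc (suc (length U))        ≡⟨ ℕₚ.*-distribˡ-+ 3 2 (length U) ⟩
        6 ℕ.+ 3 ℕ.* length U              ≤⟨ ℕₚ.+-monoʳ-≤ 6 balanced ⟩
        6 ℕ.+ (2 ℕ.* size U ℕ.+ 3)        ≡⟨ ≡.cong (ℕ._+ 3) (≡.sym (ℕₚ.*-distribˡ-+ 2 3 (size U))) ⟩
        2 ℕ.* (3 ℕ.+ size U) ℕ.+ 3        ≤⟨ ℕₚ.+-monoˡ-≤ 3 (ℕₚ.*-monoʳ-≤ 2 grow) ⟩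
        2 ℕ.* size (c ∷ b ∷ U) ℕ.+ 3      ∎
        where open ℕₚ.≤-Reasoning

    exhaust : ∀ fuel U → v ∈ U → Balanced U → length V ≤ length U ℕ.+ fuel →
      ∃ λ U′ → Balanced U′ × (length V ≤ length U′)
    exhaust zero    U v∈ balanced enough = U , balanced , ℕₚ.≤-trans enough (ℕₚ.≤-reflexive (ℕₚ.+-identityʳ _))
    exhaust (suc k) U v∈ balanced enough with length V ℕ.≤? length U
    ... | yes long = U , balanced , long
    ... | no short with extend U v∈ balanced (ℕₚ.≰⇒> short)
    ...   | U′ , v∈′ , balanced′ , longer = exhaust k U′ v∈′ balanced′
      (ℕₚ.≤-trans enough (ℕₚ.≤-trans (ℕₚ.≤-reflexive (ℕₚ.+-suc (length U) k)) (ℕₚ.+-monoˡ-≤ k longer)))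

    edges-bound : 3 ℕ.* length I ≤ 2 ℕ.* length H
    edges-bound with exhaust (length I) (v ∷ []) (here ≡.refl) (ℕₚ.m≤n+m 3 _) ℕₚ.≤-refl
    ... | U , balanced , long = ℕₚ.+-cancelˡ-≤ 3 _ _ (begin
      3 ℕ.+ 3 ℕ.* length I         ≡⟨ ℕₚ.*-suc 3 (length I) ⟨
      3 ℕ.* length V               ≤⟨ ℕₚ.*-monoʳ-≤ 3 long ⟩
      3 ℕ.* length U               ≤⟨ balanced ⟩
      2 ℕ.* size U ℕ.+ 3           ≤⟨ ℕₚ.+-monoˡ-≤ 3 (ℕₚ.*-monoʳ-≤ 2 (count-≤ (inside U) H)) ⟩
      2 ℕ.* length H ℕ.+ 3         ≡⟨ ℕₚ.+-comm (2 ℕ.* length H) 3 ⟩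
      3 ℕ.+ 2 ℕ.* length H         ∎)
      where open ℕₚ.≤-Reasoning

  pairsL-loopless : ∀ {V : List ℕ} → Unique V → All (λ e → proj₁ e ≢ proj₂ e) (pairsL V)
  pairsL-loopless []          = []
  pairsL-loopless (x∉V ∷ uniq) = Allₚ.++⁺ (Allₚ.map⁺ x∉V) (pairsL-loopless uniq)

  module Moebius (A : QAlgebra) where
    open QAlgebra A
    open SubsetSums A
    open Solver using (solve; _:=_; _:+_; _:*_; :-_)
    open SetoidReasoning setoid

    triangleFreeInd : List Edge → Carrier
    triangleFreeInd E = ind (¬? (tri? E))

    triangleFreeInd-↭ : ∀ {E E′} → E ↭ E′ → triangleFreeInd E ≈ triangleFreeInd E′
    triangleFreeInd-↭ {E} {E′} p = ind-⇔ (¬? (tri? E)) (¬? (tri? E′))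
      (λ n t → n (tri-mono (Permₚ.∈-resp-↭ (↭-sym p)) t)) (λ n t → n (tri-mono (Permₚ.∈-resp-↭ p) t))

    triangleFreeInd-++ : ∀ {I O E E′} → Disjoint I O → On I E → On O E′ →
      triangleFreeInd (E ++ E′) ≈ triangleFreeInd E * triangleFreeInd E′
    triangleFreeInd-++ {E = E} {E′} disjoint on on′ = decide (tri? E) (tri? E′)
      where
      decide : (d : Dec (Tri E)) (d′ : Dec (Tri E′)) → triangleFreeInd (E ++ E′) ≈ ind (¬? d) * ind (¬? d′)
      decide (yes t) d′      = trans (ind-no (¬? (tri? (E ++ E′))) (λ n → n (tri-mono ∈-++⁺ˡ t))) (sym (zeroˡ _))
      decide (no _)  (yes t) = trans (ind-no (¬? (tri? (E ++ E′))) (λ n → n (tri-mono (∈-++⁺ʳ E) t))) (sym (zeroʳ _))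
      decide (no n)  (no n′) = trans (ind-yes (¬? (tri? (E ++ E′))) ([ n , n′ ] ∘ tri-++⁻ disjoint on on′)) (sym (*-identityˡ 1#))

    -- The alternating sum of f over the subsets E of X with sign (-1)^(|X| - |E|), evaluated one
    -- element at a time.
    möbius : ∀ {B : Set} → (List B → Carrier) → List B → Carrier
    möbius f []      = f []
    möbius f (x ∷ X) = möbius (λ E → f (x ∷ E)) X + - möbius f X

    möbius-cong : ∀ {B : Set} (X : List B) {f g} → (∀ E → E ⊆ X → f E ≈ g E) → möbius f X ≈ möbius g X
    möbius-cong []      eq = eq [] []
    möbius-cong (x ∷ X) eq = +-cong (möbius-cong X (λ E s → eq (x ∷ E) (≡.refl ∷ s))) (-‿cong (möbius-cong X (λ E s → eq E (x ∷ʳ s))))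

    möbius-*ˡ : ∀ {B : Set} (X : List B) y f → möbius (λ E → y * f E) X ≈ y * möbius f X
    möbius-*ˡ []      y f = refl
    möbius-*ˡ (x ∷ X) y f = trans (+-cong (möbius-*ˡ X y _) (-‿cong (möbius-*ˡ X y f)))
      (solve 3 (λ y a b → y :* a :+ :- (y :* b) := y :* (a :+ :- b)) refl y _ _)

    möbius-++ : ∀ {B : Set} (X Y : List B) {f g h} → (∀ E E′ → E ⊆ X → E′ ⊆ Y → f (E ++ E′) ≈ g E * h E′) →
      möbius f (X ++ Y) ≈ möbius g X * möbius h Y
    möbius-++ []      Y {f} {g} {h} eq = trans (möbius-cong Y (λ E′ s → eq [] E′ [] s)) (möbius-*ˡ Y (g []) h)
    möbius-++ (x ∷ X) Y {f} {g} {h} eq = trans (+-cong (möbius-++ X Y (λ E E′ s → eq (x ∷ E) E′ (≡.refl ∷ s)))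
        (-‿cong (möbius-++ X Y (λ E E′ s → eq E E′ (x ∷ʳ s)))))
      (solve 3 (λ a b c → a :* c :+ :- (b :* c) := (a :+ :- b) :* c) refl _ _ _)

    möbius-map : ∀ {B C : Set} (ρ : B → C) X f → möbius f (map ρ X) ≈ möbius (f ∘ map ρ) X
    möbius-map ρ []      f = refl
    möbius-map ρ (x ∷ X) f = +-cong (möbius-map ρ X _) (-‿cong (möbius-map ρ X f))

    möbius-↭ : ∀ {B : Set} {X Y : List B} {f} → (∀ {E E′} → E ↭ E′ → f E ≈ f E′) → X ↭ Y → möbius f X ≈ möbius f Y
    möbius-↭ inv Perm.refl  = refl
    möbius-↭ inv (prep x p) = +-cong (möbius-↭ (inv ∘ prep x) p) (-‿cong (möbius-↭ inv p))
    möbius-↭ {X = _ ∷ _ ∷ X} {_ ∷ _ ∷ Y} {f} inv (swap x y p) = trans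
      (+-cong (+-cong (trans (möbius-cong X (λ E _ → inv (swap x y Perm.refl))) (möbius-↭ (inv ∘ prep y ∘ prep x) p))
          (-‿cong (möbius-↭ (inv ∘ prep x) p))) (-‿cong (+-cong (möbius-↭ (inv ∘ prep y) p) (-‿cong (möbius-↭ inv p)))))
      (solve 4 (λ a b c d → (a :+ :- b) :+ :- (c :+ :- d) := (a :+ :- c) :+ :- (b :+ :- d)) refl _ _ _ _)
    möbius-↭ inv (Perm.trans p q) = trans (möbius-↭ inv p) (möbius-↭ inv q)

    möbius-insensitive : ∀ {B : Set} x (X : List B) {f} → (∀ E → E ⊆ X → f (x ∷ E) ≈ f E) → möbius f (x ∷ X) ≈ 0#
    möbius-insensitive x X eq = trans (+-congʳ (möbius-cong X eq)) (-‿inverseʳ _)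

    -- Writing f(E) as the sum of its Möbius values over H inside E and exchanging the sums, the
    -- supersets E of H contribute w^|H| q^(|X| - |H|), which is q^|X| y^|H|. The recursion performs
    -- this for one element at a time and never divides by q.
    möbius-inversion : ∀ {B : Set} (X : List B) f {y q w} → q * y ≈ w → q ≈ 1# + w →
      pow q (length X) * Σsub X (λ H → möbius f H * pow y (length H)) ≈ Σsub X (λ E → f E * pow w (length E))
    möbius-inversion []      f qy q≈ = *-identityˡ _
    möbius-inversion (x ∷ X) f {y} {q} {w} qy q≈ = begin
      q * Q * (Σsub X (λ H → (möbius fx H + - möbius f H) * (y * pow y (length H))) + M₀)
        ≈⟨ *-congˡ (+-congʳ (trans (Σsub-cong X (λ H _ → solve 4 (λ a b y p → (a :+ :- b) :* (y :* p) := y :* (a :* p) :+ (:- y) :* (b :* p)) refl (möbius fx H) (möbius f H) y (pow y (length H))))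
             (trans (Σsub-+ X _ _) (+-cong (Σsub-*ˡ X y _) (Σsub-*ˡ X (- y) _))))) ⟩
      q * Q * ((y * M₁ + (- y) * M₀) + M₀)
        ≈⟨ solve 5 (λ q Q y a b → q :* Q :* ((y :* a :+ (:- y) :* b) :+ b) := (q :* y) :* (Q :* a) :+ (q :+ :- (q :* y)) :* (Q :* b)) refl q Q y M₁ M₀ ⟩
      (q * y) * (Q * M₁) + (q + - (q * y)) * (Q * M₀)
        ≈⟨ +-cong (*-cong qy (möbius-inversion X fx qy q≈)) (*-cong one (möbius-inversion X f qy q≈)) ⟩
      w * Σsub X (λ E → fx E * pow w (length E)) + 1# * Σsub X (λ E → f E * pow w (length E))
        ≈⟨ +-cong (trans (sym (Σsub-*ˡ X w _)) (Σsub-cong X (λ E _ → solve 3 (λ w a p → w :* (a :* p) := a :* (w :* p)) refl w (fx E) (pow w (length E))))) (*-identityˡ _) ⟩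
      Σsub (x ∷ X) (λ E → f E * pow w (length E)) ∎
      where
      fx = λ E → f (x ∷ E)
      Q  = pow q (length X)
      M₁ = Σsub X (λ H → möbius fx H * pow y (length H))
      M₀ = Σsub X (λ H → möbius f H * pow y (length H))
      one : q + - (q * y) ≈ 1#
      one = trans (+-cong q≈ (-‿cong qy)) (solve 2 (λ o w → o :+ w :+ :- w := o) refl 1# w)

    triangleMöbius : List Edge → Carrier
    triangleMöbius = möbius triangleFreeInd

    -- If e lies in no triangle of H, then it lies in none of any subset, so toggling e never
    -- changes triangle-freeness and the alternating sum cancels in pairs.
    triangleMöbius-uncovered : ∀ {H e} → e ∈ H → ¬ CommonNeighbour H e → triangleMöbius H ≈ 0#
    triangleMöbius-uncovered {H} {e} e∈H ¬c with ∈-∃++ e∈H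
    ... | H₁ , H₂ , ≡.refl = trans (möbius-↭ triangleFreeInd-↭ (Permₚ.shift e H₁ H₂)) (möbius-insensitive e (H₁ ++ H₂) insensitive)
      where
      back : ∀ {E} → E ⊆ H₁ ++ H₂ → ∀ {f} → f ∈ e ∷ E → f ∈ H₁ ++ e ∷ H₂
      back s (here ≡.refl) = e∈H
      back s (there i)     = Permₚ.∈-resp-↭ (↭-sym (Permₚ.shift e H₁ H₂)) (there (lookup s i))
      insensitive : ∀ E → E ⊆ H₁ ++ H₂ → triangleFreeInd (e ∷ E) ≈ triangleFreeInd E
      insensitive E s = ind-⇔ (¬? (tri? (e ∷ E))) (¬? (tri? E))
        (λ n t → n (tri-mono there t)) (λ n t → n (tri-∷⁻ (¬c ∘ common-mono (back s)) t))

    triangleMöbius-sparse : ∀ {v I H} → Unique (v ∷ I) → H ⊆ pairsL (v ∷ I) → 2 ℕ.* length H < 3 ℕ.* length I →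
      ind (conn? v I H) * triangleMöbius H ≈ 0#
    triangleMöbius-sparse {v} {I} {H} uniq sub sparse = decide (conn? v I H) (All.all? (commonNeighbour? H) H)
      where
      decide : (d : Dec (Conn v I H)) → Dec (All (CommonNeighbour H) H) → ind d * triangleMöbius H ≈ 0#
      decide (no _)  _         = zeroˡ _
      decide (yes c) (yes cov) = ⊥-elim (ℕₚ.<⇒≱ sparse (TriangleCovered.edges-bound uniq (All-resp-⊆ sub (pairsL-loopless uniq)) c cov))
      decide (yes c) (no ¬cov) with find (Allₚ.¬All⇒Any¬ (commonNeighbour? H) H ¬cov)
      ... | e , e∈H , ¬c = trans (*-congˡ (triangleMöbius-uncovered e∈H ¬c)) (zeroʳ _)

    weighted : (List Edge → Carrier) → Carrier → List Edge → Carrier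
    weighted f x E = f E * pow x (length E)

    weighted-multiplicative : ∀ {f} x → Multiplicative f → Multiplicative (weighted f x)
    weighted-multiplicative x mult = record
      { φ-↭  = λ p → *-cong (φ-↭ p) (reflexive (≡.cong (pow x) (Permₚ.↭-length p)))
      ; φ-++ = λ {I} {O} {E} {E′} d on on′ → trans
          (*-cong (φ-++ d on on′) (trans (reflexive (≡.cong (pow x) (Listₚ.length-++ E))) (pow-+ x (length E) (length E′))))
          (solve 4 (λ a b c d → (a :* b) :* (c :* d) := (a :* c) :* (b :* d)) refl _ _ _ _)
      }
      where open Multiplicative mult

    triangleFreeInd-multiplicative : Multiplicative triangleFreeInd
    triangleFreeInd-multiplicative = record { φ-↭ = triangleFreeInd-↭ ; φ-++ = triangleFreeInd-++ }

    triangleMöbius-multiplicative : Multiplicative triangleMöbius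
    triangleMöbius-multiplicative = record
      { φ-↭  = möbius-↭ triangleFreeInd-↭
      ; φ-++ = λ {I} {O} {E} {E′} d on on′ → möbius-++ E E′ (λ F F′ s s′ → triangleFreeInd-++ d (All-resp-⊆ s on) (All-resp-⊆ s′ on′))
      }

-- Exponential generating functions and the exponential formula

module LabelledCounting where
  open RationalAlgebras
  open TreeFunction using (1/!; 1/!-suc)
  open SimpleGraphs
  open Connectivity
  open import Defs using (pairs; EdgeSet; connected)
  open import Data.Fin using (Fin; zero; suc)
  open import Data.Integer using (+_)
  open import Data.Nat as ℕ using (ℕ; zero; suc; _≤_; _<_; s≤s)
  import Data.Nat.Properties as ℕₚ
  open import Data.Nat.Induction using (<-rec)
  import Data.Rational as ℚ
  open import Data.List as List using (List; []; _∷_; map; length; allFin; applyUpTo; lookup)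
  import Data.List.Properties as Listₚ
  open import Data.List.Membership.Propositional.Properties using (∈-lookup)
  open import Data.List.Relation.Unary.All as All using (All; []; _∷_)
  open import Data.List.Relation.Unary.AllPairs using ([]; _∷_)
  open import Data.List.Relation.Unary.Unique.Propositional using (Unique)
  open import Data.List.Relation.Unary.Unique.Propositional.Properties using (upTo⁺)
  open import Data.List.Relation.Ternary.Interleaving.Propositional using (consˡ)
  open import Data.Empty using (⊥-elim)
  open import Function using (_∘_; id)
  open import Relation.Nullary.Decidable using (T?)
  open import Relation.Binary.PropositionalEquality as ≡ using (_≡_)
  import Relation.Binary.Reasoning.Setoid as SetoidReasoning

  lookup-injective : ∀ {A : Set} {xs : List A} → Unique xs → ∀ {i j} → lookup xs i ≡ lookup xs j → i ≡ j
  lookup-injective (_ ∷ _) {zero}  {zero}  _  = ≡.refl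
  lookup-injective {xs = _ ∷ xs} (x∉ ∷ _) {zero}  {suc j} eq = ⊥-elim (All.lookup x∉ (∈-lookup {xs = xs} j) eq)
  lookup-injective {xs = _ ∷ xs} (x∉ ∷ _) {suc i} {zero}  eq = ⊥-elim (All.lookup x∉ (∈-lookup {xs = xs} i) (≡.sym eq))
  lookup-injective (_ ∷ u) {suc i} {suc j} eq = ≡.cong suc (lookup-injective u eq)

  map-lookup : ∀ {A : Set} (xs : List A) → map (lookup xs) (allFin (length xs)) ≡ xs
  map-lookup xs = ≡.trans (Listₚ.map-tabulate id (lookup xs)) (Listₚ.tabulate-lookup xs)

  record Derivation (A : QAlgebra) : Set where
    open QAlgebra A
    field
      ∂      : Carrier → Carrier
      ∂-cong : ∀ {x y} → x ≈ y → ∂ x ≈ ∂ y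
      ∂-+    : ∀ x y → ∂ (x + y) ≈ ∂ x + ∂ y
      ∂-*    : ∀ x y → ∂ (x * y) ≈ ∂ x * y + x * ∂ y
      ∂-ι    : ∀ p → ∂ (ι p) ≈ 0#

  module Exponential (A : QAlgebra) where
    open QAlgebra A
    open PowerSeries A
    open SubsetSums A
    module 𝕊 = QAlgebra series-algebra
    open Solver using (solve; _:=_; _:+_; _:*_; :-_; con)

    egf : (ℕ → Carrier) → ℕ → Carrier
    egf f n = ι (1/! n) * f n

    ν*1/! : ∀ n → ν (suc n) * ι (1/! (suc n)) ≈ ι (1/! n)
    ν*1/! n = trans (sym (ι-* _ _)) (reflexive (≡.cong ι (1/!-suc n)))

    D-egf : ∀ f → D (egf f) ≋ shift (egf (f ∘ suc))
    D-egf f zero    = trans (*-congʳ ι-0) (zeroˡ _)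
    D-egf f (suc n) = trans (sym (*-assoc _ _ _)) (*-congʳ (ν*1/! n))

    -- Deciding the side of the head vertex differentiates one factor or the other, so the recursion
    -- of the split sum is the Leibniz rule for D. Binomial coefficients never appear; the factor n
    -- + 1 is cancelled instead.
    Σsplit-egf : ∀ V f g → ι (1/! (length V)) * Σsplit V (λ I O → f (length I) * g (length O)) ≈ (egf f ⊛ egf g) (length V)
    Σsplit-egf []      f g = solve 3 (λ i a b → con ℚ.1ℚ :* (a :* b) := (con ℚ.1ℚ :* a) :* (con ℚ.1ℚ :* b)) refl (ι ℚ.1ℚ) (f 0) (g 0)
    Σsplit-egf (x ∷ V) f g = ν-cancel n (begin
      ν (suc n) * (ι (1/! (suc n)) * (Σsplit V (λ I O → f (suc (length I)) * g (length O)) + Σsplit V (λ I O → f (length I) * g (suc (length O)))))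
        ≈⟨ trans (sym (*-assoc _ _ _)) (trans (*-congʳ (ν*1/! n)) (distribˡ _ _ _)) ⟩
      ι (1/! n) * Σsplit V (λ I O → f (suc (length I)) * g (length O)) + ι (1/! n) * Σsplit V (λ I O → f (length I) * g (suc (length O)))
        ≈⟨ +-cong (Σsplit-egf V (f ∘ suc) g) (Σsplit-egf V f (g ∘ suc)) ⟩
      (egf (f ∘ suc) ⊛ egf g) n + (egf f ⊛ egf (g ∘ suc)) n
        ≈⟨ +-cong (shift-⊛ (egf (f ∘ suc)) (egf g) (suc n))
             (trans (⊛-comm (egf f) (shift (egf (g ∘ suc))) (suc n)) (trans (shift-⊛ (egf (g ∘ suc)) (egf f) (suc n)) (⊛-comm (egf (g ∘ suc)) (egf f) n))) ⟨
      (shift (egf (f ∘ suc)) ⊛ egf g) (suc n) + (egf f ⊛ shift (egf (g ∘ suc))) (suc n)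
        ≈⟨ +-cong (𝕊.*-congʳ {egf g} (D-egf f) (suc n)) (𝕊.*-congˡ {egf f} (D-egf g) (suc n)) ⟨
      (D (egf f) ⊛ egf g) (suc n) + (egf f ⊛ D (egf g)) (suc n)
        ≈⟨ D-⊛ (egf f) (egf g) (suc n) ⟨
      ν (suc n) * (egf f ⊛ egf g) (suc n) ∎)
      where
      open SetoidReasoning setoid
      n = length V

    -- The weight φ lives on arbitrary labels, where vertex sets can be split, and φF on the graphs
    -- to be counted. Their agreement under every injective labelling makes a sum over a vertex set
    -- depend on its size only.
    module Labelled {φ : List Edge → Carrier} {φF : ∀ n → EdgeSet n → Carrier} (mult : Multiplicative φ)
        (relabelling : ∀ {n} (ρ : Fin n → ℕ) → (∀ {i j} → ρ i ≡ ρ j → i ≡ j) → ∀ E → φ (map (relabel ρ) E) ≈ φF n E) where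

      allCount : ℕ → Carrier
      allCount n = Σsub (pairs n) (φF n)

      connectedCount : ℕ → Carrier
      connectedCount n = Σsub (pairs n) (λ E → ind (T? (connected E)) * φF n E)

      Σsub-pairsL : ∀ (V : List ℕ) f → Σsub (pairsL V) f ≈ Σsub (pairs (length V)) (f ∘ map (relabel (lookup V)))
      Σsub-pairsL V f = begin
        Σsub (pairsL V) f                                                     ≡⟨ ≡.cong (λ U → Σsub (pairsL U) f) (map-lookup V) ⟨
        Σsub (pairsL (map (lookup V) (allFin (length V)))) f                  ≡⟨ ≡.cong (λ ps → Σsub ps f) (pairsL-map (lookup V) (allFin (length V))) ⟩
        Σsub (map (relabel (lookup V)) (pairsL (allFin (length V)))) f        ≈⟨ Σsub-map (relabel (lookup V)) (pairsL (allFin (length V))) f ⟩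
        Σsub (pairsL (allFin (length V))) (f ∘ map (relabel (lookup V)))      ≡⟨ ≡.cong (λ ps → Σsub ps (f ∘ map (relabel (lookup V)))) (pairs≡pairsL (length V)) ⟨
        Σsub (pairs (length V)) (f ∘ map (relabel (lookup V)))                ∎
        where open SetoidReasoning setoid

      allGraphs-count : ∀ V → Unique V → allGraphs φ V ≈ allCount (length V)
      allGraphs-count V uniq = trans (Σsub-pairsL V φ) (Σsub-cong (pairs (length V)) (λ E _ → relabelling (lookup V) (lookup-injective uniq) E))

      connectedGraphs-count : ∀ v I → Unique (v ∷ I) → connectedGraphs φ v I ≈ connectedCount (suc (length I))
      connectedGraphs-count v I uniq = trans (Σsub-pairsL (v ∷ I) (λ E → ind (conn? v I E) * φ E))
        (Σsub-cong (pairs (suc (length I))) (λ E _ → *-cong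
          (ind-⇔ (conn? v I (map (relabel ρ) E)) (T? (connected E))
            (λ c → conn⇒connected ρ inj E (≡.subst (λ J → Conn v J (map (relabel ρ) E)) (≡.sym (map-lookup I)) c))
            (λ t → ≡.subst (λ J → Conn v J (map (relabel ρ) E)) (map-lookup I) (connected⇒conn ρ inj E t)))
          (relabelling ρ inj E)))
        where
        ρ : Fin (suc (length I)) → ℕ
        ρ = lookup (v ∷ I)
        inj : ∀ {i j} → ρ i ≡ ρ j → i ≡ j
        inj = lookup-injective uniq

      allSeries : ℕ → Carrier
      allSeries = egf allCount

      -- The test `connected` holds vacuously for the graph without vertices, so the constant term
      -- is set to 0, as the logarithm of a series with constant term 1 requires.
      connectedSeries : ℕ → Carrier
      connectedSeries zero    = 0#
      connectedSeries (suc n) = egf connectedCount (suc n)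

      D-connectedSeries : D connectedSeries ≋ shift (egf (connectedCount ∘ suc))
      D-connectedSeries zero    = zeroʳ _
      D-connectedSeries (suc n) = D-egf connectedCount (suc n)

      -- The differentiated form of F = exp L. Differentiation distinguishes a vertex, here 0, and
      -- splitting off its component gives the product.
      exponential-formula : D allSeries ≋ D connectedSeries ⊛ allSeries
      exponential-formula zero    = trans (trans (*-congʳ ι-0) (zeroˡ _)) (sym (trans (*-congʳ (zeroʳ _)) (zeroˡ _)))
      exponential-formula (suc n) = begin
        D allSeries (suc n)
          ≈⟨ D-egf allCount (suc n) ⟩
        ι (1/! n) * allCount (suc n)
          ≡⟨ ≡.cong (λ m → ι (1/! m) * allCount (suc m)) (Listₚ.length-applyUpTo suc n) ⟨
        ι (1/! (length V)) * allCount (suc (length V))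
          ≈⟨ *-congˡ (allGraphs-count (0 ∷ V) uniq) ⟨
        ι (1/! (length V)) * allGraphs φ (0 ∷ V)
          ≈⟨ *-congˡ (trans (component-formula mult 0 V uniq) (Σsplit-cong V (λ {I} {O} s →
               *-cong (connectedGraphs-count 0 I (interleaving-uniqueˡ (consˡ s) uniq)) (allGraphs-count O (interleaving-uniqueʳ {I = 0 ∷ I} (consˡ s) uniq))))) ⟩
        ι (1/! (length V)) * Σsplit V (λ I O → connectedCount (suc (length I)) * allCount (length O))
          ≈⟨ Σsplit-egf V (connectedCount ∘ suc) allCount ⟩
        (egf (connectedCount ∘ suc) ⊛ allSeries) (length V)
          ≡⟨ ≡.cong (egf (connectedCount ∘ suc) ⊛ allSeries) (Listₚ.length-applyUpTo suc n) ⟩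
        (egf (connectedCount ∘ suc) ⊛ allSeries) n
          ≈⟨ shift-⊛ (egf (connectedCount ∘ suc)) allSeries (suc n) ⟨
        (shift (egf (connectedCount ∘ suc)) ⊛ allSeries) (suc n)
          ≈⟨ 𝕊.*-congʳ {allSeries} D-connectedSeries (suc n) ⟨
        (D connectedSeries ⊛ allSeries) (suc n) ∎
        where
        open SetoidReasoning setoid
        V = applyUpTo suc n
        uniq : Unique (0 ∷ V)
        uniq = upTo⁺ (suc n)

    -- D G has no constant term, so each coefficient of D H involves only earlier coefficients of H.
    D-unique-zero : ∀ {G H} → D H ≋ D G ⊛ H → H 0 ≈ 0# → ∀ n → H n ≈ 0#
    D-unique-zero {G} {H} eq H₀ = <-rec (λ n → H n ≈ 0#) step
      where
      step : ∀ n → (∀ {m} → m < n → H m ≈ 0#) → H n ≈ 0#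
      step zero    _   = H₀
      step (suc n) rec = ν-cancel n (trans (eq (suc n)) (trans
        (+-cong (trans (*-congʳ (trans (*-congʳ ι-0) (zeroˡ _))) (zeroˡ _))
          (conv-0 n (λ a b a+b≡n → trans (*-congˡ (rec (s≤s (≡.subst (b ≤_) a+b≡n (ℕₚ.m≤n+m b a))))) (zeroʳ _))))
        (trans (+-identityˡ 0#) (sym (zeroʳ _)))))

    module Lift (𝒟 : Derivation A) where
      open Derivation 𝒟

      ∂S : (ℕ → Carrier) → (ℕ → Carrier)
      ∂S X n = ∂ (X n)

      ∂-conv : ∀ f n → ∂ (conv f n) ≈ conv (λ a b → ∂ (f a b)) n
      ∂-conv f zero    = refl
      ∂-conv f (suc n) = trans (∂-+ _ _) (+-congˡ (∂-conv _ n))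

      ∂S-⊛ : ∀ X Y → ∂S (X ⊛ Y) ≋ ∂S X ⊛ Y 𝕊.+ X ⊛ ∂S Y
      ∂S-⊛ X Y n = trans (∂-conv _ n) (trans (conv-cong (λ a b → ∂-* (X a) (Y b)) n) (conv-+ _ _ n))

      ∂S-D : ∀ X → ∂S (D X) ≋ D (∂S X)
      ∂S-D X n = trans (∂-* (ν n) (X n)) (trans (+-congʳ (trans (*-congʳ (∂-ι _)) (zeroˡ _))) (+-identityˡ _))

      -- The relation of F to its logarithm is transferred from D to a second derivation without
      -- forming the exponential: the defect ∂F - (∂L) F satisfies the same linear equation as F and
      -- has constant term 0.
      logarithmic-derivative : ∀ F L → D F ≋ D L ⊛ F → ∂ (F 0) ≈ 0# → ∂ (L 0) ≈ 0# → ∂S F ≋ ∂S L ⊛ F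
      logarithmic-derivative F L eq F₀ L₀ n = trans
        (solve 2 (λ a b → a := (a :+ :- b) :+ b) refl (∂S F n) ((∂S L ⊛ F) n))
        (trans (+-congʳ (D-unique-zero {L} {H} DH H₀ n)) (+-identityˡ _))
        where
        H : ℕ → Carrier
        H = ∂S F 𝕊.+ 𝕊.- (∂S L ⊛ F)
        H₀ : H 0 ≈ 0#
        H₀ = trans (+-cong F₀ (-‿cong (trans (*-congʳ L₀) (zeroˡ _)))) (-‿inverseʳ 0#)
        module S = 𝕊.Solver
        DH : D H ≋ D L ⊛ H
        DH = begin
          D H                                                                     ≈⟨ (λ n → trans (D-+ (∂S F) (λ m → - (∂S L ⊛ F) m) n) (+-congˡ (D-neg (∂S L ⊛ F) n))) ⟩
          D (∂S F) 𝕊.+ 𝕊.- D (∂S L ⊛ F)                                           ≈⟨ (λ n → +-cong (left n) (-‿cong (right n))) ⟩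
          (∂S (D L) ⊛ F 𝕊.+ D L ⊛ ∂S F) 𝕊.+ 𝕊.- (∂S (D L) ⊛ F 𝕊.+ ∂S L ⊛ (D L ⊛ F))
            ≈⟨ S.solve 5 (λ a f l g h → (a S.:* f S.:+ l S.:* g) S.:+ S.:- (a S.:* f S.:+ h S.:* (l S.:* f)) S.:= l S.:* (g S.:+ S.:- (h S.:* f)))
                 (λ _ → refl) (∂S (D L)) F (D L) (∂S F) (∂S L) ⟩
          D L ⊛ H ∎
          where
          open SetoidReasoning 𝕊.setoid
          left : D (∂S F) ≋ ∂S (D L) ⊛ F 𝕊.+ D L ⊛ ∂S F
          left n = trans (sym (∂S-D F n)) (trans (∂-cong (eq n)) (∂S-⊛ (D L) F n))
          right : D (∂S L ⊛ F) ≋ ∂S (D L) ⊛ F 𝕊.+ ∂S L ⊛ (D L ⊛ F)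
          right n = trans (D-⊛ (∂S L) F n) (+-cong (𝕊.*-congʳ {F} (λ m → sym (∂S-D L m)) n) (𝕊.*-congˡ {∂S L} eq n))

-- The vertex and edge equations in two variables

module BivariateSeries where
  open RationalAlgebras
  open LabelledCounting using (Derivation; module Exponential)
  open import Data.Nat as ℕ using (ℕ; zero; suc; _<_; s≤s)
  import Data.Nat.Properties as ℕₚ
  open import Data.Rational using (0ℚ; 1ℚ; ½)
  open import Relation.Binary.PropositionalEquality as ≡ using (_≡_)
  import Relation.Binary.Reasoning.Setoid as SetoidReasoning

  pow-choose2 : (A : QAlgebra) → QAlgebra.Carrier A → ℕ → QAlgebra.Carrier A
  pow-choose2 A x zero    = QAlgebra.1# A
  pow-choose2 A x (suc n) = QAlgebra._*_ A (pow-choose2 A x n) (QAlgebra.pow A x n)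

  -- The field `∂-q` fits the derivation q w d/dw: with its factor q, every power of q is an
  -- eigenvector up to w and no division by q arises.
  record Setting : Set₁ where
    field
      coefficients : QAlgebra
      derivation   : Derivation coefficients
    open QAlgebra coefficients
    open Derivation derivation
    open PowerSeries coefficients using (_≋_; _⊛_; D)
    field
      w   : Carrier
      ∂-q : ∂ (1# + w) ≈ w * (1# + w)
      M A L F    : ℕ → Carrier
      M-0        : M 0 ≈ 1#
      A-0        : A 0 ≈ 0#
      L-0        : L 0 ≈ 0#
      M-formula  : D M ≋ D A ⊛ M
      F-formula  : D F ≋ D L ⊛ F
      F≋         : F ≋ (λ n → pow-choose2 coefficients (1# + w) n * M n)

  module Bivariate (𝒮 : Setting) where
    open Setting 𝒮 public
    open QAlgebra coefficients public
    open Derivation derivation public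
    open PowerSeries coefficients public
    open Exponential coefficients using (module Lift)
    open Lift derivation public using (∂S)
    open Lift derivation using (logarithmic-derivative)
    module 𝕊 = QAlgebra series-algebra
    private
      module S = 𝕊.Solver
      module R = SetoidReasoning setoid
      module ≋R = SetoidReasoning 𝕊.setoid
    open Solver using (solve; _:=_; _:+_; _:*_; :-_; con)

    q : Carrier
    q = 1# + w

    qᴮ : ℕ → Carrier
    qᴮ = pow-choose2 coefficients q

    Ser : Set
    Ser = ℕ → Carrier

    σ : Ser → Ser
    σ X n = pow q n * X n

    σ-⊛ : ∀ X Y → σ (X ⊛ Y) ≋ σ X ⊛ σ Y
    σ-⊛ X Y n = trans (sym (conv-*ˡ (pow q n) _ n)) (conv-cong≡ n split)
      where
      split : ∀ a b → a ℕ.+ b ≡ n → pow q n * (X a * Y b) ≈ (pow q a * X a) * (pow q b * Y b)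
      split a b ≡.refl = trans (*-congʳ (pow-+ q a b))
        (solve 4 (λ p r x y → (p :* r) :* (x :* y) := (p :* x) :* (r :* y)) refl (pow q a) (pow q b) (X a) (Y b))

    Φ : Ser → Ser
    Φ X n = qᴮ n * X n

    -- Since (n+1 choose 2) = (n choose 2) + n, conjugation by Φ turns multiplication by z into the
    -- operator z σ.
    Φ-shift : ∀ X → Φ (shift X) ≋ shift (σ (Φ X))
    Φ-shift X zero    = zeroʳ _
    Φ-shift X (suc n) = solve 3 (λ a b x → (a :* b) :* x := b :* (a :* x)) refl (qᴮ n) (pow q n) (X n)

    F-0 : F 0 ≈ 1#
    F-0 = trans (F≋ 0) (trans (*-identityˡ _) M-0)

    private
      U : Ser
      U = 𝕊.1# 𝕊.+ 𝕊.- F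

      U-0 : U 0 ≈ 0#
      U-0 = trans (+-congˡ (-‿cong F-0)) (-‿inverseʳ 1#)

    1/F : Ser
    1/F = geometric U

    F-inverse : F ⊛ 1/F ≋ 𝕊.1#
    F-inverse = begin
      F ⊛ 1/F                                        ≈⟨ S.solve 3 (λ f g o → f S.:* g S.:= o S.:* g S.:+ S.:- ((o S.:+ S.:- f) S.:* g)) (λ _ → refl) F 1/F 𝕊.1# ⟩
      𝕊.1# ⊛ 1/F 𝕊.+ 𝕊.- (U ⊛ 1/F)                   ≈⟨ 𝕊.+-congʳ {𝕊.- (U ⊛ 1/F)} (λ n → trans (𝕊.*-identityˡ 1/F n) (geometric-fixpoint U-0 n)) ⟩
      𝕊.1# 𝕊.+ U ⊛ 1/F 𝕊.+ 𝕊.- (U ⊛ 1/F)             ≈⟨ S.solve 2 (λ o x → o S.:+ x S.:+ S.:- x S.:= o) (λ _ → refl) 𝕊.1# (U ⊛ 1/F) ⟩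
      𝕊.1#                                           ∎
      where open ≋R

    F-cancel : ∀ X Y → X ⊛ F ≋ Y ⊛ F → X ≋ Y
    F-cancel X Y eq n = trans (sym (undo X n)) (trans (𝕊.*-congʳ {1/F} eq n) (undo Y n))
      where
      undo : ∀ X → (X ⊛ F) ⊛ 1/F ≋ X
      undo X n = trans (⊛-assoc X F 1/F n) (trans (𝕊.*-congˡ {X} F-inverse n) (𝕊.*-identityʳ X n))

    E : Ser
    E = shift (σ F) ⊛ 1/F

    E-F : E ⊛ F ≋ shift (σ F)
    E-F n = trans (⊛-assoc (shift (σ F)) 1/F F n) (trans (𝕊.*-congˡ {shift (σ F)} (λ m → trans (⊛-comm 1/F F m) (F-inverse m)) n) (𝕊.*-identityʳ (shift (σ F)) n))

    E-0 : E 0 ≈ 0#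
    E-0 = zeroˡ _

    E-1 : E 1 ≈ 1#
    E-1 = begin
      E 1                          ≈⟨ solve 3 (λ e e₀ o → e := (con 0ℚ :* o :+ e :* con 1ℚ)) refl (E 1) (E 0) (F 1) ⟩
      ι 0ℚ * F 1 + E 1 * ι 1ℚ      ≈⟨ +-cong (*-congʳ (trans ι-0 (sym E-0))) (*-congˡ (trans ι-1 (sym F-0))) ⟩
      (E ⊛ F) 1                    ≈⟨ E-F 1 ⟩
      1# * F 0                     ≈⟨ trans (*-identityˡ _) F-0 ⟩
      1#                           ∎
      where open R

    powE : ℕ → Ser
    powE zero    = 𝕊.1#
    powE (suc m) = E ⊛ σ (powE m)

    powE-vanishes : ∀ m {n} → n < m → powE m n ≈ 0#
    powE-vanishes (suc m) {n} (s≤s n≤m) = conv-0 n term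
      where
      term : ∀ a b → a ℕ.+ b ≡ n → E a * σ (powE m) b ≈ 0#
      term zero    b _      = trans (*-congʳ E-0) (zeroˡ _)
      term (suc a) b ≡.refl = trans (*-congˡ (trans (*-congˡ (powE-vanishes m (ℕₚ.≤-trans (s≤s (ℕₚ.m≤n+m b a)) n≤m))) (zeroʳ _))) (zeroʳ _)

    shifts : ℕ → Ser → Ser
    shifts zero    X = X
    shifts (suc m) X = shift (shifts m X)

    shifts-+ : ∀ m X n → shifts m X (m ℕ.+ n) ≈ X n
    shifts-+ zero    X n = refl
    shifts-+ (suc m) X n = shifts-+ m X n

    -- The product of the shifted copies of E = z σF / F telescopes. Multiplied by F, it leaves m
    -- applications of z σ to F, which by `Φ-shift` is Φ of z^m M.
    powE-F : ∀ m → powE m ⊛ F ≋ Φ (shifts m M)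
    powE-F zero    n = trans (𝕊.*-identityˡ F n) (F≋ n)
    powE-F (suc m) = begin
      (E ⊛ σ (powE m)) ⊛ F              ≈⟨ S.solve 3 (λ e p f → (e S.:* p) S.:* f S.:= (e S.:* f) S.:* p) (λ _ → refl) E (σ (powE m)) F ⟩
      (E ⊛ F) ⊛ σ (powE m)              ≈⟨ 𝕊.*-congʳ {σ (powE m)} E-F ⟩
      shift (σ F) ⊛ σ (powE m)          ≈⟨ shift-⊛ (σ F) (σ (powE m)) ⟩
      shift (σ F ⊛ σ (powE m))          ≈⟨ shift-cong (λ n → trans (⊛-comm (σ F) (σ (powE m)) n) (sym (σ-⊛ (powE m) F n))) ⟩
      shift (σ (powE m ⊛ F))            ≈⟨ shift-cong (λ n → *-congˡ (powE-F m n)) ⟩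
      shift (σ (Φ (shifts m M)))        ≈⟨ Φ-shift (shifts m M) ⟨
      Φ (shift (shifts m M))            ∎
      where open ≋R

    Ψ : Ser → Ser
    Ψ X n = sum (suc n) (λ m → X m * powE m n)

    -- Φ is not multiplicative, but each monomial z^m of X can be moved across it by `powE-F`; thus
    -- z^m is replaced by `powE m`. The order of `powE m` keeps the sum over m finite.
    Φ-⊛-M : ∀ X → Φ (X ⊛ M) ≋ Ψ X ⊛ F
    Φ-⊛-M X n = begin
      qᴮ n * conv (λ a b → X a * M b) n
        ≈⟨ trans (sym (conv-*ˡ (qᴮ n) _ n)) (conv-cong≡ n shifted) ⟩
      conv (λ a b → X a * (powE a ⊛ F) n) n
        ≈⟨ conv≈sum (λ a b → X a * (powE a ⊛ F) n) n ⟩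
      sum (suc n) (λ a → X a * (powE a ⊛ F) n)
        ≈⟨ sum-cong (suc n) (λ a _ → trans (sym (conv-*ˡ (X a) _ n)) (conv-cong (λ c d → sym (*-assoc _ _ _)) n)) ⟩
      sum (suc n) (λ a → conv (λ c d → X a * powE a c * F d) n)
        ≈⟨ conv-sum (suc n) (λ c d a → X a * powE a c * F d) n ⟨
      conv (λ c d → sum (suc n) (λ a → X a * powE a c * F d)) n
        ≈⟨ conv-cong≡ n truncate ⟩
      (Ψ X ⊛ F) n ∎
      where
      open R
      shifted : ∀ a b → a ℕ.+ b ≡ n → qᴮ n * (X a * M b) ≈ X a * (powE a ⊛ F) n
      shifted a b ≡.refl = trans (solve 3 (λ q x m → q :* (x :* m) := x :* (q :* m)) refl (qᴮ n) (X a) (M b))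
        (*-congˡ (sym (trans (powE-F a (a ℕ.+ b)) (*-congˡ (shifts-+ a M b)))))
      truncate : ∀ c d → c ℕ.+ d ≡ n → sum (suc n) (λ a → X a * powE a c * F d) ≈ Ψ X c * F d
      truncate c d ≡.refl = trans (sym (sum-*ʳ (suc n) (F d) (λ a → X a * powE a c)))
        (*-congʳ (sum-truncate-≤ (s≤s (ℕₚ.m≤m+n c d)) (λ a c<a → trans (*-congˡ (powE-vanishes a c<a)) (zeroʳ _))))

    Y : Ser
    Y = D L

    D-Φ : ∀ X → D (Φ X) ≋ Φ (D X)
    D-Φ X n = solve 3 (λ n q x → n :* (q :* x) := q :* (n :* x)) refl (ν n) (qᴮ n) (X n)

    Y≋Ψ : Y ≋ Ψ (D A)
    Y≋Ψ = F-cancel Y (Ψ (D A)) (begin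
      D L ⊛ F           ≈⟨ F-formula ⟨
      D F               ≈⟨ D-cong F≋ ⟩
      D (Φ M)           ≈⟨ D-Φ M ⟩
      Φ (D M)           ≈⟨ (λ n → *-congˡ (M-formula n)) ⟩
      Φ (D A ⊛ M)       ≈⟨ Φ-⊛-M (D A) ⟩
      Ψ (D A) ⊛ F       ∎)
      where open ≋R

    D-shift : ∀ X → D (shift X) ≋ shift X 𝕊.+ shift (D X)
    D-shift X zero    = trans (zeroʳ _) (sym (+-identityˡ 0#))
    D-shift X (suc n) = trans (*-congʳ (ν-suc n))
      (solve 2 (λ n x → (con 1ℚ :+ n) :* x := x :+ n :* x) refl (ν n) (X n))

    D-σ : ∀ X → D (σ X) ≋ σ (D X)
    D-σ X n = solve 3 (λ n q x → n :* (q :* x) := q :* (n :* x)) refl (ν n) (pow q n) (X n)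

    -- The logarithmic derivative of E F = z σF: the three factors on the two sides contribute 1, σY
    -- and Y.
    vertex-equation : D E ≋ E 𝕊.+ E ⊛ (σ Y 𝕊.+ 𝕊.- Y)
    vertex-equation = F-cancel (D E) (E 𝕊.+ E ⊛ (σ Y 𝕊.+ 𝕊.- Y)) (begin
      D E ⊛ F
        ≈⟨ S.solve 4 (λ d f e y → d S.:* f S.:= (d S.:* f S.:+ e S.:* (y S.:* f)) S.:+ S.:- (e S.:* (y S.:* f))) (λ _ → refl) (D E) F E Y ⟩
      (D E ⊛ F 𝕊.+ E ⊛ (Y ⊛ F)) 𝕊.+ 𝕊.- (E ⊛ (Y ⊛ F))
        ≈⟨ 𝕊.+-congʳ {𝕊.- (E ⊛ (Y ⊛ F))} product ⟩
      (E ⊛ F 𝕊.+ σ Y ⊛ (E ⊛ F)) 𝕊.+ 𝕊.- (E ⊛ (Y ⊛ F))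
        ≈⟨ S.solve 4 (λ e f s y → (e S.:* f S.:+ s S.:* (e S.:* f)) S.:+ S.:- (e S.:* (y S.:* f)) S.:= (e S.:+ e S.:* (s S.:+ S.:- y)) S.:* f) (λ _ → refl) E F (σ Y) Y ⟩
      (E 𝕊.+ E ⊛ (σ Y 𝕊.+ 𝕊.- Y)) ⊛ F ∎)
      where
      open ≋R
      product : D E ⊛ F 𝕊.+ E ⊛ (Y ⊛ F) ≋ E ⊛ F 𝕊.+ σ Y ⊛ (E ⊛ F)
      product = begin
        D E ⊛ F 𝕊.+ E ⊛ (Y ⊛ F)                   ≈⟨ 𝕊.+-congˡ {D E ⊛ F} (𝕊.*-congˡ {E} F-formula) ⟨
        D E ⊛ F 𝕊.+ E ⊛ D F                       ≈⟨ D-⊛ E F ⟨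
        D (E ⊛ F)                                 ≈⟨ D-cong E-F ⟩
        D (shift (σ F))                           ≈⟨ D-shift (σ F) ⟩
        shift (σ F) 𝕊.+ shift (D (σ F))           ≈⟨ 𝕊.+-congˡ {shift (σ F)} (shift-cong (λ n → trans (D-σ F n) (trans (*-congˡ (F-formula n)) (trans (σ-⊛ Y F n) (⊛-comm (σ Y) (σ F) n))))) ⟩
        shift (σ F) 𝕊.+ shift (σ F ⊛ σ Y)         ≈⟨ 𝕊.+-congˡ {shift (σ F)} (λ n → trans (sym (shift-⊛ (σ F) (σ Y) n)) (⊛-comm (shift (σ F)) (σ Y) n)) ⟩
        shift (σ F) 𝕊.+ σ Y ⊛ shift (σ F)         ≈⟨ (λ n → +-cong (sym (E-F n)) (𝕊.*-congˡ {σ Y} (λ m → sym (E-F m)) n)) ⟩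
        E ⊛ F 𝕊.+ σ Y ⊛ (E ⊛ F)                   ∎

    scale : Carrier → Ser → Ser
    scale x X n = x * X n

    ∂-1 : ∂ 1# ≈ 0#
    ∂-1 = trans (∂-cong (sym ι-1)) (∂-ι 1ℚ)

    ∂-0 : ∂ 0# ≈ 0#
    ∂-0 = trans (∂-cong (sym ι-0)) (∂-ι 0ℚ)

    ∂-pow-q : ∀ n → ∂ (pow q n) ≈ ν n * (w * pow q n)
    ∂-pow-q zero    = trans ∂-1 (sym (trans (*-congʳ ι-0) (zeroˡ _)))
    ∂-pow-q (suc n) = begin
      ∂ (q * pow q n)                               ≈⟨ ∂-* q (pow q n) ⟩
      ∂ q * pow q n + q * ∂ (pow q n)               ≈⟨ +-cong (*-congʳ ∂-q) (*-congˡ (∂-pow-q n)) ⟩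
      w * q * pow q n + q * (ν n * (w * pow q n))   ≈⟨ solve 4 (λ w q p n → w :* q :* p :+ q :* (n :* (w :* p)) := (con 1ℚ :+ n) :* (w :* (q :* p))) refl w q (pow q n) (ν n) ⟩
      (ι 1ℚ + ν n) * (w * (q * pow q n))            ≈⟨ *-congʳ (ν-suc n) ⟨
      ν (suc n) * (w * (q * pow q n))               ∎
      where open R

    -- The factor is w (n choose 2). As n² - n it becomes the operator D² - D on series in z, the
    -- source of the second derivative in Wright's equation.
    ∂-qᴮ : ∀ n → ∂ (qᴮ n) ≈ ι ½ * (w * ((ν n * ν n + - ν n) * qᴮ n))
    ∂-qᴮ zero    = trans ∂-1 (trans (sym ι-0)
      (solve 2 (λ w o → con 0ℚ := con ½ :* (w :* ((con 0ℚ :* con 0ℚ :+ :- con 0ℚ) :* o))) refl w 1#))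
    ∂-qᴮ (suc n) = begin
      ∂ (qᴮ n * pow q n)
        ≈⟨ ∂-* (qᴮ n) (pow q n) ⟩
      ∂ (qᴮ n) * pow q n + qᴮ n * ∂ (pow q n)
        ≈⟨ +-cong (*-congʳ (∂-qᴮ n)) (*-congˡ (∂-pow-q n)) ⟩
      ι ½ * (w * ((ν n * ν n + - ν n) * qᴮ n)) * pow q n + qᴮ n * (ν n * (w * pow q n))
        ≈⟨ solve 4 (λ w n b p → con ½ :* (w :* ((n :* n :+ :- n) :* b)) :* p :+ b :* (n :* (w :* p))
             := con ½ :* (w :* (((con 1ℚ :+ n) :* (con 1ℚ :+ n) :+ :- (con 1ℚ :+ n)) :* (b :* p)))) refl w (ν n) (qᴮ n) (pow q n) ⟩
      ι ½ * (w * (((ι 1ℚ + ν n) * (ι 1ℚ + ν n) + - (ι 1ℚ + ν n)) * (qᴮ n * pow q n)))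
        ≈⟨ *-congˡ (*-congˡ (*-congʳ (+-cong (*-cong (ν-suc n) (ν-suc n)) (-‿cong (ν-suc n))))) ⟨
      ι ½ * (w * ((ν (suc n) * ν (suc n) + - ν (suc n)) * qᴮ (suc n))) ∎
      where open R

    ∂F≋ : ∂S F ≋ 𝕊.ι ½ ⊛ scale w (D (D F) 𝕊.+ 𝕊.- D F) 𝕊.+ Φ (∂S M)
    ∂F≋ n = begin
      ∂ (F n)
        ≈⟨ ∂-cong (F≋ n) ⟩
      ∂ (qᴮ n * M n)
        ≈⟨ ∂-* (qᴮ n) (M n) ⟩
      ∂ (qᴮ n) * M n + qᴮ n * ∂ (M n)
        ≈⟨ +-congʳ (*-congʳ (∂-qᴮ n)) ⟩
      ι ½ * (w * ((ν n * ν n + - ν n) * qᴮ n)) * M n + qᴮ n * ∂ (M n)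
        ≈⟨ +-congʳ (solve 4 (λ w n b m → con ½ :* (w :* ((n :* n :+ :- n) :* b)) :* m := con ½ :* (w :* (n :* (n :* (b :* m)) :+ :- (n :* (b :* m))))) refl w (ν n) (qᴮ n) (M n)) ⟩
      ι ½ * (w * (ν n * (ν n * (qᴮ n * M n)) + - (ν n * (qᴮ n * M n)))) + qᴮ n * ∂ (M n)
        ≈⟨ +-congʳ (*-congˡ (*-congˡ (+-cong (*-congˡ (*-congˡ (F≋ n))) (-‿cong (*-congˡ (F≋ n)))))) ⟨
      ι ½ * (w * (D (D F) n + - D F n)) + qᴮ n * ∂ (M n)
        ≈⟨ +-congʳ (ι-⊛ ½ (scale w (D (D F) 𝕊.+ 𝕊.- D F)) n) ⟨
      (𝕊.ι ½ ⊛ scale w (D (D F) 𝕊.+ 𝕊.- D F)) n + qᴮ n * ∂ (M n) ∎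
      where open R

    scale-constant : ∀ x X → scale x X ≋ constant x ⊛ X
    scale-constant x X n = sym (constant-⊛ x X n)

    -- The quadratic term arises from D (D F) = (D Y + Y²) F. Differentiating M instead of the
    -- powers of q gives the source, again transported through Φ.
    edge-equation : ∂S L ≋ 𝕊.ι ½ ⊛ scale w (D Y 𝕊.+ Y ⊛ Y 𝕊.+ 𝕊.- Y) 𝕊.+ Ψ (∂S A)
    edge-equation = F-cancel (∂S L) _ (begin
      ∂S L ⊛ F
        ≈⟨ logarithmic-derivative F L F-formula (trans (∂-cong F-0) ∂-1) (trans (∂-cong L-0) ∂-0) ⟨
      ∂S F
        ≈⟨ ∂F≋ ⟩
      h ⊛ scale w (D (D F) 𝕊.+ 𝕊.- D F) 𝕊.+ Φ (∂S M)
        ≈⟨ (λ n → +-cong (𝕊.*-congˡ {h} (scale-constant w (D (D F) 𝕊.+ 𝕊.- D F)) n)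
             (trans (*-congˡ (logarithmic-derivative M A M-formula (trans (∂-cong M-0) ∂-1) (trans (∂-cong A-0) ∂-0) n)) (Φ-⊛-M (∂S A) n))) ⟩
      h ⊛ (W ⊛ (D (D F) 𝕊.+ 𝕊.- D F)) 𝕊.+ Ψ (∂S A) ⊛ F
        ≈⟨ 𝕊.+-congʳ {Ψ (∂S A) ⊛ F} (𝕊.*-congˡ {h} (𝕊.*-congˡ {W} (λ n → +-cong (DDF n) (-‿cong (F-formula n))))) ⟩
      h ⊛ (W ⊛ ((D Y ⊛ F 𝕊.+ Y ⊛ (Y ⊛ F)) 𝕊.+ 𝕊.- (Y ⊛ F))) 𝕊.+ Ψ (∂S A) ⊛ F
        ≈⟨ S.solve 6 (λ h w d y f p → h S.:* (w S.:* ((d S.:* f S.:+ y S.:* (y S.:* f)) S.:+ S.:- (y S.:* f))) S.:+ p S.:* f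
             S.:= (h S.:* (w S.:* (d S.:+ y S.:* y S.:+ S.:- y)) S.:+ p) S.:* f) (λ _ → refl) h W (D Y) Y F (Ψ (∂S A)) ⟩
      (h ⊛ (W ⊛ (D Y 𝕊.+ Y ⊛ Y 𝕊.+ 𝕊.- Y)) 𝕊.+ Ψ (∂S A)) ⊛ F
        ≈⟨ 𝕊.*-congʳ {F} (𝕊.+-congʳ {Ψ (∂S A)} (𝕊.*-congˡ {h} (scale-constant w (D Y 𝕊.+ Y ⊛ Y 𝕊.+ 𝕊.- Y)))) ⟨
      (h ⊛ scale w (D Y 𝕊.+ Y ⊛ Y 𝕊.+ 𝕊.- Y) 𝕊.+ Ψ (∂S A)) ⊛ F ∎)
      where
      open ≋R
      h = 𝕊.ι ½
      W = constant w
      DDF : D (D F) ≋ D Y ⊛ F 𝕊.+ Y ⊛ (Y ⊛ F)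
      DDF n = trans (D-cong F-formula n) (trans (D-⊛ Y F n) (+-congˡ (𝕊.*-congˡ {Y} F-formula n)))

-- Orders in w and the substitution z ↦ z/w

module Regrading where
  open RationalAlgebras
  open LabelledCounting using (Derivation)
  open BivariateSeries
  open import Defs using (ℕ→ℚ; Series)
  open import Data.Nat as ℕ using (ℕ; zero; suc; _≤_; _<_; z≤n; s≤s; _∸_)
  import Data.Nat.Properties as ℕₚ
  open import Data.Nat.Induction using (<-rec)
  open import Data.Rational as ℚ using (ℚ; 0ℚ; 1ℚ)
  import Data.Rational.Properties as ℚₚ
  import Data.Integer as ℤ
  open import Data.Empty using (⊥-elim)
  open import Relation.Nullary using (yes; no)
  open import Relation.Binary.PropositionalEquality using (_≡_; trans; sym; refl; cong; cong₂; subst; module ≡-Reasoning)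
  import Relation.Binary.Reasoning.Setoid as SetoidReasoning

  module ℚS = PowerSeries ℚ-algebra
  open ℚS using (_⊛_; _≋_; conv; sum)

  𝕎 : QAlgebra
  𝕎 = ℚS.series-algebra

  module 𝕎 = QAlgebra 𝕎

  w : Series
  w = ℚS.shift 𝕎.1#

  w-⊛ : ∀ X → w ⊛ X ≋ ℚS.shift X
  w-⊛ X n = trans (ℚS.shift-⊛ 𝕎.1# X n) (shifted n)
    where
    shifted : ∀ n → ℚS.shift (𝕎.1# ⊛ X) n ≡ ℚS.shift X n
    shifted zero    = refl
    shifted (suc n) = 𝕎.*-identityˡ X n

  D-w : ℚS.D w ≋ w
  D-w zero          = refl
  D-w (suc zero)    = refl
  D-w (suc (suc n)) = ℚₚ.*-zeroʳ (ℕ→ℚ (suc (suc n)))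

  -- The derivation q w d/dw; here `ℚS.D` is w d/dw.
  ∇ : Derivation 𝕎
  ∇ = record
    { ∂      = ∂
    ; ∂-cong = λ p → 𝕎.*-congˡ {q} (ℚS.D-cong p)
    ; ∂-+    = λ X Y n → trans (𝕎.*-congˡ {q} (ℚS.D-+ X Y) n) (𝕎.distribˡ q (ℚS.D X) (ℚS.D Y) n)
    ; ∂-*    = λ X Y n → trans (𝕎.*-congˡ {q} (ℚS.D-⊛ X Y) n)
        (S.solve 5 (λ q dx y x dy → q S.:* (dx S.:* y S.:+ x S.:* dy) S.:= q S.:* dx S.:* y S.:+ x S.:* (q S.:* dy)) (λ _ → refl) q (ℚS.D X) Y X (ℚS.D Y) n)
    ; ∂-ι    = λ p n → trans (𝕎.*-congˡ {q} (ℚS.D-constant p) n) (𝕎.zeroʳ q n)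
    }
    where
    module S = 𝕎.Solver
    q = 𝕎.1# 𝕎.+ w
    ∂ : Series → Series
    ∂ X = q ⊛ ℚS.D X

  ∂-w : Derivation.∂ ∇ w ≋ (𝕎.1# 𝕎.+ w) ⊛ w
  ∂-w = 𝕎.*-congˡ {𝕎.1# 𝕎.+ w} D-w

  ∂-1+w : Derivation.∂ ∇ (𝕎.1# 𝕎.+ w) ≋ w ⊛ (𝕎.1# 𝕎.+ w)
  ∂-1+w n = trans (𝕎.*-congˡ {q} D-q n) (𝕎.*-comm q w n)
    where
    q = 𝕎.1# 𝕎.+ w
    D-q : ℚS.D q ≋ w
    D-q n = trans (ℚS.D-+ 𝕎.1# w n) (trans (cong₂ ℚ._+_ (ℚS.D-constant 1ℚ n) (D-w n)) (ℚₚ.+-identityˡ (w n)))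

  Ord : ℕ → Series → Set
  Ord k X = ∀ e → e < k → X e ≡ 0ℚ

  ord-cong : ∀ {k X Y} → X ≋ Y → Ord k X → Ord k Y
  ord-cong eq o e e<k = trans (sym (eq e)) (o e e<k)

  ord-≤ : ∀ {j k X} → j ≤ k → Ord k X → Ord j X
  ord-≤ j≤k o e e<j = o e (ℕₚ.≤-trans e<j j≤k)

  ord-0 : ∀ {k} → Ord k 𝕎.0#
  ord-0 e _ = refl

  ord-+ : ∀ {k X Y} → Ord k X → Ord k Y → Ord k (X 𝕎.+ Y)
  ord-+ o p e e<k = cong₂ ℚ._+_ (o e e<k) (p e e<k)

  ord-neg : ∀ {k X} → Ord k X → Ord k (𝕎.- X)
  ord-neg o e e<k = cong ℚ.-_ (o e e<k)

  ord-* : ∀ {j k X Y} → Ord j X → Ord k Y → Ord (j ℕ.+ k) (X ⊛ Y)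
  ord-* {j} {k} {X} {Y} o p e e< = ℚS.conv-0 e term
    where
    term : ∀ a b → a ℕ.+ b ≡ e → X a ℚ.* Y b ≡ 0ℚ
    term a b refl with a ℕ.<? j | b ℕ.<? k
    ... | yes a<j | _       = trans (cong (ℚ._* Y b) (o a a<j)) (ℚₚ.*-zeroˡ (Y b))
    ... | no _    | yes b<k = trans (cong (X a ℚ.*_) (p b b<k)) (ℚₚ.*-zeroʳ (X a))
    ... | no a≮j  | no b≮k  = ⊥-elim (ℕₚ.<⇒≱ e< (ℕₚ.+-mono-≤ (ℕₚ.≮⇒≥ a≮j) (ℕₚ.≮⇒≥ b≮k)))

  ord-any : ∀ {X} → Ord 0 X
  ord-any e ()

  ord-w : Ord 1 w
  ord-w zero    _ = refl
  ord-w (suc e) (s≤s ())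

  private
    module B𝕎 = PowerSeries 𝕎

  ord-conv : ∀ {k} (f : ℕ → ℕ → Series) n → (∀ a b → a ℕ.+ b ≡ n → Ord k (f a b)) → Ord k (B𝕎.conv f n)
  ord-conv f zero    o = o 0 0 refl
  ord-conv f (suc n) o = ord-+ (o 0 (suc n) refl) (ord-conv (λ a b → f (suc a) b) n (λ a b eq → o (suc a) b (cong suc eq)))

  ord-sum : ∀ {k} n (f : ℕ → Series) → (∀ m → Ord k (f m)) → Ord k (B𝕎.sum n f)
  ord-sum zero    f o = ord-0
  ord-sum (suc n) f o = ord-+ (ord-sum n f o) (o n)

  conv-eval : ∀ (f : ℕ → ℕ → Series) n e → B𝕎.conv f n e ≡ conv (λ a b → f a b e) n
  conv-eval f zero    e = refl
  conv-eval f (suc n) e = cong (f 0 (suc n) e ℚ.+_) (conv-eval (λ a b → f (suc a) b) n e)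

  sum-eval : ∀ n (f : ℕ → Series) e → B𝕎.sum n f e ≡ sum n (λ m → f m e)
  sum-eval zero    f e = refl
  sum-eval (suc n) f e = cong (ℚ._+ f n e) (sum-eval n f e)

  Double : Set
  Double = ℕ → Series

  Supported : Double → Set
  Supported X = ∀ n → Ord n (X n)

  -- The substitution z ↦ z/w, transposed: the coefficient of wⁱzⁿ in G X is that of wⁿ⁺ⁱzⁿ in X.
  G : Double → Double
  G X i n = X n (n ℕ.+ i)

  supported-⊛ : ∀ {X Y} → Supported X → Supported Y → Supported (X B𝕎.⊛ Y)
  supported-⊛ {X} {Y} sX sY n = ord-conv _ n (λ a b eq → subst (λ k → Ord k (X a ⊛ Y b)) eq (ord-* {a} {b} {X a} {Y b} (sX a) (sY b)))

  -- `G` reads only the exponents of w that are at least n at zⁿ. The support condition guarantees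
  -- that no product of smaller exponents contributes, so that regrading is multiplicative in both
  -- indices.
  G-⊛ : ∀ {X Y} → Supported X → Supported Y → ∀ i → G (X B𝕎.⊛ Y) i ≋ B𝕎.conv (λ h l → G X h ⊛ G Y l) i
  G-⊛ {X} {Y} sX sY i n = begin
    (X B𝕎.⊛ Y) n (n ℕ.+ i)
      ≡⟨ conv-eval (λ a b → X a ⊛ Y b) n (n ℕ.+ i) ⟩
    conv (λ a b → conv (λ c d → X a c ℚ.* Y b d) (n ℕ.+ i)) n
      ≡⟨ ℚS.conv-cong≡ n shifted ⟩
    conv (λ a b → conv (λ c d → G X c a ℚ.* G Y d b) i) n
      ≡⟨ ℚS.conv-swap (λ a b c d → G X c a ℚ.* G Y d b) n i ⟩
    conv (λ c d → (G X c ⊛ G Y d) n) i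
      ≡⟨ conv-eval (λ c d → G X c ⊛ G Y d) i n ⟨
    B𝕎.conv (λ h l → G X h ⊛ G Y l) i n ∎
    where
    open ≡-Reasoning
    shifted : ∀ a b → a ℕ.+ b ≡ n → conv (λ c d → X a c ℚ.* Y b d) (n ℕ.+ i) ≡ conv (λ c d → G X c a ℚ.* G Y d b) i
    shifted a b refl = begin
      conv (λ c d → X a c ℚ.* Y b d) (a ℕ.+ b ℕ.+ i)       ≡⟨ cong (conv (λ c d → X a c ℚ.* Y b d)) (ℕₚ.+-assoc a b i) ⟩
      conv (λ c d → X a c ℚ.* Y b d) (a ℕ.+ (b ℕ.+ i))
        ≡⟨ ℚS.conv-shiftˡ a (b ℕ.+ i) (λ c d c<a → trans (cong (ℚ._* Y b d) (sX a c c<a)) (ℚₚ.*-zeroˡ (Y b d))) ⟩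
      conv (λ c d → X a (a ℕ.+ c) ℚ.* Y b d) (b ℕ.+ i)
        ≡⟨ ℚS.conv-shiftʳ b i (λ c d d<b → trans (cong (X a (a ℕ.+ c) ℚ.*_) (sY b d d<b)) (ℚₚ.*-zeroʳ (X a (a ℕ.+ c)))) ⟩
      conv (λ c d → G X c a ℚ.* G Y d b) i ∎

  G-coefficient : ∀ (β : Series) {X} → Supported X → ∀ n i → (β ⊛ X n) (n ℕ.+ i) ≡ conv (λ d r → β d ℚ.* G X r n) i
  G-coefficient β {X} sX n i = ℚS.conv-shiftʳ n i (λ c d d<n → trans (cong (β c ℚ.*_) (sX n d d<n)) (ℚₚ.*-zeroʳ (β c)))

  G-D : ∀ X i → G (B𝕎.D X) i ≋ ℚS.D (G X i)
  G-D X i n = ℚS.constant-⊛ (ℕ→ℚ n) (X n) (n ℕ.+ i)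

  w-supported : ∀ (X : Double) → (∀ n → Ord (n ∸ 1) (X n)) → Supported (λ n → w ⊛ X n)
  w-supported X o zero    = ord-any {w ⊛ X 0}
  w-supported X o (suc n) = ord-* {1} {n} {w} {X (suc n)} ord-w (o (suc n))

  G-w-0 : ∀ {X} → Supported X → G (λ n → w ⊛ X n) 0 ≋ 𝕎.0#
  G-w-0 {X} sX zero    = w-⊛ (X 0) 0
  G-w-0 {X} sX (suc n) = trans (w-⊛ (X (suc n)) (suc n ℕ.+ 0)) (sX (suc n) (n ℕ.+ 0) (s≤s (ℕₚ.≤-reflexive (ℕₚ.+-identityʳ n))))

  G-w-suc : ∀ X i → G (λ n → w ⊛ X n) (suc i) ≋ G X i
  G-w-suc X i n = trans (w-⊛ (X n) (n ℕ.+ suc i)) (cong (ℚS.shift (X n)) (ℕₚ.+-suc n i))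

  powW : ℕ → Series
  powW = 𝕎.pow w

  shiftBy : ℕ → Series → Series
  shiftBy m X e = X (m ℕ.+ e)

  w^-shiftBy : ∀ m X → Ord m X → powW m ⊛ shiftBy m X ≋ X
  w^-shiftBy zero    X o = 𝕎.*-identityˡ X
  w^-shiftBy (suc m) X o n = trans (𝕎.*-assoc w (powW m) (shiftBy (suc m) X) n)
    (trans (w-⊛ (powW m ⊛ shiftBy (suc m) X) n) (tail n))
    where
    tail : ∀ n → ℚS.shift (powW m ⊛ shiftBy (suc m) X) n ≡ X n
    tail zero    = sym (o 0 (s≤s z≤n))
    tail (suc n) = w^-shiftBy m (λ e → X (suc e)) (λ e e<m → o (suc e) (s≤s e<m)) n

  ∸-+-≤ : ∀ a b m → (a ℕ.+ b) ∸ suc m ≤ (a ∸ 1) ℕ.+ (b ∸ m)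
  ∸-+-≤ zero    b m = ℕₚ.∸-monoʳ-≤ b (ℕₚ.n≤1+n m)
  ∸-+-≤ (suc a) b m = ℕₚ.m≤n+o⇒m∸n≤o (a ℕ.+ b) m (begin
    a ℕ.+ b                  ≤⟨ ℕₚ.+-monoʳ-≤ a (ℕₚ.m≤n+m∸n b m) ⟩
    a ℕ.+ (m ℕ.+ (b ∸ m))    ≡⟨ ℕₚ.+-assoc a m (b ∸ m) ⟨
    a ℕ.+ m ℕ.+ (b ∸ m)      ≡⟨ cong (ℕ._+ (b ∸ m)) (ℕₚ.+-comm a m) ⟩
    m ℕ.+ a ℕ.+ (b ∸ m)      ≡⟨ ℕₚ.+-assoc m a (b ∸ m) ⟩
    m ℕ.+ (a ℕ.+ (b ∸ m))    ∎)
    where open ℕₚ.≤-Reasoning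

  ∸-+-≤′ : ∀ m n → n ∸ 1 ≤ (m ∸ 1) ℕ.+ (n ∸ m)
  ∸-+-≤′ zero    n = ℕₚ.m∸n≤m n 1
  ∸-+-≤′ (suc m) n = ℕₚ.m≤n+o⇒m∸n≤o n 1 (ℕₚ.m≤n+m∸n n (suc m))

  record GradedSetting : Set₁ where
    field
      M A L F    : Double
      M-0        : M 0 ≋ 𝕎.1#
      A-0        : A 0 ≋ 𝕎.0#
      L-0        : L 0 ≋ 𝕎.0#
      M-formula  : B𝕎._≋_ (B𝕎.D M) (B𝕎.D A B𝕎.⊛ M)
      F-formula  : B𝕎._≋_ (B𝕎.D F) (B𝕎.D L B𝕎.⊛ F)
      F≋         : B𝕎._≋_ F (λ n → pow-choose2 𝕎 (𝕎.1# 𝕎.+ w) n ⊛ M n)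
      A-1        : A 1 ≋ 𝕎.1#
      A-2        : A 2 ≋ 𝕎.0#
      A-3        : A 3 3 ≡ ℚ.- (ℤ.+ 1 ℚ./ 6)
      A-sparse   : ∀ m e → 2 ℕ.* e < 3 ℕ.* m → A (suc m) e ≡ 0ℚ

    setting : Setting
    setting = record
      { coefficients = 𝕎 ; derivation = ∇ ; w = w ; ∂-q = ∂-1+w ; M = M ; A = A ; L = L ; F = F
      ; M-0 = M-0 ; A-0 = A-0 ; L-0 = L-0 ; M-formula = M-formula ; F-formula = F-formula ; F≋ = F≋ }

  module Graded (𝒢 : GradedSetting) where
    open GradedSetting 𝒢 using (A-1; A-2; A-3; A-sparse; setting)
    open Bivariate setting public using (E; Y; L; A; Ψ; powE; σ; q; ∂; ∂S; ∂-*; ∂-cong; scale; E-0; E-1;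
      Y≋Ψ; vertex-equation; edge-equation; powE-vanishes; ∂-1; ∂-0; ∂-+; ∂-pow-q)
    module B = B𝕎
    module 𝔹 = QAlgebra B.series-algebra
    private
      module S = 𝔹.Solver
      module 𝕎S = 𝕎.Solver
      module 𝕎R = SetoidReasoning 𝕎.setoid

    ord-σ : ∀ {k} X n → Ord k (X n) → Ord k (σ X n)
    ord-σ {k} X n o = ord-* {0} {k} {𝕎.pow q n} {X n} (ord-any {𝕎.pow q n}) o

    A-ord : ∀ m → Ord (m ∸ 1) (A m)
    A-ord zero          = ord-any {A 0}
    A-ord (suc m) e e<m = A-sparse m e (ℕₚ.<-≤-trans (ℕₚ.*-monoʳ-< 2 e<m) (ℕₚ.*-monoˡ-≤ m {2} {3} (s≤s (s≤s z≤n))))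

    private
      EOrd : ℕ → Set
      EOrd n = Ord (n ∸ 1) (E n)

    powE-ord : ∀ N → (∀ a → a ≤ N → EOrd a) → ∀ m n → n ≤ N → Ord (n ∸ m) (powE m n)
    powE-ord N eo zero    zero    _   = ord-any {powE 0 0}
    powE-ord N eo zero    (suc n) _   = ord-0
    powE-ord N eo (suc m) n       n≤N = ord-conv (λ a b → E a ⊛ σ (powE m) b) n term
      where
      term : ∀ a b → a ℕ.+ b ≡ n → Ord (n ∸ suc m) (E a ⊛ σ (powE m) b)
      term a b refl = ord-≤ {X = E a ⊛ σ (powE m) b} (∸-+-≤ a b m)
        (ord-* {a ∸ 1} {b ∸ m} {E a} {σ (powE m) b} (eo a (ℕₚ.≤-trans (ℕₚ.m≤m+n a b) n≤N))
          (ord-σ (powE m) b (powE-ord N eo m b (ℕₚ.≤-trans (ℕₚ.m≤n+m b a) n≤N))))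

    -- A cluster of m vertices has order at least m - 1 and the coefficient of zⁿ in `powE m` has
    -- order at least n - m. Only the orders of E up to n enter, as the induction for E needs.
    Y-ord′ : ∀ n → (∀ a → a ≤ n → EOrd a) → Ord (n ∸ 1) (Y n)
    Y-ord′ n eo = ord-cong (𝕎.sym {Y n} (Y≋Ψ n)) (ord-sum (suc n) (λ m → B.D A m ⊛ powE m n) (λ m →
      ord-≤ {X = B.D A m ⊛ powE m n} (∸-+-≤′ m n) (ord-* {m ∸ 1} {n ∸ m} {B.D A m} {powE m n}
        (ord-* {0} {m ∸ 1} {𝕎.ν m} {A m} (ord-any {𝕎.ν m}) (A-ord m)) (powE-ord n eo m n ℕₚ.≤-refl))))

    pow-q-0 : ∀ n → 𝕎.pow q n 0 ≡ 1ℚ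
    pow-q-0 zero    = refl
    pow-q-0 (suc n) = trans (cong (1ℚ ℚ.*_) (pow-q-0 n)) refl

    difference-ord : ∀ b {k} → Ord k (Y b) → Ord (suc k) (σ Y b 𝕎.+ 𝕎.- Y b)
    difference-ord b {k} o = ord-cong (𝕎.sym {σ Y b 𝕎.+ 𝕎.- Y b} factor)
      (ord-* {1} {k} {𝕎.pow q b 𝕎.+ 𝕎.- 𝕎.1#} {Y b} (pow-q-1 b) o)
      where
      factor : σ Y b 𝕎.+ 𝕎.- Y b ≋ (𝕎.pow q b 𝕎.+ 𝕎.- 𝕎.1#) ⊛ Y b
      factor n = trans (cong (λ x → σ Y b n ℚ.+ ℚ.- x) (sym (𝕎.*-identityˡ (Y b) n)))
        (𝕎S.solve 3 (λ p o y → p 𝕎S.:* y 𝕎S.:+ 𝕎S.:- (o 𝕎S.:* y) 𝕎S.:= (p 𝕎S.:+ 𝕎S.:- o) 𝕎S.:* y) (λ _ → refl) (𝕎.pow q b) 𝕎.1# (Y b) n)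
      pow-q-1 : ∀ b → Ord 1 (𝕎.pow q b 𝕎.+ 𝕎.- 𝕎.1#)
      pow-q-1 b zero    _ = cong (ℚ._+ ℚ.- 1ℚ) (pow-q-0 b)
      pow-q-1 b (suc e) (s≤s ())

    Y-0 : Y 0 ≋ 𝕎.0#
    Y-0 n = trans (ℚS.constant-⊛ 0ℚ (L 0) n) (ℚₚ.*-zeroˡ (L 0 n))

    -- At z^N the vertex equation reads (N - 1) E_N = sum of E_a (σY - Y)_b. Summands with a = 0 or
    -- b = 0 vanish, so only indices below N remain; since q^b - 1 is divisible by w, each summand
    -- has order (a - 1) + b = N - 1.
    E-ord : ∀ n → EOrd n
    E-ord = <-rec EOrd step
      where
      step : ∀ n → (∀ {m} → m < n → EOrd m) → EOrd n
      step zero          rec = ord-any {E 0}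
      step (suc zero)    rec = ord-any {E 1}
      step (suc (suc n)) rec e e<n = trans (sym (ℚₚ.*-identityˡ (E N e))) (*-cancelʳ-ℕ→ℚ (suc n) (begin
        1ℚ ℚ.* E N e ℚ.* ℕ→ℚ (suc n)
          ≡⟨ ℚ-solve 2 (λ n x → con 1ℚ :* x :* n := (con 1ℚ :+ n) :* x :+ :- x) refl (ℕ→ℚ (suc n)) (E N e) ⟩
        (1ℚ ℚ.+ ℕ→ℚ (suc n)) ℚ.* E N e ℚ.+ ℚ.- E N e
          ≡⟨ cong (λ x → x ℚ.* E N e ℚ.+ ℚ.- E N e) (ℕ→ℚ-suc (suc n)) ⟨
        ℕ→ℚ N ℚ.* E N e ℚ.+ ℚ.- E N e
          ≡⟨ cong (ℚ._+ ℚ.- E N e) (trans (sym (ℚS.constant-⊛ (ℕ→ℚ N) (E N) e)) (vertex-equation N e)) ⟩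
        E N e ℚ.+ K e ℚ.+ ℚ.- E N e
          ≡⟨ ℚ-solve 2 (λ x k → x :+ k :+ :- x := k) refl (E N e) (K e) ⟩
        K e
          ≡⟨ ord-conv (λ a b → E a ⊛ (σ Y b 𝕎.+ 𝕎.- Y b)) N term e e<n ⟩
        0ℚ
          ≡⟨ ℚₚ.*-zeroˡ (ℕ→ℚ (suc n)) ⟨
        0ℚ ℚ.* ℕ→ℚ (suc n) ∎))
        where
        open ≡-Reasoning
        open QAlgebra.Solver ℚ-algebra using (_:=_; _:+_; _:*_; :-_; con) renaming (solve to ℚ-solve)
        N = suc (suc n)
        K = (E B.⊛ (σ Y 𝔹.+ 𝔹.- Y)) N
        term : ∀ a b → a ℕ.+ b ≡ N → Ord (suc n) (E a ⊛ (σ Y b 𝕎.+ 𝕎.- Y b))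
        term zero b _ e _ = trans (𝕎.*-congʳ {σ Y b 𝕎.+ 𝕎.- Y b} E-0 e) (𝕎.zeroˡ (σ Y b 𝕎.+ 𝕎.- Y b) e)
        term (suc a) zero _ e _ = trans (𝕎.*-congˡ {E (suc a)} zero-difference e) (𝕎.zeroʳ (E (suc a)) e)
          where
          zero-difference : σ Y 0 𝕎.+ 𝕎.- Y 0 ≋ 𝕎.0#
          zero-difference m = trans (cong (ℚ._+ ℚ.- Y 0 m) (𝕎.*-identityˡ (Y 0) m)) (ℚₚ.+-inverseʳ (Y 0 m))
        term (suc a) (suc b) eq = subst (λ k → Ord k (E (suc a) ⊛ (σ Y (suc b) 𝕎.+ 𝕎.- Y (suc b))))
          (ℕₚ.suc-injective eq)
          (ord-* {a} {suc b} {E (suc a)} {σ Y (suc b) 𝕎.+ 𝕎.- Y (suc b)} (rec (subst (suc a <_) eq (ℕₚ.m<m+n (suc a) (s≤s z≤n))))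
            (difference-ord (suc b) (Y-ord′ (suc b) (λ c c≤b → rec (ℕₚ.≤-<-trans c≤b (subst (suc b <_) eq (ℕₚ.m<n+m (suc b) (s≤s z≤n))))))))

    Y-ord : ∀ n → Ord (n ∸ 1) (Y n)
    Y-ord n = Y-ord′ n (λ a _ → E-ord a)

    L-ord : ∀ n → Ord (n ∸ 1) (L n)
    L-ord zero    = ord-any {L 0}
    L-ord (suc n) e e<n = *-cancelʳ-ℕ→ℚ (suc n) (trans (ℚₚ.*-comm (L (suc n) e) (ℕ→ℚ (suc n)))
      (trans (sym (ℚS.constant-⊛ (ℕ→ℚ (suc n)) (L (suc n)) e)) (trans (Y-ord (suc n) e e<n) (sym (ℚₚ.*-zeroˡ (ℕ→ℚ (suc n)))))))

    -- The orders n - 1 fall short of the support condition by one; the factor w repairs this and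
    -- shifts the index, so that trees receive index 0.
    Ê Ŷ L̂ : Double
    Ê = scale w E
    Ŷ = scale w Y
    L̂ = scale w L

    Ê-supported : Supported Ê
    Ê-supported = w-supported E E-ord

    Ŷ-supported : Supported Ŷ
    Ŷ-supported = w-supported Y Y-ord

    L̂-supported : Supported L̂
    L̂-supported = w-supported L L-ord

    σ-supported : ∀ {X} → Supported X → Supported (σ X)
    σ-supported {X} sX n = ord-σ X n (sX n)

    powÊ : ℕ → Double
    powÊ zero    = 𝔹.1#
    powÊ (suc m) = Ê B.⊛ σ (powÊ m)

    powÊ-supported : ∀ m → Supported (powÊ m)
    powÊ-supported zero    zero    = ord-any {powÊ 0 0}
    powÊ-supported zero    (suc n) = ord-0
    powÊ-supported (suc m) = supported-⊛ Ê-supported (σ-supported (powÊ-supported m))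

    powÊ≋ : ∀ m n → powÊ m n ≋ powW m ⊛ powE m n
    powÊ≋ zero    n = 𝕎.sym {𝕎.1# ⊛ 𝔹.1# n} (𝕎.*-identityˡ (𝔹.1# n))
    powÊ≋ (suc m) n = begin
      B.conv (λ a b → (w ⊛ E a) ⊛ (𝕎.pow q b ⊛ powÊ m b)) n
        ≈⟨ B.conv-cong (λ a b → 𝕎.*-congˡ {w ⊛ E a} (𝕎.*-congˡ {𝕎.pow q b} (powÊ≋ m b))) n ⟩
      B.conv (λ a b → (w ⊛ E a) ⊛ (𝕎.pow q b ⊛ (powW m ⊛ powE m b))) n
        ≈⟨ B.conv-cong (λ a b → 𝕎S.solve 5 (λ w e q c p → (w 𝕎S.:* e) 𝕎S.:* (q 𝕎S.:* (c 𝕎S.:* p)) 𝕎S.:= (w 𝕎S.:* c) 𝕎S.:* (e 𝕎S.:* (q 𝕎S.:* p)))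
             (λ _ → refl) w (E a) (𝕎.pow q b) (powW m) (powE m b)) n ⟩
      B.conv (λ a b → (w ⊛ powW m) ⊛ (E a ⊛ σ (powE m) b)) n
        ≈⟨ B.conv-*ˡ (w ⊛ powW m) (λ a b → E a ⊛ σ (powE m) b) n ⟩
      powW (suc m) ⊛ powE (suc m) n ∎
      where open 𝕎R

    powÊ-vanishes : ∀ m {n} → n < m → powÊ m n ≋ 𝕎.0#
    powÊ-vanishes m {n} n<m e = trans (powÊ≋ m n e) (trans (𝕎.*-congˡ {powW m} (powE-vanishes m n<m) e) (𝕎.zeroʳ (powW m) e))

    Ψ̂ : (ℕ → Series) → Double
    Ψ̂ β n = B.sum (suc n) (λ m → β m ⊛ powÊ m n)

    Ψ̂-supported : ∀ β → Supported (Ψ̂ β)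
    Ψ̂-supported β n = ord-sum (suc n) (λ m → β m ⊛ powÊ m n) (λ m → ord-* {0} {n} {β m} {powÊ m n} (ord-any {β m}) (powÊ-supported m n))

    Ψ≋Ψ̂ : ∀ X β → (∀ m → X m ≋ powW m ⊛ β m) → B._≋_ (Ψ X) (Ψ̂ β)
    Ψ≋Ψ̂ X β eq n = B.sum-cong (suc n) (λ m _ → begin
      X m ⊛ powE m n                  ≈⟨ 𝕎.*-congʳ {powE m n} (eq m) ⟩
      (powW m ⊛ β m) ⊛ powE m n       ≈⟨ 𝕎S.solve 3 (λ c b p → (c 𝕎S.:* b) 𝕎S.:* p 𝕎S.:= b 𝕎S.:* (c 𝕎S.:* p)) (λ _ → refl) (powW m) (β m) (powE m n) ⟩
      β m ⊛ (powW m ⊛ powE m n)       ≈⟨ 𝕎.*-congˡ {β m} (powÊ≋ m n) ⟨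
      β m ⊛ powÊ m n                  ∎)
      where open 𝕎R

    -- A cluster with m vertices and m + d edges satisfies 2(m + d) ≥ 3(m - 1), that is, m ≤ 3 + 2d.
    -- With w^m divided out, larger m contribute nothing up to order d.
    Sparse : (ℕ → Series) → Set
    Sparse β = ∀ m d → 3 ℕ.+ 2 ℕ.* d < m → Ord (suc d) (β m)

    -- The sum over m in `Ψ̂` has a length depending on n. It is extended to a common length, where
    -- `powÊ m` vanishes for m > n, and cut back by sparsity to a length depending on i alone, so
    -- that it becomes a finite sum of series.
    G-Ψ̂ : ∀ β → Sparse β → ∀ i →
      G (Ψ̂ β) i ≋ B.sum (4 ℕ.+ 2 ℕ.* i) (λ m → B.conv (λ d r → 𝕎.ι (β m d) ⊛ G (powÊ m) r) i)
    G-Ψ̂ β sparse i n = begin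
      B.sum (suc n) (λ m → β m ⊛ powÊ m n) (n ℕ.+ i)
        ≡⟨ sum-eval (suc n) (λ m → β m ⊛ powÊ m n) (n ℕ.+ i) ⟩
      sum (suc n) (λ m → (β m ⊛ powÊ m n) (n ℕ.+ i))
        ≡⟨ ℚS.sum-cong (suc n) (λ m _ → G-coefficient (β m) {powÊ m} (powÊ-supported m) n i) ⟩
      sum (suc n) t
        ≡⟨ ℚS.sum-truncate-≤ (ℕₚ.m≤m+n (suc n) (4 ℕ.+ 2 ℕ.* i)) (λ m n<m → ℚS.conv-0 i (λ d r _ →
             trans (cong (β m d ℚ.*_) (powÊ-vanishes m n<m (n ℕ.+ r))) (ℚₚ.*-zeroʳ (β m d)))) ⟨
      sum (suc n ℕ.+ (4 ℕ.+ 2 ℕ.* i)) t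
        ≡⟨ ℚS.sum-truncate-≤ (ℕₚ.m≤n+m (4 ℕ.+ 2 ℕ.* i) (suc n)) (λ m big → ℚS.conv-0 i (λ d r eq →
             trans (cong (ℚ._* G (powÊ m) r n) (sparse m i big d (s≤s (subst (d ≤_) eq (ℕₚ.m≤m+n d r))))) (ℚₚ.*-zeroˡ (G (powÊ m) r n)))) ⟩
      sum (4 ℕ.+ 2 ℕ.* i) t
        ≡⟨ ℚS.sum-cong (4 ℕ.+ 2 ℕ.* i) (λ m _ → trans (ℚS.conv-cong (λ d r → sym (ℚS.constant-⊛ (β m d) (G (powÊ m) r) n)) i)
             (sym (conv-eval (λ d r → 𝕎.ι (β m d) ⊛ G (powÊ m) r) i n))) ⟩
      sum (4 ℕ.+ 2 ℕ.* i) (λ m → B.conv (λ d r → 𝕎.ι (β m d) ⊛ G (powÊ m) r) i n)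
        ≡⟨ sum-eval (4 ℕ.+ 2 ℕ.* i) (λ m → B.conv (λ d r → 𝕎.ι (β m d) ⊛ G (powÊ m) r) i) n ⟨
      B.sum (4 ℕ.+ 2 ℕ.* i) (λ m → B.conv (λ d r → 𝕎.ι (β m d) ⊛ G (powÊ m) r) i) n ∎
      where
      open ≡-Reasoning
      t : ℕ → ℚ
      t m = conv (λ d r → β m d ℚ.* G (powÊ m) r n) i

    -- A with the contribution z of the isolated vertices removed
    A° : Double
    A° zero                = A 0
    A° (suc zero)          = 𝕎.0#
    A° (suc (suc m))       = A (suc (suc m))

    δ₁ : Double
    δ₁ = B.shift 𝔹.1#

    A≋ : ∀ m → A m ≋ δ₁ m 𝕎.+ A° m
    A≋ zero          e = sym (ℚₚ.+-identityˡ (A 0 e))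
    A≋ (suc zero)    e = trans (A-1 e) (sym (ℚₚ.+-identityʳ (𝕎.1# e)))
    A≋ (suc (suc m)) e = sym (ℚₚ.+-identityˡ (A (suc (suc m)) e))

    A°-ord : ∀ m → Ord m (A° m)
    A°-ord zero                = ord-any {A 0}
    A°-ord (suc zero)          = ord-0
    A°-ord (suc (suc zero))    e _ = A-2 e
    A°-ord (suc (suc (suc m))) e (s≤s e≤) = A-sparse (suc (suc m)) e (s≤s (begin
      2 ℕ.* e                     ≤⟨ ℕₚ.*-monoʳ-≤ 2 e≤ ⟩
      2 ℕ.* (2 ℕ.+ m)             ≡⟨ ℕₚ.*-distribˡ-+ 2 2 m ⟩
      4 ℕ.+ 2 ℕ.* m               ≤⟨ ℕₚ.+-mono-≤ {4} {5} (s≤s (s≤s (s≤s (s≤s z≤n)))) (ℕₚ.*-monoˡ-≤ m {2} {3} (s≤s (s≤s z≤n))) ⟩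
      5 ℕ.+ 3 ℕ.* m               ≡⟨ cong ℕ.pred (ℕₚ.*-distribˡ-+ 3 2 m) ⟨
      ℕ.pred (3 ℕ.* (2 ℕ.+ m))    ∎))
      where open ℕₚ.≤-Reasoning

    α̂ : ℕ → Series
    α̂ m = shiftBy m (A° m)

    w^-α̂ : ∀ m → powW m ⊛ α̂ m ≋ A° m
    w^-α̂ m = w^-shiftBy m (A° m) (A°-ord m)

    α̂-sparse : Sparse α̂
    α̂-sparse (suc zero)    d _ = ord-0
    α̂-sparse (suc (suc m)) d (s≤s (s≤s big)) e (s≤s e≤d) = A-sparse (suc m) (suc (suc m) ℕ.+ e) (begin-strict
      2 ℕ.* (2 ℕ.+ m ℕ.+ e)             ≤⟨ ℕₚ.*-monoʳ-≤ 2 (ℕₚ.+-monoʳ-≤ (2 ℕ.+ m) e≤d) ⟩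
      2 ℕ.* (2 ℕ.+ m ℕ.+ d)             ≡⟨ ℕₚ.*-distribˡ-+ 2 (2 ℕ.+ m) d ⟩
      2 ℕ.* (2 ℕ.+ m) ℕ.+ 2 ℕ.* d       ≡⟨ cong (ℕ._+ 2 ℕ.* d) (ℕₚ.*-distribˡ-+ 2 2 m) ⟩
      4 ℕ.+ 2 ℕ.* m ℕ.+ 2 ℕ.* d         ≡⟨ cong (4 ℕ.+_) (ℕₚ.+-comm (2 ℕ.* m) (2 ℕ.* d)) ⟩
      2 ℕ.+ (2 ℕ.+ 2 ℕ.* d) ℕ.+ 2 ℕ.* m ≤⟨ ℕₚ.+-monoˡ-≤ (2 ℕ.* m) (ℕₚ.+-monoʳ-≤ 2 big) ⟩
      2 ℕ.+ m ℕ.+ 2 ℕ.* m               <⟨ ℕₚ.≤-refl ⟩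
      3 ℕ.+ 3 ℕ.* m                     ≡⟨ ℕₚ.*-suc 3 m ⟨
      3 ℕ.* suc m                       ∎)
      where open ℕₚ.≤-Reasoning

    νCoefficient : ℕ → Series
    νCoefficient m = 𝕎.ν m ⊛ α̂ m

    νCoefficient-sparse : Sparse νCoefficient
    νCoefficient-sparse m d big = ord-* {0} {suc d} {𝕎.ν m} {α̂ m} (ord-any {𝕎.ν m}) (α̂-sparse m d big)

    -- The quotient of ∂(w^m α̂_m) by w^m, by the product rule with ∂w = q w.
    ∂Coefficient : ℕ → Series
    ∂Coefficient m = 𝕎.ν m ⊛ (q ⊛ α̂ m) 𝕎.+ ∂ (α̂ m)

    ∂Coefficient-sparse : Sparse ∂Coefficient
    ∂Coefficient-sparse m d big = ord-+ {X = 𝕎.ν m ⊛ (q ⊛ α̂ m)}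
      (ord-* {0} {suc d} {𝕎.ν m} {q ⊛ α̂ m} (ord-any {𝕎.ν m}) (ord-* {0} {suc d} {q} {α̂ m} (ord-any {q}) (α̂-sparse m d big)))
      (ord-* {0} {suc d} {q} {ℚS.D (α̂ m)} (ord-any {q}) (λ e e<d → trans (cong (ℕ→ℚ e ℚ.*_) (α̂-sparse m d big e e<d)) (ℚₚ.*-zeroʳ (ℕ→ℚ e))))

    ∂-powW : ∀ m → ∂ (powW m) ≋ 𝕎.ν m ⊛ (q ⊛ powW m)
    ∂-powW zero    e = trans (∂-1 e) (sym (trans (ℚS.constant-⊛ 0ℚ (q ⊛ 𝕎.1#) e) (ℚₚ.*-zeroˡ ((q ⊛ 𝕎.1#) e))))
    ∂-powW (suc m) = begin
      ∂ (w ⊛ powW m)                                          ≈⟨ ∂-* w (powW m) ⟩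
      ∂ w ⊛ powW m 𝕎.+ w ⊛ ∂ (powW m)                         ≈⟨ (λ e → cong₂ ℚ._+_ (𝕎.*-congʳ {powW m} ∂-w e) (𝕎.*-congˡ {w} (∂-powW m) e)) ⟩
      (q ⊛ w) ⊛ powW m 𝕎.+ w ⊛ (𝕎.ν m ⊛ (q ⊛ powW m))         ≈⟨ 𝕎S.solve 4 (λ q w p n → (q 𝕎S.:* w) 𝕎S.:* p 𝕎S.:+ w 𝕎S.:* (n 𝕎S.:* (q 𝕎S.:* p)) 𝕎S.:= (𝕎S.con 1ℚ 𝕎S.:+ n) 𝕎S.:* (q 𝕎S.:* (w 𝕎S.:* p)))
                                                                   (λ _ → refl) q w (powW m) (𝕎.ν m) ⟩
      (𝕎.ι 1ℚ 𝕎.+ 𝕎.ν m) ⊛ (q ⊛ powW (suc m))                 ≈⟨ 𝕎.*-congʳ {q ⊛ powW (suc m)} (𝕎.ν-suc m) ⟨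
      𝕎.ν (suc m) ⊛ (q ⊛ powW (suc m))                        ∎
      where open 𝕎R

    ∂A≋ : ∀ m → ∂S A m ≋ powW m ⊛ ∂Coefficient m
    ∂A≋ m = begin
      ∂ (A m)                                                        ≈⟨ ∂-cong (A≋ m) ⟩
      ∂ (δ₁ m 𝕎.+ A° m)                                              ≈⟨ ∂-+ (δ₁ m) (A° m) ⟩
      ∂ (δ₁ m) 𝕎.+ ∂ (A° m)                                          ≈⟨ (λ e → cong₂ ℚ._+_ (∂-δ₁ m e) (∂-cong (𝕎.sym {powW m ⊛ α̂ m} (w^-α̂ m)) e)) ⟩
      𝕎.0# 𝕎.+ ∂ (powW m ⊛ α̂ m)                                      ≈⟨ 𝕎.+-identityˡ (∂ (powW m ⊛ α̂ m)) ⟩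
      ∂ (powW m ⊛ α̂ m)                                               ≈⟨ ∂-* (powW m) (α̂ m) ⟩
      ∂ (powW m) ⊛ α̂ m 𝕎.+ powW m ⊛ ∂ (α̂ m)                          ≈⟨ 𝕎.+-congʳ {powW m ⊛ ∂ (α̂ m)} (𝕎.*-congʳ {α̂ m} (∂-powW m)) ⟩
      (𝕎.ν m ⊛ (q ⊛ powW m)) ⊛ α̂ m 𝕎.+ powW m ⊛ ∂ (α̂ m)              ≈⟨ 𝕎S.solve 5 (λ n q p a d → (n 𝕎S.:* (q 𝕎S.:* p)) 𝕎S.:* a 𝕎S.:+ p 𝕎S.:* d 𝕎S.:= p 𝕎S.:* (n 𝕎S.:* (q 𝕎S.:* a) 𝕎S.:+ d))
                                                                          (λ _ → refl) (𝕎.ν m) q (powW m) (α̂ m) (∂ (α̂ m)) ⟩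
      powW m ⊛ ∂Coefficient m                                        ∎
      where
      open 𝕎R
      ∂-δ₁ : ∀ m → ∂ (δ₁ m) ≋ 𝕎.0#
      ∂-δ₁ zero          = ∂-0
      ∂-δ₁ (suc zero)    = ∂-1
      ∂-δ₁ (suc (suc m)) = ∂-0

    DA°≋ : ∀ m → B.D A° m ≋ powW m ⊛ νCoefficient m
    DA°≋ m = begin
      𝕎.ν m ⊛ A° m                    ≈⟨ 𝕎.*-congˡ {𝕎.ν m} (w^-α̂ m) ⟨
      𝕎.ν m ⊛ (powW m ⊛ α̂ m)          ≈⟨ 𝕎S.solve 3 (λ n p a → n 𝕎S.:* (p 𝕎S.:* a) 𝕎S.:= p 𝕎S.:* (n 𝕎S.:* a)) (λ _ → refl) (𝕎.ν m) (powW m) (α̂ m) ⟩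
      powW m ⊛ (𝕎.ν m ⊛ α̂ m)          ∎
      where open 𝕎R

    -- The one-vertex cluster is the term z of log M, and Ψ replaces z by E. It is split off because
    -- its order 0 lies below its size 1, which rules out division by w^m.
    Ψ-δ₁ : B._≋_ (Ψ δ₁) E
    Ψ-δ₁ zero    e = trans (trans (ℚₚ.+-identityˡ ((𝕎.0# ⊛ 𝕎.1#) e)) (𝕎.zeroˡ 𝕎.1# e)) (sym (E-0 e))
    Ψ-δ₁ (suc n) e = begin
      Ψ δ₁ (suc n) e
        ≡⟨ trans (B.sum-first (suc n) f e) (cong (f 0 e ℚ.+_) (B.sum-first n (λ j → f (suc j)) e)) ⟩
      f 0 e ℚ.+ (f 1 e ℚ.+ B.sum n (λ j → f (suc (suc j))) e)
        ≡⟨ cong₂ ℚ._+_ (𝕎.zeroˡ (powE 0 (suc n)) e) (cong₂ ℚ._+_ (trans (𝕎.*-identityˡ (powE 1 (suc n)) e) (powE-1 e)) rest) ⟩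
      0ℚ ℚ.+ (E (suc n) e ℚ.+ 0ℚ)
        ≡⟨ trans (ℚₚ.+-identityˡ (E (suc n) e ℚ.+ 0ℚ)) (ℚₚ.+-identityʳ (E (suc n) e)) ⟩
      E (suc n) e ∎
      where
      open ≡-Reasoning
      f : ℕ → Series
      f m = δ₁ m ⊛ powE m (suc n)
      rest : B.sum n (λ j → f (suc (suc j))) e ≡ 0ℚ
      rest = trans (sum-eval n (λ j → f (suc (suc j))) e) (trans
        (ℚS.sum-cong n {g = λ _ → 0ℚ} (λ j _ → 𝕎.zeroˡ (powE (suc (suc j)) (suc n)) e)) (ℚS.sum-truncate-≤ {0} {n} z≤n (λ _ _ → refl)))
      σ-1 : B._≋_ (σ 𝔹.1#) 𝔹.1#
      σ-1 zero    = 𝕎.*-identityˡ 𝕎.1#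
      σ-1 (suc n) = 𝕎.zeroʳ (𝕎.pow q (suc n))
      powE-1 : powE 1 (suc n) ≋ E (suc n)
      powE-1 e = trans (𝔹.*-congˡ {E} σ-1 (suc n) e) (𝔹.*-identityʳ E (suc n) e)

    Y≋ : B._≋_ Y (E 𝔹.+ Ψ̂ νCoefficient)
    Y≋ n e = begin
      Y n e                                    ≡⟨ Y≋Ψ n e ⟩
      Ψ (B.D A) n e                            ≡⟨ B.sum-cong (suc n) (λ m _ → 𝕎.*-congʳ {powE m n} (DA≋ m)) e ⟩
      Ψ (δ₁ 𝔹.+ B.D A°) n e                    ≡⟨ Ψ-+ n e ⟩
      Ψ δ₁ n e ℚ.+ Ψ (B.D A°) n e              ≡⟨ cong₂ ℚ._+_ (Ψ-δ₁ n e) (Ψ≋Ψ̂ (B.D A°) νCoefficient DA°≋ n e) ⟩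
      E n e ℚ.+ Ψ̂ νCoefficient n e             ∎
      where
      open ≡-Reasoning
      DA≋ : ∀ m → B.D A m ≋ δ₁ m 𝕎.+ B.D A° m
      DA≋ m e = trans (𝕎.*-congˡ {𝕎.ν m} (A≋ m) e) (trans (𝕎.distribˡ (𝕎.ν m) (δ₁ m) (A° m) e) (cong (ℚ._+ B.D A° m e) (D-δ₁ m e)))
        where
        D-δ₁ : ∀ m → 𝕎.ν m ⊛ δ₁ m ≋ δ₁ m
        D-δ₁ zero          = 𝕎.zeroʳ (𝕎.ν 0)
        D-δ₁ (suc zero)    e = trans (ℚS.constant-⊛ 1ℚ 𝕎.1# e) (ℚₚ.*-identityˡ (𝕎.1# e))
        D-δ₁ (suc (suc m)) = 𝕎.zeroʳ (𝕎.ν (suc (suc m)))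
      Ψ-+ : ∀ n e → Ψ (δ₁ 𝔹.+ B.D A°) n e ≡ Ψ δ₁ n e ℚ.+ Ψ (B.D A°) n e
      Ψ-+ n e = trans (B.sum-cong (suc n) (λ m _ → 𝕎.distribʳ (powE m n) (δ₁ m) (B.D A° m)) e) (B.sum-+ (suc n) (λ m → δ₁ m ⊛ powE m n) (λ m → B.D A° m ⊛ powE m n) e)

-- The graded system attached to the bivariate equations

module TreeSystems where
  open RationalAlgebras
  open TreeFunction using (D-Tser)
  open LaurentPolynomials
  open GradedSystems
  open Regrading
  open import Defs using (ℕ→ℚ; Series; Tser)
  open import Data.Nat as ℕ using (ℕ; zero; suc; _≤_; _<_; z≤n; s≤s; _∸_)
  import Data.Nat.Properties as ℕₚ
  open import Data.Nat.Induction using (<-rec)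
  open import Data.Rational as ℚ using (ℚ; 0ℚ; 1ℚ; ½)
  import Data.Rational.Properties as ℚₚ
  import Data.Integer as ℤ
  open import Data.Product using (_,_)
  open import Relation.Binary.PropositionalEquality using (_≡_; trans; sym; refl; cong; cong₂; subst; module ≡-Reasoning)
  import Relation.Binary.Reasoning.Setoid as SetoidReasoning
  open PowerSeries ℚ-algebra hiding (D-+)
  open QAlgebra.Solver ℚ-algebra using (_:=_; _:+_; _:*_; :-_; con) renaming (solve to ℚ-solve)

  unit-cancel : ∀ R X → R 0 ≡ 1ℚ → R ⊛ X ≋ 𝕎.0# → X ≋ 𝕎.0#
  unit-cancel R X R₀ eq = <-rec (λ n → X n ≡ 0ℚ) step
    where
    step : ∀ n → (∀ {m} → m < n → X m ≡ 0ℚ) → X n ≡ 0ℚ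
    step zero    rec = trans (sym (ℚₚ.*-identityˡ (X 0))) (trans (cong (ℚ._* X 0) (sym R₀)) (eq 0))
    step (suc n) rec = begin
      X (suc n)                                                          ≡⟨ trans (ℚₚ.+-identityʳ (1ℚ ℚ.* X (suc n))) (ℚₚ.*-identityˡ (X (suc n))) ⟨
      1ℚ ℚ.* X (suc n) ℚ.+ 0ℚ                                            ≡⟨ cong₂ ℚ._+_ (cong (ℚ._* X (suc n)) (sym R₀)) (sym lower) ⟩
      (R ⊛ X) (suc n)                                                    ≡⟨ eq (suc n) ⟩
      0ℚ                                                                 ∎
      where
      open ≡-Reasoning
      lower : conv (λ a b → R (suc a) ℚ.* X b) n ≡ 0ℚ
      lower = conv-0 n (λ a b a+b≡n → trans (cong (R (suc a) ℚ.*_) (rec (s≤s (subst (b ≤_) a+b≡n (ℕₚ.m≤n+m b a))))) (ℚₚ.*-zeroʳ (R (suc a))))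

  treeAlgebra : TreeAlgebra
  treeAlgebra = record
    { algebra     = series-algebra
    ; D           = D
    ; D-cong      = D-cong
    ; D-+         = PowerSeries.D-+ ℚ-algebra
    ; D-*         = D-⊛
    ; D-ι         = D-constant
    ; T           = Tser
    ; D-T         = D-Tser
    ; Q           = geometric Tser
    ; θ*Q         = θ*Q
    -- D T is z times a series with constant term 1, so it is not a zero divisor.
    ; DT-cancel   = λ X eq → unit-cancel (λ n → D Tser (suc n)) X refl (λ n → trans (sym (shift-⊛ (λ n → D Tser (suc n)) X (suc n)))
                      (trans (𝕎.*-congʳ {X} D-shift (suc n)) (eq (suc n))))
    ; ι-injective = λ p eq → eq 0
    }
    where
    D-shift : shift (λ n → D Tser (suc n)) ≋ D Tser
    D-shift zero    = refl
    D-shift (suc n) = refl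
    θ*Q : (𝕎.1# 𝕎.+ 𝕎.- Tser) ⊛ geometric Tser ≋ 𝕎.1#
    θ*Q = begin
      (𝕎.1# 𝕎.+ 𝕎.- Tser) ⊛ Q                     ≈⟨ S.solve 3 (λ o t g → (o S.:+ S.:- t) S.:* g S.:= o S.:* g S.:+ S.:- (t S.:* g)) (λ _ → refl) 𝕎.1# Tser Q ⟩
      𝕎.1# ⊛ Q 𝕎.+ 𝕎.- (Tser ⊛ Q)                 ≈⟨ 𝕎.+-congʳ {𝕎.- (Tser ⊛ Q)} (λ n → trans (𝕎.*-identityˡ Q n) (geometric-fixpoint {Tser} refl n)) ⟩
      𝕎.1# 𝕎.+ Tser ⊛ Q 𝕎.+ 𝕎.- (Tser ⊛ Q)        ≈⟨ S.solve 2 (λ o x → o S.:+ x S.:+ S.:- x S.:= o) (λ _ → refl) 𝕎.1# (Tser ⊛ Q) ⟩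
      𝕎.1#                                        ∎
      where
      open SetoidReasoning 𝕎.setoid
      module S = 𝕎.Solver
      Q = geometric Tser

  open Poles treeAlgebra public using (In; in-cong; in-poly; in-≤; in-+; in-scale; in-neg; in-*; in-D; in-conv; in-sum; poly-1; in-0; Lead; θ; θ^)

  -- At index n ≥ 2 the equation expresses (n - 1) X_n through products of smaller coefficients, the
  -- extreme summands being zero. At index 1 the factor vanishes, which is why X 1 must be
  -- prescribed.
  tree-equation-unique : ∀ X → D X ≋ X 𝕎.+ X ⊛ D X → X 0 ≡ 0ℚ → X 1 ≡ 1ℚ → X ≋ Tser
  tree-equation-unique X eq X₀ X₁ = <-rec (λ n → X n ≡ Tser n) step
    where
    Lower : ∀ n → Set
    Lower n = ∀ {m} → m < n → X m ≡ Tser m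
    solved : ∀ Z n → D Z ≋ Z 𝕎.+ Z ⊛ D Z → ℕ→ℚ (suc n) ℚ.* Z (suc (suc n)) ≡ (Z ⊛ D Z) (suc (suc n))
    solved Z n eq = begin
      ℕ→ℚ (suc n) ℚ.* z                               ≡⟨ ℚ-solve 2 (λ n z → n :* z := (con 1ℚ :+ n) :* z :+ :- z) refl (ℕ→ℚ (suc n)) z ⟩
      (1ℚ ℚ.+ ℕ→ℚ (suc n)) ℚ.* z ℚ.+ ℚ.- z            ≡⟨ cong (λ x → x ℚ.* z ℚ.+ ℚ.- z) (ℕ→ℚ-suc (suc n)) ⟨
      D Z (suc (suc n)) ℚ.+ ℚ.- z                     ≡⟨ cong (ℚ._+ ℚ.- z) (eq (suc (suc n))) ⟩
      z ℚ.+ (Z ⊛ D Z) (suc (suc n)) ℚ.+ ℚ.- z         ≡⟨ ℚ-solve 2 (λ z k → z :+ k :+ :- z := k) refl z ((Z ⊛ D Z) (suc (suc n))) ⟩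
      (Z ⊛ D Z) (suc (suc n))                         ∎
      where
      open ≡-Reasoning
      z = Z (suc (suc n))
    step : ∀ n → Lower n → X n ≡ Tser n
    step zero          rec = X₀
    step (suc zero)    rec = X₁
    step (suc (suc n)) rec = *-cancelʳ-ℕ→ℚ (suc n) (trans (ℚₚ.*-comm (X (suc (suc n))) (ℕ→ℚ (suc n)))
      (trans (solved X n eq) (trans (conv-cong≡ (suc (suc n)) term) (trans (sym (solved Tser n D-Tser)) (ℚₚ.*-comm (ℕ→ℚ (suc n)) (Tser (suc (suc n))))))))
      where
      term : ∀ a b → a ℕ.+ b ≡ suc (suc n) → X a ℚ.* (ℕ→ℚ b ℚ.* X b) ≡ Tser a ℚ.* (ℕ→ℚ b ℚ.* Tser b)
      term zero    b eq = trans (trans (cong (ℚ._* (ℕ→ℚ b ℚ.* X b)) X₀) (ℚₚ.*-zeroˡ (ℕ→ℚ b ℚ.* X b))) (sym (ℚₚ.*-zeroˡ (ℕ→ℚ b ℚ.* Tser b)))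
      term (suc a) zero eq = trans (vanish (X (suc a)) (X 0)) (sym (vanish (Tser (suc a)) (Tser 0)))
        where
        vanish : ∀ x y → x ℚ.* (0ℚ ℚ.* y) ≡ 0ℚ
        vanish x y = trans (cong (x ℚ.*_) (ℚₚ.*-zeroˡ y)) (ℚₚ.*-zeroʳ x)
      term (suc a) (suc b) eq = cong₂ (λ x y → x ℚ.* (ℕ→ℚ (suc b) ℚ.* y))
        (rec (subst (suc a <_) eq (ℕₚ.m<m+n (suc a) (s≤s z≤n)))) (rec (subst (suc b <_) eq (ℕₚ.m<n+m (suc b) (s≤s z≤n))))

  -- For positive arguments (3h - 1) + (3l - 1) falls one short of 3(h + l) - 1, and the value 0 at
  -- 0 makes the remaining cases equalities.
  poleBound-+ : ∀ h l → poleBound h ℕ.+ poleBound l ≤ poleBound (h ℕ.+ l)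
  poleBound-+ zero    l       = ℕₚ.≤-refl
  poleBound-+ (suc h) zero    = ℕₚ.≤-reflexive (trans (ℕₚ.+-identityʳ _) (cong (λ k → 2 ℕ.+ 3 ℕ.* k) (sym (ℕₚ.+-identityʳ h))))
  poleBound-+ (suc h) (suc l) = begin
    (2 ℕ.+ 3 ℕ.* h) ℕ.+ (2 ℕ.+ 3 ℕ.* l)      ≡⟨ solve 2 (λ h l → (con′ 2 ⊕ con′ 3 ⊗ h) ⊕ (con′ 2 ⊕ con′ 3 ⊗ l) ⊜ con′ 4 ⊕ con′ 3 ⊗ (h ⊕ l)) refl h l ⟩
    4 ℕ.+ 3 ℕ.* (h ℕ.+ l)                    ≤⟨ ℕₚ.n≤1+n _ ⟩
    5 ℕ.+ 3 ℕ.* (h ℕ.+ l)                    ≡⟨ solve 2 (λ h l → con′ 5 ⊕ con′ 3 ⊗ (h ⊕ l) ⊜ con′ 2 ⊕ con′ 3 ⊗ (h ⊕ (con′ 1 ⊕ l))) refl h l ⟩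
    2 ℕ.+ 3 ℕ.* (h ℕ.+ suc l)                ∎
    where
    open ℕₚ.≤-Reasoning
    open import Data.Nat.Solver using (module +-*-Solver)
    open +-*-Solver using (solve) renaming (_:+_ to _⊕_; _:*_ to _⊗_; _:=_ to _⊜_; con to con′)

  poleBound-double : ∀ j r → 2 ℕ.* j ℕ.+ poleBound r ≤ poleBound (j ℕ.+ r)
  poleBound-double zero    r = ℕₚ.≤-refl
  poleBound-double (suc j) r = ℕₚ.≤-trans (ℕₚ.+-monoˡ-≤ (poleBound r) (begin
    2 ℕ.* suc j          ≡⟨ ℕₚ.*-suc 2 j ⟩
    2 ℕ.+ 2 ℕ.* j        ≤⟨ ℕₚ.+-monoʳ-≤ 2 (ℕₚ.*-monoˡ-≤ j {2} {3} (s≤s (s≤s z≤n))) ⟩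
    2 ℕ.+ 3 ℕ.* j        ∎)) (poleBound-+ (suc j) r)
    where open ℕₚ.≤-Reasoning

  poleBound-mono : ∀ {a b} → a ≤ b → poleBound a ≤ poleBound b
  poleBound-mono {a} {b} a≤b = subst (λ c → poleBound a ≤ poleBound c) (ℕₚ.m+[n∸m]≡n a≤b)
    (ℕₚ.≤-trans (ℕₚ.m≤m+n (poleBound a) (poleBound (b ∸ a))) (poleBound-+ a (b ∸ a)))

  module SystemOf (𝒢 : GradedSetting) where
    open Graded 𝒢
    open GradedSetting 𝒢 using (A-2; A-3)
    private
      module ≋R = SetoidReasoning 𝕎.setoid
      module S = 𝔹.Solver

    -- The coefficient of w^j in q^n is (n choose j), so this is the operator (D choose j).
    C : ℕ → Series → Series
    C j X n = 𝕎.pow q n j ℚ.* X n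

    1+w-split : ∀ X → q ⊛ X ≋ X 𝕎.+ w ⊛ X
    1+w-split X e = trans (𝕎.distribʳ X 𝕎.1# w e) (cong (ℚ._+ (w ⊛ X) e) (𝕎.*-identityˡ X e))

    -- The recursion of the binomial coefficients in j, read off from ∂(q^n) = n w q^n.
    pow-q-suc : ∀ n j → ℕ→ℚ (suc j) ℚ.* 𝕎.pow q n (suc j) ≡ ℕ→ℚ n ℚ.* 𝕎.pow q n j ℚ.+ ℚ.- (ℕ→ℚ j ℚ.* 𝕎.pow q n j)
    pow-q-suc n j = begin
      a                                    ≡⟨ ℚ-solve 2 (λ a b → a := a :+ b :+ :- b) refl a b ⟩
      a ℚ.+ b ℚ.+ ℚ.- b                    ≡⟨ cong (ℚ._+ ℚ.- b) (trans (1+w-split (D (𝕎.pow q n)) (suc j)) (cong (a ℚ.+_) (w-⊛ (D (𝕎.pow q n)) (suc j)))) ⟨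
      ∂ (𝕎.pow q n) (suc j) ℚ.+ ℚ.- b      ≡⟨ cong (ℚ._+ ℚ.- b) (trans (∂-pow-q n (suc j)) (trans (constant-⊛ (ℕ→ℚ n) (w ⊛ 𝕎.pow q n) (suc j)) (cong (ℕ→ℚ n ℚ.*_) (w-⊛ (𝕎.pow q n) (suc j))))) ⟩
      ℕ→ℚ n ℚ.* 𝕎.pow q n j ℚ.+ ℚ.- b      ∎
      where
      open ≡-Reasoning
      a = ℕ→ℚ (suc j) ℚ.* 𝕎.pow q n (suc j)
      b = ℕ→ℚ j ℚ.* 𝕎.pow q n j

    C-0 : ∀ X → C 0 X ≋ X
    C-0 X n = trans (cong (ℚ._* X n) (pow-q-0 n)) (ℚₚ.*-identityˡ (X n))

    C-suc : ∀ j X → 𝕎.ι (ℤ.+ 1 ℚ./ suc j) ⊛ (D (C j X) 𝕎.+ 𝕎.- (𝕎.ι (ℕ→ℚ j) ⊛ C j X)) ≋ C (suc j) X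
    C-suc j X n = begin
      (𝕎.ι r ⊛ (D (C j X) 𝕎.+ 𝕎.- (𝕎.ι (ℕ→ℚ j) ⊛ C j X))) n
        ≡⟨ constant-⊛ r (D (C j X) 𝕎.+ 𝕎.- (𝕎.ι (ℕ→ℚ j) ⊛ C j X)) n ⟩
      r ℚ.* (ℕ→ℚ n ℚ.* (p ℚ.* X n) ℚ.+ ℚ.- (𝕎.ι (ℕ→ℚ j) ⊛ C j X) n)
        ≡⟨ cong (λ x → r ℚ.* (ℕ→ℚ n ℚ.* (p ℚ.* X n) ℚ.+ ℚ.- x)) (constant-⊛ (ℕ→ℚ j) (C j X) n) ⟩
      r ℚ.* (ℕ→ℚ n ℚ.* (p ℚ.* X n) ℚ.+ ℚ.- (ℕ→ℚ j ℚ.* (p ℚ.* X n)))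
        ≡⟨ ℚ-solve 5 (λ r n p x j → r :* (n :* (p :* x) :+ :- (j :* (p :* x))) := r :* ((n :* p :+ :- (j :* p)) :* x)) refl r (ℕ→ℚ n) p (X n) (ℕ→ℚ j) ⟩
      r ℚ.* ((ℕ→ℚ n ℚ.* p ℚ.+ ℚ.- (ℕ→ℚ j ℚ.* p)) ℚ.* X n)
        ≡⟨ cong (λ x → r ℚ.* (x ℚ.* X n)) (pow-q-suc n j) ⟨
      r ℚ.* (ℕ→ℚ (suc j) ℚ.* p′ ℚ.* X n)
        ≡⟨ ℚ-solve 4 (λ r s p x → r :* (s :* p :* x) := (r :* s) :* (p :* x)) refl r (ℕ→ℚ (suc j)) p′ (X n) ⟩
      r ℚ.* ℕ→ℚ (suc j) ℚ.* (p′ ℚ.* X n)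
        ≡⟨ trans (cong (ℚ._* (p′ ℚ.* X n)) (/-*-cancel 1 (suc j))) (ℚₚ.*-identityˡ (p′ ℚ.* X n)) ⟩
      p′ ℚ.* X n ∎
      where
      open ≡-Reasoning
      r = ℤ.+ 1 ℚ./ suc j
      p = 𝕎.pow q n j
      p′ = 𝕎.pow q n (suc j)

    C-1 : ∀ X → C 1 X ≋ D X
    C-1 X n = cong (ℚ._* X n) (trans (sym (ℚₚ.*-identityˡ (𝕎.pow q n 1))) (trans (pow-q-suc n 0)
      (trans (cong (λ p → ℕ→ℚ n ℚ.* p ℚ.+ ℚ.- (0ℚ ℚ.* p)) (pow-q-0 n)) (ℚ-solve 1 (λ n → n :* con 1ℚ :+ :- (con 0ℚ :* con 1ℚ) := n) refl (ℕ→ℚ n)))))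

    -- (D choose j) is a polynomial of degree j in D, and each D raises the pole order by at most 2.
    C-in : ∀ j {d X} → In d X → In (2 ℕ.* j ℕ.+ d) (C j X)
    C-in zero    {d} {X} i = in-cong (𝕎.sym {C 0 X} (C-0 X)) i
    C-in (suc j) {d} {X} i = in-cong (C-suc j X) (subst (λ e → In e (𝕎.ι (ℤ.+ 1 ℚ./ suc j) ⊛ (D (C j X) 𝕎.+ 𝕎.- (𝕎.ι (ℕ→ℚ j) ⊛ C j X))))
      (cong (ℕ._+ d) (sym (ℕₚ.*-suc 2 j)))
      (in-scale _ (in-+ (in-D (C-in j i)) (in-neg (in-≤ (ℕₚ.m≤n+m (2 ℕ.* j ℕ.+ d) 2) (in-scale (ℕ→ℚ j) (C-in j i)))))))

    G-σ : ∀ {X} → Supported X → ∀ i → G (σ X) i ≋ B.conv (λ j r → C j (G X r)) i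
    G-σ {X} sX i n = trans (G-coefficient (𝕎.pow q n) {X} sX n i) (sym (conv-eval (λ j r → C j (G X r)) i n))

    -- Products stay within the bound by subadditivity, and σ does so because j steps in the
    -- w-grading allow 3j while `C j` costs only 2j. Hence all cluster terms obey the bound of their
    -- own index, one step below the unknown that they accompany.
    Tame : ℕ → Double → Set
    Tame n X = ∀ h → h ≤ n → In (poleBound h) (X h)

    tame-σ : ∀ {n X} → Supported X → Tame n (G X) → Tame n (G (σ X))
    tame-σ {n} {X} sX t h h≤n = in-cong (𝕎.sym {G (σ X) h} (G-σ sX h)) (in-conv h (λ j r eq →
      in-≤ (subst (λ k → 2 ℕ.* j ℕ.+ poleBound r ≤ poleBound k) eq (poleBound-double j r))
        (C-in j (t r (ℕₚ.≤-trans (subst (r ≤_) eq (ℕₚ.m≤n+m r j)) h≤n)))))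

    tame-⊛ : ∀ {n X Y} → Supported X → Supported Y → Tame n (G X) → Tame n (G Y) → Tame n (G (X B.⊛ Y))
    tame-⊛ {n} {X} {Y} sX sY tX tY h h≤n = in-cong (𝕎.sym {G (X B.⊛ Y) h} (G-⊛ sX sY h)) (in-conv h (λ a b eq →
      in-≤ (subst (λ k → poleBound a ℕ.+ poleBound b ≤ poleBound k) eq (poleBound-+ a b))
        (in-* (tX a (ℕₚ.≤-trans (subst (a ≤_) eq (ℕₚ.m≤m+n a b)) h≤n)) (tY b (ℕₚ.≤-trans (subst (b ≤_) eq (ℕₚ.m≤n+m b a)) h≤n)))))

    G-1-0 : G 𝔹.1# 0 ≋ 𝕎.1#
    G-1-0 zero    = refl
    G-1-0 (suc n) = refl

    tame-powÊ : ∀ {n} → Tame n (G Ê) → ∀ m → Tame n (G (powÊ m))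
    tame-powÊ t zero    zero    _ = in-cong (𝕎.sym {G 𝔹.1# 0} G-1-0) (in-poly poly-1)
    tame-powÊ t zero    (suc h) _ = in-cong (λ { zero → refl ; (suc n) → refl }) (in-0 (poleBound (suc h)))
    tame-powÊ t (suc m) = tame-⊛ Ê-supported (σ-supported (powÊ-supported m)) t (tame-σ (powÊ-supported m) (tame-powÊ t m))

    tame-Ψ̂ : ∀ β → Sparse β → ∀ n → Tame n (G Ê) → In (poleBound n) (G (Ψ̂ β) n)
    tame-Ψ̂ β sparse n t = in-cong (𝕎.sym {G (Ψ̂ β) n} (G-Ψ̂ β sparse n)) (in-sum (4 ℕ.+ 2 ℕ.* n) (λ m → in-conv n (λ d r eq →
      let r≤n = subst (r ≤_) eq (ℕₚ.m≤n+m r d) in in-≤ (poleBound-mono r≤n) (in-scale (β m d) (tame-powÊ t m r r≤n)))))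

    private
      W𝔹 Q𝔹 : Double
      W𝔹 = B.constant w
      Q𝔹 = B.constant q

      scale≋ : ∀ x X → B._≋_ (scale x X) (B.constant x B.⊛ X)
      scale≋ x X n e = sym (B.constant-⊛ x X n e)

      D-scale : ∀ x X → B._≋_ (B.D (scale x X)) (scale x (B.D X))
      D-scale x X n = 𝕎.Solver.solve 3 (λ n x y → n 𝕎.Solver.:* (x 𝕎.Solver.:* y) 𝕎.Solver.:= x 𝕎.Solver.:* (n 𝕎.Solver.:* y)) (λ _ → refl) (𝕎.ν n) x (X n)

      σ-scale : ∀ x X → B._≋_ (σ (scale x X)) (scale x (σ X))
      σ-scale x X n = 𝕎.Solver.solve 3 (λ n x y → n 𝕎.Solver.:* (x 𝕎.Solver.:* y) 𝕎.Solver.:= x 𝕎.Solver.:* (n 𝕎.Solver.:* y)) (λ _ → refl) (𝕎.pow q n) x (X n)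

    module 𝔹R = SetoidReasoning 𝔹.setoid

    Δ : Double
    Δ = σ Ŷ 𝔹.+ 𝔹.- Ŷ

    Δ-supported : Supported Δ
    Δ-supported n = ord-+ (σ-supported Ŷ-supported n) (ord-neg (Ŷ-supported n))

    -- The quadratic term needs one factor w for each of its two series, so the linear terms carry a
    -- second w. After regrading they sit one index lower than the convolution.
    vertexˆ : B._≋_ (scale w (B.D Ê)) (scale w Ê 𝔹.+ Ê B.⊛ Δ)
    vertexˆ = begin
      scale w (B.D Ê)                              ≈⟨ scale≋ w (B.D Ê) ⟩
      W𝔹 B.⊛ B.D Ê                                 ≈⟨ 𝔹.*-congˡ {W𝔹} (λ n e → trans (D-scale w E n e) (trans (scale≋ w (B.D E) n e) (𝔹.*-congˡ {W𝔹} vertex-equation n e))) ⟩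
      W𝔹 B.⊛ (W𝔹 B.⊛ (E 𝔹.+ E B.⊛ (σ Y 𝔹.+ 𝔹.- Y)))
        ≈⟨ S.solve 4 (λ w e s y → w S.:* (w S.:* (e S.:+ e S.:* (s S.:+ S.:- y))) S.:= w S.:* (w S.:* e) S.:+ (w S.:* e) S.:* (w S.:* s S.:+ S.:- (w S.:* y))) (λ _ _ → refl) W𝔹 E (σ Y) Y ⟩
      W𝔹 B.⊛ (W𝔹 B.⊛ E) 𝔹.+ (W𝔹 B.⊛ E) B.⊛ (W𝔹 B.⊛ σ Y 𝔹.+ 𝔹.- (W𝔹 B.⊛ Y))
        ≈⟨ (λ n e → cong₂ ℚ._+_ (trans (𝔹.*-congˡ {W𝔹} (λ n e → sym (scale≋ w E n e)) n e) (sym (scale≋ w Ê n e)))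
             (𝔹.*-cong {W𝔹 B.⊛ E} {Ê} {W𝔹 B.⊛ σ Y 𝔹.+ 𝔹.- (W𝔹 B.⊛ Y)} {Δ} (λ n e → sym (scale≋ w E n e))
               (λ n e → cong₂ (λ x y → x ℚ.+ ℚ.- y) (trans (sym (scale≋ w (σ Y) n e)) (sym (σ-scale w Y n e))) (sym (scale≋ w Y n e))) n e)) ⟩
      scale w Ê 𝔹.+ Ê B.⊛ Δ ∎
      where open 𝔹R

    h𝔹 : Double
    h𝔹 = 𝔹.ι ½

    Γ : Double
    Γ = Ψ̂ ∂Coefficient

    ∂L̂≋ : B._≋_ (∂S L̂) (scale q L̂ 𝔹.+ h𝔹 B.⊛ (scale w (B.D Ŷ 𝔹.+ 𝔹.- Ŷ) 𝔹.+ Ŷ B.⊛ Ŷ) 𝔹.+ scale w Γ)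
    ∂L̂≋ = begin
      ∂S L̂
        ≈⟨ (λ n e → trans (∂-* w (L n) e) (cong (ℚ._+ (w ⊛ ∂ (L n)) e) (trans (𝕎.*-congʳ {L n} ∂-w e) (𝕎.*-assoc q w (L n) e)))) ⟩
      scale q (scale w L) 𝔹.+ scale w (∂S L)
        ≈⟨ (λ n e → cong₂ ℚ._+_ (trans (scale≋ q (scale w L) n e) (𝔹.*-congˡ {Q𝔹} (scale≋ w L) n e))
             (trans (scale≋ w (∂S L) n e) (𝔹.*-congˡ {W𝔹} (λ n e → trans (edge-equation n e) (cong₂ ℚ._+_ (𝔹.*-congˡ {h𝔹} (scale≋ w Z) n e) (Ψ≋Ψ̂ (∂S A) ∂Coefficient ∂A≋ n e))) n e))) ⟩
      Q𝔹 B.⊛ (W𝔹 B.⊛ L) 𝔹.+ W𝔹 B.⊛ (h𝔹 B.⊛ (W𝔹 B.⊛ Z) 𝔹.+ Γ)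
        ≈⟨ S.solve 7 (λ q w l h d y g → q S.:* (w S.:* l) S.:+ w S.:* (h S.:* (w S.:* (d S.:+ y S.:* y S.:+ S.:- y)) S.:+ g)
             S.:= q S.:* (w S.:* l) S.:+ h S.:* (w S.:* (w S.:* d S.:+ S.:- (w S.:* y)) S.:+ (w S.:* y) S.:* (w S.:* y)) S.:+ w S.:* g) (λ _ _ → refl) Q𝔹 W𝔹 L h𝔹 (B.D Y) Y Γ ⟩
      Q𝔹 B.⊛ (W𝔹 B.⊛ L) 𝔹.+ h𝔹 B.⊛ (W𝔹 B.⊛ (W𝔹 B.⊛ B.D Y 𝔹.+ 𝔹.- (W𝔹 B.⊛ Y)) 𝔹.+ (W𝔹 B.⊛ Y) B.⊛ (W𝔹 B.⊛ Y)) 𝔹.+ W𝔹 B.⊛ Γ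
        ≈⟨ (λ n e → cong₂ ℚ._+_ (cong₂ ℚ._+_
             (trans (𝔹.*-congˡ {Q𝔹} (back L) n e) (sym (scale≋ q L̂ n e)))
             (𝔹.*-congˡ {h𝔹} (λ n e → cong₂ ℚ._+_
               (trans (𝔹.*-congˡ {W𝔹} (λ n e → cong₂ (λ x y → x ℚ.+ ℚ.- y) (trans (back (B.D Y) n e) (sym (D-scale w Y n e))) (back Y n e)) n e)
                 (sym (scale≋ w (B.D Ŷ 𝔹.+ 𝔹.- Ŷ) n e)))
               (𝔹.*-cong {W𝔹 B.⊛ Y} {Ŷ} {W𝔹 B.⊛ Y} {Ŷ} (back Y) (back Y) n e)) n e))
             (sym (scale≋ w Γ n e))) ⟩
      scale q L̂ 𝔹.+ h𝔹 B.⊛ (scale w (B.D Ŷ 𝔹.+ 𝔹.- Ŷ) 𝔹.+ Ŷ B.⊛ Ŷ) 𝔹.+ scale w Γ ∎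
      where
      open 𝔹R
      Z = B.D Y 𝔹.+ Y B.⊛ Y 𝔹.+ 𝔹.- Y
      back : ∀ X → B._≋_ (W𝔹 B.⊛ X) (scale w X)
      back X n e = sym (scale≋ w X n e)

    DW : Double → Double
    DW X n = D (X n)

    DW-supported : ∀ {X} → Supported X → Supported (DW X)
    DW-supported sX n e e<n = trans (cong (ℕ→ℚ e ℚ.*_) (sX n e e<n)) (ℚₚ.*-zeroʳ (ℕ→ℚ e))

    D-supported : ∀ {X} → Supported X → Supported (B.D X)
    D-supported {X} sX n = ord-* {0} {n} {𝕎.ν n} {X n} (ord-any {𝕎.ν n}) (sX n)

    -- On the coefficient of w^(n+i) zⁿ the operator w d/dw is multiplication by n + i. The summand
    -- i is the origin of the zeroth-order term in Wright's equation.
    G-DW : ∀ X i → G (DW X) i ≋ D (G X i) 𝕎.+ 𝕎.ι (ℕ→ℚ i) ⊛ G X i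
    G-DW X i n = trans (cong (ℚ._* X n (n ℕ.+ i)) (ℕ→ℚ-+ n i)) (trans (ℚₚ.*-distribʳ-+ (X n (n ℕ.+ i)) (ℕ→ℚ n) (ℕ→ℚ i))
      (cong (ℕ→ℚ n ℚ.* X n (n ℕ.+ i) ℚ.+_) (sym (constant-⊛ (ℕ→ℚ i) (G X i) n))))

    G-h : ∀ X i → G (h𝔹 B.⊛ X) i ≋ 𝕎.ι ½ ⊛ G X i
    G-h X i n = trans (B.constant-⊛ (𝕎.ι ½) X n (n ℕ.+ i)) (trans (constant-⊛ ½ (X n) (n ℕ.+ i)) (sym (constant-⊛ ½ (G X i) n)))

    G-q-0 : ∀ {X} → Supported X → G (scale q X) 0 ≋ G X 0
    G-q-0 {X} sX n = trans (1+w-split (X n) (n ℕ.+ 0)) (trans (cong (X n (n ℕ.+ 0) ℚ.+_) (G-w-0 sX n)) (ℚₚ.+-identityʳ (X n (n ℕ.+ 0))))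

    G-q-suc : ∀ X i → G (scale q X) (suc i) ≋ G X (suc i) 𝕎.+ G X i
    G-q-suc X i n = trans (1+w-split (X n) (n ℕ.+ suc i)) (cong (X n (n ℕ.+ suc i) ℚ.+_) (G-w-suc X i n))

    D-L̂ : B._≋_ Ŷ (B.D L̂)
    D-L̂ n e = sym (D-scale w L n e)

    Lᵢ Yᵢ Eᵢ : ℕ → Series
    Lᵢ = G L̂
    Yᵢ = G Ŷ
    Eᵢ = G Ê

    Y-L : ∀ i → Yᵢ i ≋ D (Lᵢ i)
    Y-L i n = trans (D-L̂ n (n ℕ.+ i)) (G-D L̂ i n)

    Ŷ≋ : B._≋_ Ŷ (Ê 𝔹.+ scale w (Ψ̂ νCoefficient))
    Ŷ≋ n e = trans (𝕎.*-congˡ {w} (Y≋ n) e) (𝕎.distribˡ w (E n) (Ψ̂ νCoefficient n) e)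

    Ω-0 : G Δ 0 ≋ 𝕎.0#
    Ω-0 n = trans (cong (ℚ._+ ℚ.- Yᵢ 0 n) (trans (G-σ Ŷ-supported 0 n) (C-0 (Yᵢ 0) n))) (ℚₚ.+-inverseʳ (Yᵢ 0 n))

    Ω-suc : ∀ l → G Δ (suc l) ≋ B.conv (λ j r → C (suc j) (Yᵢ r)) l
    Ω-suc l n = trans (cong (ℚ._+ ℚ.- y) (trans (G-σ Ŷ-supported (suc l) n) (cong (ℚ._+ k) (C-0 (Yᵢ (suc l)) n))))
      (ℚ-solve 2 (λ y k → y :+ k :+ :- y := k) refl y k)
      where
      y = Yᵢ (suc l) n
      k = B.conv (λ j r → C (suc j) (Yᵢ r)) l n

    vertexᵢ : ∀ i → D (Eᵢ i) ≋ Eᵢ i 𝕎.+ B.conv (λ h l → Eᵢ h ⊛ G Δ l) (suc i)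
    vertexᵢ i n = begin
      D (Eᵢ i) n                                                     ≡⟨ G-D Ê i n ⟨
      G (B.D Ê) i n                                                  ≡⟨ G-w-suc (B.D Ê) i n ⟨
      G (scale w (B.D Ê)) (suc i) n                                  ≡⟨ vertexˆ n (n ℕ.+ suc i) ⟩
      G (scale w Ê) (suc i) n ℚ.+ G (Ê B.⊛ Δ) (suc i) n              ≡⟨ cong₂ ℚ._+_ (G-w-suc Ê i n) (G-⊛ Ê-supported Δ-supported (suc i) n) ⟩
      Eᵢ i n ℚ.+ B.conv (λ h l → Eᵢ h ⊛ G Δ l) (suc i) n             ∎
      where open ≡-Reasoning

    DŶ-supported : Supported (B.D Ŷ 𝔹.+ 𝔹.- Ŷ)
    DŶ-supported n = ord-+ (D-supported Ŷ-supported n) (ord-neg (Ŷ-supported n))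

    edge-0 : D (Lᵢ 0) 𝕎.+ 𝕎.- Lᵢ 0 ≋ 𝕎.ι ½ ⊛ (Yᵢ 0 ⊛ Yᵢ 0)
    edge-0 n = begin
      D (Lᵢ 0) n ℚ.+ ℚ.- l
        ≡⟨ cong (ℚ._+ ℚ.- l) (trans (sym (trans (G-DW L̂ 0 n) (trans (cong (D (Lᵢ 0) n ℚ.+_) (trans (constant-⊛ 0ℚ (Lᵢ 0) n) (ℚₚ.*-zeroˡ l))) (ℚₚ.+-identityʳ (D (Lᵢ 0) n)))))
             (trans (sym (G-q-0 (DW-supported L̂-supported) n)) (∂L̂≋ n (n ℕ.+ 0)))) ⟩
      (G (scale q L̂) 0 n ℚ.+ G (h𝔹 B.⊛ K) 0 n ℚ.+ G (scale w Γ) 0 n) ℚ.+ ℚ.- l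
        ≡⟨ cong (ℚ._+ ℚ.- l) (cong₂ ℚ._+_ (cong₂ ℚ._+_ (G-q-0 L̂-supported n) (trans (G-h K 0 n) (𝕎.*-congˡ {𝕎.ι ½} K₀ n))) (G-w-0 (Ψ̂-supported ∂Coefficient) n)) ⟩
      (l ℚ.+ k ℚ.+ 0ℚ) ℚ.+ ℚ.- l
        ≡⟨ ℚ-solve 2 (λ l k → l :+ k :+ con 0ℚ :+ :- l := k) refl l k ⟩
      k ∎
      where
      open ≡-Reasoning
      l = Lᵢ 0 n
      k = (𝕎.ι ½ ⊛ (Yᵢ 0 ⊛ Yᵢ 0)) n
      K = scale w (B.D Ŷ 𝔹.+ 𝔹.- Ŷ) 𝔹.+ Ŷ B.⊛ Ŷ
      K₀ : G K 0 ≋ Yᵢ 0 ⊛ Yᵢ 0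
      K₀ n = trans (cong₂ ℚ._+_ (G-w-0 DŶ-supported n) (G-⊛ Ŷ-supported Ŷ-supported 0 n)) (ℚₚ.+-identityˡ ((Yᵢ 0 ⊛ Yᵢ 0) n))

    -- The factor q = 1 + w of the derivation couples the indices i + 1 and i. The product rule for
    -- L̂ = w L adds one copy of each, which lowers the coefficients i + 1 and i to i and i - 1.
    edge-suc : ∀ i → (𝕎.ν i ⊛ Lᵢ (suc i) 𝕎.+ D (Lᵢ (suc i))) 𝕎.+ ((𝕎.ν i 𝕎.+ 𝕎.- 𝕎.ι 1ℚ) ⊛ Lᵢ i 𝕎.+ D (Lᵢ i))
      ≋ 𝕎.ι ½ ⊛ (D (D (Lᵢ i)) 𝕎.+ 𝕎.- D (Lᵢ i)) 𝕎.+ 𝕎.ι ½ ⊛ B.conv (λ a b → Yᵢ a ⊛ Yᵢ b) (suc i) 𝕎.+ G Γ i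
    edge-suc i = begin
      (𝕎.ν i ⊛ L₁ 𝕎.+ D L₁) 𝕎.+ ((𝕎.ν i 𝕎.+ 𝕎.- 𝕎.ι 1ℚ) ⊛ L₀ 𝕎.+ D L₀)
        ≈⟨ V.solve 5 (λ n l₁ d₁ l₀ d₀ → (n V.:* l₁ V.:+ d₁) V.:+ ((n V.:+ V.:- V.con 1ℚ) V.:* l₀ V.:+ d₀)
             V.:= ((d₁ V.:+ (V.con 1ℚ V.:+ n) V.:* l₁) V.:+ (d₀ V.:+ n V.:* l₀)) V.:+ V.:- (l₁ V.:+ l₀)) (λ _ → refl) (𝕎.ν i) L₁ (D L₁) L₀ (D L₀) ⟩
      ((D L₁ 𝕎.+ (𝕎.ι 1ℚ 𝕎.+ 𝕎.ν i) ⊛ L₁) 𝕎.+ (D L₀ 𝕎.+ 𝕎.ν i ⊛ L₀)) 𝕎.+ 𝕎.- (L₁ 𝕎.+ L₀)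
        ≈⟨ (λ n → cong (ℚ._+ ℚ.- (L₁ n ℚ.+ L₀ n)) (∂L̂ᵢ n)) ⟩
      ((L₁ 𝕎.+ L₀) 𝕎.+ 𝕎.ι ½ ⊛ ((D (D L₀) 𝕎.+ 𝕎.- D L₀) 𝕎.+ YY) 𝕎.+ G Γ i) 𝕎.+ 𝕎.- (L₁ 𝕎.+ L₀)
        ≈⟨ V.solve 5 (λ l h a b g → (l V.:+ h V.:* (a V.:+ b) V.:+ g) V.:+ V.:- l V.:= h V.:* a V.:+ h V.:* b V.:+ g) (λ _ → refl) (L₁ 𝕎.+ L₀) (𝕎.ι ½) (D (D L₀) 𝕎.+ 𝕎.- D L₀) YY (G Γ i) ⟩
      𝕎.ι ½ ⊛ (D (D L₀) 𝕎.+ 𝕎.- D L₀) 𝕎.+ 𝕎.ι ½ ⊛ YY 𝕎.+ G Γ i ∎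
      where
      open ≋R
      module V = 𝕎.Solver
      L₁ = Lᵢ (suc i)
      L₀ = Lᵢ i
      YY = B.conv (λ a b → Yᵢ a ⊛ Yᵢ b) (suc i)
      K = scale w (B.D Ŷ 𝔹.+ 𝔹.- Ŷ) 𝔹.+ Ŷ B.⊛ Ŷ
      Kᵢ : G K (suc i) ≋ (D (D L₀) 𝕎.+ 𝕎.- D L₀) 𝕎.+ YY
      Kᵢ n = cong₂ ℚ._+_ (trans (G-w-suc (B.D Ŷ 𝔹.+ 𝔹.- Ŷ) i n)
        (cong₂ (λ x y → x ℚ.+ ℚ.- y) (trans (G-D Ŷ i n) (cong (ℕ→ℚ n ℚ.*_) (Y-L i n))) (Y-L i n))) (G-⊛ Ŷ-supported Ŷ-supported (suc i) n)
      ∂L̂ᵢ : (D L₁ 𝕎.+ (𝕎.ι 1ℚ 𝕎.+ 𝕎.ν i) ⊛ L₁) 𝕎.+ (D L₀ 𝕎.+ 𝕎.ν i ⊛ L₀) ≋ (L₁ 𝕎.+ L₀) 𝕎.+ 𝕎.ι ½ ⊛ ((D (D L₀) 𝕎.+ 𝕎.- D L₀) 𝕎.+ YY) 𝕎.+ G Γ i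
      ∂L̂ᵢ n = trans (cong₂ ℚ._+_ (trans (cong (D L₁ n ℚ.+_) (𝕎.*-congʳ {L₁} (λ m → sym (𝕎.ν-suc i m)) n)) (sym (G-DW L̂ (suc i) n))) (sym (G-DW L̂ i n)))
        (trans (sym (G-q-suc (DW L̂) i n)) (trans (∂L̂≋ n (n ℕ.+ suc i))
          (cong₂ ℚ._+_ (cong₂ ℚ._+_ (G-q-suc L̂ i n) (trans (G-h K (suc i) n) (𝕎.*-congˡ {𝕎.ι ½} Kᵢ n))) (G-w-suc Γ i n))))

    Yᵢ-0 : Yᵢ 0 ≋ Eᵢ 0
    Yᵢ-0 n = trans (Ŷ≋ n (n ℕ.+ 0)) (trans (cong (Eᵢ 0 n ℚ.+_) (G-w-0 (Ψ̂-supported νCoefficient) n)) (ℚₚ.+-identityʳ (Eᵢ 0 n)))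

    Yᵢ-suc : ∀ i → Yᵢ (suc i) ≋ Eᵢ (suc i) 𝕎.+ G (Ψ̂ νCoefficient) i
    Yᵢ-suc i n = trans (Ŷ≋ n (n ℕ.+ suc i)) (cong (Eᵢ (suc i) n ℚ.+_) (G-w-suc (Ψ̂ νCoefficient) i n))

    -- At the lowest index E and Y coincide and Ω is D E, so the vertex equation becomes the
    -- equation of the tree function.
    Eᵢ-0 : Eᵢ 0 ≋ Tser
    Eᵢ-0 = tree-equation-unique (Eᵢ 0) equation (w-⊛ (E 0) 0) (trans (w-⊛ (E 1) 1) (E-1 0))
      where
      equation : D (Eᵢ 0) ≋ Eᵢ 0 𝕎.+ Eᵢ 0 ⊛ D (Eᵢ 0)
      equation n = trans (vertexᵢ 0 n) (cong (Eᵢ 0 n ℚ.+_) (trans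
        (cong₂ ℚ._+_ (𝕎.*-congˡ {Eᵢ 0} (λ m → trans (Ω-suc 0 m) (trans (C-1 (Yᵢ 0) m) (cong (ℕ→ℚ m ℚ.*_) (Yᵢ-0 m)))) n)
          (trans (𝕎.*-congˡ {Eᵢ 1} Ω-0 n) (𝕎.zeroʳ (Eᵢ 1) n))) (ℚₚ.+-identityʳ ((Eᵢ 0 ⊛ D (Eᵢ 0)) n))))

    ∂Coefficient-0 : ∀ m → ∂Coefficient m 0 ≡ ℕ→ℚ m ℚ.* α̂ m 0
    ∂Coefficient-0 m = begin
      (𝕎.ν m ⊛ (q ⊛ α̂ m)) 0 ℚ.+ 1ℚ ℚ.* (0ℚ ℚ.* α̂ m 0)
        ≡⟨ cong₂ (λ x y → x ℚ.+ 1ℚ ℚ.* y) (constant-⊛ (ℕ→ℚ m) (q ⊛ α̂ m) 0) (ℚₚ.*-zeroˡ (α̂ m 0)) ⟩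
      ℕ→ℚ m ℚ.* (1ℚ ℚ.* α̂ m 0) ℚ.+ 0ℚ
        ≡⟨ trans (ℚₚ.+-identityʳ (ℕ→ℚ m ℚ.* (1ℚ ℚ.* α̂ m 0))) (cong (ℕ→ℚ m ℚ.*_) (ℚₚ.*-identityˡ (α̂ m 0))) ⟩
      ℕ→ℚ m ℚ.* α̂ m 0 ∎
      where open ≡-Reasoning

    -- Only the triangle has as many edges as vertices. Its coefficient -1/6 is multiplied by 3
    -- through ∂(w³), and each of its three corners carries a rooted tree.
    Γ-0 : G Γ 0 ≋ 𝕎.- (𝕎.ι ½ ⊛ (Tser ⊛ (Tser ⊛ Tser)))
    Γ-0 = begin
      G Γ 0
        ≈⟨ G-Ψ̂ ∂Coefficient ∂Coefficient-sparse 0 ⟩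
      (((𝕎.0# 𝕎.+ t 0) 𝕎.+ t 1) 𝕎.+ t 2) 𝕎.+ t 3
        ≈⟨ (λ n → cong₂ ℚ._+_ (cong₂ ℚ._+_ (cong₂ ℚ._+_ (cong (0ℚ ℚ.+_) (vanish 0 β₀ n)) (vanish 1 β₁ n)) (vanish 2 β₂ n)) (three n)) ⟩
      (((𝕎.0# 𝕎.+ 𝕎.0#) 𝕎.+ 𝕎.0#) 𝕎.+ 𝕎.0#) 𝕎.+ 𝕎.ι (ℚ.- ½) ⊛ (Tser ⊛ (Tser ⊛ Tser))
        ≈⟨ (λ n → ℚₚ.+-identityˡ ((𝕎.ι (ℚ.- ½) ⊛ (Tser ⊛ (Tser ⊛ Tser))) n)) ⟩
      𝕎.ι (ℚ.- ½) ⊛ (Tser ⊛ (Tser ⊛ Tser))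
        ≈⟨ V.solve 1 (λ x → V.con (ℚ.- ½) V.:* x V.:= V.:- (V.con ½ V.:* x)) (λ _ → refl) (Tser ⊛ (Tser ⊛ Tser)) ⟩
      𝕎.- (𝕎.ι ½ ⊛ (Tser ⊛ (Tser ⊛ Tser))) ∎
      where
      open ≋R
      module V = 𝕎.Solver
      t : ℕ → Series
      t m = 𝕎.ι (∂Coefficient m 0) ⊛ G (powÊ m) 0
      β₀ : ∂Coefficient 0 0 ≡ 0ℚ
      β₀ = trans (∂Coefficient-0 0) (ℚₚ.*-zeroˡ (α̂ 0 0))
      β₁ : ∂Coefficient 1 0 ≡ 0ℚ
      β₁ = trans (∂Coefficient-0 1) (ℚₚ.*-zeroʳ (ℕ→ℚ 1))
      β₂ : ∂Coefficient 2 0 ≡ 0ℚ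
      β₂ = trans (∂Coefficient-0 2) (trans (cong (ℕ→ℚ 2 ℚ.*_) (A-2 2)) (ℚₚ.*-zeroʳ (ℕ→ℚ 2)))
      vanish : ∀ m → ∂Coefficient m 0 ≡ 0ℚ → t m ≋ 𝕎.0#
      vanish m eq n = trans (constant-⊛ (∂Coefficient m 0) (G (powÊ m) 0) n) (trans (cong (ℚ._* G (powÊ m) 0 n) eq) (ℚₚ.*-zeroˡ (G (powÊ m) 0 n)))
      three : t 3 ≋ 𝕎.ι (ℚ.- ½) ⊛ (Tser ⊛ (Tser ⊛ Tser))
      three n = trans (constant-⊛ (∂Coefficient 3 0) (G (powÊ 3) 0) n) (trans
        (cong₂ ℚ._*_ (trans (∂Coefficient-0 3) (cong (ℕ→ℚ 3 ℚ.*_) A-3)) (cube n))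
        (sym (constant-⊛ (ℚ.- ½) (Tser ⊛ (Tser ⊛ Tser)) n)))
        where
        next : ∀ m → G (powÊ (suc m)) 0 ≋ Tser ⊛ G (powÊ m) 0
        next m n = trans (G-⊛ Ê-supported (σ-supported (powÊ-supported m)) 0 n)
          (⊛-cong {Eᵢ 0} {Tser} {G (σ (powÊ m)) 0} {G (powÊ m) 0} Eᵢ-0 (λ k → trans (G-σ (powÊ-supported m) 0 k) (C-0 (G (powÊ m) 0) k)) n)
        cube : G (powÊ 3) 0 ≋ Tser ⊛ (Tser ⊛ Tser)
        cube n = trans (next 2 n) (𝕎.*-congˡ {Tser} (λ n → trans (next 1 n) (𝕎.*-congˡ {Tser} (λ n → trans (next 0 n)
          (trans (𝕎.*-congˡ {Tser} G-1-0 n) (𝕎.*-identityʳ Tser n))) n)) n)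

    system : GradedSystem treeAlgebra
    system = record
      { L = Lᵢ ; Y = Yᵢ ; E = Eᵢ ; N = G (Ψ̂ νCoefficient) ; S = G Γ
      ; C = C ; C-1 = C-1 ; C-in = λ j i → _ , C-in j i
      ; Ω = G Δ ; Ω-0 = Ω-0 ; Ω-suc = Ω-suc
      ; Y-L = Y-L ; E-0 = Eᵢ-0 ; Y-0 = Yᵢ-0 ; Y-suc = Yᵢ-suc
      ; vertex = vertexᵢ ; edge-0 = edge-0 ; edge-suc = edge-suc
      ; N-in = tame-Ψ̂ νCoefficient νCoefficient-sparse
      ; S-in = tame-Ψ̂ ∂Coefficient ∂Coefficient-sparse
      ; S-0 = Γ-0
      }

-- The instance for triangle-free graphs and the Laurent expansion

module TriangleFreeGraphs where
  open RationalAlgebras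
  open TreeFunction using (1/!; /!-≡)
  open LaurentPolynomials
  open GradedSystems
  open WrightConstants using (wright-recurrences; Σ<≡sum; Σ<-cong)
  open SimpleGraphs
  open Connectivity
  open TriangleClusters
  open LabelledCounting
  open BivariateSeries
  open Regrading
  open TreeSystems
  open import Defs hiding (c)
  open import Data.Bool using (Bool; true; false; T; if_then_else_; not; _∧_)
  import Data.Bool.Properties as Boolₚ
  open import Data.Fin using (Fin; zero; suc)
  open import Data.Nat as ℕ using (ℕ; zero; suc; _≤_; _<_; s≤s; _∸_; _≡ᵇ_; _!)
  import Data.Nat.Properties as ℕₚ
  open import Data.Nat.Properties using (_!≢0)
  open import Data.Rational as ℚ using (ℚ; 0ℚ; 1ℚ)
  import Data.Rational.Properties as ℚₚ
  open import Data.Integer as ℤ using (ℤ)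
  import Data.Integer.Properties as ℤₚ
  open import Data.List as List using (List; []; _∷_; map; _++_; length; allFin; applyUpTo; filter)
  import Data.List.Properties as Listₚ
  open import Data.List.Membership.Propositional using (find; lose)
  open import Data.List.Membership.Propositional.Properties using (∈-allFin)
  import Data.List.Relation.Unary.Any.Properties as Anyₚ
  open import Data.List.Relation.Unary.Unique.Propositional using (Unique)
  open import Data.List.Relation.Unary.Unique.Propositional.Properties using (upTo⁺)
  open import Data.List.Relation.Binary.Sublist.Propositional using (_⊆_; []; _∷_; _∷ʳ_)
  open import Data.List.Relation.Binary.Sublist.Propositional.Properties using (length-mono-≤)
  open import Data.Product using (∃; ∃-syntax; _,_; proj₁; proj₂)
  open import Data.Empty using (⊥-elim)
  open import Function using (_∘_; id)
  open import Relation.Nullary using (¬_; Dec; yes; no; ¬?)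
  open import Relation.Nullary.Decidable using (T?)
  open import Relation.Binary.PropositionalEquality using (_≡_; trans; sym; refl; cong; cong₂; subst; module ≡-Reasoning)
  import Relation.Binary.Reasoning.Setoid as SetoidReasoning
  open PowerSeries ℚ-algebra using (_⊛_; _≋_; geometric; geometric-fixpoint; constant-⊛; sum; sum-first; sum-cong)
  open SubsetSums 𝕎
  open Moebius 𝕎
  open Exponential 𝕎 using (module Labelled)
  module ℚΣ = SubsetSums ℚ-algebra

  not-T : ∀ {b} → (T b → ¬ T (not b))
  not-T {true} _ ()

  T-not : ∀ {b} → ¬ T b → T (not b)
  T-not {true}  n = ⊥-elim (n _)
  T-not {false} _ = _

  triangle⇒Tri : ∀ {n} (ρ : Fin n → ℕ) → (∀ {i j} → ρ i ≡ ρ j → i ≡ j) → ∀ E → ¬ T (triangleFree E) → Tri (map (relabel ρ) E)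
  triangle⇒Tri {n} ρ inj E ¬t with Boolₚ.T? (not (triangleFree E))
  ... | no ¬f  = ⊥-elim (¬f (T-not ¬t))
  ... | yes t  with find (Anyₚ.any⁻ _ (allFin n) (subst T (Boolₚ.not-involutive _) t))
  ...   | a , _ , t₁ with find (Anyₚ.any⁻ _ (allFin n) t₁)
  ...     | b , _ , t₂ with find (Anyₚ.any⁻ _ (allFin n) t₂)
  ...       | c , _ , t₃ = ρ a , ρ b , ρ c ,
    adj-relabel⁺ ρ inj E (adj⇒AdjF E (proj₁ (T-∧⁻ {adj E a b} t₃))) ,
    adj-relabel⁺ ρ inj E (adj⇒AdjF E (proj₁ (T-∧⁻ {adj E b c} (proj₂ (T-∧⁻ {adj E a b} t₃))))) ,
    adj-relabel⁺ ρ inj E (adj⇒AdjF E (proj₂ (T-∧⁻ {adj E b c} (proj₂ (T-∧⁻ {adj E a b} t₃)))))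

  Tri⇒triangle : ∀ {n} (ρ : Fin n → ℕ) → (∀ {i j} → ρ i ≡ ρ j → i ≡ j) → ∀ E → Tri (map (relabel ρ) E) → ¬ T (triangleFree E)
  Tri⇒triangle {n} ρ inj E (x , y , z , p , q , r) with relabel-image ρ inj E p | relabel-image ρ inj E q
  ... | a , b , refl , refl | b′ , c , eq , refl with refl ← inj eq =
    not-T (Anyₚ.any⁺ _ (lose (∈-allFin a) (Anyₚ.any⁺ _ (lose (∈-allFin b) (Anyₚ.any⁺ _ (lose (∈-allFin c)
      (T-∧⁺ (AdjF⇒adj E (adj-relabel⁻ ρ inj E p)) (T-∧⁺ (AdjF⇒adj E (adj-relabel⁻ ρ inj E q)) (AdjF⇒adj E (adj-relabel⁻ ρ inj E r))))))))))

  triangleFreeF : ∀ n → EdgeSet n → Series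
  triangleFreeF n E = ind (T? (triangleFree E))

  triangleFree-relabel : ∀ {n} (ρ : Fin n → ℕ) → (∀ {i j} → ρ i ≡ ρ j → i ≡ j) → ∀ E →
    triangleFreeInd (map (relabel ρ) E) ≋ triangleFreeF n E
  triangleFree-relabel ρ inj E = ind-⇔ (¬? (tri? (map (relabel ρ) E))) (T? (triangleFree E))
    (λ n → decide (T? (triangleFree E)) n) (λ t tri → Tri⇒triangle ρ inj E tri t)
    where
    decide : Dec (T (triangleFree E)) → ¬ Tri (map (relabel ρ) E) → T (triangleFree E)
    decide (yes t) _ = t
    decide (no ¬t) n = ⊥-elim (n (triangle⇒Tri ρ inj E ¬t))

  -- The series w/(1 + w).
  y : Series
  y = w ⊛ geometric (𝕎.- w)

  q*y : (𝕎.1# 𝕎.+ w) ⊛ y ≋ w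
  q*y = begin
    (𝕎.1# 𝕎.+ w) ⊛ (w ⊛ r)                   ≈⟨ S.solve 3 (λ o w g → (o S.:+ w) S.:* (w S.:* g) S.:= w S.:* (o S.:* g S.:+ S.:- (S.:- w S.:* g))) (λ _ → refl) 𝕎.1# w r ⟩
    w ⊛ (𝕎.1# ⊛ r 𝕎.+ 𝕎.- ((𝕎.- w) ⊛ r))     ≈⟨ 𝕎.*-congˡ {w} (λ n → cong (ℚ._+ ℚ.- ((𝕎.- w) ⊛ r) n) (trans (𝕎.*-identityˡ r n) (geometric-fixpoint {𝕎.- w} refl n))) ⟩
    w ⊛ ((𝕎.1# 𝕎.+ (𝕎.- w) ⊛ r) 𝕎.+ 𝕎.- ((𝕎.- w) ⊛ r))
      ≈⟨ 𝕎.*-congˡ {w} (S.solve 2 (λ o x → (o S.:+ x) S.:+ S.:- x S.:= o) (λ _ → refl) 𝕎.1# ((𝕎.- w) ⊛ r)) ⟩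
    w ⊛ 𝕎.1#                                 ≈⟨ 𝕎.*-identityʳ w ⟩
    w                                        ∎
    where
    open SetoidReasoning 𝕎.setoid
    module S = 𝕎.Solver
    r = geometric (𝕎.- w)

  pow-y-ord : ∀ k → Ord k (𝕎.pow y k)
  pow-y-ord zero    = ord-any {𝕎.1#}
  pow-y-ord (suc k) = ord-* {1} {k} {y} {𝕎.pow y k} (ord-* {1} {0} {w} {geometric (𝕎.- w)} ord-w (ord-any {geometric (𝕎.- w)})) (pow-y-ord k)

  allφ : List Edge → Series
  allφ = weighted triangleFreeInd w

  clusterφ : List Edge → Series
  clusterφ = weighted triangleMöbius y

  allφ-relabel : ∀ {n} (ρ : Fin n → ℕ) → (∀ {i j} → ρ i ≡ ρ j → i ≡ j) → ∀ E →
    allφ (map (relabel ρ) E) ≋ triangleFreeF n E ⊛ 𝕎.pow w (length E)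
  allφ-relabel {n} ρ inj E e = trans (𝕎.*-congʳ {𝕎.pow w (length (map (relabel ρ) E))} (triangleFree-relabel ρ inj E) e)
    (cong (λ l → (triangleFreeF n E ⊛ 𝕎.pow w l) e) (Listₚ.length-map (relabel ρ) E))

  clusterφ-relabel : ∀ {n} (ρ : Fin n → ℕ) → (∀ {i j} → ρ i ≡ ρ j → i ≡ j) → ∀ E →
    clusterφ (map (relabel ρ) E) ≋ möbius (triangleFreeF n) E ⊛ 𝕎.pow y (length E)
  clusterφ-relabel {n} ρ inj E e = trans (𝕎.*-congʳ {𝕎.pow y (length (map (relabel ρ) E))}
      (λ e → trans (möbius-map (relabel ρ) E triangleFreeInd e) (möbius-cong E (λ F _ → triangleFree-relabel ρ inj F) e)) e)
    (cong (λ l → (möbius (triangleFreeF n) E ⊛ 𝕎.pow y l) e) (Listₚ.length-map (relabel ρ) E))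

  module TriangleFree = Labelled (weighted-multiplicative w triangleFreeInd-multiplicative) allφ-relabel
  module Cluster = Labelled (weighted-multiplicative y triangleMöbius-multiplicative) clusterφ-relabel

  pow-length-pairsL : ∀ {B : Set} x (V : List B) → 𝕎.pow x (length (pairsL V)) ≋ pow-choose2 𝕎 x (length V)
  pow-length-pairsL x []      n = refl
  pow-length-pairsL x (v ∷ V) = begin
    𝕎.pow x (length (map (v ,_) V ++ pairsL V))                  ≡⟨ cong (𝕎.pow x) (trans (Listₚ.length-++ (map (v ,_) V)) (cong (ℕ._+ length (pairsL V)) (Listₚ.length-map (v ,_) V))) ⟩
    𝕎.pow x (length V ℕ.+ length (pairsL V))                     ≈⟨ 𝕎.pow-+ x (length V) (length (pairsL V)) ⟩
    𝕎.pow x (length V) ⊛ 𝕎.pow x (length (pairsL V))             ≈⟨ 𝕎.*-comm (𝕎.pow x (length V)) (𝕎.pow x (length (pairsL V))) ⟩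
    𝕎.pow x (length (pairsL V)) ⊛ 𝕎.pow x (length V)             ≈⟨ 𝕎.*-congʳ {𝕎.pow x (length V)} (pow-length-pairsL x V) ⟩
    pow-choose2 𝕎 x (length V) ⊛ 𝕎.pow x (length V)              ∎
    where open SetoidReasoning 𝕎.setoid

  pow-length-pairs : ∀ x n → 𝕎.pow x (length (pairs n)) ≋ pow-choose2 𝕎 x n
  pow-length-pairs x n e = trans (cong (λ ps → 𝕎.pow x (length ps) e) (pairs≡pairsL n))
    (trans (pow-length-pairsL x (allFin n) e) (cong (λ m → pow-choose2 𝕎 x m e) (Listₚ.length-tabulate {n = n} id)))

  -- Möbius inversion over the set of all pairs, whose number supplies the power of q.
  F≋ : ∀ n → TriangleFree.allSeries n ≋ pow-choose2 𝕎 (𝕎.1# 𝕎.+ w) n ⊛ Cluster.allSeries n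
  F≋ n = begin
    𝕎.ι (1/! n) ⊛ TriangleFree.allCount n
      ≈⟨ 𝕎.*-congˡ {𝕎.ι (1/! n)} (möbius-inversion (pairs n) (triangleFreeF n) {y} {𝕎.1# 𝕎.+ w} {w} q*y (λ _ → refl)) ⟨
    𝕎.ι (1/! n) ⊛ (𝕎.pow (𝕎.1# 𝕎.+ w) (length (pairs n)) ⊛ Cluster.allCount n)
      ≈⟨ 𝕎.*-congˡ {𝕎.ι (1/! n)} (𝕎.*-congʳ {Cluster.allCount n} (pow-length-pairs (𝕎.1# 𝕎.+ w) n)) ⟩
    𝕎.ι (1/! n) ⊛ (Q ⊛ Cluster.allCount n)
      ≈⟨ S.solve 3 (λ i q c → i S.:* (q S.:* c) S.:= q S.:* (i S.:* c)) (λ _ → refl) (𝕎.ι (1/! n)) Q (Cluster.allCount n) ⟩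
    Q ⊛ (𝕎.ι (1/! n) ⊛ Cluster.allCount n) ∎
    where
    open SetoidReasoning 𝕎.setoid
    module S = 𝕎.Solver
    Q = pow-choose2 𝕎 (𝕎.1# 𝕎.+ w) n

  Σsub-eval : ∀ {B : Set} (xs : List B) f e → Σsub xs f e ≡ ℚΣ.Σsub xs (λ E → f E e)
  Σsub-eval []       f e = refl
  Σsub-eval (x ∷ xs) f e = cong₂ ℚ._+_ (Σsub-eval xs (λ E → f (x ∷ E)) e) (Σsub-eval xs f e)

  Σsub-vanishes : ∀ {B : Set} (xs : List B) {f} e → (∀ E → E ⊆ xs → f E e ≡ 0ℚ) → Σsub xs f e ≡ 0ℚ
  Σsub-vanishes xs {f} e z = trans (Σsub-eval xs f e) (trans (ℚΣ.Σsub-cong xs z) (ℚΣ.Σsub-0 xs (λ _ → refl)))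

  Σsub-full : ∀ {B : Set} (xs : List B) {f} e → (∀ E → E ⊆ xs → length E < length xs → f E e ≡ 0ℚ) → Σsub xs f e ≡ f xs e
  Σsub-full []       e z = refl
  Σsub-full (x ∷ xs) {f} e z = trans (cong₂ ℚ._+_
      (Σsub-full xs {λ E → f (x ∷ E)} e (λ E s l → z (x ∷ E) (refl ∷ s) (s≤s l)))
      (Σsub-vanishes xs e (λ E s → z E (x ∷ʳ s) (s≤s (length-mono-≤ s)))))
    (ℚₚ.+-identityʳ _)

  clusterTerm : ℕ → List ℕ → List Edge → Series
  clusterTerm v I H = ind (conn? v I H) ⊛ clusterφ H

  clusterTerm-sparse : ∀ {v I H} e → Unique (v ∷ I) → H ⊆ pairsL (v ∷ I) → 2 ℕ.* length H < 3 ℕ.* length I → clusterTerm v I H e ≡ 0ℚ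
  clusterTerm-sparse {v} {I} {H} e uniq sub sparse = trans (sym (𝕎.*-assoc (ind (conn? v I H)) (triangleMöbius H) (𝕎.pow y (length H)) e))
    (trans (𝕎.*-congʳ {𝕎.pow y (length H)} (triangleMöbius-sparse uniq sub sparse) e) (𝕎.zeroˡ (𝕎.pow y (length H)) e))

  clusterTerm-ord : ∀ v I H → Ord (length H) (clusterTerm v I H)
  clusterTerm-ord v I H = ord-* {0} {length H} {ind (conn? v I H)} {clusterφ H} (ord-any {ind (conn? v I H)})
    (ord-* {0} {length H} {triangleMöbius H} {𝕎.pow y (length H)} (ord-any {triangleMöbius H}) (pow-y-ord (length H)))

  A≈ : ∀ m e → Cluster.connectedSeries (suc m) e ≡ 1/! (suc m) ℚ.* Σsub (pairsL (0 ∷ applyUpTo suc m)) (clusterTerm 0 (applyUpTo suc m)) e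
  A≈ m e = trans (constant-⊛ (1/! (suc m)) (Cluster.connectedCount (suc m)) e) (cong (1/! (suc m) ℚ.*_)
    (trans (cong (λ k → Cluster.connectedCount (suc k) e) (sym (Listₚ.length-applyUpTo suc m)))
      (sym (Cluster.connectedGraphs-count 0 (applyUpTo suc m) (upTo⁺ (suc m)) e))))

  -- An edge set with few edges has no weight by the bound for covered graphs, and one with more
  -- than e edges has order above e in w because y is divisible by w.
  A-sparse : ∀ m e → 2 ℕ.* e < 3 ℕ.* m → Cluster.connectedSeries (suc m) e ≡ 0ℚ
  A-sparse m e sparse = trans (A≈ m e) (trans (cong (1/! (suc m) ℚ.*_) (Σsub-vanishes (pairsL (0 ∷ I)) e term)) (ℚₚ.*-zeroʳ (1/! (suc m))))
    where
    I = applyUpTo suc m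
    length-I : length I ≡ m
    length-I = Listₚ.length-applyUpTo suc m
    term : ∀ H → H ⊆ pairsL (0 ∷ I) → clusterTerm 0 I H e ≡ 0ℚ
    term H sub with 2 ℕ.* length H ℕ.<? 3 ℕ.* length I
    ... | yes lt = clusterTerm-sparse e (upTo⁺ (suc m)) sub lt
    ... | no ¬lt = clusterTerm-ord 0 I H e (ℕₚ.*-cancelˡ-< 2 e (length H)
      (ℕₚ.<-≤-trans sparse (subst (λ k → 3 ℕ.* k ≤ 2 ℕ.* length H) length-I (ℕₚ.≮⇒≥ ¬lt))))

  A-1 : Cluster.connectedSeries 1 ≋ 𝕎.1#
  A-1 e = trans (constant-⊛ 1ℚ (Cluster.connectedCount 1) e) (trans (ℚₚ.*-identityˡ (Cluster.connectedCount 1 e)) (unit e))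
    where
    unit : 𝕎.1# ⊛ (𝕎.1# ⊛ 𝕎.1#) ≋ 𝕎.1#
    unit e = trans (𝕎.*-identityˡ (𝕎.1# ⊛ 𝕎.1#) e) (𝕎.*-identityˡ 𝕎.1# e)

  A-2 : Cluster.connectedSeries 2 ≋ 𝕎.0#
  A-2 e = trans (A≈ 1 e) (trans (cong (1/! 2 ℚ.*_) (Σsub-vanishes (pairsL (0 ∷ 1 ∷ [])) {clusterTerm 0 (1 ∷ [])} e
    (λ H sub → clusterTerm-sparse e (upTo⁺ 2) sub (s≤s (ℕₚ.*-monoʳ-≤ 2 (length-mono-≤ sub)))))) (ℚₚ.*-zeroʳ (1/! 2)))

  -- On three vertices only the full edge set contributes at w³. Its Möbius value is -1, since the
  -- indicator is 1 on all proper subsets and 0 on the triangle, and the denominator is 3!.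
  A-3 : Cluster.connectedSeries 3 3 ≡ ℚ.- (ℤ.+ 1 ℚ./ 6)
  A-3 = trans (A≈ 2 3) (cong (1/! 3 ℚ.*_) (trans (Σsub-full ps {clusterTerm 0 (1 ∷ 2 ∷ [])} 3 smaller) whole))
    where
    ps = pairsL (0 ∷ 1 ∷ 2 ∷ [])
    smaller : ∀ H → H ⊆ ps → length H < 3 → clusterTerm 0 (1 ∷ 2 ∷ []) H 3 ≡ 0ℚ
    smaller H sub lt = clusterTerm-sparse 3 (upTo⁺ 3) sub (ℕₚ.*-monoʳ-< 2 lt)
    möbius-triangle : triangleMöbius ps ≋ 𝕎.ι (ℚ.- 1ℚ)
    möbius-triangle zero    = refl
    möbius-triangle (suc e) = refl
    whole : clusterTerm 0 (1 ∷ 2 ∷ []) ps 3 ≡ ℚ.- 1ℚ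
    whole = trans (𝕎.*-identityˡ (clusterφ ps) 3) (trans (𝕎.*-congʳ {𝕎.pow y 3} möbius-triangle 3) (trans (constant-⊛ (ℚ.- 1ℚ) (𝕎.pow y 3) 3) refl))

  M-0 : Cluster.allSeries 0 ≋ 𝕎.1#
  M-0 e = trans (𝕎.*-identityˡ (𝕎.1# ⊛ 𝕎.1#) e) (𝕎.*-identityˡ 𝕎.1# e)

  graphSetting : GradedSetting
  graphSetting = record
    { M = Cluster.allSeries ; A = Cluster.connectedSeries ; L = TriangleFree.connectedSeries ; F = TriangleFree.allSeries
    ; M-0 = M-0 ; A-0 = λ _ → refl ; L-0 = λ _ → refl
    ; M-formula = Cluster.exponential-formula ; F-formula = TriangleFree.exponential-formula ; F≋ = F≋
    ; A-1 = A-1 ; A-2 = A-2 ; A-3 = A-3 ; A-sparse = A-sparse }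

  pow-w : ∀ m e → powW m e ≡ (if m ≡ᵇ e then 1ℚ else 0ℚ)
  pow-w zero    zero    = refl
  pow-w zero    (suc e) = refl
  pow-w (suc m) zero    = w-⊛ (powW m) 0
  pow-w (suc m) (suc e) = trans (w-⊛ (powW m) (suc e)) (pow-w m e)

  length-filter-sublists : ∀ {B : Set} (P : List B → Bool) xs →
    ℕ→ℚ (length (filter (T? ∘ P) (sublists xs))) ≡ ℚΣ.Σsub xs (λ E → if P E then 1ℚ else 0ℚ)
  length-filter-sublists P [] with P []
  ... | true  = refl
  ... | false = refl
  length-filter-sublists P (x ∷ xs) = begin
    ℕ→ℚ (length (filter (T? ∘ P) (map (x ∷_) (sublists xs) ++ sublists xs)))
      ≡⟨ cong (ℕ→ℚ ∘ length) (Listₚ.filter-++ (T? ∘ P) (map (x ∷_) (sublists xs)) (sublists xs)) ⟩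
    ℕ→ℚ (length (filter (T? ∘ P) (map (x ∷_) (sublists xs)) ++ filter (T? ∘ P) (sublists xs)))
      ≡⟨ cong ℕ→ℚ (Listₚ.length-++ (filter (T? ∘ P) (map (x ∷_) (sublists xs)))) ⟩
    ℕ→ℚ (length (filter (T? ∘ P) (map (x ∷_) (sublists xs))) ℕ.+ length (filter (T? ∘ P) (sublists xs)))
      ≡⟨ ℕ→ℚ-+ (length (filter (T? ∘ P) (map (x ∷_) (sublists xs)))) (length (filter (T? ∘ P) (sublists xs))) ⟩
    ℕ→ℚ (length (filter (T? ∘ P) (map (x ∷_) (sublists xs)))) ℚ.+ ℕ→ℚ (length (filter (T? ∘ P) (sublists xs)))
      ≡⟨ cong₂ ℚ._+_ (trans (cong ℕ→ℚ (length-filter-map (sublists xs))) (length-filter-sublists (λ E → P (x ∷ E)) xs)) (length-filter-sublists P xs) ⟩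
    ℚΣ.Σsub (x ∷ xs) (λ E → if P E then 1ℚ else 0ℚ) ∎
    where
    open ≡-Reasoning
    length-filter-map : ∀ Es → length (filter (T? ∘ P) (map (x ∷_) Es)) ≡ length (filter (λ E → T? (P (x ∷ E))) Es)
    length-filter-map []       = refl
    length-filter-map (E ∷ Es) with P (x ∷ E)
    ... | true  = cong suc (length-filter-map Es)
    ... | false = length-filter-map Es

  graph-coefficient : ∀ n k → TriangleFree.connectedCount n (n ℕ.+ k) ≡ ℕ→ℚ (g n k)
  graph-coefficient n k = trans (Σsub-eval (pairs n) _ (n ℕ.+ k)) (trans (ℚΣ.Σsub-cong (pairs n) (λ E _ → term (length E) (connected E) (triangleFree E)))
    (sym (length-filter-sublists (λ E → (length E ≡ᵇ n ℕ.+ k) ∧ connected E ∧ triangleFree E) (pairs n))))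
    where
    zeroˡ : ∀ X → (𝕎.0# ⊛ X) (n ℕ.+ k) ≡ 0ℚ
    zeroˡ X = 𝕎.zeroˡ X (n ℕ.+ k)
    if-false : ∀ c → 0ℚ ≡ (if c ∧ false then 1ℚ else 0ℚ)
    if-false true  = refl
    if-false false = refl
    term : ∀ m (x y : Bool) → (ind (T? x) ⊛ (ind (T? y) ⊛ powW m)) (n ℕ.+ k) ≡ (if (m ≡ᵇ n ℕ.+ k) ∧ x ∧ y then 1ℚ else 0ℚ)
    term m true  true  = trans (𝕎.*-identityˡ (𝕎.1# ⊛ powW m) (n ℕ.+ k)) (trans (𝕎.*-identityˡ (powW m) (n ℕ.+ k))
      (trans (pow-w m (n ℕ.+ k)) (cong (if_then 1ℚ else 0ℚ) (sym (Boolₚ.∧-identityʳ (m ≡ᵇ n ℕ.+ k))))))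
    term m true  false = trans (𝕎.*-identityˡ (𝕎.0# ⊛ powW m) (n ℕ.+ k)) (trans (zeroˡ (powW m)) (if-false (m ≡ᵇ n ℕ.+ k)))
    term m false y     = trans (zeroˡ (ind (T? y) ⊛ powW m)) (if-false (m ≡ᵇ n ℕ.+ k))

  open SystemOf graphSetting using (Lᵢ; system)

  -- Because of the factor w in L̂, index i selects n + i - 1 edges; excess k + 1 therefore sits at
  -- index k + 2.
  series-coefficient : ∀ k n → Lᵢ (suc (suc k)) n ≡ ℚ._/_ (ℤ.+ g n (suc k)) (n !) {{n !≢0}}
  series-coefficient k zero    = w-⊛ (TriangleFree.connectedSeries 0) (suc (suc k))
  series-coefficient k (suc n) = begin
    Lᵢ (suc (suc k)) (suc n)
      ≡⟨ w-⊛ (TriangleFree.connectedSeries (suc n)) (suc n ℕ.+ suc (suc k)) ⟩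
    TriangleFree.connectedSeries (suc n) (n ℕ.+ suc (suc k))
      ≡⟨ cong (TriangleFree.connectedSeries (suc n)) (ℕₚ.+-suc n (suc k)) ⟩
    TriangleFree.connectedSeries (suc n) (suc n ℕ.+ suc k)
      ≡⟨ constant-⊛ (1/! (suc n)) (TriangleFree.connectedCount (suc n)) (suc n ℕ.+ suc k) ⟩
    1/! (suc n) ℚ.* TriangleFree.connectedCount (suc n) (suc n ℕ.+ suc k)
      ≡⟨ cong (1/! (suc n) ℚ.*_) (graph-coefficient (suc n) (suc k)) ⟩
    1/! (suc n) ℚ.* ℕ→ℚ (g (suc n) (suc k))
      ≡⟨ ℚₚ.*-comm (1/! (suc n)) (ℕ→ℚ (g (suc n) (suc k))) ⟩
    ℕ→ℚ (g (suc n) (suc k)) ℚ.* 1/! (suc n)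
      ≡⟨ /!-≡ (g (suc n) (suc k)) (suc n) ⟨
    ℚ._/_ (ℤ.+ g (suc n) (suc k)) (suc n !) {{suc n !≢0}} ∎
    where open ≡-Reasoning

  private
    module 𝒫 = Poles treeAlgebra
    Q : Series
    Q = geometric Tser

  Q^ : ℕ → Series
  Q^ = 𝕎.pow Q

  ·S≋⊛ : ∀ X Y → X ·S Y ≋ X ⊛ Y
  ·S≋⊛ X Y n = trans (Σ<≡sum (suc n) (λ i → X i ℚ.* Y (n ∸ i))) (sym (ℚS.conv≈sum (λ a b → X a ℚ.* Y b) n))

  powS≋pow : ∀ {X Y} → X ≋ Y → ∀ m → powS X m ≋ 𝕎.pow Y m
  powS≋pow eq zero    zero    = refl
  powS≋pow eq zero    (suc n) = refl
  powS≋pow {X} {Y} eq (suc m) n = trans (·S≋⊛ X (powS X m) n) (ℚS.⊛-cong {X} {Y} {powS X m} {𝕎.pow Y m} eq (powS≋pow eq m) n)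

  invOneMinusT≋Q : invOneMinusT ≋ Q
  invOneMinusT≋Q n = trans (Σ<≡sum (suc n) (λ j → powS Tser j n)) (sum-cong (suc n) (λ j _ → powS≋pow {Tser} (λ _ → refl) j n))

  oneMinusT≋θ : oneMinusT ≋ θ
  oneMinusT≋θ zero    = refl
  oneMinusT≋θ (suc n) = sym (ℚₚ.+-identityˡ (ℚ.- Tser (suc n)))

  -- Factors Q and θ cancel in pairs until one exponent is exhausted, which matches the two clauses
  -- of `P`.
  P≋ : ∀ d j → P (d ℤ.⊖ j) ≋ Q^ d ⊛ θ^ j
  P≋ d       zero    n = trans (powS≋pow invOneMinusT≋Q d n) (sym (𝕎.*-identityʳ (Q^ d) n))
  P≋ zero    (suc j) n = trans (powS≋pow oneMinusT≋θ (suc j) n) (sym (𝕎.*-identityˡ (θ^ (suc j)) n))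
  P≋ (suc d) (suc j) = begin
    P (suc d ℤ.⊖ suc j)             ≡⟨ cong P (ℤₚ.[1+m]⊖[1+n]≡m⊖n d j) ⟩
    P (d ℤ.⊖ j)                     ≈⟨ P≋ d j ⟩
    Q^ d ⊛ θ^ j                     ≈⟨ 𝕎.*-identityˡ (Q^ d ⊛ θ^ j) ⟨
    𝕎.1# ⊛ (Q^ d ⊛ θ^ j)            ≈⟨ 𝕎.*-congʳ {Q^ d ⊛ θ^ j} 𝒫.θ*Q ⟨
    (θ ⊛ Q) ⊛ (Q^ d ⊛ θ^ j)         ≈⟨ S.solve 4 (λ t q a b → (t S.:* q) S.:* (a S.:* b) S.:= (q S.:* a) S.:* (t S.:* b)) (λ _ → refl) θ Q (Q^ d) (θ^ j) ⟩
    (Q ⊛ Q^ d) ⊛ (θ ⊛ θ^ j)         ∎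
    where
    open SetoidReasoning 𝕎.setoid
    module S = 𝕎.Solver

  Q^θ^ : ∀ d → Q^ d ⊛ θ^ d ≋ 𝕎.1#
  Q^θ^ d n = trans (sym (P≋ d d n)) (trans (cong (λ z → P z n) (ℤₚ.n⊖n≡0 d)) (powS≋pow {Q} {Q} (λ _ → refl) 0 n))

  ev-sum : ∀ R m c n → (R ⊛ 𝒫.ev m c) n ≡ sum m (λ j → c j ℚ.* (R ⊛ θ^ j) n)
  ev-sum R zero    c n = 𝕎.zeroʳ R n
  ev-sum R (suc m) c n = begin
    (R ⊛ (𝕎.ι (c 0) 𝕎.+ θ ⊛ E)) n
      ≡⟨ S.solve 4 (λ r a t e → r S.:* (a S.:+ t S.:* e) S.:= a S.:* r S.:+ (r S.:* t) S.:* e) (λ _ → refl) R (𝕎.ι (c 0)) θ E n ⟩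
    (𝕎.ι (c 0) ⊛ R) n ℚ.+ ((R ⊛ θ) ⊛ E) n
      ≡⟨ cong₂ ℚ._+_ (trans (constant-⊛ (c 0) R n) (cong (c 0 ℚ.*_) (sym (𝕎.*-identityʳ R n)))) (ev-sum (R ⊛ θ) m (c ∘ suc) n) ⟩
    c 0 ℚ.* (R ⊛ θ^ 0) n ℚ.+ sum m (λ j → c (suc j) ℚ.* ((R ⊛ θ) ⊛ θ^ j) n)
      ≡⟨ cong (c 0 ℚ.* (R ⊛ θ^ 0) n ℚ.+_) (sum-cong m (λ j _ → cong (c (suc j) ℚ.*_) (𝕎.*-assoc R θ (θ^ j) n))) ⟩
    c 0 ℚ.* (R ⊛ θ^ 0) n ℚ.+ sum m (λ j → c (suc j) ℚ.* (R ⊛ θ^ (suc j)) n)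
      ≡⟨ sum-first m (λ j → c j ℚ.* (R ⊛ θ^ j) n) ⟨
    sum (suc m) (λ j → c j ℚ.* (R ⊛ θ^ j) n) ∎
    where
    open ≡-Reasoning
    module S = 𝕎.Solver
    E = 𝒫.ev m (c ∘ suc)

  -- The expansion is stated with at least one remaining term, so the coefficients are padded by
  -- zeros beyond the degree.
  truncated : ℕ → (ℕ → ℚ) → ℕ → ℚ
  truncated zero    c j       = 0ℚ
  truncated (suc m) c zero    = c 0
  truncated (suc m) c (suc j) = truncated m (c ∘ suc) j

  ev-truncated : ∀ m c → 𝒫.ev m c ≋ 𝒫.ev (suc m) (truncated m c)
  ev-truncated zero    c n = sym (trans (cong₂ ℚ._+_ (𝕎.ι-0 n) (𝕎.zeroʳ θ n)) refl)
  ev-truncated (suc m) c n = cong (𝕎.ι (c 0) n ℚ.+_) (𝕎.*-congˡ {θ} (ev-truncated m (c ∘ suc)) n)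

  lead-expansion : ∀ {d p r X} → Lead d p r X → ∃ λ m → ∃ λ (c : ℕ → ℚ) → ∀ n →
    X n ≡ p ℚ.* P (d ℤ.⊖ 0) n ℚ.+ r ℚ.* P (d ℤ.⊖ 1) n ℚ.+ Σ< (suc m) (λ j → c j ℚ.* P (d ℤ.⊖ (2 ℕ.+ j)) n)
  lead-expansion {d} {p} {r} {X} (𝒫.mkLead {z} pz eq) = m , truncated m c , expansion
    where
    m = proj₁ (𝒫.poly-ev pz)
    c = proj₁ (proj₂ (𝒫.poly-ev pz))
    c̄ = 𝒫.cons p (𝒫.cons r (truncated m c))
    X≋ : X ≋ Q^ d ⊛ 𝒫.ev (3 ℕ.+ m) c̄
    X≋ = begin
      X                             ≈⟨ 𝕎.*-identityˡ X ⟨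
      𝕎.1# ⊛ X                      ≈⟨ 𝕎.*-congʳ {X} (Q^θ^ d) ⟨
      (Q^ d ⊛ θ^ d) ⊛ X             ≈⟨ 𝕎.*-assoc (Q^ d) (θ^ d) X ⟩
      Q^ d ⊛ (θ^ d ⊛ X)             ≈⟨ 𝕎.*-congˡ {Q^ d} eq ⟩
      Q^ d ⊛ (𝕎.ι p 𝕎.+ θ ⊛ (𝕎.ι r 𝕎.+ θ ⊛ z))
        ≈⟨ 𝕎.*-congˡ {Q^ d} (𝕎.+-congˡ {𝕎.ι p} (𝕎.*-congˡ {θ} (𝕎.+-congˡ {𝕎.ι r} (𝕎.*-congˡ {θ} (λ n → trans (proj₂ (proj₂ (𝒫.poly-ev pz)) n) (ev-truncated m c n)))))) ⟩
      Q^ d ⊛ 𝒫.ev (3 ℕ.+ m) c̄       ∎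
      where open SetoidReasoning 𝕎.setoid
    expansion : ∀ n → X n ≡ p ℚ.* P (d ℤ.⊖ 0) n ℚ.+ r ℚ.* P (d ℤ.⊖ 1) n ℚ.+ Σ< (suc m) (λ j → truncated m c j ℚ.* P (d ℤ.⊖ (2 ℕ.+ j)) n)
    expansion n = begin
      X n                                           ≡⟨ X≋ n ⟩
      (Q^ d ⊛ 𝒫.ev (3 ℕ.+ m) c̄) n                   ≡⟨ ev-sum (Q^ d) (3 ℕ.+ m) c̄ n ⟩
      sum (3 ℕ.+ m) (λ j → c̄ j ℚ.* (Q^ d ⊛ θ^ j) n) ≡⟨ sum-cong (3 ℕ.+ m) (λ j _ → cong (c̄ j ℚ.*_) (P≋ d j n)) ⟨
      sum (3 ℕ.+ m) t                               ≡⟨ sum-first (2 ℕ.+ m) t ⟩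
      t 0 ℚ.+ sum (2 ℕ.+ m) (λ j → t (suc j))             ≡⟨ cong (t 0 ℚ.+_) (sum-first (suc m) (λ j → t (suc j))) ⟩
      t 0 ℚ.+ (t 1 ℚ.+ sum (suc m) t₂)              ≡⟨ ℚₚ.+-assoc (t 0) (t 1) (sum (suc m) t₂) ⟨
      t 0 ℚ.+ t 1 ℚ.+ sum (suc m) t₂                ≡⟨ cong (λ x → t 0 ℚ.+ t 1 ℚ.+ x) (Σ<≡sum (suc m) t₂) ⟨
      t 0 ℚ.+ t 1 ℚ.+ Σ< (suc m) t₂                 ∎
      where
      open ≡-Reasoning
      t : ℕ → ℚ
      t j = c̄ j ℚ.* P (d ℤ.⊖ j) n
      t₂ : ℕ → ℚ
      t₂ j = t (suc (suc j))

  connected-lead : ∀ k → Lead (3 ℕ.* suc k) (b (suc k)) (ℚ.- c′ (suc k)) (Lᵢ (suc (suc k)))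
  connected-lead k = Leading.Good.L-lead (Leading.good treeAlgebra system b (λ k → ℚ.- c′ k) wright-recurrences (suc k)) k refl

  lead-laurent : ∀ {d p r X} → Lead d p (ℚ.- r) X → ∃[ m ] ∃ λ (ω : ℤ → ℚ) → ∀ n →
    X n ≡ (p ℚ.* P (ℤ.+ d) n) ℚ.- (r ℚ.* P (ℤ.+ d ℤ.- ℤ.+ 1) n)
      ℚ.+ Σ< (suc m) (λ j → ω (ℤ.+ d ℤ.- ℤ.+ 2 ℤ.- ℤ.+ j) ℚ.* P (ℤ.+ d ℤ.- ℤ.+ 2 ℤ.- ℤ.+ j) n)
  lead-laurent {d} {p} {r} {X} lead = reindex (lead-expansion lead)
    where
    index : ∀ j → ℤ.+ d ℤ.- ℤ.+ 2 ℤ.- ℤ.+ j ≡ d ℤ.⊖ (2 ℕ.+ j)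
    index j = trans (ℤₚ.+-assoc (ℤ.+ d) (ℤ.- ℤ.+ 2) (ℤ.- ℤ.+ j))
      (trans (cong (λ z → (ℤ.+ d) ℤ.+ z) (sym (ℤₚ.neg-distrib-+ (ℤ.+ 2) (ℤ.+ j)))) (ℤₚ.m-n≡m⊖n d (2 ℕ.+ j)))
    cancel : ∀ x z → x ℤ.- (x ℤ.- z) ≡ z
    cancel x z = begin
      x ℤ.- (x ℤ.- z)                ≡⟨ cong (λ u → x ℤ.+ u) (ℤₚ.neg-distrib-+ x (ℤ.- z)) ⟩
      x ℤ.+ (ℤ.- x ℤ.+ ℤ.- (ℤ.- z))  ≡⟨ ℤₚ.+-assoc x (ℤ.- x) (ℤ.- (ℤ.- z)) ⟨
      x ℤ.- x ℤ.+ ℤ.- (ℤ.- z)        ≡⟨ cong₂ ℤ._+_ (ℤₚ.+-inverseʳ x) (ℤₚ.neg-involutive z) ⟩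
      ℤ.0ℤ ℤ.+ z                     ≡⟨ ℤₚ.+-identityˡ z ⟩
      z                              ∎
      where open ≡-Reasoning
    reindex : (∃ λ m → ∃ λ (c : ℕ → ℚ) → ∀ n →
        X n ≡ p ℚ.* P (d ℤ.⊖ 0) n ℚ.+ ℚ.- r ℚ.* P (d ℤ.⊖ 1) n ℚ.+ Σ< (suc m) (λ j → c j ℚ.* P (d ℤ.⊖ (2 ℕ.+ j)) n)) → _
    reindex (m , c , expansion) = m , ω , λ n → trans (expansion n)
      (cong₂ (λ x z → p ℚ.* P (ℤ.+ d) n ℚ.+ x ℚ.+ z) (second n)
        (Σ<-cong (suc m) (λ j _ → cong₂ ℚ._*_ (sym (ω-index j)) (cong (λ z → P z n) (sym (index j))))))
      where
      ω : ℤ → ℚ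
      -- The coefficient is found by the distance of the exponent from d - 2; the sum only visits
      -- exponents at or below d - 2, where this distance is j.
      ω i = c ℤ.∣ ℤ.+ d ℤ.- ℤ.+ 2 ℤ.- i ∣
      ω-index : ∀ j → ω (ℤ.+ d ℤ.- ℤ.+ 2 ℤ.- ℤ.+ j) ≡ c j
      ω-index j = cong (λ i → c ℤ.∣ i ∣) (cancel (ℤ.+ d ℤ.- ℤ.+ 2) (ℤ.+ j))
      second : ∀ n → ℚ.- r ℚ.* P (d ℤ.⊖ 1) n ≡ ℚ.- (r ℚ.* P (ℤ.+ d ℤ.- ℤ.+ 1) n)
      second n = trans (sym (ℚₚ.neg-distribˡ-* r (P (d ℤ.⊖ 1) n)))
        (cong (λ z → ℚ.- (r ℚ.* P z n)) (sym (ℤₚ.m-n≡m⊖n d 1)))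

-- The theorem on connected triangle-free graphs

open TriangleFreeGraphs using (series-coefficient; lead-laurent; connected-lead)
open import Defs
open import Data.Nat using (ℕ; suc; _≤_; _*_)
open import Data.Integer using (ℤ; +_) renaming (_-_ to _-ℤ_)
open import Data.Rational using (ℚ; _+_; _-_) renaming (_*_ to _*ℚ_)
open import Data.Product using (∃; ∃-syntax; _,_)
open import Relation.Binary.PropositionalEquality using (_≡_; trans; sym)
open import Data.Nat.Properties using (_!≢0)
open import Data.Nat using (_!)
open import Data.Rational using (_/_)

transport : ∀ {X X′ : Series} {Z : ℕ → (ℤ → ℚ) → Series} → (∀ n → X n ≡ X′ n) →
  (∃[ m ] ∃ λ (ω : ℤ → ℚ) → ∀ n → X n ≡ Z m ω n) → ∃[ m ] ∃ λ (ω : ℤ → ℚ) → ∀ n → X′ n ≡ Z m ω n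
transport eq (m , ω , e) = m , ω , λ n → trans (sym (eq n)) (e n)

theorem14 : (k : ℕ) → 2 ≤ k →
    ∃[ N ] ∃ λ (ω : ℤ → ℚ) → (n : ℕ) →
    _/_ (+ g n k) (n !) {{n !≢0}}
    ≡ (b k *ℚ P (+ (3 * k)) n) - (c′ k *ℚ P (+ (3 * k) -ℤ + 1) n)
    + Σ< (suc N) (λ j → ω (+ (3 * k) -ℤ + 2 -ℤ + j) *ℚ P (+ (3 * k) -ℤ + 2 -ℤ + j) n)
theorem14 (suc k) _ = transport (series-coefficient k) (lead-laurent (connected-lead k))
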